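{- Let $\zeta_5$ be a primitive fifth root of unity and write $c=\zeta_5+\zeta_5^4$. Then $$\frac{1}{(q;q)_\infty}\left(\sum_{n=-\infty}^\infty\frac{q^{3n^2+n}}{(1-\zeta_5q^{3n})(1-\zeta_5^{ -1}q^{3n})}-\sum_{n=-\infty}^\infty \frac{q^{3n^2+7n+2}}{(1-\zeta_5q^{3n+1})(1-\zeta_5^{ -1}q^{3n+1})}\right)=(q^{25};q^{25})_\infty\sum_{j=0}^{3}q^jA_{45j}(q^5),$$ where $$A_{450}(q)=\frac{3+c}{5}\frac{[q^2;q^5]_\infty}{[q;q^5]_\infty^2}-q(1+c)\frac{[q^2;q^{15}]_\infty}{[q,q^4,q^5,q^6;q^{15}]_\infty},\qquad A_{451}(q)=\frac{ -2+c}{5}\frac{1}{[q;q^5]_\infty}+\frac{1}{[q^2,q^3,q^5;q^{15}]_\infty},$$ $$A_{452}(q)=\frac{1+2c}{5}\frac{1}{[q^2;q^5]_\infty}-\frac{1}{[q,q^5,q^6;q^{15}]_\infty},\qquad A_{453}(q)=\frac{ -1-2c}{5}\frac{[q;q^5]_\infty}{[q^2;q^5]_\infty^2}-c\,q\frac{[q;q^{15}]_\infty}{[q^2,q^3,q^5,q^7;q^{15}]_\infty}.$$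
   Context: $(a;q)_\infty=\prod_{j\ge0}(1-aq^j)$; $[z;q]_\infty=(z;q)_\infty(q/z;q)_\infty$ and $[z_1,\dots,z_k;q]_\infty=[z_1;q]_\infty\cdots[z_k;q]_\infty$. -}

module Defs where

open import Data.Nat as ℕ using (ℕ; zero; suc)
open import Data.Integer as ℤ using (ℤ; +_; -[1+_])
open import Data.Rational as ℚ using (ℚ; 0ℚ; 1ℚ)
open import Data.List using (List; []; _∷_)
open import Data.Product using (_×_; _,_)
open import Relation.Nullary using (¬_; yes; no)
open import Relation.Binary.PropositionalEquality using (_≡_; _≢_)

-- The field K = Q(x)/(1+x+x²+x³+x⁴) = Q(ζ₅), basis 1, x, x², x³.

record K : Set where
  constructor mkK
  field
    k0 k1 k2 k3 : ℚ

open K public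

ofℚ : ℚ → K
ofℚ a = mkK a 0ℚ 0ℚ 0ℚ

0K 1K xK : K
0K = ofℚ 0ℚ
1K = ofℚ 1ℚ
xK = mkK 0ℚ 1ℚ 0ℚ 0ℚ

infixl 6 _+K_ _-K_
infixl 7 _*K_

_+K_ : K → K → K
mkK a0 a1 a2 a3 +K mkK b0 b1 b2 b3 =
  mkK (a0 ℚ.+ b0) (a1 ℚ.+ b1) (a2 ℚ.+ b2) (a3 ℚ.+ b3)

-K_ : K → K
-K mkK a0 a1 a2 a3 = mkK (ℚ.- a0) (ℚ.- a1) (ℚ.- a2) (ℚ.- a3)

_-K_ : K → K → K
a -K b = a +K (-K b)

-- multiplication: multiply as polynomials, then reduce with x⁵ = 1 and
-- x⁴ = -1 - x - x² - x³.
_*K_ : K → K → K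
mkK a0 a1 a2 a3 *K mkK b0 b1 b2 b3 =
  let p0 = a0 ℚ.* b0
      p1 = a0 ℚ.* b1 ℚ.+ a1 ℚ.* b0
      p2 = a0 ℚ.* b2 ℚ.+ a1 ℚ.* b1 ℚ.+ a2 ℚ.* b0
      p3 = a0 ℚ.* b3 ℚ.+ a1 ℚ.* b2 ℚ.+ a2 ℚ.* b1 ℚ.+ a3 ℚ.* b0
      p4 = a1 ℚ.* b3 ℚ.+ a2 ℚ.* b2 ℚ.+ a3 ℚ.* b1
      p5 = a2 ℚ.* b3 ℚ.+ a3 ℚ.* b2
      p6 = a3 ℚ.* b3
  in mkK (p0 ℚ.+ p5 ℚ.- p4) (p1 ℚ.+ p6 ℚ.- p4) (p2 ℚ.- p4) (p3 ℚ.- p4)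

_^K_ : K → ℕ → K
a ^K zero = 1K
a ^K suc n = a *K (a ^K n)

scaleℚ : ℚ → K → K
scaleℚ r a = ofℚ r *K a

σ : ℕ → K → K
σ j (mkK a0 a1 a2 a3) =
  let X = xK ^K j in
  ofℚ a0 +K scaleℚ a1 X +K scaleℚ a2 (X *K X) +K scaleℚ a3 (X *K X *K X)

-- inverse via the norm: a⁻¹ = (σ₂a σ₃a σ₄a) / N(a); (0⁻¹ := 0, never used)
invK : K → K
invK a with conj ← σ 2 a *K σ 3 a *K σ 4 a | k0 (a *K conj) ℚ.≟ 0ℚ
... | yes _ = 0K
... | no n≢0 = scaleℚ (ℚ.1/_ (k0 (a *K conj)) {{ℚ.≢-nonZero n≢0}}) conj

PrimitiveRoot : ℕ → K → Set
PrimitiveRoot n z =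
  (z ^K n ≡ 1K) × (∀ j → 0 ℕ.< j → j ℕ.< n → z ^K j ≢ 1K)

-- Formal power series in q over K, as coefficient sequences.

PS : Set
PS = ℕ → K

constPS : K → PS
constPS a zero = a
constPS a (suc n) = 0K

onePS : PS
onePS = constPS 1K

infixl 6 _⊕_ _⊖_
infixl 7 _⊛_
infixl 7 _⊛L_

_⊕_ : PS → PS → PS
(f ⊕ g) n = f n +K g n

_⊖_ : PS → PS → PS
(f ⊖ g) n = f n -K g n

scalePS : K → PS → PS
scalePS a f n = a *K f n

shiftPS : ℕ → PS → PS
shiftPS zero f = f
shiftPS (suc j) f zero = 0K
shiftPS (suc j) f (suc n) = shiftPS j f n

mono : K → ℕ → PS
mono a j = shiftPS j (constPS a)

_⊛_ : PS → PS → PS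
(f ⊛ g) zero = f 0 *K g 0
(f ⊛ g) (suc n) = f 0 *K g (suc n) +K ((λ m → f (suc m)) ⊛ g) n

-- reciprocal of a power series with invertible constant term
-- g 0 = f(0)⁻¹,  g m = - f(0)⁻¹ Σ_{i=1}^{m} f i · g (m - i)
private
  -- Σ_{i} f (i + 1) · l[i]  for the list l = [g_{m-1}, …, g_0]
  convList : PS → List K → K
  convList f [] = 0K
  convList f (g ∷ gs) = f 1 *K g +K convList (λ m → f (suc m)) gs

  invUpTo : PS → ℕ → List K
  invUpTo f zero = invK (f 0) ∷ []
  invUpTo f (suc n) =
    let prev = invUpTo f n in
    (-K (invK (f 0) *K convList f prev)) ∷ prev

  headK : List K → K
  headK [] = 0K
  headK (a ∷ _) = a

invPS : PS → PS
invPS f n = headK (invUpTo f n)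

dil : (k : ℕ) → .{{ℕ.NonZero k}} → PS → PS
dil k f n with n ℕ.% k ℕ.≟ 0
... | yes _ = f (n ℕ./ k)
... | no _ = 0K

prodUpTo : (ℕ → PS) → ℕ → PS
prodUpTo F zero = F 0
prodUpTo F (suc N) = prodUpTo F N ⊛ F (suc N)

-- (q^a ; q^m)_∞ = Π_{j≥0} (1 - q^{a + j m}),  for a, m ≥ 1.
-- Its coefficient of q^N only involves the factors with j ≤ N
-- (since a + j m > N for j > N), so it is computed from that finite product.
poch : ℕ → ℕ → PS
poch a m N = prodUpTo (λ j → onePS ⊖ mono 1K (a ℕ.+ j ℕ.* m)) N N

-- [q^a ; q^m]_∞ = (q^a ; q^m)_∞ (q^m / q^a ; q^m)_∞   (0 < a < m)
theta : ℕ → ℕ → PS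
theta a m = poch a m ⊛ poch (m ℕ.∸ a) m

-- Formal Laurent series: q^s · f  with s ∈ ℤ and f a power series.

record LS : Set where
  constructor mkLS
  field
    lshift : ℤ
    lser   : PS

open LS public

coeffLS : LS → ℤ → K
coeffLS (mkLS s f) N with N ℤ.- s
... | + k = f k
... | -[1+ _ ] = 0K

_⊛L_ : LS → LS → LS
mkLS s f ⊛L mkLS t g = mkLS (s ℤ.+ t) (f ⊛ g)

qpow : ℤ → LS
qpow e = mkLS e onePS

-- expansion in (nonnegative) powers of q of 1/(1 - α q^e), e ∈ ℤ:
--   e ≥ 0 :  the reciprocal of the power series 1 - α q^e
--   e = -d < 0 :  1/(1 - α q^{-d}) = -α⁻¹ q^d / (1 - α⁻¹ q^d)
geomInv : K → ℤ → LS
geomInv α (+ e) = mkLS (+ 0) (invPS (onePS ⊖ mono α e))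
geomInv α -[1+ k ] =
  mkLS (+ 0) (scalePS (-K (invK α))
    (shiftPS (suc k) (invPS (onePS ⊖ mono (invK α) (suc k)))))

-- Bilateral sum Σ_{n ∈ ℤ} T n of Laurent series T n whose q-adic valuations
-- are ≥ max(0, |n|) (true for both sums in the theorem): the coefficient of
-- q^N is the finite sum over |n| ≤ N + 1.
private
  sumRange : (ℤ → LS) → ℕ → ℕ → K
  sumRange T N zero = coeffLS (T (+ 0)) (+ N)
  sumRange T N (suc b) =
    coeffLS (T (+ suc b)) (+ N) +K coeffLS (T -[1+ b ]) (+ N)
      +K sumRange T N b

bilateralSum : (ℤ → LS) → PS
bilateralSum T N = sumRange T N (suc N)

term1 : K → ℤ → LS
term1 ζ n =
  qpow (+ 3 ℤ.* n ℤ.* n ℤ.+ n)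
    ⊛L geomInv ζ (+ 3 ℤ.* n) ⊛L geomInv (invK ζ) (+ 3 ℤ.* n)

term2 : K → ℤ → LS
term2 ζ n =
  qpow (+ 3 ℤ.* n ℤ.* n ℤ.+ + 7 ℤ.* n ℤ.+ + 2)
    ⊛L geomInv ζ (+ 3 ℤ.* n ℤ.+ + 1)
    ⊛L geomInv (invK ζ) (+ 3 ℤ.* n ℤ.+ + 1)

LHS : K → PS
LHS ζ = invPS (poch 1 1) ⊛ (bilateralSum (term1 ζ) ⊖ bilateralSum (term2 ζ))

fifth : K
fifth = ofℚ ((+ 1) ℚ./ 5)

κ : ℤ → K
κ r = ofℚ (r ℚ./ 1)

A450 A451 A452 A453 : K → PS
A450 c =
  scalePS ((κ (+ 3) +K c) *K fifth) (theta 2 5 ⊛ invPS (theta 1 5 ⊛ theta 1 5))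
  ⊖ shiftPS 1 (scalePS (κ (+ 1) +K c)
      (theta 2 15 ⊛ invPS (theta 1 15 ⊛ theta 4 15 ⊛ theta 5 15 ⊛ theta 6 15)))
A451 c =
  scalePS ((κ (ℤ.- + 2) +K c) *K fifth) (invPS (theta 1 5))
  ⊕ invPS (theta 2 15 ⊛ theta 3 15 ⊛ theta 5 15)
A452 c =
  scalePS ((κ (+ 1) +K κ (+ 2) *K c) *K fifth) (invPS (theta 2 5))
  ⊖ invPS (theta 1 15 ⊛ theta 5 15 ⊛ theta 6 15)
A453 c =
  scalePS ((κ (ℤ.- + 1) -K κ (+ 2) *K c) *K fifth)
    (theta 1 5 ⊛ invPS (theta 2 5 ⊛ theta 2 5))
  ⊖ shiftPS 1 (scalePS c
      (theta 1 15 ⊛ invPS (theta 2 15 ⊛ theta 3 15 ⊛ theta 5 15 ⊛ theta 7 15)))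

RHS : K → PS
RHS c = poch 25 25 ⊛
  (dil 5 (A450 c) ⊕ shiftPS 1 (dil 5 (A451 c))
   ⊕ shiftPS 2 (dil 5 (A452 c)) ⊕ shiftPS 3 (dil 5 (A453 c)))

module Submission where

{-
Write T(z) = (z, q/z, q; q)_∞ and θ(z) = z Σ_n (-1)^n z^n q^{n(3n-1)/2}, ζ = ζ₅, (q) = (q; q)_∞.  By partial
fractions the difference of the two Lambert series is (A(ζ) - A(ζ⁻¹)) / (ζ - ζ⁻¹) with

  A(z) = Σ_k q^{k(3k-2)} (1/(1 - z q^{3k}) - 1/(1 - z q^{2-3k})).

The coefficients E_m in T(z) A(z) = Σ_m (-1)^m z^m q^{m(m-1)/2} E_m satisfy E_{m+1} = q^{2(m-1)} E_m, hence
T(z) A(z) = - E_1 θ(z), and letting z → 1 Jacobi's identity for (q)³ gives E_1 = - (q)².  As T(ζ⁻¹) = - ζ⁻¹ T(ζ)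
and T(ζ) T(ζ²) = (1 - ζ) (1 - ζ²) (q) (q⁵; q⁵)_∞, the left-hand side L of the theorem satisfies

  (1 - ζ) (1 - ζ²) (ζ - ζ⁻¹) (q⁵; q⁵)_∞ L = N T(ζ²),   N = θ(ζ) + ζ θ(ζ⁻¹).

Both N and T(ζ²) are theta series, so the triple product determines their residue classes modulo 5.  The classes
of the product are those of the right-hand side by two instances of the quintuple product identity, each of which
is a change of variables in a double sum over ℤ², split by parity.
-}

open import Level using (0ℓ)
open import Algebra.Bundles using (AbelianGroup; CommutativeRing; RawRing)
open import Algebra.Structures using (IsCommutativeRing)
open import Data.Fin as Fin using (Fin; toℕ; fromℕ<)
import Data.Fin.Properties as FinP
open import Data.Integer as ℤ using (ℤ; +_; -[1+_]; ∣_∣)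
import Data.Integer.DivMod as ℤD
import Data.Integer.Properties as ℤP
import Data.Integer.Solver as ℤSolver
open import Data.List using (List; []; _∷_; map; _++_; cartesianProduct; deduplicate; allFin)
open import Data.List.Membership.DecPropositional using (_∈?_)
open import Data.List.Membership.Propositional using (_∈_; _∉_)
import Data.List.Membership.Propositional.Properties as ∈P
open import Data.List.Relation.Unary.All as All using (All; []; _∷_)
open import Data.List.Relation.Unary.AllPairs using ([]; _∷_)
open import Data.List.Relation.Unary.Any using (here; there)
import Data.List.Relation.Unary.Unique.DecPropositional.Properties as DecUniqueP
open import Data.List.Relation.Unary.Unique.Propositional using (Unique)
import Data.List.Relation.Unary.Unique.Propositional.Properties as UniqueP
open import Data.Maybe using (Maybe; just; nothing)
open import Data.Nat as ℕ using (ℕ; zero; suc; _≤_; _<_; _∸_; z≤n; s≤s)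
import Data.Nat.DivMod as ℕDM
import Data.Nat.Properties as ℕP
import Data.Nat.Solver as ℕSolver
open import Data.Product using (Σ; _×_; _,_; proj₁; proj₂; swap)
import Data.Product.Properties as ProdP
open import Data.Rational as ℚ using (ℚ; 0ℚ; 1ℚ; mkℚ; NonNegative; Positive)
import Data.Rational.Properties as ℚP
open import Data.Vec using (Vec; []; _∷_)
open import Function using (_∘_)
open import Relation.Binary.Definitions using (DecidableEquality)
open import Relation.Nullary using (Dec; yes; no; contradiction)
import Relation.Binary.PropositionalEquality as ≡
open ≡ using (_≡_; _≢_; cong; cong₂; module ≡-Reasoning)

-- The obstacle is to expand `T(z)/(1 - z q^n)` for every integer `n`. Dividing formally and
-- cancelling the terms that pair off leaves the partial theta series `v`, which are power series in
-- `q` and keep their meaning at `z = 1`, `n = 0`, where the divisor is zero. This is what replaces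
-- the limit `z → 1`: the coefficients `E_m` do not involve `z`, so they may be computed in the
-- instance `z = 1`. There `T(1) = 0` kills every quotient except the one at `n = 0`, and summation
-- by parts identifies that one with Jacobi's series.
--
-- Negative powers of `q` are avoided by clearing: a relation with a factor `q^n` is stated for all
-- naturals with `a = b + n`, with `q^a` and `q^b` in place of `q^n` and 1. Division is always
-- cancellation, either of a power of `q` or of a series whose constant term has a known inverse.

module IntegerCoefficientSolver (R : CommutativeRing 0ℓ 0ℓ) where
  open CommutativeRing R
  open import Algebra.Solver.Ring.AlmostCommutativeRing
  open import Algebra.Properties.Semiring.Mult.TCOptimised semiring renaming (_×_ to _⋅_)
  open import Algebra.Properties.Ring ring using (-‿distribˡ-*; -‿distribʳ-*; -0#≈0#; -‿involutive)
  open import Algebra.Properties.AbelianGroup +-abelianGroup using (⁻¹-∙-comm)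
  open import Relation.Binary.Reasoning.Setoid setoid

  private
    fromℤ : ℤ → Carrier
    fromℤ (+ n) = n ⋅ 1#
    fromℤ -[1+ n ] = - (suc n ⋅ 1#)

    suc-× : ∀ n → suc n ⋅ 1# ≈ 1# + n ⋅ 1#
    suc-× n = ×-homo-+ 1# 1 n

    ⊖-homo : ∀ m n → fromℤ (m ℤ.⊖ n) ≈ m ⋅ 1# + - (n ⋅ 1#)
    ⊖-homo zero zero = sym (-‿inverseʳ 0#)
    ⊖-homo zero (suc n) = sym (+-identityˡ _)
    ⊖-homo (suc m) zero = sym (trans (+-congˡ -0#≈0#) (+-identityʳ _))
    ⊖-homo (suc m) (suc n) = begin
      fromℤ (suc m ℤ.⊖ suc n)            ≡⟨ ≡.cong fromℤ (ℤP.[1+m]⊖[1+n]≡m⊖n m n) ⟩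
      fromℤ (m ℤ.⊖ n)                    ≈⟨ ⊖-homo m n ⟩
      m ⋅ 1# + - (n ⋅ 1#)                ≈⟨ +-congʳ (+-identityˡ _) ⟨
      0# + m ⋅ 1# + - (n ⋅ 1#)           ≈⟨ +-congʳ (+-congʳ (-‿inverseʳ 1#)) ⟨
      1# + - 1# + m ⋅ 1# + - (n ⋅ 1#)    ≈⟨ +-congʳ (+-assoc _ _ _) ⟩
      1# + (- 1# + m ⋅ 1#) + - (n ⋅ 1#)  ≈⟨ +-congʳ (+-congˡ (+-comm _ _)) ⟩
      1# + (m ⋅ 1# + - 1#) + - (n ⋅ 1#)  ≈⟨ +-congʳ (+-assoc _ _ _) ⟨
      1# + m ⋅ 1# + - 1# + - (n ⋅ 1#)    ≈⟨ +-assoc _ _ _ ⟩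
      1# + m ⋅ 1# + (- 1# + - (n ⋅ 1#))  ≈⟨ +-congˡ (⁻¹-∙-comm _ _) ⟩
      1# + m ⋅ 1# + - (1# + n ⋅ 1#)      ≈⟨ +-cong (suc-× m) (-‿cong (suc-× n)) ⟨
      suc m ⋅ 1# + - (suc n ⋅ 1#)        ∎

    neg-homo : ∀ i → fromℤ (ℤ.- i) ≈ - fromℤ i
    neg-homo (+ zero) = sym -0#≈0#
    neg-homo (+ suc n) = refl
    neg-homo -[1+ n ] = sym (-‿involutive _)

    +-homo : ∀ i j → fromℤ (i ℤ.+ j) ≈ fromℤ i + fromℤ j
    +-homo (+ m) (+ n) = ×-homo-+ 1# m n
    +-homo (+ m) -[1+ n ] = ⊖-homo m (suc n)
    +-homo -[1+ m ] (+ n) = trans (⊖-homo n (suc m)) (+-comm _ _)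
    +-homo -[1+ m ] -[1+ n ] = begin
      - (suc (suc (m ℕ.+ n)) ⋅ 1#)     ≡⟨ ≡.cong (λ k → - (suc k ⋅ 1#)) (ℕP.+-suc m n) ⟨
      - ((suc m ℕ.+ suc n) ⋅ 1#)       ≈⟨ -‿cong (×-homo-+ 1# (suc m) (suc n)) ⟩
      - (suc m ⋅ 1# + suc n ⋅ 1#)      ≈⟨ ⁻¹-∙-comm _ _ ⟨
      - (suc m ⋅ 1#) + - (suc n ⋅ 1#)  ∎
      where import Data.Nat.Properties as ℕP

    pos-*-homo : ∀ m j → fromℤ (+ m ℤ.* j) ≈ fromℤ (+ m) * fromℤ j
    pos-*-homo m (+ n) = trans (reflexive (≡.cong fromℤ (≡.sym (ℤP.pos-* m n)))) (×1-homo-* m n)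
    pos-*-homo m -[1+ n ] = begin
      fromℤ (+ m ℤ.* -[1+ n ])           ≡⟨ ≡.cong fromℤ (ℤP.neg-distribʳ-* (+ m) (+ suc n)) ⟨
      fromℤ (ℤ.- (+ m ℤ.* + suc n))      ≈⟨ neg-homo (+ m ℤ.* + suc n) ⟩
      - fromℤ (+ m ℤ.* + suc n)          ≈⟨ -‿cong (pos-*-homo m (+ suc n)) ⟩
      - (fromℤ (+ m) * fromℤ (+ suc n))  ≈⟨ -‿distribʳ-* _ _ ⟩
      fromℤ (+ m) * fromℤ -[1+ n ]       ∎

    *-homo : ∀ i j → fromℤ (i ℤ.* j) ≈ fromℤ i * fromℤ j
    *-homo (+ m) j = pos-*-homo m j
    *-homo -[1+ m ] j = begin
      fromℤ (-[1+ m ] ℤ.* j)         ≡⟨ ≡.cong fromℤ (ℤP.neg-distribˡ-* (+ suc m) j) ⟨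
      fromℤ (ℤ.- (+ suc m ℤ.* j))    ≈⟨ neg-homo (+ suc m ℤ.* j) ⟩
      - fromℤ (+ suc m ℤ.* j)        ≈⟨ -‿cong (pos-*-homo (suc m) j) ⟩
      - (fromℤ (+ suc m) * fromℤ j)  ≈⟨ -‿distribˡ-* _ _ ⟩
      fromℤ -[1+ m ] * fromℤ j       ∎

    ℤ-rawRing : RawRing 0ℓ 0ℓ
    ℤ-rawRing = record
      { Carrier = ℤ ; _≈_ = ≡._≡_ ; _+_ = ℤ._+_ ; _*_ = ℤ._*_ ; -_ = ℤ.-_
      ; 0# = + 0 ; 1# = + 1 }

    morphism : ℤ-rawRing -Raw-AlmostCommutative⟶ fromCommutativeRing R
    morphism = record
      { ⟦_⟧ = fromℤ ; +-homo = +-homo ; *-homo = *-homo ; -‿homo = neg-homo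
      ; 0-homo = refl ; 1-homo = refl }

    -- Only the integer coefficients of normal forms are compared, so numerals simplify even though
    -- equality in the ring itself need not be decidable.
    _coeff≟_ : ∀ i j → Maybe (fromℤ i ≈ fromℤ j)
    i coeff≟ j with i ℤ.≟ j
    ... | yes i≡j = just (reflexive (≡.cong fromℤ i≡j))
    ... | no _ = nothing

  open import Algebra.Solver.Ring ℤ-rawRing (fromCommutativeRing R) morphism _coeff≟_ public
    using (Polynomial; solve; prove; ⟦_⟧↓; _:=_; _:+_; _:*_; _:-_; _:^_; :-_; con; var; ⟦_⟧)

-- Formal power series over a commutative ring.

record CoefficientRing : Set₁ where
  infixl 6 _+_
  infixl 7 _*_
  infix 8 -_
  field
    Carrier : Set
    _+_ _*_ : Carrier → Carrier → Carrier
    -_ : Carrier → Carrier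
    0# 1# : Carrier
    isCommutativeRing : IsCommutativeRing _≡_ _+_ _*_ -_ 0# 1#

  commutativeRing : CommutativeRing 0ℓ 0ℓ
  commutativeRing = record { isCommutativeRing = isCommutativeRing }

module PowerSeries (𝓡 : CoefficientRing) where

  open CoefficientRing 𝓡 public renaming (Carrier to R)
  module R = CommutativeRing commutativeRing
  module RS = IntegerCoefficientSolver commutativeRing
  open ≡-Reasoning

  PS : Set
  PS = ℕ → R

  infix 4 _≈_
  _≈_ : PS → PS → Set
  f ≈ g = ∀ n → f n ≡ g n

  infixl 6 _⊕_ _⊖_
  infixl 7 _⊛_
  infix 8 ⊝_

  _⊕_ _⊖_ _⊛_ : PS → PS → PS
  ⊝_ : PS → PS
  (f ⊕ g) n = f n + g n
  (f ⊖ g) n = f n + - g n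
  (⊝ f) n = - f n

  tail : PS → PS
  tail f n = f (suc n)

  scale : R → PS → PS
  scale a f n = a * f n

  (f ⊛ g) zero = f 0 * g 0
  (f ⊛ g) (suc n) = f 0 * g (suc n) + (tail f ⊛ g) n

  const : R → PS
  const a zero = a
  const a (suc n) = 0#

  𝟘 𝟙 : PS
  𝟘 _ = 0#
  𝟙 = const 1#

  -- Locality of the Cauchy product. The bounded form gives both the congruence `⊛-cong` and the
  -- congruence `[]-⊛` modulo a power of `q`.
  ⊛-≤-cong : ∀ {f f′ g g′} n → (∀ i → i ≤ n → f i ≡ f′ i) → (∀ i → i ≤ n → g i ≡ g′ i) →
             (f ⊛ g) n ≡ (f′ ⊛ g′) n
  ⊛-≤-cong zero p q = cong₂ _*_ (p 0 z≤n) (q 0 z≤n)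
  ⊛-≤-cong (suc n) p q = cong₂ _+_ (cong₂ _*_ (p 0 z≤n) (q (suc n) ℕP.≤-refl))
    (⊛-≤-cong n (λ i i≤n → p (suc i) (s≤s i≤n)) (λ i i≤n → q i (ℕP.m≤n⇒m≤1+n i≤n)))

  ⊛-cong : ∀ {f f′ g g′} → f ≈ f′ → g ≈ g′ → f ⊛ g ≈ f′ ⊛ g′
  ⊛-cong p q n = ⊛-≤-cong n (λ i _ → p i) (λ i _ → q i)

  -- The product is defined by peeling coefficients off the left factor; this is the mirror
  -- recursion, which makes commutativity an induction.
  ⊛-suc′ : ∀ f g n → (f ⊛ g) (suc n) ≡ (f ⊛ tail g) n + f (suc n) * g 0
  ⊛-suc′ f g zero = ≡.refl
  ⊛-suc′ f g (suc n) = begin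
    f 0 * g (suc (suc n)) + (tail f ⊛ g) (suc n)                          ≡⟨ R.+-congˡ (⊛-suc′ (tail f) g n) ⟩
    f 0 * g (suc (suc n)) + ((tail f ⊛ tail g) n + f (suc (suc n)) * g 0) ≡⟨ R.+-assoc _ _ _ ⟨
    (f ⊛ tail g) (suc n) + f (suc (suc n)) * g 0                          ∎

  ⊛-comm : ∀ f g → f ⊛ g ≈ g ⊛ f
  ⊛-comm f g zero = R.*-comm _ _
  ⊛-comm f g (suc n) = begin
    f 0 * g (suc n) + (tail f ⊛ g) n  ≡⟨ cong₂ _+_ (R.*-comm _ _) (⊛-comm (tail f) g n) ⟩
    g (suc n) * f 0 + (g ⊛ tail f) n  ≡⟨ R.+-comm _ _ ⟩
    (g ⊛ tail f) n + g (suc n) * f 0  ≡⟨ ⊛-suc′ g f n ⟨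
    (g ⊛ f) (suc n)                   ∎

  ⊛-distribʳ : ∀ h f g → (f ⊕ g) ⊛ h ≈ f ⊛ h ⊕ g ⊛ h
  ⊛-distribʳ h f g zero = R.distribʳ _ _ _
  ⊛-distribʳ h f g (suc n) = begin
    (f 0 + g 0) * h (suc n) + (tail (f ⊕ g) ⊛ h) n
      ≡⟨ R.+-congˡ (⊛-distribʳ h (tail f) (tail g) n) ⟩
    (f 0 + g 0) * h (suc n) + ((tail f ⊛ h) n + (tail g ⊛ h) n)
      ≡⟨ RS.solve 5 (λ a b c d e → (a :+ b) :* c :+ (d :+ e) := (a :* c :+ d) :+ (b :* c :+ e))
           ≡.refl (f 0) (g 0) (h (suc n)) _ _ ⟩
    (f ⊛ h ⊕ g ⊛ h) (suc n) ∎
    where open RS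

  scale-⊛ : ∀ a f g → scale a f ⊛ g ≈ scale a (f ⊛ g)
  scale-⊛ a f g zero = R.*-assoc _ _ _
  scale-⊛ a f g (suc n) = begin
    a * f 0 * g (suc n) + (scale a (tail f) ⊛ g) n
      ≡⟨ cong₂ _+_ (R.*-assoc _ _ _) (scale-⊛ a (tail f) g n) ⟩
    a * (f 0 * g (suc n)) + a * (tail f ⊛ g) n ≡⟨ R.distribˡ _ _ _ ⟨
    a * (f ⊛ g) (suc n) ∎

  ⊛-assoc : ∀ f g h → (f ⊛ g) ⊛ h ≈ f ⊛ (g ⊛ h)
  ⊛-assoc f g h zero = R.*-assoc _ _ _
  ⊛-assoc f g h (suc n) = begin
    f 0 * g 0 * h (suc n) + ((scale (f 0) (tail g) ⊕ tail f ⊛ g) ⊛ h) n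
      ≡⟨ R.+-congˡ (⊛-distribʳ h (scale (f 0) (tail g)) (tail f ⊛ g) n) ⟩
    f 0 * g 0 * h (suc n) + ((scale (f 0) (tail g) ⊛ h) n + ((tail f ⊛ g) ⊛ h) n)
      ≡⟨ cong₂ (λ x y → f 0 * g 0 * h (suc n) + (x + y)) (scale-⊛ (f 0) (tail g) h n) (⊛-assoc (tail f) g h n) ⟩
    f 0 * g 0 * h (suc n) + (f 0 * (tail g ⊛ h) n + (tail f ⊛ (g ⊛ h)) n)
      ≡⟨ RS.solve 5 (λ a b c d e → a :* b :* c :+ (a :* d :+ e) := a :* (b :* c :+ d) :+ e)
           ≡.refl (f 0) (g 0) (h (suc n)) _ _ ⟩
    (f ⊛ (g ⊛ h)) (suc n) ∎
    where open RS

  𝟘-⊛ : ∀ f n → (𝟘 ⊛ f) n ≡ 0#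
  𝟘-⊛ f zero = R.zeroˡ _
  𝟘-⊛ f (suc n) = ≡.trans (cong₂ _+_ (R.zeroˡ _) (𝟘-⊛ f n)) (R.+-identityʳ _)

  const-⊛ : ∀ a f → const a ⊛ f ≈ scale a f
  const-⊛ a f zero = ≡.refl
  const-⊛ a f (suc n) = ≡.trans (R.+-congˡ (𝟘-⊛ f n)) (R.+-identityʳ _)

  PS-isCommutativeRing : IsCommutativeRing _≈_ _⊕_ _⊛_ ⊝_ 𝟘 𝟙
  PS-isCommutativeRing = record
    { isRing = record
      { +-isAbelianGroup = record
        { isGroup = record
          { isMonoid = record
            { isSemigroup = record
              { isMagma = record
                { isEquivalence = record
                  { refl = λ _ → ≡.refl ; sym = λ p n → ≡.sym (p n) ; trans = λ p q n → ≡.trans (p n) (q n) }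
                ; ∙-cong = λ p q n → cong₂ _+_ (p n) (q n) }
              ; assoc = λ f g h n → R.+-assoc _ _ _ }
            ; identity = (λ f n → R.+-identityˡ _) , (λ f n → R.+-identityʳ _) }
          ; inverse = (λ f n → R.-‿inverseˡ _) , (λ f n → R.-‿inverseʳ _)
          ; ⁻¹-cong = λ p n → cong -_ (p n) }
        ; comm = λ f g n → R.+-comm _ _ }
      ; *-cong = ⊛-cong
      ; *-assoc = ⊛-assoc
      ; *-identity = 𝟙-⊛ , (λ f n → ≡.trans (⊛-comm f 𝟙 n) (𝟙-⊛ f n))
      ; distrib = (λ h f g n → ≡.trans (⊛-comm h (f ⊕ g) n) (≡.trans (⊛-distribʳ h f g n)
                     (cong₂ _+_ (⊛-comm f h n) (⊛-comm g h n)))) , ⊛-distribʳ }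
    ; *-comm = ⊛-comm }
    where
    𝟙-⊛ : ∀ f → 𝟙 ⊛ f ≈ f
    𝟙-⊛ f n = ≡.trans (const-⊛ 1# f n) (R.*-identityˡ _)

  PS-commutativeRing : CommutativeRing 0ℓ 0ℓ
  PS-commutativeRing = record { isCommutativeRing = PS-isCommutativeRing }

  module S = CommutativeRing PS-commutativeRing
  module SS = IntegerCoefficientSolver PS-commutativeRing

  infix 4 _≈[_]_
  _≈[_]_ : PS → ℕ → PS → Set
  f ≈[ M ] g = ∀ n → n < M → f n ≡ g n

  -- Divisibility by `q^M`. Convergence of sums and products is expressed through it throughout.
  Ord : ℕ → PS → Set
  Ord M f = f ≈[ M ] 𝟘

  ≈⇒≈[] : ∀ {f g M} → f ≈ g → f ≈[ M ] g
  ≈⇒≈[] p n _ = p n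

  []-sym : ∀ {f g M} → f ≈[ M ] g → g ≈[ M ] f
  []-sym p n n<M = ≡.sym (p n n<M)

  []-trans : ∀ {f g h M} → f ≈[ M ] g → g ≈[ M ] h → f ≈[ M ] h
  []-trans p q n n<M = ≡.trans (p n n<M) (q n n<M)

  []-⊕ : ∀ {f f′ g g′ M} → f ≈[ M ] f′ → g ≈[ M ] g′ → f ⊕ g ≈[ M ] f′ ⊕ g′
  []-⊕ p q n n<M = cong₂ _+_ (p n n<M) (q n n<M)

  []-⊛ : ∀ {f f′ g g′ M} → f ≈[ M ] f′ → g ≈[ M ] g′ → f ⊛ g ≈[ M ] f′ ⊛ g′
  []-⊛ p q n n<M = ⊛-≤-cong n (λ i i≤n → p i (ℕP.≤-<-trans i≤n n<M)) (λ i i≤n → q i (ℕP.≤-<-trans i≤n n<M))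

  []⇒≈ : ∀ {f g} → (∀ M → f ≈[ M ] g) → f ≈ g
  []⇒≈ p n = p (suc n) n ℕP.≤-refl

  []-mono : ∀ {f g M M′} → M′ ≤ M → f ≈[ M ] g → f ≈[ M′ ] g
  []-mono M′≤M p n n<M′ = p n (ℕP.<-≤-trans n<M′ M′≤M)

  Ord-⊛ : ∀ {f g} d e → Ord d f → Ord e g → Ord (d ℕ.+ e) (f ⊛ g)
  Ord-⊛ {f} {g} zero e _ q n n<e =
    ≡.trans ([]-⊛ {f} {f} (λ _ _ → ≡.refl) q n n<e) (≡.trans (⊛-comm f 𝟘 n) (𝟘-⊛ f n))
  Ord-⊛ {f} {g} (suc d) e p q zero _ = ≡.trans (cong (_* g 0) (p 0 (s≤s z≤n))) (R.zeroˡ _)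
  Ord-⊛ {f} {g} (suc d) e p q (suc n) (s≤s n<) = ≡.trans
    (cong₂ _+_ (≡.trans (cong (_* g (suc n)) (p 0 (s≤s z≤n))) (R.zeroˡ _))
               (Ord-⊛ d e (λ i i<d → p (suc i) (s≤s i<d)) q n n<))
    (R.+-identityʳ _)

  Ord-⊛ˡ : ∀ {f g d} → Ord d f → Ord d (f ⊛ g)
  Ord-⊛ˡ {f} {g} {d} p = []-mono (ℕP.≤-reflexive (≡.sym (ℕP.+-identityʳ d))) (Ord-⊛ {f} {g} d 0 p (λ _ ()))

  Ord-⊛ʳ : ∀ {f g d} → Ord d g → Ord d (f ⊛ g)
  Ord-⊛ʳ {f} {g} {d} p = Ord-⊛ {f} {g} 0 d (λ _ ()) p

  Ord-⊕ : ∀ {f g d} → Ord d f → Ord d g → Ord d (f ⊕ g)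
  Ord-⊕ p q n n<d = ≡.trans (cong₂ _+_ (p n n<d) (q n n<d)) (R.+-identityʳ _)

  Ord-⊝ : ∀ {f d} → Ord d f → Ord d (⊝ f)
  Ord-⊝ p n n<d = ≡.trans (cong -_ (p n n<d)) -0#≈0#
    where open import Algebra.Properties.Ring R.ring using (-0#≈0#)

  Ord-≈ : ∀ {f g d} → f ≈ g → Ord d f → Ord d g
  Ord-≈ f≈g p n n<d = ≡.trans (≡.sym (f≈g n)) (p n n<d)

  shift : ℕ → PS → PS
  shift zero f = f
  shift (suc j) f zero = 0#
  shift (suc j) f (suc n) = shift j f n

  mono : R → ℕ → PS
  mono a j = shift j (const a)

  X : ℕ → PS
  X = mono 1#

  shift-cong : ∀ j {f g} → f ≈ g → shift j f ≈ shift j g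
  shift-cong zero p n = p n
  shift-cong (suc j) p zero = ≡.refl
  shift-cong (suc j) p (suc n) = shift-cong j p n

  shift-⊛ : ∀ j f g → shift j f ⊛ g ≈ shift j (f ⊛ g)
  shift-⊛ zero f g n = ≡.refl
  shift-⊛ (suc j) f g zero = R.zeroˡ _
  shift-⊛ (suc j) f g (suc n) =
    ≡.trans (cong₂ _+_ (R.zeroˡ _) (shift-⊛ j f g n)) (R.+-identityˡ _)

  shift-shift : ∀ i j f → shift i (shift j f) ≈ shift (i ℕ.+ j) f
  shift-shift zero j f n = ≡.refl
  shift-shift (suc i) j f zero = ≡.refl
  shift-shift (suc i) j f (suc n) = shift-shift i j f n

  shift-+ : ∀ j f n → shift j f (j ℕ.+ n) ≡ f n
  shift-+ zero f n = ≡.refl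
  shift-+ (suc j) f n = shift-+ j f n

  const-* : ∀ a b → const a ⊛ const b ≈ const (a * b)
  const-* a b n = ≡.trans (const-⊛ a (const b) n) (lemma n)
    where
    lemma : scale a (const b) ≈ const (a * b)
    lemma zero = ≡.refl
    lemma (suc n) = R.zeroʳ a

  mono-⊛ : ∀ a i b j → mono a i ⊛ mono b j ≈ mono (a * b) (i ℕ.+ j)
  mono-⊛ a i b j = S.trans (shift-⊛ i (const a) (mono b j)) (S.trans
    (shift-cong i (S.trans (S.*-comm (const a) (mono b j)) (S.trans (shift-⊛ j (const b) (const a))
      (shift-cong j (S.trans (const-* b a) (λ n → cong (λ c → const c n) (R.*-comm b a)))))))
    (shift-shift i j (const (a * b))))

  X-⊛ : ∀ i j → X i ⊛ X j ≈ X (i ℕ.+ j)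
  X-⊛ i j = S.trans (mono-⊛ 1# i 1# j) (λ n → cong (λ c → mono c (i ℕ.+ j) n) (R.*-identityˡ 1#))

  shift≈X⊛ : ∀ j f → shift j f ≈ X j ⊛ f
  shift≈X⊛ j f = S.sym (S.trans (shift-⊛ j 𝟙 f) (shift-cong j (S.*-identityˡ f)))

  mono≈ : ∀ a j → mono a j ≈ const a ⊛ X j
  mono≈ a j = S.trans (λ n → cong (λ c → mono c j n) (≡.sym (R.*-identityʳ a))) (S.sym (mono-⊛ a 0 1# j))

  -- `q^j` is not a unit; this cancellation stands in for multiplication by a negative power of `q`.
  X-cancel : ∀ j {f g} → X j ⊛ f ≈ X j ⊛ g → f ≈ g
  X-cancel j {f} {g} p n = begin
    f n                     ≡⟨ shift-+ j f n ⟨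
    shift j f (j ℕ.+ n)     ≡⟨ shift≈X⊛ j f (j ℕ.+ n) ⟩
    (X j ⊛ f) (j ℕ.+ n)     ≡⟨ p (j ℕ.+ n) ⟩
    (X j ⊛ g) (j ℕ.+ n)     ≡⟨ shift≈X⊛ j g (j ℕ.+ n) ⟨
    shift j g (j ℕ.+ n)     ≡⟨ shift-+ j g n ⟩
    g n                     ∎

  Ord-mono : ∀ a j → Ord j (mono a j)
  Ord-mono a (suc j) zero _ = ≡.refl
  Ord-mono a (suc j) (suc n) (s≤s n<j) = Ord-mono a j n n<j

  -- If `q^n` divides `g`, the coefficient of `q^n` in `f ⊛ g` is `f 0 * g n`, so the vanishing of
  -- the product raises the order of `g` step by step. Only an inverse of the constant term is used,
  -- so the coefficients may have zero divisors.
  unit-cancel-0 : ∀ {f g} a → a * f 0 ≡ 1# → f ⊛ g ≈ 𝟘 → g ≈ 𝟘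
  unit-cancel-0 {f} {g} a a*f0 fg≈0 = []⇒≈ ord
    where
    lowest : ∀ f n → Ord n g → (f ⊛ g) n ≡ f 0 * g n
    lowest f zero _ = ≡.refl
    lowest f (suc n) p = ≡.trans (R.+-congˡ (Ord-⊛ʳ {tail f} p n ℕP.≤-refl)) (R.+-identityʳ _)

    ord : ∀ n → Ord n g
    ord (suc n) m (s≤s m≤n) with m ℕ.≟ n
    ... | no m≢n = ord n m (ℕP.≤∧≢⇒< m≤n m≢n)
    ... | yes ≡.refl = begin
      g n               ≡⟨ R.*-identityˡ _ ⟨
      1# * g n          ≡⟨ cong (_* g n) a*f0 ⟨
      a * f 0 * g n     ≡⟨ R.*-assoc _ _ _ ⟩
      a * (f 0 * g n)   ≡⟨ cong (a *_) (lowest f n (ord n)) ⟨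
      a * (f ⊛ g) n     ≡⟨ cong (a *_) (fg≈0 n) ⟩
      a * 0#            ≡⟨ R.zeroʳ a ⟩
      0#                ∎

  unit-cancel : ∀ {f g h} a → a * f 0 ≡ 1# → f ⊛ g ≈ f ⊛ h → g ≈ h
  unit-cancel {f} {g} {h} a a*f0 p n = RP.x∙y⁻¹≈ε⇒x≈y (g n) (h n) (unit-cancel-0 {f} {g ⊖ h} a a*f0 lemma n)
    where
    import Algebra.Properties.Group R.+-group as RP
    lemma : f ⊛ (g ⊖ h) ≈ 𝟘
    lemma = S.trans (SS.solve 3 (λ f g h → f :* (g :- h) := f :* g :- f :* h) S.refl f g h)
      (S.trans (S.+-congʳ p) (S.-‿inverseʳ (f ⊛ h)))
      where open SS

-- Summable families of power series.

record DecEq (I : Set) : Set where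
  field _≟_ : DecidableEquality I

open DecEq {{...}}

instance
  ℤ-DecEq : DecEq ℤ
  ℤ-DecEq = record { _≟_ = ℤ._≟_ }

  Fin-DecEq : ∀ {n} → DecEq (Fin n)
  Fin-DecEq = record { _≟_ = Fin._≟_ }

  ×-DecEq : ∀ {I J} → {{DecEq I}} → {{DecEq J}} → DecEq (I × J)
  ×-DecEq = record { _≟_ = ProdP.≡-dec _≟_ _≟_ }

-- The order is that in which the bilateral sum of the statement adds its terms, so the two are
-- compared without rearrangement.
window : ℕ → List ℤ
window zero = + 0 ∷ []
window (suc b) = + suc b ∷ -[1+ b ] ∷ window b

∈-window⁻ : ∀ b {i} → i ∈ window b → ∣ i ∣ ≤ b
∈-window⁻ zero (here ≡.refl) = z≤n
∈-window⁻ (suc b) (here ≡.refl) = ℕP.≤-refl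
∈-window⁻ (suc b) (there (here ≡.refl)) = ℕP.≤-refl
∈-window⁻ (suc b) (there (there p)) = ℕP.m≤n⇒m≤1+n (∈-window⁻ b p)

∈-window⁺ : ∀ b i → ∣ i ∣ ≤ b → i ∈ window b
∈-window⁺ zero (+ zero) z≤n = here ≡.refl
∈-window⁺ (suc b) i ∣i∣≤ with ∣ i ∣ ℕ.≟ suc b
∈-window⁺ (suc b) (+ n) ∣i∣≤ | yes ≡.refl = here ≡.refl
∈-window⁺ (suc b) -[1+ n ] ∣i∣≤ | yes ≡.refl = there (here ≡.refl)
∈-window⁺ (suc b) i ∣i∣≤ | no ≢ = there (there (∈-window⁺ b i (ℕP.≤-pred (ℕP.≤∧≢⇒< ∣i∣≤ ≢))))

window-unique : ∀ b → Unique (window b)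
window-unique zero = [] ∷ []
window-unique (suc b) = ((λ ()) ∷ fresh (+ suc b) ≡.refl) ∷ fresh -[1+ b ] ≡.refl ∷ window-unique b
  where
  fresh : ∀ i → ∣ i ∣ ≡ suc b → All (i ≢_) (window b)
  fresh i ∣i∣ = All.tabulate λ {j} j∈ i≡j →
    ℕP.<-irrefl ≡.refl (ℕP.≤-trans (ℕP.≤-reflexive (≡.trans (≡.sym ∣i∣) (cong ∣_∣ i≡j))) (∈-window⁻ b j∈))

-- F : I → PS is summable when only finitely many of its members are nonzero modulo each q^M.
module Summation (𝓡 : CoefficientRing) where
  open PowerSeries 𝓡

  private variable
    I J : Set

  sumL : List I → (I → PS) → PS
  sumL [] F = 𝟘
  sumL (i ∷ is) F = F i ⊕ sumL is F

  Support : ℕ → (I → PS) → List I → Set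
  Support M F is = ∀ i → i ∉ is → Ord M (F i)

  Summable : (I → PS) → Set
  Summable {I} F = ∀ M → Σ (List I) λ is → Unique is × Support M F is

  -- For each modulus a single list shows that the rest of the family is negligible and that the
  -- list adds up to `S`. Keeping the support in the definition lets sums be multiplied, reindexed
  -- and interchanged list by list.
  HasSum : (I → PS) → PS → Set
  HasSum {I} F S = ∀ M → Σ (List I) λ is → Unique is × Support M F is × (S ≈[ M ] sumL is F)

  sumL-cong : ∀ {F G} (is : List I) → (∀ i → F i ≈ G i) → sumL is F ≈ sumL is G
  sumL-cong [] p = S.refl
  sumL-cong (i ∷ is) p = S.+-cong (p i) (sumL-cong is p)

  sumL-[]cong : ∀ {F G M} (is : List I) → (∀ i → F i ≈[ M ] G i) → sumL is F ≈[ M ] sumL is G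
  sumL-[]cong [] p _ _ = ≡.refl
  sumL-[]cong (i ∷ is) p = []-⊕ (p i) (sumL-[]cong is p)

  sumL-⊕ : ∀ {F G} (is : List I) → sumL is (λ i → F i ⊕ G i) ≈ sumL is F ⊕ sumL is G
  sumL-⊕ [] = S.sym (S.+-identityˡ 𝟘)
  sumL-⊕ {F = F} {G} (i ∷ is) = S.trans (S.+-congˡ (sumL-⊕ is))
    (solve 4 (λ a b c d → (a :+ b) :+ (c :+ d) := (a :+ c) :+ (b :+ d)) S.refl (F i) (G i) (sumL is F) (sumL is G))
    where open SS

  sumL-⊛ˡ : ∀ g {F} (is : List I) → sumL is (λ i → g ⊛ F i) ≈ g ⊛ sumL is F
  sumL-⊛ˡ g [] = S.sym (S.zeroʳ g)
  sumL-⊛ˡ g (i ∷ is) = S.trans (S.+-congˡ (sumL-⊛ˡ g is)) (S.sym (S.distribˡ g _ _))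

  sumL-map : ∀ (φ : J → I) {F} is → sumL (map φ is) F ≈ sumL is (F ∘ φ)
  sumL-map φ [] = S.refl
  sumL-map φ (i ∷ is) = S.+-congˡ (sumL-map φ is)

  sumL-++ : ∀ {F} (is js : List I) → sumL (is ++ js) F ≈ sumL is F ⊕ sumL js F
  sumL-++ [] js = S.sym (S.+-identityˡ _)
  sumL-++ (i ∷ is) js = S.trans (S.+-congˡ (sumL-++ is js)) (S.sym (S.+-assoc _ _ _))

  sumL-× : ∀ {F : I × J → PS} is js → sumL (cartesianProduct is js) F ≈ sumL is (λ i → sumL js (λ j → F (i , j)))
  sumL-× [] js = S.refl
  sumL-× {F = F} (i ∷ is) js = S.trans (sumL-++ (map (i ,_) js) (cartesianProduct is js))
    (S.+-cong (sumL-map (i ,_) js) (sumL-× is js))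

  sumL-Ord : ∀ {F M} (is : List I) → (∀ i → i ∈ is → Ord M (F i)) → Ord M (sumL is F)
  sumL-Ord [] p _ _ = ≡.refl
  sumL-Ord {F = F} (i ∷ is) p = Ord-⊕ {F i} (p i (here ≡.refl)) (sumL-Ord is (λ j j∈ → p j (there j∈)))

  remove : ∀ {i : I} is → i ∈ is → List I
  remove (j ∷ is) (here _) = is
  remove (j ∷ is) (there p) = j ∷ remove is p

  sumL-remove : ∀ {F i} (is : List I) (p : i ∈ is) → sumL is F ≈ F i ⊕ sumL (remove is p) F
  sumL-remove (i ∷ is) (here ≡.refl) = S.refl
  sumL-remove {F = F} {i} (j ∷ is) (there p) = S.trans (S.+-congˡ (sumL-remove is p))
    (solve 3 (λ a b c → a :+ (b :+ c) := b :+ (a :+ c)) S.refl (F j) (F i) (sumL (remove is p) F))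
    where open SS

  ∈-remove⁻ : ∀ {i j : I} is (p : i ∈ is) → j ∈ remove is p → j ∈ is
  ∈-remove⁻ (_ ∷ is) (here _) q = there q
  ∈-remove⁻ (_ ∷ is) (there p) (here e) = here e
  ∈-remove⁻ (_ ∷ is) (there p) (there q) = there (∈-remove⁻ is p q)

  ∈-remove⁺ : ∀ {i j : I} is (p : i ∈ is) → j ≢ i → j ∈ is → j ∈ remove is p
  ∈-remove⁺ (_ ∷ is) (here ≡.refl) j≢i (here e) = contradiction e j≢i
  ∈-remove⁺ (_ ∷ is) (here _) j≢i (there q) = q
  ∈-remove⁺ (_ ∷ is) (there p) j≢i (here e) = here e
  ∈-remove⁺ (_ ∷ is) (there p) j≢i (there q) = there (∈-remove⁺ is p j≢i q)

  remove-unique : ∀ {i : I} is (p : i ∈ is) → Unique is → Unique (remove is p)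
  remove-unique (_ ∷ is) (here _) (_ ∷ u) = u
  remove-unique (j ∷ is) (there p) (f ∷ u) =
    All.tabulate (λ k∈ → All.lookup f (∈-remove⁻ is p k∈)) ∷ remove-unique is p u

  remove-∌ : ∀ {i : I} is (p : i ∈ is) → Unique is → i ∉ remove is p
  remove-∌ (_ ∷ is) (here ≡.refl) (f ∷ u) q = All.lookup f q ≡.refl
  remove-∌ (j ∷ is) (there p) (f ∷ u) (here ≡.refl) = All.lookup f p ≡.refl
  remove-∌ (j ∷ is) (there p) (f ∷ u) (there q) = remove-∌ is p u q

  -- Members common to both lists are cancelled one at a time, and a member of only one list is
  -- negligible. Hence the value of a sum does not depend on the chosen support, which gives
  -- `hasSum-unique`.
  sumL-indep : {{_ : DecEq I}} → ∀ {F M} (is js : List I) → Unique is → Unique js →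
    (∀ i → i ∈ is → i ∉ js → Ord M (F i)) → (∀ i → i ∈ js → i ∉ is → Ord M (F i)) →
    sumL is F ≈[ M ] sumL js F
  sumL-indep [] js u v p q = []-sym (sumL-Ord js (λ i i∈ → q i i∈ λ ()))
  sumL-indep {F = F} (i ∷ is) js (i∉ ∷ u) v p q with _∈?_ _≟_ i js
  ... | yes i∈ = []-trans
    ([]-⊕ {F i} (λ _ _ → ≡.refl) (sumL-indep is (remove js i∈) u (remove-unique js i∈ v)
      (λ j j∈ j∉ → p j (there j∈) (λ j∈js → j∉ (∈-remove⁺ js i∈ (λ j≡i → All.lookup i∉ j∈ (≡.sym j≡i)) j∈js)))
      (λ { j j∈ j∉ → q j (∈-remove⁻ js i∈ j∈) λ where
             (here ≡.refl) → remove-∌ js i∈ v j∈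
             (there j∈is) → j∉ j∈is })))
    (≈⇒≈[] (S.sym (sumL-remove {F = F} js i∈)))
  ... | no i∉js = []-trans
    ([]-⊕ (p i (here ≡.refl) i∉js) (sumL-indep is js u v (λ j j∈ → p j (there j∈))
      (λ { j j∈ j∉ → q j j∈ λ where
             (here ≡.refl) → i∉js j∈
             (there j∈is) → j∉ j∈is })))
    (≈⇒≈[] (S.+-identityˡ _))

  module _ {{_ : DecEq I}} where

    sumL-support : ∀ {F M} (is js : List I) → Unique is → Unique js → Support M F is → Support M F js →
      sumL is F ≈[ M ] sumL js F
    sumL-support is js u v p q = sumL-indep is js u v (λ i _ → q i) (λ i _ → p i)

    total : {F : I → PS} → Summable F → PS
    total {F} s N = sumL (proj₁ (s (suc N))) F N

    hasSum-total : {F : I → PS} (s : Summable F) → HasSum F (total s)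
    hasSum-total {F} s M with s M in eq
    ... | is , u , p = is , u , p , λ N N<M → sumL-support (proj₁ (s (suc N))) is
            (proj₁ (proj₂ (s (suc N)))) u (proj₂ (proj₂ (s (suc N))))
            (λ i i∉ → []-mono N<M (p i i∉)) N ℕP.≤-refl

    hasSum-unique : {F : I → PS} → ∀ {S S′} → HasSum F S → HasSum F S′ → S ≈ S′
    hasSum-unique h h′ = []⇒≈ λ M →
      let is , u , p , e = h M ; js , v , q , e′ = h′ M in
      []-trans e ([]-trans (sumL-support is js u v p q) ([]-sym e′))

    hasSum-⊕ : {F G : I → PS} → ∀ {S T} → HasSum F S → HasSum G T → HasSum (λ i → F i ⊕ G i) (S ⊕ T)
    hasSum-⊕ {F} {G} h k M =
      let is , u , p , e = h M ; js , v , q , e′ = k M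
          -- The union of both supports, freed of repetitions, since a repeated index would be
          -- counted twice. This is where decidable equality of indices enters.
          ks = deduplicate _≟_ (is ++ js)
          w = DecUniqueP.deduplicate-! _≟_ (is ++ js)
          p′ = λ i i∉ → p i (λ i∈ → i∉ (∈P.∈-deduplicate⁺ _≟_ (∈P.∈-++⁺ˡ i∈)))
          q′ = λ i i∉ → q i (λ i∈ → i∉ (∈P.∈-deduplicate⁺ _≟_ (∈P.∈-++⁺ʳ is i∈)))
      in ks , w , (λ i i∉ → Ord-⊕ {F i} (p′ i i∉) (q′ i i∉)) ,
         []-trans ([]-⊕ ([]-trans e (sumL-support is ks u w p p′)) ([]-trans e′ (sumL-support js ks v w q q′)))
           (≈⇒≈[] (S.sym (sumL-⊕ ks)))

  hasSum-cong : {F G : I → PS} → ∀ {S T} → (∀ i → F i ≈ G i) → S ≈ T → HasSum F S → HasSum G T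
  hasSum-cong {F = F} p e h M =
    let is , u , q , e′ = h M in
    is , u , (λ i i∉ → Ord-≈ (p i) (q i i∉)) ,
    []-trans (≈⇒≈[] (S.sym e)) ([]-trans e′ (≈⇒≈[] (sumL-cong is p)))

  hasSum-⊛ˡ : ∀ g {F : I → PS} {S} → HasSum F S → HasSum (λ i → g ⊛ F i) (g ⊛ S)
  hasSum-⊛ˡ g {F} h M =
    let is , u , p , e = h M in
    is , u , (λ i i∉ → Ord-⊛ʳ {g} (p i i∉)) ,
    []-trans ([]-⊛ {g} (λ _ _ → ≡.refl) e) (≈⇒≈[] (S.sym (sumL-⊛ˡ g is)))

  hasSum-⊝ : {F : I → PS} → ∀ {S} → HasSum F S → HasSum (λ i → ⊝ F i) (⊝ S)
  hasSum-⊝ {F = F} h = hasSum-cong (λ i → -1*x≈-x (F i)) (-1*x≈-x _) (hasSum-⊛ˡ (⊝ 𝟙) h)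
    where open import Algebra.Properties.Ring S.ring using (-1*x≈-x)

  hasSum-⊖ : {{_ : DecEq I}} {F G : I → PS} → ∀ {S T} → HasSum F S → HasSum G T → HasSum (λ i → F i ⊖ G i) (S ⊖ T)
  hasSum-⊖ h k = hasSum-⊕ h (hasSum-⊝ k)

  hasSum-map : {F : I → PS} {S : PS} (φ : J → I) (ψ : I → J) → (∀ i → φ (ψ i) ≡ i) → (∀ j → ψ (φ j) ≡ j) →
    HasSum F S → HasSum (F ∘ φ) S
  hasSum-map {F = F} φ ψ φψ ψφ h M =
    let is , u , p , e = h M in
    map ψ is , UniqueP.map⁺ (λ {i} {j} eq → ≡.trans (≡.sym (φψ i)) (≡.trans (cong φ eq) (φψ j))) u ,
    (λ j j∉ → p (φ j) (λ φj∈ → j∉ (≡.subst (_∈ map ψ is) (ψφ j) (∈P.∈-map⁺ ψ φj∈)))) ,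
    []-trans e (≈⇒≈[] (S.trans (sumL-cong is (λ i n → cong (λ k → F k n) (≡.sym (φψ i))))
      (S.sym (sumL-map ψ is))))

  hasSum-Ord : {F : I → PS} {S : PS} → ∀ {d} → (∀ i → Ord d (F i)) → HasSum F S → Ord d S
  hasSum-Ord {d = d} p h = let is , u , _ , e = h d in []-trans e (sumL-Ord is (λ i _ → p i))

  module _ {{_ : DecEq I}} {{_ : DecEq J}} where

    hasSum-⊛ : {F : I → PS} {G : J → PS} → ∀ {S T} → HasSum F S → HasSum G T →
      HasSum (λ (i , j) → F i ⊛ G j) (S ⊛ T)
    hasSum-⊛ {F} {G} {S} {T} h k M =
      let is , u , p , e = h M ; js , v , q , e′ = k M in
      cartesianProduct is js , UniqueP.cartesianProduct⁺ u v , support is js p q ,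
      []-trans ([]-⊛ e e′) (≈⇒≈[] (lemma is js))
      where
      support : ∀ is js → Support M F is → Support M G js →
        Support M (λ (i , j) → F i ⊛ G j) (cartesianProduct is js)
      support is js p q (i , j) ∉× with _∈?_ _≟_ i is
      ... | no i∉ = Ord-⊛ˡ {F i} (p i i∉)
      ... | yes i∈ = Ord-⊛ʳ {F i} (q j (λ j∈ → ∉× (∈P.∈-cartesianProduct⁺ i∈ j∈)))

      lemma : ∀ is js → sumL is F ⊛ sumL js G ≈ sumL (cartesianProduct is js) (λ (i , j) → F i ⊛ G j)
      lemma is js = S.sym (S.trans (sumL-× is js) (S.trans (sumL-cong is (λ i → sumL-⊛ˡ (F i) js))
        (S.trans (sumL-cong is (λ i → S.*-comm (F i) _)) (S.trans (sumL-⊛ˡ (sumL js G) is) (S.*-comm _ _)))))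

    -- The support of the double family is enlarged to the rectangle spanned by its two projections.
    -- A row whose index is not among the first projections has only negligible entries, so its sum
    -- is negligible too.
    hasSum-fubini : {F : I × J → PS} {Row : I → PS} → ∀ {S} → HasSum F S →
      (∀ i → HasSum (λ j → F (i , j)) (Row i)) → HasSum Row S
    hasSum-fubini {F} {Row} h k M =
      let ps , u , p , e = h M
          is = deduplicate _≟_ (map proj₁ ps)
          js = deduplicate _≟_ (map proj₂ ps)
          iu = DecUniqueP.deduplicate-! _≟_ (map proj₁ ps)
          ju = DecUniqueP.deduplicate-! _≟_ (map proj₂ ps)
          i∈ : ∀ {i j} → (i , j) ∈ ps → i ∈ is
          i∈ = λ r → ∈P.∈-deduplicate⁺ _≟_ (∈P.∈-map⁺ proj₁ r)
          j∈ : ∀ {i j} → (i , j) ∈ ps → j ∈ js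
          j∈ = λ r → ∈P.∈-deduplicate⁺ _≟_ (∈P.∈-map⁺ proj₂ r)
          row : ∀ i → Row i ≈[ M ] sumL js (λ j → F (i , j))
          row = λ i → let ks , v , q , e′ = k i M in
            []-trans e′ (sumL-support ks js v ju q (λ j j∉ → p (i , j) (j∉ ∘ j∈)))
      in is , iu , (λ i i∉ → hasSum-Ord (λ j → p (i , j) (i∉ ∘ i∈)) (k i)) ,
         []-trans e ([]-trans
           (sumL-support ps (cartesianProduct is js) u (UniqueP.cartesianProduct⁺ iu ju) p
             (λ (i , j) ∉× → p (i , j) (λ r → ∉× (∈P.∈-cartesianProduct⁺ (i∈ r) (j∈ r)))))
           ([]-trans (≈⇒≈[] (sumL-× is js)) (sumL-[]cong is (λ i → []-sym (row i)))))

  hasSum-swap : {F : I × J → PS} → ∀ {S} → HasSum F S → HasSum (λ (j , i) → F (i , j)) S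
  hasSum-swap = hasSum-map swap swap (λ _ → ≡.refl) (λ _ → ≡.refl)

  hasSum-Fin : ∀ {n} (F : Fin n → PS) → HasSum F (sumL (allFin n) F)
  hasSum-Fin {n} F M = allFin n , UniqueP.allFin⁺ n , (λ i i∉ → contradiction (∈P.∈-allFin i) i∉) , λ _ _ → ≡.refl

  -- An index outside `window (suc N)` has absolute value at least `N + 2`, so its term has order at
  -- least `N + 1` and does not reach the coefficient of `q^N`. The truncation is the one used in
  -- the statement.
  hasSum-window : ∀ {F : ℤ → PS} S → (∀ i → Ord (∣ i ∣ ∸ 1) (F i)) →
    (∀ N → S N ≡ sumL (window (suc N)) F N) → HasSum F S
  hasSum-window {F} S p e = hasSum-cong (λ _ → S.refl) (λ N → ≡.sym (e N)) (hasSum-total summable)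
    where
    summable : Summable F
    summable zero = window 0 , window-unique 0 , λ _ _ _ ()
    summable (suc N) = window (suc N) , window-unique (suc N) , λ i i∉ →
      []-mono (ℕP.<⇒≤pred (ℕP.≰⇒> (λ ∣i∣≤ → i∉ (∈-window⁺ (suc N) i ∣i∣≤)))) (p i)

  private
    far : ∀ c M i → i ∉ window (M ℕ.+ c) → M ≤ ∣ i ∣ ∸ c
    far c M i i∉ = ℕP.m+n≤o⇒m≤o∸n M (ℕP.<⇒≤ (ℕP.≰⇒> (λ ∣i∣≤ → i∉ (∈-window⁺ _ i ∣i∣≤))))

  -- The offset `c` leaves room for bounds such as `(∣ i ∣ ∸ 1) + (∣ j ∣ ∸ 1)`, which come from a
  -- product of two theta-like terms.
  summable-ℤ² : ∀ c {F : ℤ × ℤ → PS} → (∀ i j → Ord (∣ i ∣ ℕ.+ ∣ j ∣ ∸ c) (F (i , j))) → Summable F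
  summable-ℤ² c {F} p M = cartesianProduct W W , UniqueP.cartesianProduct⁺ (window-unique (M ℕ.+ c)) (window-unique (M ℕ.+ c)) , support
    where
    W = window (M ℕ.+ c)
    support : Support M F (cartesianProduct W W)
    support (i , j) ∉× with _∈?_ ℤ._≟_ i W
    ... | no i∉ = []-mono (ℕP.≤-trans (far c M i i∉) (ℕP.∸-monoˡ-≤ c (ℕP.m≤m+n _ _))) (p i j)
    ... | yes i∈ = []-mono (ℕP.≤-trans (far c M j (λ j∈ → ∉× (∈P.∈-cartesianProduct⁺ i∈ j∈)))
                     (ℕP.∸-monoˡ-≤ c (ℕP.m≤n+m _ ∣ i ∣))) (p i j)

-- Triangular numbers and equalities between exponents.

triangle : ℕ → ℕ
triangle zero = 0
triangle (suc n) = suc n ℕ.+ triangle n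

-- The value is `i(i+1)/2` for all integers: at `i = -(n+1)` the two factors are `-(n+1)` and `-n`.
-- In particular `tri (- i)` is `i(i-1)/2`.
tri : ℤ → ℕ
tri (+ n) = triangle n
tri -[1+ n ] = triangle n

-- Twice an exponent, as an integer polynomial: this is how equations between exponents are proved.
record Twice (e : ℕ) (p : ℤ) : Set where
  constructor twice
  field doubled : + 2 ℤ.* + e ≡ p

open Twice

infixl 6 _+ᵉ_
infixl 7 _*ᵉ_

_+ᵉ_ : ∀ {d e p q} → Twice d p → Twice e q → Twice (d ℕ.+ e) (p ℤ.+ q)
_+ᵉ_ {d} {e} (twice x) (twice y) = twice (≡.trans (ℤP.*-distribˡ-+ (+ 2) (+ d) (+ e)) (cong₂ ℤ._+_ x y))

_*ᵉ_ : ∀ c {e p} → Twice e p → Twice (c ℕ.* e) (+ c ℤ.* p)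
_*ᵉ_ c {e} {p} (twice x) = twice (≡.trans (cong (+ 2 ℤ.*_) (ℤP.pos-* c e))
  (≡.trans (solve 3 (λ a b c → a :* (b :* c) := b :* (a :* c)) ≡.refl (+ 2) (+ c) (+ e)) (cong (+ c ℤ.*_) x)))
  where open ℤSolver.+-*-Solver

numᵉ : ∀ n → Twice n (+ 2 ℤ.* + n)
numᵉ n = twice ≡.refl

triangleᵉ : ∀ n → Twice (triangle n) (+ n ℤ.* (+ n ℤ.+ + 1))
triangleᵉ zero = twice ≡.refl
triangleᵉ (suc n) = twice (≡.trans (doubled (numᵉ (suc n) +ᵉ triangleᵉ n))
  (solve 1 (λ n → con (+ 2) :* (con (+ 1) :+ n) :+ n :* (n :+ con (+ 1)) :=
      (con (+ 1) :+ n) :* (con (+ 1) :+ n :+ con (+ 1))) ≡.refl (+ n)))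
  where open ℤSolver.+-*-Solver

triᵉ : ∀ i → Twice (tri i) (i ℤ.* (i ℤ.+ + 1))
triᵉ (+ n) = triangleᵉ n
triᵉ -[1+ n ] = twice (≡.trans (doubled (triangleᵉ n))
  (solve 1 (λ n → n :* (n :+ con (+ 1)) := (:- (con (+ 1) :+ n)) :* (:- (con (+ 1) :+ n) :+ con (+ 1))) ≡.refl (+ n)))
  where open ℤSolver.+-*-Solver

equalᵉ : ∀ {d e p q} → Twice d p → Twice e q → p ≡ q → d ≡ e
equalᵉ {d} {e} (twice x) (twice y) p≡q =
  ℤP.+-injective (ℤP.*-cancelˡ-≡ (+ 2) (+ d) (+ e) (≡.trans x (≡.trans p≡q (≡.sym y))))

module Exponents where
  open ℤSolver.+-*-Solver public using (Polynomial; con; var; _:*_; _:+_; :-_; ⟦_⟧; ⟦_⟧↓; prove)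

  infixl 6 _:⊞_
  infixl 7 _:⊠_

  data Exponent (n : ℕ) : Set where
    :num : ℕ → Exponent n
    :tri : Polynomial n → Exponent n
    _:⊞_ : Exponent n → Exponent n → Exponent n
    _:⊠_ : ℕ → Exponent n → Exponent n

  :θexp : ∀ {n} → ℕ → ℕ → Polynomial n → Exponent n
  :θexp b b′ p = b :⊠ :tri p :⊞ b′ :⊠ :tri (:- p)

  value : ∀ {n} → Exponent n → Vec ℤ n → ℕ
  value (:num c) ρ = c
  value (:tri p) ρ = tri (⟦ p ⟧ ρ)
  value (d :⊞ e) ρ = value d ρ ℕ.+ value e ρ
  value (c :⊠ e) ρ = c ℕ.* value e ρ

  twice-value : ∀ {n} → Exponent n → Polynomial n
  twice-value (:num c) = con (+ 2) :* con (+ c)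
  twice-value (:tri p) = p :* (p :+ con (+ 1))
  twice-value (d :⊞ e) = twice-value d :+ twice-value e
  twice-value (c :⊠ e) = con (+ c) :* twice-value e

  Twice-value : ∀ {n} (e : Exponent n) ρ → Twice (value e ρ) (⟦ twice-value e ⟧ ρ)
  Twice-value (:num c) ρ = numᵉ c
  Twice-value (:tri p) ρ = triᵉ (⟦ p ⟧ ρ)
  Twice-value (d :⊞ e) ρ = Twice-value d ρ +ᵉ Twice-value e ρ
  Twice-value (c :⊠ e) ρ = c *ᵉ Twice-value e ρ

  -- Exponents are naturals built from halved products, which a ring solver cannot treat directly.
  -- Their doubles are integer polynomials, so an equality of exponents reduces to an equality of
  -- normal forms that holds by computation.
  exponents-equal : ∀ {n} (d e : Exponent n) ρ → ⟦ twice-value d ⟧↓ ρ ≡ ⟦ twice-value e ⟧↓ ρ → value d ρ ≡ value e ρ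
  exponents-equal d e ρ p = equalᵉ (Twice-value d ρ) (Twice-value e ρ) (prove ρ (twice-value d) (twice-value e) p)

n≤triangle : ∀ n → n ≤ triangle n
n≤triangle zero = z≤n
n≤triangle (suc n) = ℕP.m≤m+n (suc n) _

∣i∣∸1≤tri : ∀ i → ∣ i ∣ ∸ 1 ≤ tri i
∣i∣∸1≤tri (+ n) = ℕP.≤-trans (ℕP.m∸n≤m n 1) (n≤triangle n)
∣i∣∸1≤tri -[1+ n ] = n≤triangle n

-- Infinite products.

module Products (𝓡 : CoefficientRing) where
  open PowerSeries 𝓡 public
  open Summation 𝓡 public

  prodUpTo : (ℕ → PS) → ℕ → PS
  prodUpTo F zero = F 0
  prodUpTo F (suc n) = prodUpTo F n ⊛ F (suc n)

  -- The diagonal of the partial products, the convention of `poch` in the statement. It is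
  -- meaningful for a `Convergent` family, where a factor with index above `n` cannot change the
  -- coefficient of `q^n`.
  Π∞ : (ℕ → PS) → PS
  Π∞ F n = prodUpTo F n n

  Convergent : (ℕ → PS) → Set
  Convergent F = ∀ j → F j ≈[ j ] 𝟙

  prodUpTo-cong : ∀ {F G} → (∀ j → F j ≈ G j) → ∀ n → prodUpTo F n ≈ prodUpTo G n
  prodUpTo-cong p zero = p 0
  prodUpTo-cong p (suc n) = S.*-cong (prodUpTo-cong p n) (p (suc n))

  prodUpTo-⊛ : ∀ F G n → prodUpTo (λ j → F j ⊛ G j) n ≈ prodUpTo F n ⊛ prodUpTo G n
  prodUpTo-⊛ F G zero = S.refl
  prodUpTo-⊛ F G (suc n) = S.trans (S.*-congʳ (prodUpTo-⊛ F G n))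
    (solve 4 (λ a b c d → (a :* b) :* (c :* d) := (a :* c) :* (b :* d)) S.refl
      (prodUpTo F n) (prodUpTo G n) (F (suc n)) (G (suc n)))
    where open SS

  prodUpTo-head : ∀ F n → prodUpTo F (suc n) ≈ F 0 ⊛ prodUpTo (F ∘ suc) n
  prodUpTo-head F zero = S.refl
  prodUpTo-head F (suc n) = S.trans (S.*-congʳ (prodUpTo-head F n)) (S.*-assoc _ _ _)

  prodUpTo-stable : ∀ {F} → Convergent F → ∀ m d → prodUpTo F (d ℕ.+ m) ≈[ suc m ] prodUpTo F m
  prodUpTo-stable c m zero _ _ = ≡.refl
  prodUpTo-stable {F} c m (suc d) = []-trans
    ([]-⊛ (prodUpTo-stable c m d) ([]-mono (s≤s (ℕP.m≤n+m m d)) (c (suc (d ℕ.+ m)))))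
    (≈⇒≈[] (S.*-identityʳ _))

  Π∞-approx : ∀ {F} → Convergent F → ∀ {m n} → m ≤ n → prodUpTo F n ≈[ suc m ] Π∞ F
  Π∞-approx {F} c {m} {n} m≤n k (s≤s k≤m) = prodUpTo-stable′ (ℕP.≤-trans k≤m m≤n)
    where
    prodUpTo-stable′ : k ≤ n → prodUpTo F n k ≡ prodUpTo F k k
    prodUpTo-stable′ k≤n = ≡.subst (λ l → prodUpTo F l k ≡ prodUpTo F k k) (ℕP.m∸n+n≡m k≤n)
      (prodUpTo-stable {F} c k (n ∸ k) k ℕP.≤-refl)

  -- Serves as the definition of a limit: `G` is the product as soon as some arbitrarily long
  -- partial products approach it, which need not be all of them. Regrouped and dilated products are
  -- identified in this way.
  Π∞-unique : ∀ {F G} → Convergent F → (∀ m → Σ ℕ λ n → m ≤ n × (prodUpTo F n ≈[ suc m ] G)) → Π∞ F ≈ G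
  Π∞-unique {F} {G} c p m =
    let n , m≤n , e = p m in ≡.trans (≡.sym (Π∞-approx {F} c m≤n m ℕP.≤-refl)) (e m ℕP.≤-refl)

  Π∞-cong : ∀ {F G} → (∀ j → F j ≈ G j) → Π∞ F ≈ Π∞ G
  Π∞-cong p n = prodUpTo-cong p n n

  Convergent-⊛ : ∀ {F G} → Convergent F → Convergent G → Convergent (λ j → F j ⊛ G j)
  Convergent-⊛ c d j = []-trans ([]-⊛ (c j) (d j)) (≈⇒≈[] (S.*-identityˡ 𝟙))

  Π∞-⊛ : ∀ {F G} → Convergent F → Convergent G → Π∞ (λ j → F j ⊛ G j) ≈ Π∞ F ⊛ Π∞ G
  Π∞-⊛ {F} {G} c d = Π∞-unique (Convergent-⊛ {F} {G} c d) λ m → m , ℕP.≤-refl ,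
    []-trans (≈⇒≈[] (prodUpTo-⊛ F G m)) ([]-⊛ (Π∞-approx {F} c ℕP.≤-refl) (Π∞-approx {G} d ℕP.≤-refl))

  Π∞-head : ∀ {F} → Convergent F → Π∞ F ≈ F 0 ⊛ Π∞ (F ∘ suc)
  Π∞-head {F} c = Π∞-unique {F} c λ m → suc m , ℕP.n≤1+n m ,
    []-trans (≈⇒≈[] (prodUpTo-head F m))
      ([]-⊛ {F 0} (λ _ _ → ≡.refl) (Π∞-approx {F ∘ suc} (λ j → []-mono (ℕP.n≤1+n j) (c (suc j))) ℕP.≤-refl))

  factor : R → ℕ → ℕ → ℕ → PS
  factor α b a j = 𝟙 ⊕ mono α (b ℕ.+ j ℕ.* a)

  -- (-α q^b; q^a)_∞
  Poch : R → ℕ → ℕ → PS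
  Poch α b a = Π∞ (factor α b a)

  factor-convergent : ∀ α b a → Convergent (factor α b (suc a))
  factor-convergent α b a j = []-trans
    ([]-⊕ {𝟙} (λ _ _ → ≡.refl) ([]-mono (ℕP.≤-trans (ℕP.m≤m*n j (suc a)) (ℕP.m≤n+m _ b)) (Ord-mono α (b ℕ.+ j ℕ.* suc a))))
    (≈⇒≈[] (S.+-identityʳ 𝟙))

  Poch-head : ∀ α b a → Poch α b (suc a) ≈ (𝟙 ⊕ mono α b) ⊛ Poch α (b ℕ.+ suc a) (suc a)
  Poch-head α b a = S.trans (Π∞-head {factor α b (suc a)} (factor-convergent α b a)) (S.*-cong
    (λ n → cong (λ e → (𝟙 ⊕ mono α e) n) (ℕP.+-identityʳ b))
    (Π∞-cong λ j n → cong (λ e → (𝟙 ⊕ mono α e) n) (≡.sym (ℕP.+-assoc b (suc a) (j ℕ.* suc a)))))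

  Poch-0 : ∀ α b a → Poch α (suc b) a 0 ≡ 1#
  Poch-0 α b a = R.+-identityʳ 1#

  -- Exactly `n` factors, whereas `prodUpTo` has `n + 1`; the finite triple product has to start
  -- from the empty product.
  poch : R → ℕ → ℕ → ℕ → PS
  poch α b a zero = 𝟙
  poch α b a (suc n) = poch α b a n ⊛ factor α b a n

  poch≈prodUpTo : ∀ α b a n → poch α b a (suc n) ≈ prodUpTo (factor α b a) n
  poch≈prodUpTo α b a zero = S.*-identityˡ _
  poch≈prodUpTo α b a (suc n) = S.*-congʳ (poch≈prodUpTo α b a n)

  poch-approx : ∀ α b a {m n} → m ≤ n → poch α b (suc a) n ≈[ m ] Poch α b (suc a)
  poch-approx α b a {zero} _ _ ()
  poch-approx α b a {suc m} {suc n} (s≤s m≤n) = []-trans (≈⇒≈[] (poch≈prodUpTo α b (suc a) n))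
    (Π∞-approx {factor α b (suc a)} (factor-convergent α b a) m≤n)

-- Theta series and the finite form of the triple product.

module ThetaSeries (𝓡 : CoefficientRing) where
  open Products 𝓡 public
  module ℤS = ℤSolver.+-*-Solver

  infixr 9 _^_
  _^_ : R → ℕ → R
  x ^ zero = 1#
  x ^ suc n = x * x ^ n

  ^-+ : ∀ x m n → x ^ (m ℕ.+ n) ≡ x ^ m * x ^ n
  ^-+ x zero n = ≡.sym (R.*-identityˡ _)
  ^-+ x (suc m) n = ≡.trans (cong (x *_) (^-+ x m n)) (≡.sym (R.*-assoc _ _ _))

  inverse-^ : ∀ {x y} → x * y ≡ 1# → ∀ n → x ^ n * y ^ n ≡ 1#
  inverse-^ xy≡1 zero = R.*-identityˡ 1#
  inverse-^ {x} {y} xy≡1 (suc n) = ≡.trans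
    (RS.solve 4 (λ a b c d → (a :* c) :* (b :* d) := (a :* b) :* (c :* d)) ≡.refl x y (x ^ n) (y ^ n))
    (≡.trans (cong₂ _*_ xy≡1 (inverse-^ xy≡1 n)) (R.*-identityˡ 1#))
    where open RS

  -- For mutually inverse `x` and `y` the product `x ^ m * y ^ n` is the integer power of `x` with
  -- exponent `m - n`; the hypothesis compares two such differences without subtracting.
  inverse-^-≡ : ∀ {x y} → x * y ≡ 1# → ∀ {m n m′ n′} → m ℕ.+ n′ ≡ m′ ℕ.+ n → x ^ m * y ^ n ≡ x ^ m′ * y ^ n′
  inverse-^-≡ {x} {y} xy≡1 {m} {n} {m′} {n′} eq = ≡.trans (≡.sym (lemma m n n′))
    (≡.trans (cong₂ (λ k l → x ^ k * y ^ l) eq (ℕP.+-comm n n′)) (lemma m′ n′ n))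
    where
    open RS
    lemma : ∀ m n k → x ^ (m ℕ.+ k) * y ^ (n ℕ.+ k) ≡ x ^ m * y ^ n
    lemma m n k = ≡.trans (cong₂ _*_ (^-+ x m k) (^-+ y n k)) (≡.trans
      (RS.solve 4 (λ a b c d → (a :* b) :* (c :* d) := (a :* c) :* (b :* d)) ≡.refl (x ^ m) (x ^ k) (y ^ n) (y ^ k))
      (≡.trans (R.*-congˡ (inverse-^ xy≡1 k)) (R.*-identityʳ _)))

  mono-≡ : ∀ {a a′ e e′} → a ≡ a′ → e ≡ e′ → mono a e ≈ mono a′ e′
  mono-≡ p q n = cong₂ (λ a e → mono a e n) p q

  Σℤ : (ℤ → PS) → PS
  Σℤ F N = sumL (window (suc N)) F N

  hasSum-Σℤ : ∀ {F} → (∀ i → Ord (∣ i ∣ ∸ 1) (F i)) → HasSum F (Σℤ F)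
  hasSum-Σℤ {F} p = hasSum-window (Σℤ F) p (λ _ → ≡.refl)

  hasSum-[]cong : ∀ {I} {{_ : DecEq I}} {F G : I → PS} {S T} M → (∀ i → F i ≈[ M ] G i) →
    HasSum F S → HasSum G T → S ≈[ M ] T
  hasSum-[]cong M p h k n n<M = x∙y⁻¹≈ε⇒x≈y _ _ (hasSum-Ord {d = M}
    (λ i m m<M → ≡.trans (R.+-congʳ (p i m m<M)) (R.-‿inverseʳ _)) (hasSum-⊖ h k) n n<M)
    where open import Algebra.Properties.Group R.+-group using (x∙y⁻¹≈ε⇒x≈y)

  θexp : ℕ → ℕ → ℤ → ℕ
  θexp b b′ n = b ℕ.* tri n ℕ.+ b′ ℕ.* tri (ℤ.- n)

  θexpᵉ : ∀ b b′ n → Twice (θexp b b′ n) (+ b ℤ.* (n ℤ.* (n ℤ.+ + 1)) ℤ.+ + b′ ℤ.* (ℤ.- n ℤ.* (ℤ.- n ℤ.+ + 1)))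
  θexpᵉ b b′ n = b *ᵉ triᵉ n +ᵉ b′ *ᵉ triᵉ (ℤ.- n)

  -- When `α * β ≡ 1#` the coefficient is the integer power of `α` with exponent `n`, because
  -- `tri n - tri (- n) = n`. Pairing `α` with its inverse avoids negative exponents.
  θterm : R → R → ℕ → ℕ → ℤ → PS
  θterm α β b b′ n = mono (α ^ tri n * β ^ tri (ℤ.- n)) (θexp b b′ n)

  -- Ramanujan's f(α q^b, β q^b′) = Σ_n (α q^b)^{n(n+1)/2} (β q^b′)^{n(n-1)/2}.
  Θ : R → R → ℕ → ℕ → PS
  Θ α β b b′ = Σℤ (θterm α β b b′)

  ∣i∣∸1≤θexp : ∀ b b′ n → 1 ≤ b ℕ.+ b′ → ∣ n ∣ ∸ 1 ≤ θexp b b′ n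
  ∣i∣∸1≤θexp (suc b) b′ n _ = ℕP.≤-trans (∣i∣∸1≤tri n) (ℕP.≤-trans (ℕP.m≤m+n _ _) (ℕP.m≤m+n _ _))
  ∣i∣∸1≤θexp zero (suc b′) n _ = ℕP.≤-trans
    (≡.subst (λ k → k ∸ 1 ≤ tri (ℤ.- n)) (ℤP.∣-i∣≡∣i∣ n) (∣i∣∸1≤tri (ℤ.- n))) (ℕP.m≤m+n _ _)

  θterm-Ord : ∀ α β b b′ n → 1 ≤ b ℕ.+ b′ → Ord (∣ n ∣ ∸ 1) (θterm α β b b′ n)
  θterm-Ord α β b b′ n 1≤ = []-mono (∣i∣∸1≤θexp b b′ n 1≤) (Ord-mono _ (θexp b b′ n))

  hasSum-Θ : ∀ α β b b′ → 1 ≤ b ℕ.+ b′ → HasSum (θterm α β b b′) (Θ α β b b′)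
  hasSum-Θ α β b b′ 1≤ = hasSum-Σℤ λ n → θterm-Ord α β b b′ n 1≤

  mono-neg : ∀ e → mono (- 1#) e ≈ ⊝ X e
  mono-neg e = S.trans (mono≈ (- 1#) e) (S.trans (const-⊛ (- 1#) (X e)) (λ n → -1*x≈-x (X e n)))
    where open import Algebra.Properties.Ring R.ring using (-1*x≈-x)

  -- Finite forms of the triple product: the n-th term of the theta series is weighted
  -- by tail products which vanish unless -K ≤ n ≤ I and tend to 1.
  module FiniteTripleProduct (α β : R) (αβ≡1 : α * β ≡ 1#) (b b′ a₀ : ℕ) (b+b′≡a : b ℕ.+ b′ ≡ suc a₀) where
    a : ℕ
    a = suc a₀

    term : ℤ → PS
    term = θterm α β b b′

    term-Ord : ∀ n → Ord (∣ n ∣ ∸ 1) (term n)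
    term-Ord n = θterm-Ord α β b b′ n (ℕP.≤-trans (s≤s z≤n) (ℕP.≤-reflexive (≡.sym b+b′≡a)))

    -- This is `(q^a; q^a)_∞ / (q^a; q^a)_k`, with the usual convention that the reciprocal of a
    -- symbol of negative length is 0; then `tl-pred` also holds at 0. The product of the two tails
    -- in `summand` is thus a q-binomial coefficient `[I+K, K+n]` times a factor free of `n`.
    tl : ℤ → PS
    tl (+ k) = Poch (- 1#) (a ℕ.+ k ℕ.* a) a
    tl -[1+ k ] = 𝟘

    tl-pred : ∀ i → tl (+ i ℤ.- + 1) ≈ (𝟙 ⊖ X (i ℕ.* a)) ⊛ tl (+ i)
    tl-pred zero = S.sym (S.trans (S.*-congʳ (S.-‿inverseʳ 𝟙)) (S.zeroˡ _))
    tl-pred (suc i) = S.trans (Poch-head (- 1#) (a ℕ.+ i ℕ.* a) a₀) (S.*-cong (S.+-congˡ (mono-neg (a ℕ.+ i ℕ.* a)))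
      (λ n → cong (λ e → Poch (- 1#) e a n) (ℕP.+-comm (a ℕ.+ i ℕ.* a) a)))

    -- The Pascal rule for q-binomial coefficients, from `(1 - x) + x (1 - y) = 1 - x y` with
    -- `x = q^{ia}` and `y = q^{ka}`. For negative `i` all products of tails vanish, so the relation
    -- between `A` and `B` is required only for natural `i`.
    step-core : ∀ (A B : PS) i k L → i ℤ.+ k ≡ + L → (∀ j → i ≡ + j → B ≈ A ⊛ X (j ℕ.* a)) →
      A ⊛ (tl (i ℤ.- + 1) ⊛ tl k) ⊕ B ⊛ (tl i ⊛ tl (k ℤ.- + 1)) ≈ (𝟙 ⊖ X (L ℕ.* a)) ⊛ (A ⊛ (tl i ⊛ tl k))
    step-core A B -[1+ i ] k L _ _ = S.trans
      (S.+-cong (S.*-congˡ {A} (S.zeroˡ _)) (S.*-congˡ {B} (S.zeroˡ _)))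
      (S.trans (SS.solve 3 (λ A B C → A :* con (+ 0) :+ B :* con (+ 0) := C :* (A :* con (+ 0))) S.refl A B (𝟙 ⊖ X (L ℕ.* a)))
        (S.*-congˡ (S.*-congˡ {A} (S.sym (S.zeroˡ _)))))
      where open SS
    step-core A B (+ i) -[1+ k ] L _ _ = S.trans
      (S.+-cong (S.*-congˡ {A} (S.zeroʳ _)) (S.*-congˡ {B} (S.zeroʳ _)))
      (S.trans (SS.solve 3 (λ A B C → A :* con (+ 0) :+ B :* con (+ 0) := C :* (A :* con (+ 0))) S.refl A B (𝟙 ⊖ X (L ℕ.* a)))
        (S.*-congˡ (S.*-congˡ {A} (S.sym (S.zeroʳ _)))))
      where open SS
    step-core A B (+ i) (+ k) L i+k≡L B≈ = S.trans
      (S.+-cong (S.*-congˡ {A} (S.*-congʳ (tl-pred i))) (S.*-cong (B≈ i ≡.refl) (S.*-congˡ {tl (+ i)} (tl-pred k))))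
      (S.trans (SS.solve 5 (λ A x y s t → A :* ((con (+ 1) :- x) :* s :* t) :+ A :* x :* (s :* ((con (+ 1) :- y) :* t))
                   := (con (+ 1) :- x :* y) :* (A :* (s :* t))) S.refl A (X (i ℕ.* a)) (X (k ℕ.* a)) (tl (+ i)) (tl (+ k)))
        (S.*-congʳ {A ⊛ (tl (+ i) ⊛ tl (+ k))} (S.+-congˡ {𝟙} (S.-‿cong (S.trans (X-⊛ (i ℕ.* a) (k ℕ.* a))
          (λ n → cong (λ e → X e n) (≡.trans (≡.sym (ℕP.*-distribʳ-+ a i k)) (cong (ℕ._* a) (ℤP.+-injective i+k≡L)))))))))
      where open SS

    term-pred : ∀ I n j → + suc I ℤ.- n ≡ + j →
      mono α (b ℕ.+ I ℕ.* a) ⊛ term (n ℤ.- + 1) ≈ term n ⊛ X (j ℕ.* a)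
    term-pred I n j eq = S.trans (mono-⊛ α (b ℕ.+ I ℕ.* a) _ (θexp b b′ (n ℤ.- + 1))) (S.trans (mono-≡ coefficient exponent)
      (S.sym (mono-⊛ _ (θexp b b′ n) 1# (j ℕ.* a))))
      where
      coefficient : α * (α ^ tri (n ℤ.- + 1) * β ^ tri (ℤ.- (n ℤ.- + 1))) ≡ α ^ tri n * β ^ tri (ℤ.- n) * 1#
      coefficient = ≡.trans (≡.sym (R.*-assoc _ _ _)) (≡.trans
        (inverse-^-≡ αβ≡1 {suc (tri (n ℤ.- + 1))} {tri (ℤ.- (n ℤ.- + 1))} {tri n} {tri (ℤ.- n)}
          (equalᵉ (numᵉ 1 +ᵉ triᵉ (n ℤ.- + 1) +ᵉ triᵉ (ℤ.- n)) (triᵉ n +ᵉ triᵉ (ℤ.- (n ℤ.- + 1)))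
            (ℤS.solve 1 (λ n → con (+ 2) :+ (n :- con (+ 1)) :* (n :- con (+ 1) :+ con (+ 1)) :+ (:- n) :* (:- n :+ con (+ 1))
               := n :* (n :+ con (+ 1)) :+ (:- (n :- con (+ 1))) :* (:- (n :- con (+ 1)) :+ con (+ 1))) ≡.refl n)))
        (≡.sym (R.*-identityʳ _)))
        where open ℤS
      aᵉ : Twice a (+ 2 ℤ.* (+ b ℤ.+ + b′))
      aᵉ = ≡.subst (λ c → Twice a (+ 2 ℤ.* + c)) (≡.sym b+b′≡a) (numᵉ a)
      exponent : b ℕ.+ I ℕ.* a ℕ.+ θexp b b′ (n ℤ.- + 1) ≡ θexp b b′ n ℕ.+ j ℕ.* a
      exponent = equalᵉ (numᵉ b +ᵉ I *ᵉ aᵉ +ᵉ θexpᵉ b b′ (n ℤ.- + 1)) (θexpᵉ b b′ n +ᵉ j *ᵉ aᵉ)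
        (≡.trans (ℤS.solve 4 (λ b b′ I n →
             con (+ 2) :* b :+ I :* (con (+ 2) :* (b :+ b′)) :+ (b :* ((n :- con (+ 1)) :* (n :- con (+ 1) :+ con (+ 1)))
               :+ b′ :* ((:- (n :- con (+ 1))) :* (:- (n :- con (+ 1)) :+ con (+ 1))))
             := b :* (n :* (n :+ con (+ 1))) :+ b′ :* ((:- n) :* (:- n :+ con (+ 1)))
               :+ (con (+ 1) :+ I :- n) :* (con (+ 2) :* (b :+ b′))) ≡.refl (+ b) (+ b′) (+ I) n)
          (cong (λ j → + b ℤ.* (n ℤ.* (n ℤ.+ + 1)) ℤ.+ + b′ ℤ.* (ℤ.- n ℤ.* (ℤ.- n ℤ.+ + 1))
               ℤ.+ j ℤ.* (+ 2 ℤ.* (+ b ℤ.+ + b′))) eq))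
        where open ℤS

    -- The weight 1 leads to the triple product and the weight `n` to its derivative. The recurrence
    -- shifts the argument of the weight, hence the general `w`.
    summand : (ℤ → R) → ℕ → ℕ → ℤ → PS
    summand w I K n = const (w n) ⊛ (term n ⊛ (tl (+ I ℤ.- n) ⊛ tl (+ K ℤ.+ n)))

    W : (ℤ → R) → ℕ → ℕ → PS
    W w I K = Σℤ (summand w I K)

    hasSum-W : ∀ w I K → HasSum (summand w I K) (W w I K)
    hasSum-W w I K = hasSum-Σℤ λ n → Ord-⊛ʳ {const (w n)} (Ord-⊛ˡ {term n} (term-Ord n))

    W-suc : ∀ w I K → (𝟙 ⊖ X ((suc I ℕ.+ K) ℕ.* a)) ⊛ W w (suc I) K ≈
      W w I K ⊕ mono α (b ℕ.+ I ℕ.* a) ⊛ W (λ n → w (n ℤ.+ + 1)) I K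
    W-suc w I K = hasSum-unique
      (hasSum-⊛ˡ (𝟙 ⊖ X ((suc I ℕ.+ K) ℕ.* a)) (hasSum-W w (suc I) K))
      (hasSum-cong termwise S.refl (hasSum-⊕ (hasSum-W w I K)
        (hasSum-⊛ˡ (mono α (b ℕ.+ I ℕ.* a)) (hasSum-map (ℤ._- + 1) (ℤ._+ + 1)
          (λ n → solve 1 (λ n → n :+ con (+ 1) :- con (+ 1) := n) ≡.refl n)
          (λ n → solve 1 (λ n → n :- con (+ 1) :+ con (+ 1) := n) ≡.refl n)
          (hasSum-W (λ n → w (n ℤ.+ + 1)) I K)))))
      where
      open ℤS
      termwise : ∀ n → summand w I K n ⊕ mono α (b ℕ.+ I ℕ.* a) ⊛ summand (λ n → w (n ℤ.+ + 1)) I K (n ℤ.- + 1)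
        ≈ (𝟙 ⊖ X ((suc I ℕ.+ K) ℕ.* a)) ⊛ summand w (suc I) K n
      termwise n = S.trans (S.+-cong
          (S.*-congˡ {const (w n)} (S.*-congˡ {term n} (S.*-congʳ {tl k} (λ m → cong (λ z → tl z m) e₁))))
          (S.*-congˡ {μ} (S.*-cong (λ m → cong (λ z → const (w z) m) e₀) (S.*-congˡ {term (n ℤ.- + 1)}
            (S.*-cong (λ m → cong (λ z → tl z m) e₂) (λ m → cong (λ z → tl z m) e₃))))))
        (S.trans (SS.solve 8 (λ c A M A′ p q r s → c SS.:* (A SS.:* (p SS.:* q)) SS.:+ M SS.:* (c SS.:* (A′ SS.:* (r SS.:* s)))
            SS.:= c SS.:* (A SS.:* (p SS.:* q) SS.:+ M SS.:* A′ SS.:* (r SS.:* s))) S.refl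
            (const (w n)) (term n) μ (term (n ℤ.- + 1)) (tl (i ℤ.- + 1)) (tl k) (tl i) (tl (k ℤ.- + 1)))
        (S.trans (S.*-congˡ {const (w n)} (step-core (term n) (μ ⊛ term (n ℤ.- + 1)) i k (suc I ℕ.+ K) e₄ (term-pred I n)))
          (SS.solve 3 (λ c x y → c SS.:* (x SS.:* y) SS.:= x SS.:* (c SS.:* y)) S.refl
            (const (w n)) (𝟙 ⊖ X ((suc I ℕ.+ K) ℕ.* a)) (term n ⊛ (tl i ⊛ tl k)))))
        where
        i = + suc I ℤ.- n
        k = + K ℤ.+ n
        μ = mono α (b ℕ.+ I ℕ.* a)
        e₀ : n ℤ.- + 1 ℤ.+ + 1 ≡ n
        e₀ = solve 1 (λ n → n :- con (+ 1) :+ con (+ 1) := n) ≡.refl n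
        e₁ : + I ℤ.- n ≡ i ℤ.- + 1
        e₁ = solve 2 (λ I n → I :- n := con (+ 1) :+ I :- n :- con (+ 1)) ≡.refl (+ I) n
        e₂ : + I ℤ.- (n ℤ.- + 1) ≡ i
        e₂ = solve 2 (λ I n → I :- (n :- con (+ 1)) := con (+ 1) :+ I :- n) ≡.refl (+ I) n
        e₃ : + K ℤ.+ (n ℤ.- + 1) ≡ k ℤ.- + 1
        e₃ = solve 2 (λ K n → K :+ (n :- con (+ 1)) := K :+ n :- con (+ 1)) ≡.refl (+ K) n
        e₄ : i ℤ.+ k ≡ + (suc I ℕ.+ K)
        e₄ = solve 3 (λ I K n → con (+ 1) :+ I :- n :+ (K :+ n) := con (+ 1) :+ I :+ K) ≡.refl (+ I) (+ K) n

    tl-approx : ∀ j → tl (+ j) ≈[ suc j ] 𝟙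
    tl-approx j = []-trans ([]-sym (Π∞-approx {factor (- 1#) (a ℕ.+ j ℕ.* a) a} (factor-convergent (- 1#) (a ℕ.+ j ℕ.* a) a₀) (ℕP.≤-refl {j}))) (prod j)
      where
      fac : ∀ i → factor (- 1#) (a ℕ.+ j ℕ.* a) a i ≈[ suc j ] 𝟙
      fac i = []-trans ([]-⊕ {𝟙} (λ _ _ → ≡.refl) ([]-mono
          (ℕP.≤-trans (s≤s (ℕP.≤-trans (ℕP.m≤m*n j a) (ℕP.m≤n+m _ a₀))) (ℕP.m≤m+n _ (i ℕ.* a)))
          (Ord-mono (- 1#) (a ℕ.+ j ℕ.* a ℕ.+ i ℕ.* a))))
        (≈⇒≈[] (S.+-identityʳ 𝟙))
      prod : ∀ i → prodUpTo (factor (- 1#) (a ℕ.+ j ℕ.* a) a) i ≈[ suc j ] 𝟙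
      prod zero = fac 0
      prod (suc i) = []-trans ([]-⊛ (prod i) (fac (suc i))) (≈⇒≈[] (S.*-identityˡ 𝟙))

    -- The term has order at least `∣ n ∣ ∸ 1`, and each tail differs from 1 only from order
    -- `M - ∣ n ∣ + 1` on, so the errors have order at least `M`. Terms with `∣ n ∣` above `M` are
    -- themselves negligible.
    summand-approx : ∀ w M n → summand w M M n ≈[ M ] const (w n) ⊛ term n
    summand-approx w M n with ∣ n ∣ ℕ.≤? M
    ... | no ∣n∣≰M = []-trans (Ord-⊛ʳ {const (w n)} (Ord-⊛ˡ {term n} small)) ([]-sym (Ord-⊛ʳ {const (w n)} small))
      where
      small : Ord M (term n)
      small = []-mono (ℕP.<⇒≤pred (ℕP.≰⇒> ∣n∣≰M)) (term-Ord n)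
    ... | yes ∣n∣≤M = []-⊛ {const (w n)} (λ _ _ → ≡.refl) (near n ∣n∣≤M)
      where
      absorb : ∀ d {T U V} → Ord (d ∸ 1) T → ∀ {i k} → M ≤ d ℕ.+ i → M ≤ d ℕ.+ k → U ≈[ suc i ] 𝟙 → V ≈[ suc k ] 𝟙 →
        T ⊛ (U ⊛ V) ≈[ M ] T
      absorb d {T} {U} {V} o {i} {k} M≤i M≤k u v = []-trans (≈⇒≈[] (S.sym (SS.solve 3
          (λ T U V → T :* (U :- con (+ 1)) :* V :+ T :* (V :- con (+ 1)) :+ T := T :* (U :* V)) S.refl T U V)))
        ([]-trans ([]-⊕ ([]-⊕
            (Ord-⊛ˡ {T ⊛ (U ⊖ 𝟙)} ([]-mono (bound M≤i) (Ord-⊛ {T} (d ∸ 1) (suc i) o (diff u))))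
            ([]-mono (bound M≤k) (Ord-⊛ {T} (d ∸ 1) (suc k) o (diff v)))) (λ _ _ → ≡.refl))
          (≈⇒≈[] (S.trans (S.+-congʳ (S.+-identityˡ 𝟘)) (S.+-identityˡ T))))
        where
        open SS
        diff : ∀ {f c} → f ≈[ c ] 𝟙 → Ord c (f ⊖ 𝟙)
        diff p m m<c = ≡.trans (R.+-congʳ (p m m<c)) (R.-‿inverseʳ _)
        bound : ∀ {d c} → M ≤ d ℕ.+ c → M ≤ (d ∸ 1) ℕ.+ suc c
        bound {zero} M≤ = ℕP.m≤n⇒m≤1+n M≤
        bound {suc d} {c} M≤ = ℕP.≤-trans M≤ (ℕP.≤-reflexive (≡.sym (ℕP.+-suc d c)))
      near : ∀ n → ∣ n ∣ ≤ M → term n ⊛ (tl (+ M ℤ.- n) ⊛ tl (+ M ℤ.+ n)) ≈[ M ] term n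
      near (+ n) n≤M = absorb n (term-Ord (+ n)) {M ∸ n} {M ℕ.+ n}
        (ℕP.≤-reflexive (≡.sym (ℕP.m+[n∸m]≡n n≤M))) (ℕP.≤-trans (ℕP.m≤m+n M n) (ℕP.m≤n+m _ n))
        (≡.subst (λ z → tl z ≈[ suc (M ∸ n) ] 𝟙) (≡.sym (≡.trans (ℤP.m-n≡m⊖n M n) (ℤP.⊖-≥ n≤M))) (tl-approx (M ∸ n)))
        (tl-approx (M ℕ.+ n))
      near -[1+ n ] n≤M = absorb (suc n) (term-Ord -[1+ n ]) {M ℕ.+ suc n} {M ∸ suc n}
        (ℕP.≤-trans (ℕP.m≤m+n M (suc n)) (ℕP.m≤n+m _ (suc n))) (ℕP.≤-reflexive (≡.sym (ℕP.m+[n∸m]≡n n≤M)))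
        (tl-approx (M ℕ.+ suc n))
        (≡.subst (λ z → tl z ≈[ suc (M ∸ suc n) ] 𝟙) (≡.sym (ℤP.⊖-≥ n≤M)) (tl-approx (M ∸ suc n)))

    W-00 : ∀ w → W w 0 0 ≈ const (w (+ 0)) ⊛ (tl (+ 0) ⊛ tl (+ 0))
    W-00 w = hasSum-unique (hasSum-W w 0 0) λ M →
      window 0 , window-unique 0 , (λ { (+ zero) i∉ → contradiction (∈-window⁺ 0 (+ 0) z≤n) i∉
                                      ; (+ suc n) _ → vanish (+ suc n) (S.zeroˡ (tl (+ suc n)))
                                      ; -[1+ n ] _ → vanish -[1+ n ] (S.zeroʳ (tl (+ suc n))) }) ,
      ≈⇒≈[] (S.sym (S.trans (S.+-identityʳ _) (S.*-congˡ {const (w (+ 0))} (S.trans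
        (S.*-congʳ {tl (+ 0) ⊛ tl (+ 0)} term-0) (S.*-identityˡ _)))))
      where
      vanish : ∀ n {M} → tl (+ 0 ℤ.- n) ⊛ tl (+ 0 ℤ.+ n) ≈ 𝟘 → Ord M (summand w 0 0 n)
      vanish n p = Ord-⊛ʳ {const (w n)} (Ord-⊛ʳ {term n} (≈⇒≈[] p))
      term-0 : term (+ 0) ≈ 𝟙
      term-0 = mono-≡ (R.*-identityʳ 1#) (cong₂ ℕ._+_ (ℕP.*-zeroʳ b) (ℕP.*-zeroʳ b′))

    weighted-Θ : (ℤ → R) → PS
    weighted-Θ w = Σℤ (λ n → const (w n) ⊛ term n)

    hasSum-weighted-Θ : ∀ w → HasSum (λ n → const (w n) ⊛ term n) (weighted-Θ w)
    hasSum-weighted-Θ w = hasSum-Σℤ λ n → Ord-⊛ʳ {const (w n)} (term-Ord n)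

    W-approx : ∀ w M → W w M M ≈[ M ] weighted-Θ w
    W-approx w M = hasSum-[]cong M (summand-approx w M) (hasSum-W w M M) (hasSum-weighted-Θ w)

-- The triple product and Jacobi's cube identity.

module TripleProduct (𝓡 : CoefficientRing) where
  open ThetaSeries 𝓡 public
  open import Relation.Binary.Reasoning.Setoid S.setoid
  open import Algebra.Properties.Ring R.ring using (-1*x≈-x; -‿involutive)

  const-cong : ∀ {a a′} → a ≡ a′ → const a ≈ const a′
  const-cong eq n = cong (λ c → const c n) eq

  const-+ : ∀ a a′ → const (a + a′) ≈ const a ⊕ const a′
  const-+ a a′ zero = ≡.refl
  const-+ a a′ (suc n) = ≡.sym (R.+-identityʳ 0#)

  const-0 : const 0# ≈ 𝟘
  const-0 zero = ≡.refl
  const-0 (suc n) = ≡.refl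

  module TripleProductIdentity (α β : R) (αβ≡1 : α * β ≡ 1#) (b b′ a₀ : ℕ) (b+b′≡a : b ℕ.+ b′ ≡ suc a₀) where
    open FiniteTripleProduct α β αβ≡1 b b′ a₀ b+b′≡a public
    private
      -- Replacing `n` by `-n` exchanges `α` with `β` and `I` with `K`, so the recurrence in `K` is
      -- the recurrence in `I` for the reversed series.
      module Rev = FiniteTripleProduct β α (≡.trans (R.*-comm β α) αβ≡1) b′ b a₀ (≡.trans (ℕP.+-comm b′ b) b+b′≡a)

      tl-Rev : ∀ i → Rev.tl i ≈ tl i
      tl-Rev (+ n) = S.refl
      tl-Rev -[1+ n ] = S.refl

    θterm-neg : ∀ n → θterm β α b′ b (ℤ.- n) ≈ term n
    θterm-neg n = mono-≡
      (≡.trans (R.*-comm _ _) (cong (λ m → α ^ tri m * β ^ tri (ℤ.- n)) (ℤP.neg-involutive n)))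
      (≡.trans (ℕP.+-comm (b′ ℕ.* tri (ℤ.- n)) _) (cong (λ m → b ℕ.* tri m ℕ.+ b′ ℕ.* tri (ℤ.- n)) (ℤP.neg-involutive n)))

    W-cong : ∀ {w v} I K → (∀ n → w n ≡ v n) → W w I K ≈ W v I K
    W-cong {w} {v} I K p = hasSum-unique (hasSum-W w I K)
      (hasSum-cong (λ n → S.*-congʳ (const-cong (≡.sym (p n)))) S.refl (hasSum-W v I K))

    W-⊕ : ∀ {w v} I K → W (λ n → w n + v n) I K ≈ W w I K ⊕ W v I K
    W-⊕ {w} {v} I K = hasSum-unique (hasSum-W (λ n → w n + v n) I K)
      (hasSum-cong (λ n → S.sym (S.trans (S.*-congʳ (const-+ (w n) (v n))) (S.distribʳ _ (const (w n)) (const (v n))))) S.refl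
        (hasSum-⊕ (hasSum-W w I K) (hasSum-W v I K)))

    W-Rev : ∀ w I K → Rev.W w K I ≈ W (w ∘ ℤ.-_) I K
    W-Rev w I K = hasSum-unique
      (hasSum-map ℤ.-_ ℤ.-_ ℤP.neg-involutive ℤP.neg-involutive (Rev.hasSum-W w K I))
      (hasSum-cong (λ n → S.*-congˡ {const (w (ℤ.- n))} (S.sym (S.*-cong (θterm-neg n) (S.trans (S.*-comm _ _)
          (S.*-cong (S.trans (tl-Rev (+ I ℤ.+ ℤ.- n)) S.refl) (S.trans (tl-Rev (+ K ℤ.- (ℤ.- n)))
            (λ m → cong (λ z → tl (+ K ℤ.+ z) m) (ℤP.neg-involutive n))))))))
        S.refl (hasSum-W (w ∘ ℤ.-_) I K))

    W-suc′ : ∀ w I K → (𝟙 ⊖ X ((suc K ℕ.+ I) ℕ.* a)) ⊛ W w I (suc K) ≈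
      W w I K ⊕ mono β (b′ ℕ.+ K ℕ.* a) ⊛ W (λ n → w (n ℤ.- + 1)) I K
    W-suc′ w I K = begin
      (𝟙 ⊖ X ((suc K ℕ.+ I) ℕ.* a)) ⊛ W w I (suc K)
        ≈⟨ S.*-congˡ (W-cong I (suc K) (λ n → cong w (ℤP.neg-involutive n))) ⟨
      (𝟙 ⊖ X ((suc K ℕ.+ I) ℕ.* a)) ⊛ W (w ∘ ℤ.-_ ∘ ℤ.-_) I (suc K)
        ≈⟨ S.*-congˡ (W-Rev (w ∘ ℤ.-_) I (suc K)) ⟨
      (𝟙 ⊖ X ((suc K ℕ.+ I) ℕ.* a)) ⊛ Rev.W (w ∘ ℤ.-_) (suc K) I
        ≈⟨ Rev.W-suc (w ∘ ℤ.-_) K I ⟩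
      Rev.W (w ∘ ℤ.-_) K I ⊕ mono β (b′ ℕ.+ K ℕ.* a) ⊛ Rev.W (λ n → w (ℤ.- (n ℤ.+ + 1))) K I
        ≈⟨ S.+-cong (S.trans (W-Rev (w ∘ ℤ.-_) I K) (W-cong I K (λ n → cong w (ℤP.neg-involutive n))))
             (S.*-congˡ (S.trans (W-Rev (λ n → w (ℤ.- (n ℤ.+ + 1))) I K) (W-cong I K (λ n → cong w
               (solve 1 (λ n → :- (:- n :+ con (+ 1)) := n :- con (+ 1)) ≡.refl n))))) ⟩
      W w I K ⊕ mono β (b′ ℕ.+ K ℕ.* a) ⊛ W (λ n → w (n ℤ.- + 1)) I K ∎
      where open ℤS

    one : ℤ → R
    one _ = 1#

    qprod : ℕ → PS
    qprod = poch (- 1#) a a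

    qprod-suc : ∀ n → qprod (suc n) ≈ qprod n ⊛ (𝟙 ⊖ X (suc n ℕ.* a))
    qprod-suc n = S.*-congˡ {qprod n} (S.+-congˡ {𝟙} (mono-neg (suc n ℕ.* a)))

    qprod-0 : ∀ n → 1# * qprod n 0 ≡ 1#
    qprod-0 n = ≡.trans (R.*-identityˡ _) (go n)
      where
      go : ∀ n → qprod n 0 ≡ 1#
      go zero = ≡.refl
      go (suc n) = ≡.trans (cong₂ _*_ (go n) (R.+-identityʳ 1#)) (R.*-identityʳ 1#)

    qprod-approx : ∀ {m n} → m ≤ n → qprod n ≈[ m ] Poch (- 1#) a a
    qprod-approx = poch-approx (- 1#) a a₀

    tl-0 : tl (+ 0) ≈ Poch (- 1#) a a
    tl-0 n = cong (λ e → Poch (- 1#) e a n) (ℕP.+-identityʳ a)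

    advance : ∀ {V V′ f T} L → (𝟙 ⊖ X (suc L ℕ.* a)) ⊛ V′ ≈ f ⊛ V → V ⊛ qprod L ≈ T → V′ ⊛ qprod (suc L) ≈ f ⊛ T
    advance {V} {V′} {f} {T} L p q = begin
      V′ ⊛ qprod (suc L)                              ≈⟨ S.*-congˡ {V′} (qprod-suc L) ⟩
      V′ ⊛ (qprod L ⊛ (𝟙 ⊖ X (suc L ℕ.* a)))          ≈⟨ solve 3 (λ v q x → v :* (q :* x) := x :* v :* q) S.refl V′ (qprod L) (𝟙 ⊖ X (suc L ℕ.* a)) ⟩
      (𝟙 ⊖ X (suc L ℕ.* a)) ⊛ V′ ⊛ qprod L            ≈⟨ S.*-congʳ p ⟩
      f ⊛ V ⊛ qprod L                                 ≈⟨ S.*-assoc f V _ ⟩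
      f ⊛ (V ⊛ qprod L)                               ≈⟨ S.*-congˡ {f} q ⟩
      f ⊛ T                                           ∎
      where open SS

    reindex : ∀ {V T} {L L′} → L ≡ L′ → V ⊛ qprod L ≈ T → V ⊛ qprod L′ ≈ T
    reindex ≡.refl p = p

    -- Cauchy's finite triple product: with constant weight each step in `I` or `K` contributes one
    -- linear factor. The initial value `W one 0 0` is the square of `(q^a; q^a)_∞`, and in the
    -- limit one of these two factors is cancelled.
    W-product : ∀ I K → W one I K ⊛ qprod (I ℕ.+ K) ≈ poch α b a I ⊛ poch β b′ a K ⊛ W one 0 0
    W-product zero zero = solve 1 (λ w → w :* con (+ 1) := con (+ 1) :* con (+ 1) :* w) S.refl (W one 0 0)
      where open SS
    W-product (suc I) zero = S.trans
      (advance (I ℕ.+ 0) (S.trans (W-suc one I 0)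
          (solve 2 (λ w m → w :+ m :* w := (con (+ 1) :+ m) :* w) S.refl (W one I 0) (mono α (b ℕ.+ I ℕ.* a))))
        (W-product I zero))
      (solve 4 (λ f p q w → f :* (p :* q :* w) := p :* f :* q :* w) S.refl (factor α b a I) (poch α b a I) 𝟙 (W one 0 0))
      where open SS
    W-product I (suc K) = reindex (≡.sym (ℕP.+-suc I K)) (S.trans
      (advance (I ℕ.+ K) (S.trans (S.*-congʳ (S.+-congˡ {𝟙} (S.-‿cong (λ n → cong (λ e → X (suc e ℕ.* a) n) (ℕP.+-comm I K)))))
        (S.trans (W-suc′ one I K)
          (solve 2 (λ w m → w :+ m :* w := (con (+ 1) :+ m) :* w) S.refl (W one I K) (mono β (b′ ℕ.+ K ℕ.* a)))))
        (W-product I K))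
      (solve 4 (λ f p q w → f :* (p :* q :* w) := p :* (q :* f) :* w) S.refl (factor β b′ a K) (poch α b a I) (poch β b′ a K) (W one 0 0)))
      where open SS

    W-one-00 : W one 0 0 ≈ Poch (- 1#) a a ⊛ Poch (- 1#) a a
    W-one-00 = S.trans (W-00 one) (S.trans (S.*-identityˡ _) (S.*-cong tl-0 tl-0))

    weighted-one : weighted-Θ one ≈ Θ α β b b′
    weighted-one = hasSum-unique (hasSum-weighted-Θ one)
      (hasSum-cong (λ n → S.sym (S.*-identityˡ (term n))) S.refl (hasSum-Σℤ term-Ord))

    triple-product : Θ α β b b′ ≈ Poch α b a ⊛ Poch β b′ a ⊛ Poch (- 1#) a a
    triple-product = unit-cancel {Q} 1# (≡.trans (R.*-identityˡ _) (Poch-0 (- 1#) a₀ a)) ([]⇒≈ λ M →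
      []-trans (≈⇒≈[] (S.trans (S.*-comm Q _) (S.*-congʳ (S.sym weighted-one))))
      ([]-trans ([]-⊛ ([]-sym (W-approx one M)) ([]-sym (qprod-approx (ℕP.m≤m+n M M))))
      ([]-trans (≈⇒≈[] (W-product M M))
      ([]-trans ([]-⊛ ([]-⊛ (poch-approx α b a₀ ℕP.≤-refl) (poch-approx β b′ a₀ ℕP.≤-refl)) (≈⇒≈[] W-one-00))
      (≈⇒≈[] (solve 3 (λ x y q → x :* y :* (q :* q) := q :* (x :* y :* q)) S.refl (Poch α b a) (Poch β b′ a) Q))))))
      where
      open SS
      Q = Poch (- 1#) a a

  open TripleProductIdentity public using (triple-product)

  -- The image of an integer in the ring, used as the weight that differentiates the theta series.
  ι : ℤ → R
  ι (+ zero) = 0#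
  ι (+ suc n) = ι (+ n) + 1#
  ι -[1+ zero ] = - 1#
  ι -[1+ suc n ] = ι -[1+ n ] + - 1#

  ι-suc : ∀ n → ι (n ℤ.+ + 1) ≡ ι n + 1#
  ι-suc (+ n) = cong (λ k → ι (+ k)) (ℕP.+-comm n 1)
  ι-suc -[1+ zero ] = ≡.sym (R.-‿inverseˡ 1#)
  ι-suc -[1+ suc n ] = ≡.sym (≡.trans (R.+-assoc _ _ _) (≡.trans (R.+-congˡ (R.-‿inverseˡ 1#)) (R.+-identityʳ _)))

  ι-pred : ∀ n → ι (n ℤ.- + 1) ≡ ι n + - 1#
  ι-pred n = ≡.sym (≡.trans (cong (λ m → ι m + - 1#) (solve 1 (λ n → n := n :- con (+ 1) :+ con (+ 1)) ≡.refl n))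
    (≡.trans (R.+-congʳ (ι-suc (n ℤ.- + 1))) (≡.trans (R.+-assoc _ _ _) (≡.trans (R.+-congˡ (R.-‿inverseʳ 1#)) (R.+-identityʳ _)))))
    where open ℤS

  -1*-1 : - 1# * - 1# ≡ 1#
  -1*-1 = ≡.trans (-1*x≈-x (- 1#)) (-‿involutive 1#)

  module _ where
    open TripleProductIdentity (- 1#) (- 1#) -1*-1 0 1 0 ≡.refl hiding (triple-product)
    private
      Q : PS
      Q = Poch (- 1#) 1 1
      W₀ : PS
      W₀ = W one 0 0

      poch-vanishes : ∀ I → poch (- 1#) 0 1 (suc I) ≈ 𝟘
      poch-vanishes zero = S.trans (S.*-identityˡ _) (S.trans (S.+-congˡ {𝟙} (mono-neg 0)) (S.-‿inverseʳ 𝟙))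
      poch-vanishes (suc I) = S.trans (S.*-congʳ (poch-vanishes I)) (S.zeroˡ _)

      -- At `z = 1` the first Pochhammer symbol begins with the factor `1 - q^0`.
      W-one-vanishes : ∀ I K → W one (suc I) K ≈ 𝟘
      W-one-vanishes I K = unit-cancel-0 {qprod (suc I ℕ.+ K)} 1# (qprod-0 (suc I ℕ.+ K))
        (S.trans (S.*-comm (qprod (suc I ℕ.+ K)) _) (S.trans (W-product (suc I) K)
          (S.trans (S.*-congʳ (S.trans (S.*-congʳ (poch-vanishes I)) (S.zeroˡ _))) (S.zeroˡ _))))

      W-shifted : ∀ c (v : ℤ → R) I K → (∀ n → v n ≡ ι n + c) → W v (suc I) K ≈ W ι (suc I) K
      W-shifted c v I K p = S.trans (W-cong {v} {λ n → ι n + c} (suc I) K p)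
        (S.trans (W-⊕ {ι} {λ _ → c} (suc I) K)
        (S.trans (S.+-congˡ (hasSum-unique (hasSum-W (λ _ → c) (suc I) K)
          (hasSum-cong (λ n → S.*-congˡ {const c} (S.*-identityˡ _)) (S.trans (S.*-congˡ {const c} (W-one-vanishes I K)) (S.zeroʳ _))
            (hasSum-⊛ˡ (const c) (hasSum-W one (suc I) K))))) (S.+-identityʳ _)))

      W-ι-00 : W ι 0 0 ≈ 𝟘
      W-ι-00 = S.trans (W-00 ι) (S.trans (S.*-congʳ const-0) (S.zeroˡ _))

      -- Shifting the weight by a constant adds a multiple of the unweighted sum, which vanishes as
      -- soon as the first index is positive. From then on the weighted sums obey the product
      -- recurrence. The first step, whose factor would be `1 - q^0`, contributes -1 instead: this
      -- is the derivative of that factor.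
      W-ι-product : ∀ I K → W ι (suc I) K ⊛ qprod (suc I ℕ.+ K) ≈ ⊝ (qprod I ⊛ qprod K ⊛ W₀)
      W-ι-product zero zero = S.trans (advance {W₀} {W ι 1 0} {⊝ 𝟙} {W₀} 0
        (S.trans (W-suc ι 0 0) (S.trans (S.+-cong W-ι-00 (S.*-cong (mono-neg 0)
          (S.trans (W-cong 0 0 ι-suc) (S.trans (W-⊕ {ι} {one} 0 0)
            (S.trans (S.+-congʳ W-ι-00) (S.+-identityˡ _)))))) (S.+-identityˡ _)))
        (S.*-identityʳ W₀))
        (solve 1 (λ w → :- (con (+ 1)) :* w := :- (con (+ 1) :* con (+ 1) :* w)) S.refl W₀)
        where open SS
      W-ι-product (suc I) zero = S.trans (advance {W ι (suc I) 0} {W ι (suc (suc I)) 0} {𝟙 ⊖ X (suc I ℕ.* 1)} (suc I ℕ.+ 0)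
        (S.trans (W-suc ι (suc I) 0) (S.trans (S.+-congˡ {W ι (suc I) 0} (S.*-cong (mono-neg (suc I ℕ.* 1)) (W-shifted 1# (λ n → ι (n ℤ.+ + 1)) I 0 ι-suc)))
          (solve 2 (λ w x → w :+ :- x :* w := (con (+ 1) :- x) :* w) S.refl (W ι (suc I) 0) (X (suc I ℕ.* 1)))))
        (W-ι-product I zero))
        (S.trans (solve 4 (λ f p q w → f :* (:- (p :* q :* w)) := :- (p :* f :* q :* w)) S.refl (𝟙 ⊖ X (suc I ℕ.* 1)) (qprod I) (qprod 0) W₀)
          (S.-‿cong (S.*-congʳ (S.*-congʳ (S.sym (qprod-suc I))))))
        where open SS
      W-ι-product I (suc K) = reindex {W ι (suc I) (suc K)} (≡.sym (ℕP.+-suc (suc I) K)) (S.trans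
        (advance {W ι (suc I) K} {W ι (suc I) (suc K)} {𝟙 ⊖ X (suc K ℕ.* 1)} (suc I ℕ.+ K)
          (S.trans (S.*-congʳ (S.+-congˡ {𝟙} (S.-‿cong (λ n → cong (λ e → X (suc e ℕ.* 1) n) (ℕP.+-comm (suc I) K)))))
          (S.trans (W-suc′ ι (suc I) K)
          (S.trans (S.+-congˡ {W ι (suc I) K} (S.*-cong (mono-neg (suc K ℕ.* 1)) (W-shifted (- 1#) (λ n → ι (n ℤ.- + 1)) I K ι-pred)))
            (solve 2 (λ w x → w :+ :- x :* w := (con (+ 1) :- x) :* w) S.refl (W ι (suc I) K) (X (suc K ℕ.* 1))))))
          (W-ι-product I K))
        (S.trans (solve 4 (λ f p q w → f :* (:- (p :* q :* w)) := :- (p :* (q :* f) :* w)) S.refl (𝟙 ⊖ X (suc K ℕ.* 1)) (qprod I) (qprod K) W₀)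
          (S.-‿cong (S.*-congʳ (S.*-congˡ {qprod I} (S.sym (qprod-suc K)))))))
        where open SS

    -- Jacobi's identity for (q; q)_∞³ is the derivative of the triple product at z = 1.
    jacobi : weighted-Θ ι ≈ ⊝ (Q ⊛ Q ⊛ Q)
    jacobi = unit-cancel {Q} 1# (≡.trans (R.*-identityˡ _) (Poch-0 (- 1#) 0 1)) ([]⇒≈ λ M →
      []-trans (≈⇒≈[] (S.*-comm Q _))
      ([]-trans ([]-⊛ ([]-sym ([]-mono (ℕP.n≤1+n M) (W-approx ι (suc M))))
          ([]-sym (poch-approx (- 1#) 1 0 {M} {suc M ℕ.+ suc M} (ℕP.≤-trans (ℕP.n≤1+n M) (ℕP.m≤m+n (suc M) (suc M))))))
      ([]-trans (≈⇒≈[] (S.trans (W-ι-product M (suc M))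
          (solve 3 (λ a b w → :- (a :* b :* w) := (:- con (+ 1)) :* (a :* b :* w)) S.refl (qprod M) (qprod (suc M)) W₀)))
      ([]-trans ([]-⊛ {⊝ 𝟙} (λ _ _ → ≡.refl) ([]-⊛ ([]-⊛ (poch-approx (- 1#) 1 0 {M} {M} ℕP.≤-refl)
          (poch-approx (- 1#) 1 0 {M} {suc M} (ℕP.n≤1+n M))) (≈⇒≈[] (W-one-00))))
      (≈⇒≈[] (solve 1 (λ q → (:- con (+ 1)) :* (q :* q :* (q :* q)) := q :* (:- (q :* q :* q))) S.refl Q))))))
      where open SS

-- Splitting of products, partial theta series, and theta quotients with one linear factor removed.

module Lambert (𝓡 : CoefficientRing) where
  open TripleProduct 𝓡 public
  open import Relation.Binary.Reasoning.Setoid S.setoid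

  fprod : (ℕ → PS) → ℕ → PS
  fprod F zero = 𝟙
  fprod F (suc n) = fprod F n ⊛ F n

  fprod-cong : ∀ {F G} → (∀ j → F j ≈ G j) → ∀ n → fprod F n ≈ fprod G n
  fprod-cong p zero = S.refl
  fprod-cong p (suc n) = S.*-cong (fprod-cong p n) (p n)

  fprod-+ : ∀ F m n → fprod F (m ℕ.+ n) ≈ fprod F m ⊛ fprod (λ j → F (m ℕ.+ j)) n
  fprod-+ F m zero = S.trans (λ k → cong (λ l → fprod F l k) (ℕP.+-identityʳ m)) (S.sym (S.*-identityʳ _))
  fprod-+ F m (suc n) = S.trans (λ k → cong (λ l → fprod F l k) (ℕP.+-suc m n))
    (S.trans (S.*-congʳ (fprod-+ F m n)) (S.*-assoc _ _ _))

  fprod≈prodUpTo : ∀ F n → fprod F (suc n) ≈ prodUpTo F n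
  fprod≈prodUpTo F zero = S.*-identityˡ _
  fprod≈prodUpTo F (suc n) = S.*-congʳ (fprod≈prodUpTo F n)

  block : (ℕ → PS) → ℕ → ℕ → PS
  block F k j = fprod (λ i → F (j ℕ.* k ℕ.+ i)) k

  fprod-block : ∀ F k n → fprod (block F k) n ≈ fprod F (n ℕ.* k)
  fprod-block F k zero = S.refl
  fprod-block F k (suc n) = S.trans (S.*-congʳ (fprod-block F k n)) (S.trans (S.sym (fprod-+ F (n ℕ.* k) k))
    (λ m → cong (λ l → fprod F l m) (ℕP.+-comm (n ℕ.* k) k)))

  fprod-convergent : ∀ (G : ℕ → ℕ → PS) k → (∀ i → Convergent (λ j → G j i)) → Convergent (λ j → fprod (G j) k)
  fprod-convergent G zero c j _ _ = ≡.refl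
  fprod-convergent G (suc k) c = Convergent-⊛ {λ j → fprod (G j) k} {λ j → G j k} (fprod-convergent G k c) (c k)

  Π∞-fprod : ∀ (G : ℕ → ℕ → PS) k → (∀ i → Convergent (λ j → G j i)) →
    Π∞ (λ j → fprod (G j) k) ≈ fprod (λ i → Π∞ (λ j → G j i)) k
  Π∞-fprod G zero c = Π∞-unique {λ _ → 𝟙} (λ _ _ _ → ≡.refl) λ m → m , ℕP.≤-refl , ≈⇒≈[] (ones m)
    where
    ones : ∀ m → prodUpTo (λ _ → 𝟙) m ≈ 𝟙
    ones zero = S.refl
    ones (suc m) = S.trans (S.*-identityʳ _) (ones m)
  Π∞-fprod G (suc k) c = S.trans (Π∞-⊛ {λ j → fprod (G j) k} {λ j → G j k} (fprod-convergent G k c) (c k))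
    (S.*-congʳ (Π∞-fprod G k c))

  -- Consecutive blocks of `k + 1` factors: the first `m + 1` blocks form an ordinary partial
  -- product with `(m + 1)(k + 1)` factors, so no rearrangement of an infinite product is involved.
  Π∞-block : ∀ {F} → Convergent F → ∀ k → Π∞ F ≈ fprod (λ i → Π∞ (λ j → F (j ℕ.* suc k ℕ.+ i))) (suc k)
  Π∞-block {F} c k = S.trans (S.sym (Π∞-unique {block F (suc k)} (fprod-convergent _ (suc k) c′) λ m →
      m , ℕP.≤-refl , []-trans
        (≈⇒≈[] (S.trans (S.sym (fprod≈prodUpTo (block F (suc k)) m)) (S.trans (fprod-block F (suc k) (suc m))
          (fprod≈prodUpTo F (k ℕ.+ m ℕ.* suc k)))))
        (Π∞-approx {F} c (ℕP.≤-trans (ℕP.m≤m*n m (suc k)) (ℕP.m≤n+m _ k)))))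
    (Π∞-fprod _ (suc k) c′)
    where
    c′ : ∀ i → Convergent (λ j → F (j ℕ.* suc k ℕ.+ i))
    c′ i j = []-mono (ℕP.≤-trans (ℕP.m≤m*n j (suc k)) (ℕP.m≤m+n _ i)) (c (j ℕ.* suc k ℕ.+ i))

  Poch-split : ∀ α b a k → Poch α b (suc a) ≈ fprod (λ i → Poch α (b ℕ.+ i ℕ.* suc a) (suc k ℕ.* suc a)) (suc k)
  Poch-split α b a k = S.trans (Π∞-block {factor α b (suc a)} (factor-convergent α b a) k)
    (fprod-cong (λ i → Π∞-cong λ j n → cong (λ e → (𝟙 ⊕ mono α e) n)
      (solve 5 (λ b j k i a → b :+ (j :* (con 1 :+ k) :+ i) :* (con 1 :+ a) := b :+ i :* (con 1 :+ a) :+ j :* ((con 1 :+ k) :* (con 1 :+ a)))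
        ≡.refl b j k i a)) (suc k))
    where open ℕSolver.+-*-Solver

  X-≡ : ∀ {d e} → d ≡ e → X d ≈ X e
  X-≡ eq n = cong (λ e → X e n) eq

  []-⊖ : ∀ {f f′ g g′ M} → f ≈[ M ] f′ → g ≈[ M ] g′ → f ⊖ g ≈[ M ] f′ ⊖ g′
  []-⊖ p q n n<M = cong₂ (λ x y → x + - y) (p n n<M) (q n n<M)

  module PartialTheta where
    truncated : ℕ → ℕ → PS
    truncated zero p = 𝟘
    truncated (suc k) p = 𝟙 ⊖ X (suc p) ⊛ truncated k (suc p)

    truncated-suc : ∀ k p → truncated (suc k) p ≈[ k ] truncated k p
    truncated-suc k p n n<k = x∙y⁻¹≈ε⇒x≈y _ _ (difference k p n n<k)
      where
      open import Algebra.Properties.Group R.+-group using (x∙y⁻¹≈ε⇒x≈y)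
      open SS
      difference : ∀ k p → Ord k (truncated (suc k) p ⊖ truncated k p)
      difference zero p _ ()
      difference (suc k) p = Ord-≈ {X (suc p) ⊛ (⊝ (truncated (suc k) (suc p) ⊖ truncated k (suc p)))}
        (solve 3 (λ x f g → x :* (:- (f :- g)) := (con (+ 1) :- x :* f) :- (con (+ 1) :- x :* g)) S.refl
          (X (suc p)) (truncated (suc k) (suc p)) (truncated k (suc p)))
        ([]-mono (s≤s (ℕP.m≤n+m k p)) (Ord-⊛ {X (suc p)} (suc p) k (Ord-mono 1# (suc p))
          (Ord-⊝ {truncated (suc k) (suc p) ⊖ truncated k (suc p)} (difference k (suc p)))))

    truncated-+ : ∀ d k p → truncated (d ℕ.+ k) p ≈[ k ] truncated k p
    truncated-+ zero k p _ _ = ≡.refl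
    truncated-+ (suc d) k p = []-trans ([]-mono (ℕP.m≤n+m k d) (truncated-suc (d ℕ.+ k) p)) (truncated-+ d k p)

  -- The partial theta series Σ_{r ≥ 0} (-1)^r q^{rp + r(r+1)/2}.
  partialθ : ℕ → PS
  partialθ p n = PartialTheta.truncated (suc n) p n

  partialθ-approx : ∀ k p → partialθ p ≈[ k ] PartialTheta.truncated k p
  partialθ-approx k p n n<k = ≡.trans (≡.sym (PartialTheta.truncated-+ (k ∸ suc n) (suc n) p n ℕP.≤-refl))
    (cong (λ l → PartialTheta.truncated l p n) (ℕP.m∸n+n≡m n<k))

  partialθ-rec : ∀ p → partialθ p ≈ 𝟙 ⊖ X (suc p) ⊛ partialθ (suc p)
  partialθ-rec p = []⇒≈ λ M → []-trans ([]-mono (ℕP.n≤1+n M) (partialθ-approx (suc M) p))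
    ([]-⊖ {𝟙} (λ _ _ → ≡.refl) ([]-⊛ {X (suc p)} (λ _ _ → ≡.refl) ([]-sym (partialθ-approx M (suc p)))))

  -- Formally `v s = Σ_{r≥0} (-1)^r q^{r(r+1)/2 - rs}`, the factor beside the `m`-th theta term when
  -- the theta series is divided by `1 - z q^n`, with `s = m - n`. For positive `s` the terms `r`
  -- and `2s - 1 - r` cancel; the terms from `r = 2s` on form the first clause.
  v : ℤ → PS
  v (+ s) = X s ⊛ partialθ s
  v -[1+ p ] = partialθ (suc p)

  -- v s + q^{1-s} v (s - 1) = 1, cleared of negative powers.
  v-rec : ∀ a b s → + a ℤ.+ + 1 ≡ + b ℤ.+ s → X a ⊛ v s ⊕ X b ⊛ v (s ℤ.- + 1) ≈ X a
  v-rec a b (+ zero) eq = begin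
    X a ⊛ (𝟙 ⊛ partialθ 0) ⊕ X b ⊛ partialθ 1
      ≈⟨ S.+-cong (S.*-congˡ {X a} (S.*-congˡ {𝟙} (partialθ-rec 0))) (S.*-congʳ (S.trans (X-≡ b≡) (S.sym (X-⊛ a 1)))) ⟩
    X a ⊛ (𝟙 ⊛ (𝟙 ⊖ X 1 ⊛ partialθ 1)) ⊕ X a ⊛ X 1 ⊛ partialθ 1
      ≈⟨ solve 3 (λ a x f → a :* (con (+ 1) :* (con (+ 1) :- x :* f)) :+ a :* x :* f := a) S.refl (X a) (X 1) (partialθ 1) ⟩
    X a ∎
    where
    open SS
    b≡ : b ≡ a ℕ.+ 1
    b≡ = ≡.sym (≡.trans (ℤP.+-injective eq) (ℕP.+-identityʳ b))
  v-rec a b (+ suc t) eq = begin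
    X a ⊛ (X (suc t) ⊛ partialθ (suc t)) ⊕ X b ⊛ (X t ⊛ partialθ t)
      ≈⟨ S.+-congˡ (S.trans (S.sym (S.*-assoc (X b) (X t) _)) (S.*-cong (S.trans (X-⊛ b t) (X-≡ b≡)) (partialθ-rec t))) ⟩
    X a ⊛ (X (suc t) ⊛ partialθ (suc t)) ⊕ X a ⊛ (𝟙 ⊖ X (suc t) ⊛ partialθ (suc t))
      ≈⟨ solve 2 (λ a y → a :* y :+ a :* (con (+ 1) :- y) := a) S.refl (X a) (X (suc t) ⊛ partialθ (suc t)) ⟩
    X a ∎
    where
    open SS
    b≡ : b ℕ.+ t ≡ a
    b≡ = ℕP.suc-injective (≡.trans (≡.sym (ℕP.+-suc b t)) (≡.trans (≡.sym (ℤP.+-injective eq)) (ℕP.+-comm a 1)))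
  v-rec a b -[1+ p ] eq = begin
    X a ⊛ partialθ (suc p) ⊕ X b ⊛ v (-[1+ p ] ℤ.- + 1)
      ≈⟨ S.+-cong (S.*-congˡ {X a} (partialθ-rec (suc p))) (S.*-cong (S.trans (X-≡ b≡) (S.sym (X-⊛ a (suc (suc p)))))
           (λ n → cong (λ k → partialθ (suc (suc k)) n) (ℕP.+-identityʳ p))) ⟩
    X a ⊛ (𝟙 ⊖ X (suc (suc p)) ⊛ partialθ (suc (suc p))) ⊕ X a ⊛ X (suc (suc p)) ⊛ partialθ (suc (suc p))
      ≈⟨ solve 3 (λ a x f → a :* (con (+ 1) :- x :* f) :+ a :* x :* f := a) S.refl (X a) (X (suc (suc p))) (partialθ (suc (suc p))) ⟩
    X a ∎
    where
    open SS
    b≡ : b ≡ a ℕ.+ suc (suc p)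
    b≡ = ℤP.+-injective (≡.trans (ℤS.solve 2 (λ b p → b ℤS.:= b ℤS.:+ (ℤS.:- (ℤS.con (+ 1) ℤS.:+ p)) ℤS.:+ (ℤS.con (+ 1) ℤS.:+ p)) ≡.refl (+ b) (+ p))
      (≡.trans (cong (ℤ._+ + suc p) (≡.sym eq)) (ℤS.solve 2 (λ a p → a ℤS.:+ ℤS.con (+ 1) ℤS.:+ (ℤS.con (+ 1) ℤS.:+ p) ℤS.:= a ℤS.:+ (ℤS.con (+ 2) ℤS.:+ p)) ≡.refl (+ a) (+ p))))

  -- The middle value is eliminated between two consecutive recurrences. A distance of two is what
  -- arises when `m` grows by 1 and `k` by 1, since `m - 3k` then drops by 2.
  v-rec² : ∀ a b c s → + a ℤ.+ + 1 ≡ + b ℤ.+ s → + b ℤ.+ + 1 ≡ + c ℤ.+ (s ℤ.- + 1) →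
    X a ⊛ v s ⊖ X c ⊛ v (s ℤ.- + 1 ℤ.- + 1) ≈ X a ⊖ X b
  v-rec² a b c s p q = begin
    X a ⊛ v s ⊖ X c ⊛ v (s ℤ.- + 1 ℤ.- + 1)
      ≈⟨ solve 3 (λ x y z → x :- z := (x :+ y) :- (y :+ z)) S.refl (X a ⊛ v s) (X b ⊛ v (s ℤ.- + 1)) (X c ⊛ v (s ℤ.- + 1 ℤ.- + 1)) ⟩
    (X a ⊛ v s ⊕ X b ⊛ v (s ℤ.- + 1)) ⊖ (X b ⊛ v (s ℤ.- + 1) ⊕ X c ⊛ v (s ℤ.- + 1 ℤ.- + 1))
      ≈⟨ S.+-cong (v-rec a b s p) (S.-‿cong (v-rec b c (s ℤ.- + 1) q)) ⟩
    X a ⊖ X b ∎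
    where open SS

  module PolarExpansion (α β : R) (αβ≡1 : α * β ≡ 1#) where

    θ : ℤ → PS
    θ = θterm α β 0 1

    θ-Ord : ∀ m → Ord (∣ m ∣ ∸ 1) (θ m)
    θ-Ord m = θterm-Ord α β 0 1 m (s≤s z≤n)

    θ-pred : ∀ a b m → + a ℤ.+ m ≡ + b ℤ.+ + 1 → const α ⊛ (X b ⊛ θ (m ℤ.- + 1)) ≈ X a ⊛ θ m
    θ-pred a b m eq = S.trans (S.*-congˡ {const α} (mono-⊛ 1# b _ (θexp 0 1 (m ℤ.- + 1))))
      (S.trans (mono-⊛ α 0 _ (b ℕ.+ θexp 0 1 (m ℤ.- + 1)))
      (S.trans (mono-≡ coefficient exponent) (S.sym (mono-⊛ 1# a _ (θexp 0 1 m)))))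
      where
      open ℤS
      coefficient : α * (1# * (α ^ tri (m ℤ.- + 1) * β ^ tri (ℤ.- (m ℤ.- + 1)))) ≡ 1# * (α ^ tri m * β ^ tri (ℤ.- m))
      coefficient = ≡.trans (R.*-congˡ (R.*-identityˡ _)) (≡.trans (≡.sym (R.*-assoc _ _ _)) (≡.trans
        (inverse-^-≡ αβ≡1 {suc (tri (m ℤ.- + 1))} {tri (ℤ.- (m ℤ.- + 1))} {tri m} {tri (ℤ.- m)}
          (equalᵉ (numᵉ 1 +ᵉ triᵉ (m ℤ.- + 1) +ᵉ triᵉ (ℤ.- m)) (triᵉ m +ᵉ triᵉ (ℤ.- (m ℤ.- + 1)))
            (solve 1 (λ n → con (+ 2) :+ (n :- con (+ 1)) :* (n :- con (+ 1) :+ con (+ 1)) :+ (:- n) :* (:- n :+ con (+ 1))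
               := n :* (n :+ con (+ 1)) :+ (:- (n :- con (+ 1))) :* (:- (n :- con (+ 1)) :+ con (+ 1))) ≡.refl m)))
        (≡.sym (R.*-identityˡ _))))
      exponent : b ℕ.+ θexp 0 1 (m ℤ.- + 1) ≡ a ℕ.+ θexp 0 1 m
      exponent = equalᵉ (numᵉ b +ᵉ θexpᵉ 0 1 (m ℤ.- + 1)) (numᵉ a +ᵉ θexpᵉ 0 1 m)
        (≡.trans (solve 2 (λ b m → con (+ 2) :* b :+ (con (+ 0) :* ((m :- con (+ 1)) :* (m :- con (+ 1) :+ con (+ 1)))
             :+ con (+ 1) :* ((:- (m :- con (+ 1))) :* (:- (m :- con (+ 1)) :+ con (+ 1))))
           := con (+ 2) :* (b :+ con (+ 1) :- m) :+ (con (+ 0) :* (m :* (m :+ con (+ 1))) :+ con (+ 1) :* ((:- m) :* (:- m :+ con (+ 1))))) ≡.refl (+ b) m)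
          (cong (λ c → + 2 ℤ.* c ℤ.+ (+ 0 ℤ.* (m ℤ.* (m ℤ.+ + 1)) ℤ.+ + 1 ℤ.* (ℤ.- m ℤ.* (ℤ.- m ℤ.+ + 1))))
            (≡.trans (cong (ℤ._- m) (≡.sym eq)) (solve 2 (λ a m → a :+ m :- m := a) ≡.refl (+ a) m))))

    clear : ∀ m → Σ ℕ λ a → Σ ℕ λ b → + a ℤ.+ m ≡ + b ℤ.+ + 1
    clear (+ n) = 1 , n , cong +_ (ℕP.+-comm 1 n)
    clear -[1+ n ] = suc (suc n) , 0 , ℤS.solve 1 (λ n → con (+ 2) :+ n :+ :- (con (+ 1) :+ n) := con (+ 1)) ≡.refl (+ n)
      where open ℤS

    -- f(α, q/α) / (1 + α q^n)
    quotient : ℤ → PS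
    quotient n = Σℤ (λ m → θ m ⊛ v (m ℤ.- n))

    hasSum-quotient : ∀ n → HasSum (λ m → θ m ⊛ v (m ℤ.- n)) (quotient n)
    hasSum-quotient n = hasSum-Σℤ λ m → Ord-⊛ˡ {θ m} (θ-Ord m)

    quotient-term : ∀ a b n m → + a ≡ + b ℤ.+ n →
      X b ⊛ (θ m ⊛ v (m ℤ.- n)) ⊕ const α ⊛ X a ⊛ (θ (m ℤ.- + 1) ⊛ v (m ℤ.- + 1 ℤ.- n)) ≈ X b ⊛ θ m
    quotient-term a b n m eq = let c , d , e = clear m in X-cancel d (begin
      X d ⊛ (X b ⊛ (θ m ⊛ v (m ℤ.- n)) ⊕ const α ⊛ X a ⊛ (θ (m ℤ.- + 1) ⊛ v (m ℤ.- + 1 ℤ.- n)))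
        ≈⟨ SS.solve 8 (λ d b t u α a t′ u′ → d SS.:* (b SS.:* (t SS.:* u) SS.:+ α SS.:* a SS.:* (t′ SS.:* u′))
             SS.:= (d SS.:* b) SS.:* u SS.:* t SS.:+ a SS.:* u′ SS.:* (α SS.:* (d SS.:* t′))) S.refl
             (X d) (X b) (θ m) (v (m ℤ.- n)) (const α) (X a) (θ (m ℤ.- + 1)) (v (m ℤ.- + 1 ℤ.- n)) ⟩
      X d ⊛ X b ⊛ v (m ℤ.- n) ⊛ θ m ⊕ X a ⊛ v (m ℤ.- + 1 ℤ.- n) ⊛ (const α ⊛ (X d ⊛ θ (m ℤ.- + 1)))
        ≈⟨ S.+-cong (S.*-congʳ (S.*-congʳ (X-⊛ d b))) (S.*-cong (S.*-congˡ {X a} (λ k → cong (λ z → v z k) (e₁ m))) (θ-pred c d m e)) ⟩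
      X (d ℕ.+ b) ⊛ v (m ℤ.- n) ⊛ θ m ⊕ X a ⊛ v (m ℤ.- n ℤ.- + 1) ⊛ (X c ⊛ θ m)
        ≈⟨ SS.solve 6 (λ y u t a u′ c → y SS.:* u SS.:* t SS.:+ a SS.:* u′ SS.:* (c SS.:* t) SS.:= (y SS.:* u SS.:+ a SS.:* c SS.:* u′) SS.:* t) S.refl
             (X (d ℕ.+ b)) (v (m ℤ.- n)) (θ m) (X a) (v (m ℤ.- n ℤ.- + 1)) (X c) ⟩
      (X (d ℕ.+ b) ⊛ v (m ℤ.- n) ⊕ X a ⊛ X c ⊛ v (m ℤ.- n ℤ.- + 1)) ⊛ θ m
        ≈⟨ S.*-congʳ (S.trans (S.+-congˡ (S.*-congʳ (X-⊛ a c))) (v-rec (d ℕ.+ b) (a ℕ.+ c) (m ℤ.- n) (e₂ c d m e))) ⟩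
      X (d ℕ.+ b) ⊛ θ m
        ≈⟨ S.*-congʳ (X-⊛ d b) ⟨
      X d ⊛ X b ⊛ θ m
        ≈⟨ S.*-assoc (X d) (X b) (θ m) ⟩
      X d ⊛ (X b ⊛ θ m) ∎)
      where
      open ℤS
      e₁ : ∀ m → m ℤ.- + 1 ℤ.- n ≡ m ℤ.- n ℤ.- + 1
      e₁ m = solve 2 (λ m n → m :- con (+ 1) :- n := m :- n :- con (+ 1)) ≡.refl m n
      e₂ : ∀ c d m → + c ℤ.+ m ≡ + d ℤ.+ + 1 → + (d ℕ.+ b) ℤ.+ + 1 ≡ + (a ℕ.+ c) ℤ.+ (m ℤ.- n)
      e₂ c d m e = ≡.trans (solve 2 (λ d b → d :+ b :+ con (+ 1) := b :+ (d :+ con (+ 1))) ≡.refl (+ d) (+ b))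
        (≡.trans (cong (λ k → + b ℤ.+ k) (≡.sym e)) (≡.trans
          (solve 4 (λ b n c m → b :+ (c :+ m) := b :+ n :+ c :+ (m :- n)) ≡.refl (+ b) n (+ c) m)
          (cong (λ k → k ℤ.+ + c ℤ.+ (m ℤ.- n)) (≡.sym eq))))

    -- The factor `1 + α q^n`, cleared of negative powers, times the quotient gives back the theta
    -- series. For `α = -1` and `n = 0` the factor is zero; the quotient is nevertheless defined,
    -- being a sum of partial theta series and not the result of a division.
    quotient-spec : ∀ a b n → + a ≡ + b ℤ.+ n → (X b ⊕ const α ⊛ X a) ⊛ quotient n ≈ X b ⊛ Θ α β 0 1
    quotient-spec a b n eq = hasSum-unique
      (hasSum-cong (λ m → quotient-term a b n m eq) (S.sym (S.distribʳ (quotient n) (X b) (const α ⊛ X a)))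
        (hasSum-⊕ (hasSum-⊛ˡ (X b) (hasSum-quotient n)) (hasSum-⊛ˡ (const α ⊛ X a)
          (hasSum-map (ℤ._- + 1) (ℤ._+ + 1) (λ n → ℤS.solve 1 (λ n → n :+ con (+ 1) :- con (+ 1) := n) ≡.refl n)
            (λ n → ℤS.solve 1 (λ n → n :- con (+ 1) :+ con (+ 1) := n) ≡.refl n) (hasSum-quotient n)))))
      (hasSum-⊛ˡ (X b) (hasSum-Θ α β 0 1 (s≤s z≤n)))
      where open ℤS

equalᵉ′ : ∀ {d e p q} x y → Twice d p → Twice e q → p ℤ.+ + 2 ℤ.* x ≡ q ℤ.+ + 2 ℤ.* y → + d ℤ.+ x ≡ + e ℤ.+ y
equalᵉ′ {d} {e} x y (twice p) (twice q) eq = ℤP.*-cancelˡ-≡ (+ 2) (+ d ℤ.+ x) (+ e ℤ.+ y)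
  (≡.trans (ℤP.*-distribˡ-+ (+ 2) (+ d) x) (≡.trans (cong (ℤ._+ + 2 ℤ.* x) p) (≡.trans eq
    (≡.trans (cong (ℤ._+ + 2 ℤ.* y) (≡.sym q)) (≡.sym (ℤP.*-distribˡ-+ (+ 2) (+ e) y))))))

-- The coefficients `E_m` and their value at `z = 1`.

module HeckeSum (𝓡 : CoefficientRing) where
  open Lambert 𝓡 public
  open import Relation.Binary.Reasoning.Setoid S.setoid

  P : ℕ → ℕ → PS
  P b b′ = Σℤ (λ k → X (θexp b b′ k))

  X-θexp-Ord : ∀ b b′ k → 1 ≤ b ℕ.+ b′ → Ord (∣ k ∣ ∸ 1) (X (θexp b b′ k))
  X-θexp-Ord b b′ k 1≤ = []-mono (∣i∣∸1≤θexp b b′ k 1≤) (Ord-mono 1# (θexp b b′ k))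

  hasSum-P : ∀ b b′ → 1 ≤ b ℕ.+ b′ → HasSum (λ k → X (θexp b b′ k)) (P b b′)
  hasSum-P b b′ 1≤ = hasSum-Σℤ λ k → X-θexp-Ord b b′ k 1≤

  θexp-neg : ∀ b b′ k → θexp b b′ (ℤ.- k) ≡ θexp b′ b k
  θexp-neg b b′ k = ≡.trans (ℕP.+-comm (b ℕ.* tri (ℤ.- k)) _)
    (cong (λ m → b′ ℕ.* tri m ℕ.+ b ℕ.* tri (ℤ.- k)) (ℤP.neg-involutive k))

  hasSum-neg : ∀ {F : ℤ → PS} {S} → HasSum F S → HasSum (F ∘ ℤ.-_) S
  hasSum-neg = hasSum-map ℤ.-_ ℤ.-_ ℤP.neg-involutive ℤP.neg-involutive

  hasSum-shift : ∀ {F : ℤ → PS} {S} → HasSum F S → HasSum (λ k → F (k ℤ.+ + 1)) S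
  hasSum-shift = hasSum-map (ℤ._+ + 1) (ℤ._- + 1)
    (λ n → solve 1 (λ n → n :- con (+ 1) :+ con (+ 1) := n) ≡.refl n)
    (λ n → solve 1 (λ n → n :+ con (+ 1) :- con (+ 1) := n) ≡.refl n)
    where open ℤS

  hasSum-unshift : ∀ {F : ℤ → PS} {S} → HasSum F S → HasSum (λ k → F (k ℤ.- + 1)) S
  hasSum-unshift = hasSum-map (ℤ._- + 1) (ℤ._+ + 1)
    (λ n → solve 1 (λ n → n :+ con (+ 1) :- con (+ 1) := n) ≡.refl n)
    (λ n → solve 1 (λ n → n :- con (+ 1) :+ con (+ 1) := n) ≡.refl n)
    where open ℤS

  P-sym : ∀ b b′ → 1 ≤ b ℕ.+ b′ → 1 ≤ b′ ℕ.+ b → P b b′ ≈ P b′ b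
  P-sym b b′ 1≤ 1≤′ = hasSum-unique
    (hasSum-cong (λ k → X-≡ (θexp-neg b b′ k)) S.refl (hasSum-neg (hasSum-P b b′ 1≤))) (hasSum-P b′ b 1≤′)

  -- Equal to `k(3k-2)`, the exponent that partial fractions leave in both Lambert series.
  e : ℤ → ℕ
  e = θexp 1 5

  E′ E″ E : ℤ → PS
  E′ m = Σℤ (λ k → X (e k) ⊛ v (m ℤ.- + 3 ℤ.* k))
  E″ m = Σℤ (λ k → X (e k) ⊛ v (m ℤ.- (+ 2 ℤ.- + 3 ℤ.* k)))
  E m = E′ m ⊖ E″ m

  hasSum-E′ : ∀ m → HasSum (λ k → X (e k) ⊛ v (m ℤ.- + 3 ℤ.* k)) (E′ m)
  hasSum-E′ m = hasSum-Σℤ λ k → Ord-⊛ˡ {X (e k)} (X-θexp-Ord 1 5 k (s≤s z≤n))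

  hasSum-E″ : ∀ m → HasSum (λ k → X (e k) ⊛ v (m ℤ.- (+ 2 ℤ.- + 3 ℤ.* k))) (E″ m)
  hasSum-E″ m = hasSum-Σℤ λ k → Ord-⊛ˡ {X (e k)} (X-θexp-Ord 1 5 k (s≤s z≤n))

  hasSum-E″-neg : ∀ m → HasSum (λ k → X (θexp 5 1 k) ⊛ v (m ℤ.- + 2 ℤ.- + 3 ℤ.* k)) (E″ m)
  hasSum-E″-neg m = hasSum-cong (λ k → S.*-cong (X-≡ (θexp-neg 1 5 k)) (λ n → cong (λ z → v z n)
      (solve 2 (λ m k → m :- (con (+ 2) :- con (+ 3) :* (:- k)) := m :- con (+ 2) :- con (+ 3) :* k) ≡.refl m k)))
    S.refl (hasSum-neg (hasSum-E″ m))
    where open ℤS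

  -- The naturals `a`, `c`, `b` form an arithmetic progression with difference `m - 1`. Up to a
  -- common power of `q` they stand for 1, `q^{m-1}` and `q^{2(m-1)}`.
  module _ (a b c : ℕ) (m : ℤ) (b≡ : + b ≡ + c ℤ.+ (m ℤ.- + 1)) (c≡ : + c ≡ + a ℤ.+ (m ℤ.- + 1)) where
    private
      a≡ : + a ≡ + c ℤ.- (m ℤ.- + 1)
      a≡ = ≡.trans (ℤS.solve 2 (λ a m → a ℤS.:= a ℤS.:+ m ℤS.:- m) ≡.refl (+ a) (m ℤ.- + 1)) (cong (ℤ._- (m ℤ.- + 1)) (≡.sym c≡))

      combine : ∀ {d d′ d″ s s′} → + (b ℕ.+ d) ℤ.+ + 1 ≡ + (c ℕ.+ d″) ℤ.+ s →
        + (c ℕ.+ d″) ℤ.+ + 1 ≡ + (a ℕ.+ d′) ℤ.+ (s ℤ.- + 1) → s′ ≡ s ℤ.- + 1 ℤ.- + 1 →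
        X b ⊛ (X d ⊛ v s) ⊖ X a ⊛ (X d′ ⊛ v s′) ≈ X b ⊛ X d ⊖ X c ⊛ X d″
      combine {d} {d′} {d″} {s} {s′} p q r = begin
        X b ⊛ (X d ⊛ v s) ⊖ X a ⊛ (X d′ ⊛ v s′)
          ≈⟨ S.+-cong (S.trans (S.sym (S.*-assoc (X b) (X d) _)) (S.*-congʳ (X-⊛ b d)))
               (S.-‿cong (S.trans (S.sym (S.*-assoc (X a) (X d′) _)) (S.*-cong (X-⊛ a d′) (λ n → cong (λ z → v z n) r)))) ⟩
        X (b ℕ.+ d) ⊛ v s ⊖ X (a ℕ.+ d′) ⊛ v (s ℤ.- + 1 ℤ.- + 1)
          ≈⟨ v-rec² (b ℕ.+ d) (c ℕ.+ d″) (a ℕ.+ d′) s p q ⟩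
        X (b ℕ.+ d) ⊖ X (c ℕ.+ d″)
          ≈⟨ S.+-cong (X-⊛ b d) (S.-‿cong (X-⊛ c d″)) ⟨
        X b ⊛ X d ⊖ X c ⊛ X d″ ∎

    -- Shifting `k` in the sum for `m + 1` puts the two values of `v` at distance two, and `v-rec²`
    -- removes them, leaving theta constants. The other half `E″` leaves the same constants with `k`
    -- replaced by `-k`, so they cancel in `E-suc`.
    E′-suc : X b ⊛ E′ m ⊖ X a ⊛ E′ (m ℤ.+ + 1) ≈ X b ⊛ P 1 5 ⊖ X c ⊛ P 4 2
    E′-suc = hasSum-unique
      (hasSum-⊖ (hasSum-⊛ˡ (X b) (hasSum-E′ m)) (hasSum-⊛ˡ (X a) (hasSum-shift (hasSum-E′ (m ℤ.+ + 1)))))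
      (hasSum-cong (λ k → S.sym (combine {e k} {e (k ℤ.+ + 1)} {θexp 4 2 k} {m ℤ.- + 3 ℤ.* k} {m ℤ.+ + 1 ℤ.- + 3 ℤ.* (k ℤ.+ + 1)}
          (equalᵉ′ (+ 1) (m ℤ.- + 3 ℤ.* k) (numᵉ b +ᵉ θexpᵉ 1 5 k) (numᵉ c +ᵉ θexpᵉ 4 2 k)
            (≡.trans (cong (λ B → + 2 ℤ.* B ℤ.+ (+ 1 ℤ.* (k ℤ.* (k ℤ.+ + 1)) ℤ.+ + 5 ℤ.* (ℤ.- k ℤ.* (ℤ.- k ℤ.+ + 1))) ℤ.+ + 2 ℤ.* + 1) b≡)
              (solve 3 (λ c m k → con (+ 2) :* (c :+ (m :- con (+ 1))) :+ (con (+ 1) :* (k :* (k :+ con (+ 1))) :+ con (+ 5) :* ((:- k) :* (:- k :+ con (+ 1)))) :+ con (+ 2) :* con (+ 1)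
                := con (+ 2) :* c :+ (con (+ 4) :* (k :* (k :+ con (+ 1))) :+ con (+ 2) :* ((:- k) :* (:- k :+ con (+ 1)))) :+ con (+ 2) :* (m :- con (+ 3) :* k)) ≡.refl (+ c) m k)))
          (equalᵉ′ (+ 1) (m ℤ.- + 3 ℤ.* k ℤ.- + 1) (numᵉ c +ᵉ θexpᵉ 4 2 k) (numᵉ a +ᵉ θexpᵉ 1 5 (k ℤ.+ + 1))
            (≡.trans (solve 3 (λ c m k → con (+ 2) :* c :+ (con (+ 4) :* (k :* (k :+ con (+ 1))) :+ con (+ 2) :* ((:- k) :* (:- k :+ con (+ 1)))) :+ con (+ 2) :* con (+ 1)
                := con (+ 2) :* (c :- (m :- con (+ 1))) :+ (con (+ 1) :* ((k :+ con (+ 1)) :* (k :+ con (+ 1) :+ con (+ 1))) :+ con (+ 5) :* ((:- (k :+ con (+ 1))) :* (:- (k :+ con (+ 1)) :+ con (+ 1)))) :+ con (+ 2) :* (m :- con (+ 3) :* k :- con (+ 1))) ≡.refl (+ c) m k)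
              (cong (λ A → + 2 ℤ.* A ℤ.+ (+ 1 ℤ.* ((k ℤ.+ + 1) ℤ.* (k ℤ.+ + 1 ℤ.+ + 1)) ℤ.+ + 5 ℤ.* (ℤ.- (k ℤ.+ + 1) ℤ.* (ℤ.- (k ℤ.+ + 1) ℤ.+ + 1))) ℤ.+ + 2 ℤ.* (m ℤ.- + 3 ℤ.* k ℤ.- + 1)) (≡.sym a≡))))
          (solve 2 (λ m k → m :+ con (+ 1) :- con (+ 3) :* (k :+ con (+ 1)) := m :- con (+ 3) :* k :- con (+ 1) :- con (+ 1)) ≡.refl m k)))
        S.refl (hasSum-⊖ (hasSum-⊛ˡ (X b) (hasSum-P 1 5 (s≤s z≤n))) (hasSum-⊛ˡ (X c) (hasSum-P 4 2 (s≤s z≤n)))))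
      where open ℤS

    E″-suc : X b ⊛ E″ m ⊖ X a ⊛ E″ (m ℤ.+ + 1) ≈ X b ⊛ P 5 1 ⊖ X c ⊛ P 2 4
    E″-suc = hasSum-unique
      (hasSum-⊖ (hasSum-⊛ˡ (X b) (hasSum-unshift (hasSum-E″-neg m))) (hasSum-⊛ˡ (X a) (hasSum-E″-neg (m ℤ.+ + 1))))
      (hasSum-cong (λ k → S.sym (combine {θexp 5 1 (k ℤ.- + 1)} {θexp 5 1 k} {θexp 2 4 k} {m ℤ.- + 2 ℤ.- + 3 ℤ.* (k ℤ.- + 1)} {m ℤ.+ + 1 ℤ.- + 2 ℤ.- + 3 ℤ.* k}
          (equalᵉ′ (+ 1) (m ℤ.- + 2 ℤ.- + 3 ℤ.* (k ℤ.- + 1)) (numᵉ b +ᵉ θexpᵉ 5 1 (k ℤ.- + 1)) (numᵉ c +ᵉ θexpᵉ 2 4 k)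
            (≡.trans (cong (λ B → + 2 ℤ.* B ℤ.+ (+ 5 ℤ.* ((k ℤ.- + 1) ℤ.* (k ℤ.- + 1 ℤ.+ + 1)) ℤ.+ + 1 ℤ.* (ℤ.- (k ℤ.- + 1) ℤ.* (ℤ.- (k ℤ.- + 1) ℤ.+ + 1))) ℤ.+ + 2 ℤ.* + 1) b≡)
              (solve 3 (λ c m k → con (+ 2) :* (c :+ (m :- con (+ 1))) :+ (con (+ 5) :* ((k :- con (+ 1)) :* (k :- con (+ 1) :+ con (+ 1))) :+ con (+ 1) :* ((:- (k :- con (+ 1))) :* (:- (k :- con (+ 1)) :+ con (+ 1)))) :+ con (+ 2) :* con (+ 1)
                := con (+ 2) :* c :+ (con (+ 2) :* (k :* (k :+ con (+ 1))) :+ con (+ 4) :* ((:- k) :* (:- k :+ con (+ 1)))) :+ con (+ 2) :* (m :- con (+ 2) :- con (+ 3) :* (k :- con (+ 1)))) ≡.refl (+ c) m k)))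
          (equalᵉ′ (+ 1) (m ℤ.- + 2 ℤ.- + 3 ℤ.* (k ℤ.- + 1) ℤ.- + 1) (numᵉ c +ᵉ θexpᵉ 2 4 k) (numᵉ a +ᵉ θexpᵉ 5 1 k)
            (≡.trans (solve 3 (λ c m k → con (+ 2) :* c :+ (con (+ 2) :* (k :* (k :+ con (+ 1))) :+ con (+ 4) :* ((:- k) :* (:- k :+ con (+ 1)))) :+ con (+ 2) :* con (+ 1)
                := con (+ 2) :* (c :- (m :- con (+ 1))) :+ (con (+ 5) :* (k :* (k :+ con (+ 1))) :+ con (+ 1) :* ((:- k) :* (:- k :+ con (+ 1)))) :+ con (+ 2) :* (m :- con (+ 2) :- con (+ 3) :* (k :- con (+ 1)) :- con (+ 1))) ≡.refl (+ c) m k)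
              (cong (λ A → + 2 ℤ.* A ℤ.+ (+ 5 ℤ.* (k ℤ.* (k ℤ.+ + 1)) ℤ.+ + 1 ℤ.* (ℤ.- k ℤ.* (ℤ.- k ℤ.+ + 1))) ℤ.+ + 2 ℤ.* (m ℤ.- + 2 ℤ.- + 3 ℤ.* (k ℤ.- + 1) ℤ.- + 1)) (≡.sym a≡))))
          (solve 2 (λ m k → m :+ con (+ 1) :- con (+ 2) :- con (+ 3) :* k := m :- con (+ 2) :- con (+ 3) :* (k :- con (+ 1)) :- con (+ 1) :- con (+ 1)) ≡.refl m k)))
        S.refl (hasSum-⊖ (hasSum-⊛ˡ (X b) (hasSum-unshift (hasSum-P 5 1 (s≤s z≤n)))) (hasSum-⊛ˡ (X c) (hasSum-P 2 4 (s≤s z≤n)))))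
      where open ℤS

    E-suc : X b ⊛ E m ≈ X a ⊛ E (m ℤ.+ + 1)
    E-suc = λ n → x∙y⁻¹≈ε⇒x≈y _ _ (difference n)
      where
      open import Algebra.Properties.Group R.+-group using (x∙y⁻¹≈ε⇒x≈y)
      open SS
      difference : X b ⊛ E m ⊖ X a ⊛ E (m ℤ.+ + 1) ≈ 𝟘
      difference = begin
        X b ⊛ E m ⊖ X a ⊛ E (m ℤ.+ + 1)
          ≈⟨ solve 6 (λ a b p q r s → b :* (p :- q) :- a :* (r :- s) := (b :* p :- a :* r) :- (b :* q :- a :* s)) S.refl
               (X a) (X b) (E′ m) (E″ m) (E′ (m ℤ.+ + 1)) (E″ (m ℤ.+ + 1)) ⟩
        (X b ⊛ E′ m ⊖ X a ⊛ E′ (m ℤ.+ + 1)) ⊖ (X b ⊛ E″ m ⊖ X a ⊛ E″ (m ℤ.+ + 1))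
          ≈⟨ S.+-cong E′-suc (S.-‿cong E″-suc) ⟩
        (X b ⊛ P 1 5 ⊖ X c ⊛ P 4 2) ⊖ (X b ⊛ P 5 1 ⊖ X c ⊛ P 2 4)
          ≈⟨ S.+-congʳ (S.+-cong (S.*-congˡ {X b} (P-sym 1 5 (s≤s z≤n) (s≤s z≤n))) (S.-‿cong (S.*-congˡ {X c} (P-sym 4 2 (s≤s z≤n) (s≤s z≤n))))) ⟩
        (X b ⊛ P 5 1 ⊖ X c ⊛ P 2 4) ⊖ (X b ⊛ P 5 1 ⊖ X c ⊛ P 2 4)
          ≈⟨ S.-‿inverseʳ _ ⟩
        𝟘 ∎

  private
    clear² : ∀ m → Σ ℕ λ a → Σ ℕ λ b → Σ ℕ λ c → (+ b ≡ + c ℤ.+ m) × (+ c ≡ + a ℤ.+ m)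
    clear² (+ n) = 0 , n ℕ.+ n , n , ≡.refl , ≡.refl
    clear² -[1+ n ] = suc n ℕ.+ suc n , 0 , suc n , ≡.sym (ℤP.+-inverseʳ (+ suc n)) ,
      ℤS.solve 1 (λ n → n ℤS.:= n ℤS.:+ n ℤS.:+ ℤS.:- n) ≡.refl (+ suc n)

  -- The exponent is `(m-1)(m-2)`, the solution of the recurrence with value 0 at `m = 1`. The
  -- induction runs in both directions, cancelling `X a` upwards and `X b` downwards.
  E-closed : ∀ m → E m ≈ X (2 ℕ.* tri (m ℤ.- + 2)) ⊛ E (+ 1)
  E-closed = all
    where
    Closed : ℤ → Set
    Closed m = E m ≈ X (2 ℕ.* tri (m ℤ.- + 2)) ⊛ E (+ 1)
    open ℤS
    exponents : ∀ a b c m → + b ≡ + c ℤ.+ (m ℤ.- + 1) → + c ≡ + a ℤ.+ (m ℤ.- + 1) →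
      b ℕ.+ 2 ℕ.* tri (m ℤ.- + 2) ≡ a ℕ.+ 2 ℕ.* tri (m ℤ.+ + 1 ℤ.- + 2)
    exponents a b c m p q = equalᵉ (numᵉ b +ᵉ 2 *ᵉ triᵉ (m ℤ.- + 2)) (numᵉ a +ᵉ 2 *ᵉ triᵉ (m ℤ.+ + 1 ℤ.- + 2))
      (≡.trans (cong (λ B → + 2 ℤ.* B ℤ.+ + 2 ℤ.* ((m ℤ.- + 2) ℤ.* (m ℤ.- + 2 ℤ.+ + 1))) (≡.trans p (cong (ℤ._+ (m ℤ.- + 1)) q)))
        (solve 2 (λ a m → con (+ 2) :* (a :+ (m :- con (+ 1)) :+ (m :- con (+ 1))) :+ con (+ 2) :* ((m :- con (+ 2)) :* (m :- con (+ 2) :+ con (+ 1)))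
          := con (+ 2) :* a :+ con (+ 2) :* ((m :+ con (+ 1) :- con (+ 2)) :* (m :+ con (+ 1) :- con (+ 2) :+ con (+ 1)))) ≡.refl (+ a) m))
    power : ∀ a d → X a ⊛ (X d ⊛ E (+ 1)) ≈ X (a ℕ.+ d) ⊛ E (+ 1)
    power a d = S.trans (S.sym (S.*-assoc (X a) (X d) _)) (S.*-congʳ (X-⊛ a d))
    up : ∀ m → Closed m → Closed (m ℤ.+ + 1)
    up m h = let a , b , c , p , q = clear² (m ℤ.- + 1) in X-cancel a (S.trans (S.sym (E-suc a b c m p q))
      (S.trans (S.*-congˡ {X b} h) (S.trans (power b (2 ℕ.* tri (m ℤ.- + 2)))
        (S.trans (S.*-congʳ (X-≡ (exponents a b c m p q))) (S.sym (power a (2 ℕ.* tri (m ℤ.+ + 1 ℤ.- + 2))))))))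
    down : ∀ m → Closed (m ℤ.+ + 1) → Closed m
    down m h = let a , b , c , p , q = clear² (m ℤ.- + 1) in X-cancel b (S.trans (E-suc a b c m p q)
      (S.trans (S.*-congˡ {X a} h) (S.trans (power a (2 ℕ.* tri (m ℤ.+ + 1 ℤ.- + 2)))
        (S.trans (S.*-congʳ (X-≡ (≡.sym (exponents a b c m p q)))) (S.sym (power b (2 ℕ.* tri (m ℤ.- + 2))))))))
    nonneg : ∀ n → Closed (+ n)
    nonneg zero = down (+ 0) (S.sym (S.*-identityˡ (E (+ 1))))
    nonneg (suc n) = ≡.subst Closed (cong +_ (ℕP.+-comm n 1)) (up (+ n) (nonneg n))
    all : ∀ m → Closed m
    all (+ n) = nonneg n
    all -[1+ zero ] = down -[1+ 0 ] (nonneg 0)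
    all -[1+ suc n ] = down -[1+ suc n ] (all -[1+ n ])

  module PolarSum (α β : R) (αβ≡1 : α * β ≡ 1#) where
    open PolarExpansion α β αβ≡1 public

    -- The double series behind `T(z) A(z)`: summed over `m` it gives the `k`-th polar term, summed
    -- over `k` the coefficient `θ m ⊛ E m`.
    pair : ℤ × ℤ → PS
    pair (k , m) = X (e k) ⊛ (θ m ⊛ (v (m ℤ.- + 3 ℤ.* k) ⊖ v (m ℤ.- (+ 2 ℤ.- + 3 ℤ.* k))))

    pair-summable : Summable pair
    pair-summable = summable-ℤ² 2 λ k m → []-mono (bound ∣ k ∣ ∣ m ∣)
      (Ord-⊛ {X (e k)} (∣ k ∣ ∸ 1) (∣ m ∣ ∸ 1) (X-θexp-Ord 1 5 k (s≤s z≤n)) (Ord-⊛ˡ {θ m} (θ-Ord m)))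
      where
      bound : ∀ i j → i ℕ.+ j ∸ 2 ≤ (i ∸ 1) ℕ.+ (j ∸ 1)
      bound zero j = ℕP.∸-monoʳ-≤ j (s≤s z≤n)
      bound (suc i) zero = ℕP.≤-trans (ℕP.m∸n≤m (i ℕ.+ 0) 1) ℕP.≤-refl
      bound (suc i) (suc j) = ℕP.≤-reflexive (cong (_∸ 1) (ℕP.+-suc i j))

    polar : ℤ → PS
    polar k = X (e k) ⊛ (quotient (+ 3 ℤ.* k) ⊖ quotient (+ 2 ℤ.- + 3 ℤ.* k))

    row : ∀ k → HasSum (λ m → pair (k , m)) (polar k)
    row k = hasSum-⊛ˡ (X (e k)) (hasSum-cong (λ m → SS.solve 3 (λ t x y → t :* x :- t :* y := t :* (x :- y)) S.refl
        (θ m) (v (m ℤ.- + 3 ℤ.* k)) (v (m ℤ.- (+ 2 ℤ.- + 3 ℤ.* k)))) S.refl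
      (hasSum-⊖ (hasSum-quotient (+ 3 ℤ.* k)) (hasSum-quotient (+ 2 ℤ.- + 3 ℤ.* k))))
      where open SS

    column : ∀ m → HasSum (λ k → pair (k , m)) (θ m ⊛ E m)
    column m = hasSum-cong (λ k → SS.solve 4 (λ q t x y → t :* (q :* x :- q :* y) := q :* (t :* (x :- y))) S.refl
        (X (e k)) (θ m) (v (m ℤ.- + 3 ℤ.* k)) (v (m ℤ.- (+ 2 ℤ.- + 3 ℤ.* k)))) S.refl
      (hasSum-⊛ˡ (θ m) (hasSum-⊖ (hasSum-E′ m) (hasSum-E″ m)))
      where open SS

    column-term : ∀ k → const α ⊛ (E (+ 1) ⊛ θterm α β 1 2 k) ≈ θ (k ℤ.+ + 1) ⊛ E (k ℤ.+ + 1)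
    column-term k = begin
      const α ⊛ (E (+ 1) ⊛ θterm α β 1 2 k)
        ≈⟨ SS.solve 3 (λ a e t → a SS.:* (e SS.:* t) SS.:= (a SS.:* t) SS.:* e) S.refl (const α) (E (+ 1)) (θterm α β 1 2 k) ⟩
      const α ⊛ θterm α β 1 2 k ⊛ E (+ 1)
        ≈⟨ S.*-congʳ (S.trans (mono-⊛ α 0 _ (θexp 1 2 k)) (S.trans (mono-≡ coefficient exponent)
             (S.sym (mono-⊛ _ (θexp 0 1 (k ℤ.+ + 1)) 1# (2 ℕ.* tri (k ℤ.+ + 1 ℤ.- + 2)))))) ⟩
      θ (k ℤ.+ + 1) ⊛ X (2 ℕ.* tri (k ℤ.+ + 1 ℤ.- + 2)) ⊛ E (+ 1)
        ≈⟨ S.*-assoc (θ (k ℤ.+ + 1)) _ _ ⟩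
      θ (k ℤ.+ + 1) ⊛ (X (2 ℕ.* tri (k ℤ.+ + 1 ℤ.- + 2)) ⊛ E (+ 1))
        ≈⟨ S.*-congˡ {θ (k ℤ.+ + 1)} (E-closed (k ℤ.+ + 1)) ⟨
      θ (k ℤ.+ + 1) ⊛ E (k ℤ.+ + 1) ∎
      where
      open ℤS
      coefficient : α * (α ^ tri k * β ^ tri (ℤ.- k)) ≡ α ^ tri (k ℤ.+ + 1) * β ^ tri (ℤ.- (k ℤ.+ + 1)) * 1#
      coefficient = ≡.trans (≡.sym (R.*-assoc _ _ _)) (≡.trans
        (inverse-^-≡ αβ≡1 {suc (tri k)} {tri (ℤ.- k)} {tri (k ℤ.+ + 1)} {tri (ℤ.- (k ℤ.+ + 1))}
          (equalᵉ (numᵉ 1 +ᵉ triᵉ k +ᵉ triᵉ (ℤ.- (k ℤ.+ + 1))) (triᵉ (k ℤ.+ + 1) +ᵉ triᵉ (ℤ.- k))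
            (solve 1 (λ n → con (+ 2) :+ n :* (n :+ con (+ 1)) :+ (:- (n :+ con (+ 1))) :* (:- (n :+ con (+ 1)) :+ con (+ 1))
               := (n :+ con (+ 1)) :* (n :+ con (+ 1) :+ con (+ 1)) :+ (:- n) :* (:- n :+ con (+ 1))) ≡.refl k)))
        (≡.sym (R.*-identityʳ _)))
      exponent : θexp 1 2 k ≡ θexp 0 1 (k ℤ.+ + 1) ℕ.+ 2 ℕ.* tri (k ℤ.+ + 1 ℤ.- + 2)
      exponent = equalᵉ (θexpᵉ 1 2 k) (θexpᵉ 0 1 (k ℤ.+ + 1) +ᵉ 2 *ᵉ triᵉ (k ℤ.+ + 1 ℤ.- + 2))
        (solve 1 (λ n → con (+ 1) :* (n :* (n :+ con (+ 1))) :+ con (+ 2) :* ((:- n) :* (:- n :+ con (+ 1)))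
          := con (+ 0) :* ((n :+ con (+ 1)) :* (n :+ con (+ 1) :+ con (+ 1))) :+ con (+ 1) :* ((:- (n :+ con (+ 1))) :* (:- (n :+ con (+ 1)) :+ con (+ 1)))
            :+ con (+ 2) :* ((n :+ con (+ 1) :- con (+ 2)) :* (n :+ con (+ 1) :- con (+ 2) :+ con (+ 1)))) ≡.refl k)

    hasSum-polar : HasSum polar (const α ⊛ (E (+ 1) ⊛ Θ α β 1 2))
    hasSum-polar = hasSum-cong (λ _ → S.refl)
      (hasSum-unique (hasSum-shift columns) (hasSum-cong column-term S.refl
        (hasSum-⊛ˡ (const α) (hasSum-⊛ˡ (E (+ 1)) (hasSum-Θ α β 1 2 (s≤s z≤n))))))
      (hasSum-fubini (hasSum-total pair-summable) row)
      where
      columns : HasSum (λ m → θ m ⊛ E m) (total pair-summable)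
      columns = hasSum-fubini (hasSum-swap (hasSum-total pair-summable)) column

  Q∞ : PS
  Q∞ = Poch (- 1#) 1 1

  module _ where
    open PolarSum (- 1#) (- 1#) -1*-1
    open SS
    private
      -- Here `z = 1`, so the theta series is zero, and for `n ≠ 0` the factor `1 - q^n`, cleared of
      -- negative powers, has an invertible constant term.
      quotient-nonzero : ∀ n → n ≢ + 0 → quotient n ≈ 𝟘
      Θ-one : Θ (- 1#) (- 1#) 0 1 ≈ 𝟘
      Θ-one = S.trans (triple-product (- 1#) (- 1#) -1*-1 0 1 0 ≡.refl) (S.trans (S.*-congʳ (S.trans (S.*-congʳ
        (S.trans (Poch-head (- 1#) 0 0) (S.trans (S.*-congʳ (S.trans (S.+-congˡ {𝟙} (mono-neg 0)) (S.-‿inverseʳ 𝟙))) (S.zeroˡ _))))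
        (S.zeroˡ _))) (S.zeroˡ _))

      const-neg : const (- 1#) ≈ ⊝ 𝟙
      const-neg = mono-neg 0

      quotient-nonzero (+ zero) n≢0 = contradiction ≡.refl n≢0
      quotient-nonzero (+ suc n) _ = unit-cancel-0 {X 0 ⊕ const (- 1#) ⊛ X (suc n)} 1#
        (≡.trans (R.*-identityˡ _) (≡.trans (R.+-congˡ (R.zeroʳ (- 1#))) (R.+-identityʳ 1#)))
        (S.trans (quotient-spec (suc n) 0 (+ suc n) ≡.refl) (S.trans (S.*-congˡ {X 0} Θ-one) (S.zeroʳ (X 0))))
      quotient-nonzero -[1+ n ] _ = unit-cancel-0 {X (suc n) ⊕ const (- 1#) ⊛ X 0} (- 1#)
        (≡.trans (R.*-congˡ (R.+-identityˡ _)) (≡.trans (R.*-congˡ (R.*-identityʳ _)) -1*-1))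
        (S.trans (quotient-spec 0 (suc n) -[1+ n ] (≡.sym (ℤP.+-inverseʳ (+ suc n)))) (S.trans (S.*-congˡ {X (suc n)} Θ-one) (S.zeroʳ (X (suc n)))))

      weighted : PS
      weighted = FiniteTripleProduct.weighted-Θ (- 1#) (- 1#) -1*-1 0 1 0 ≡.refl ι

      -- Summation by parts.
      weighted≈ : weighted ≈ ⊝ quotient (+ 0)
      weighted≈ = S.trans (hasSum-unique
          (FiniteTripleProduct.hasSum-weighted-Θ (- 1#) (- 1#) -1*-1 0 1 0 ≡.refl ι)
          (hasSum-cong termwise S.refl (hasSum-⊖ t (hasSum-unshift (hasSum-cong (λ n → S.trans (S.sym (S.distribʳ (θ n ⊛ v (n ℤ.- + 0)) (const (ι n)) 𝟙))
              (S.*-congʳ (S.trans (S.sym (const-+ (ι n) 1#)) (const-cong (≡.sym (ι-suc n)))))) S.refl (hasSum-⊕ t plain))))))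
        (solve 2 (λ t q → t :- (t :+ con (+ 1) :* q) := :- q) S.refl T (quotient (+ 0)))
        where
        T : PS
        T = Σℤ (λ n → const (ι n) ⊛ (θ n ⊛ v (n ℤ.- + 0)))
        t : HasSum (λ n → const (ι n) ⊛ (θ n ⊛ v (n ℤ.- + 0))) T
        t = hasSum-Σℤ λ n → Ord-⊛ʳ {const (ι n)} (Ord-⊛ˡ {θ n} (θ-Ord n))
        plain : HasSum (λ n → 𝟙 ⊛ (θ n ⊛ v (n ℤ.- + 0))) (𝟙 ⊛ quotient (+ 0))
        plain = hasSum-⊛ˡ 𝟙 (hasSum-quotient (+ 0))
        termwise : ∀ n → const (ι n) ⊛ (θ n ⊛ v (n ℤ.- + 0)) ⊖ const (ι (n ℤ.- + 1 ℤ.+ + 1)) ⊛ (θ (n ℤ.- + 1) ⊛ v (n ℤ.- + 1 ℤ.- + 0))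
          ≈ const (ι n) ⊛ θ n
        termwise n = S.trans (S.+-congˡ (S.-‿cong (S.*-congʳ (const-cong (cong ι
            (ℤS.solve 1 (λ n → n ℤS.:- ℤS.con (+ 1) ℤS.:+ ℤS.con (+ 1) ℤS.:= n) ≡.refl n))))))
          (S.trans (solve 3 (λ w x y → w :* x :- w :* y := w :* (con (+ 1) :* x :+ (:- con (+ 1)) :* con (+ 1) :* y)) S.refl
            (const (ι n)) (θ n ⊛ v (n ℤ.- + 0)) (θ (n ℤ.- + 1) ⊛ v (n ℤ.- + 1 ℤ.- + 0)))
          (S.*-congˡ {const (ι n)} (S.trans (S.+-congˡ (S.*-congʳ (S.*-congʳ (S.sym const-neg))))
            (S.trans (quotient-term 0 0 (+ 0) n ≡.refl) (S.*-identityˡ (θ n))))))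

      -- Euler's pentagonal number theorem: the three Pochhammer symbols of the triple product are
      -- the residue classes modulo 3 of `(q; q)_∞`.
      pentagonal : Θ (- 1#) (- 1#) 1 2 ≈ Q∞
      pentagonal = S.trans (triple-product (- 1#) (- 1#) -1*-1 1 2 2 ≡.refl) (S.sym (S.trans (Poch-split (- 1#) 1 0 2)
        (S.*-congʳ (S.*-congʳ (S.*-identityˡ _)))))

      -- The index `3k` is zero only for `k = 0` and `2 - 3k` is never zero, so a single quotient
      -- survives in the whole polar sum.
      polar-0 : HasSum polar (quotient (+ 0))
      polar-0 M = window 0 , window-unique 0 , (λ { (+ zero) i∉ → contradiction (∈-window⁺ 0 (+ 0) z≤n) i∉
          ; (+ suc k) _ → vanish (+ suc k) (λ ()) ; -[1+ k ] _ → vanish -[1+ k ] (λ ()) }) ,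
        ≈⇒≈[] (S.sym (S.trans (S.+-identityʳ _) (S.trans (S.*-identityˡ _) (S.trans (S.+-congˡ (S.-‿cong
          (quotient-nonzero (+ 2) λ ()))) (solve 1 (λ q → q :- con (+ 0) := q) S.refl (quotient (+ 0)))))))
        where
        vanish : ∀ k {M} → k ≢ + 0 → Ord M (polar k)
        vanish k k≢0 = ≈⇒≈[] (S.trans (S.*-congˡ {X (e k)} (S.+-cong (quotient-nonzero (+ 3 ℤ.* k) 3k≢0)
            (S.-‿cong (quotient-nonzero (+ 2 ℤ.- + 3 ℤ.* k) 2-3k≢0)))) (solve 1 (λ x → x :* (con (+ 0) :- con (+ 0)) := con (+ 0)) S.refl (X (e k))))
          where
          3k≢0 : + 3 ℤ.* k ≢ + 0
          3k≢0 p = k≢0 (ℤP.*-cancelˡ-≡ (+ 3) k (+ 0) p)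
          2-3k≢0 : + 2 ℤ.- + 3 ℤ.* k ≢ + 0
          2-3k≢0 p = 2≢3k k (≡.trans (ℤS.solve 1 (λ k → ℤS.con (+ 2) ℤS.:= (ℤS.con (+ 2) ℤS.:- ℤS.con (+ 3) ℤS.:* k) ℤS.:+ ℤS.con (+ 3) ℤS.:* k) ≡.refl k)
              (≡.trans (cong (ℤ._+ + 3 ℤ.* k) p) (ℤP.+-identityˡ _)))
            where
            2≢3k : ∀ k → + 2 ≢ + 3 ℤ.* k
            2≢3k (+ zero) ()
            2≢3k (+ suc zero) ()
            2≢3k (+ suc (suc k)) q with ℤP.+-injective q
            ... | r with ≡.trans r (ℕP.*-comm 3 (suc (suc k)))
            ... | ()
            2≢3k -[1+ k ] ()

    E-1 : E (+ 1) ≈ ⊝ (Q∞ ⊛ Q∞)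
    E-1 = unit-cancel {Q∞} 1# (≡.trans (R.*-identityˡ _) (Poch-0 (- 1#) 0 1)) (begin
      Q∞ ⊛ E (+ 1)                                       ≈⟨ solve 2 (λ q e → q :* e := :- ((:- con (+ 1)) :* (e :* q))) S.refl Q∞ (E (+ 1)) ⟩
      ⊝ (⊝ 𝟙 ⊛ (E (+ 1) ⊛ Q∞))                           ≈⟨ S.-‿cong (S.*-cong (S.sym const-neg) (S.*-congˡ {E (+ 1)} (S.sym pentagonal))) ⟩
      ⊝ (const (- 1#) ⊛ (E (+ 1) ⊛ Θ (- 1#) (- 1#) 1 2)) ≈⟨ S.-‿cong (hasSum-unique hasSum-polar polar-0) ⟩
      ⊝ quotient (+ 0)                                   ≈⟨ weighted≈ ⟨
      weighted                                           ≈⟨ jacobi ⟩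
      ⊝ (Q∞ ⊛ Q∞ ⊛ Q∞)                                   ≈⟨ solve 1 (λ q → :- (q :* q :* q) := q :* (:- (q :* q))) S.refl Q∞ ⟩
      Q∞ ⊛ ⊝ (Q∞ ⊛ Q∞)                                   ∎)

-- Residue classes of integers and two quintuple products.

module ResidueClasses (d′ : ℕ) where
  d : ℕ
  d = suc d′

  join : Fin d × ℤ → ℤ
  join (r , m) = + d ℤ.* m ℤ.+ + toℕ r

  split : ℤ → Fin d × ℤ
  split i = fromℕ< (ℤD.n%ℕd<d i d) , i ℤD./ℕ d

  join-split : ∀ i → join (split i) ≡ i
  join-split i = ≡.trans (cong (λ r → + d ℤ.* (i ℤD./ℕ d) ℤ.+ + r) (FinP.toℕ-fromℕ< (ℤD.n%ℕd<d i d)))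
    (≡.trans (ℤP.+-comm (+ d ℤ.* (i ℤD./ℕ d)) (+ (i ℤD.%ℕ d)))
    (≡.trans (cong (λ x → + (i ℤD.%ℕ d) ℤ.+ x) (ℤP.*-comm (+ d) (i ℤD./ℕ d))) (≡.sym (ℤD.a≡a%ℕn+[a/ℕn]*n i d))))

  private
    -- `d ∣m - m′∣` is the distance of two residues, hence less than `d`.
    quotient-unique : ∀ m m′ (r r′ : Fin d) → join (r , m) ≡ join (r′ , m′) → m ≡ m′
    quotient-unique m m′ r r′ eq = ℤP.i-j≡0⇒i≡j m m′ (ℤP.∣i∣≡0⇒i≡0 (zero-below ∣ m ℤ.- m′ ∣ small))
      where
      open import Data.Integer.Solver
      open +-*-Solver
      difference : + d ℤ.* (m ℤ.- m′) ≡ + toℕ r′ ℤ.- + toℕ r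
      difference = ≡.trans (solve 4 (λ d m m′ r → d :* (m :- m′) := (d :* m :+ r) :- d :* m′ :- r) ≡.refl (+ d) m m′ (+ toℕ r))
        (≡.trans (cong (λ x → x ℤ.- + d ℤ.* m′ ℤ.- + toℕ r) eq)
          (solve 4 (λ d m′ r r′ → (d :* m′ :+ r′) :- d :* m′ :- r := r′ :- r) ≡.refl (+ d) m′ (+ toℕ r) (+ toℕ r′)))
      small : d ℕ.* ∣ m ℤ.- m′ ∣ < d
      small = ≡.subst (_< d) (≡.trans (cong ∣_∣ (≡.trans (≡.sym (ℤP.m-n≡m⊖n (toℕ r′) (toℕ r))) (≡.sym difference))) (ℤP.abs-* (+ d) (m ℤ.- m′)))
        (ℕP.≤-<-trans (ℤP.∣m⊝n∣≤m⊔n (toℕ r′) (toℕ r)) (ℕP.⊔-lub (FinP.toℕ<n r′) (FinP.toℕ<n r)))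
      zero-below : ∀ n → d ℕ.* n < d → n ≡ 0
      zero-below zero _ = ≡.refl
      zero-below (suc n) p = contradiction p (ℕP.≤⇒≯ (ℕP.m≤m*n d (suc n)))

  split-join : ∀ rm → split (join rm) ≡ rm
  split-join (r , m) = cong₂ _,_ (FinP.toℕ-injective (ℤP.+-injective residue)) quot
    where
    r′ = proj₁ (split (join (r , m)))
    m′ = proj₂ (split (join (r , m)))
    quot : m′ ≡ m
    quot = quotient-unique m′ m r′ r (join-split (join (r , m)))
    open import Algebra.Properties.Group (Algebra.Bundles.AbelianGroup.group ℤP.+-0-abelianGroup) using (∙-cancelˡ)
    residue : + toℕ r′ ≡ + toℕ r
    residue = ∙-cancelˡ (+ d ℤ.* m) (+ toℕ r′) (+ toℕ r)
      (≡.trans (cong (λ x → + d ℤ.* x ℤ.+ + toℕ r′) (≡.sym quot)) (join-split (join (r , m))))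

module Quintuple (𝓡 : CoefficientRing) where
  open HeckeSum 𝓡 public
  open import Relation.Binary.Reasoning.Setoid S.setoid

  module _ {I J : Set} {{_ : DecEq I}} {{_ : DecEq J}} where
    row-summable : {F : I × J → PS} → ∀ {S} → HasSum F S → ∀ i → Summable (λ j → F (i , j))
    row-summable h i M = let ps , u , p , _ = h M in
      deduplicate _≟_ (map proj₂ ps) , DecUniqueP.deduplicate-! _≟_ (map proj₂ ps) ,
      λ j j∉ → p (i , j) (λ r → j∉ (∈P.∈-deduplicate⁺ _≟_ (∈P.∈-map⁺ proj₂ r)))

  hasSum-dissect : ∀ d′ {F : ℤ → PS} {S} (T : Fin (suc d′) → PS) → HasSum F S →
    (∀ r → HasSum (λ m → F (+ suc d′ ℤ.* m ℤ.+ + toℕ r)) (T r)) → S ≈ sumL (allFin (suc d′)) T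
  hasSum-dissect d′ T h p = hasSum-unique (hasSum-fubini (hasSum-map join split join-split split-join h) p) (hasSum-Fin T)
    where open ResidueClasses d′

  -- The integer power of `α` with exponent `n`, provided that `β` is the inverse of `α`.
  χ : R → R → ℤ → R
  χ α β n = α ^ tri n * β ^ tri (ℤ.- n)

  χ-+ : ∀ {α β} → α * β ≡ 1# → ∀ i j → χ α β (i ℤ.+ j) ≡ χ α β i * χ α β j
  χ-+ {α} {β} αβ≡1 i j = ≡.trans
    (inverse-^-≡ αβ≡1 {tri (i ℤ.+ j)} {tri (ℤ.- (i ℤ.+ j))} {tri i ℕ.+ tri j} {tri (ℤ.- i) ℕ.+ tri (ℤ.- j)}
      (equalᵉ (triᵉ (i ℤ.+ j) +ᵉ (triᵉ (ℤ.- i) +ᵉ triᵉ (ℤ.- j))) (triᵉ i +ᵉ triᵉ j +ᵉ triᵉ (ℤ.- (i ℤ.+ j)))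
        (solve 2 (λ i j → (i :+ j) :* (i :+ j :+ con (+ 1)) :+ ((:- i) :* (:- i :+ con (+ 1)) :+ (:- j) :* (:- j :+ con (+ 1)))
          := i :* (i :+ con (+ 1)) :+ j :* (j :+ con (+ 1)) :+ (:- (i :+ j)) :* (:- (i :+ j) :+ con (+ 1))) ≡.refl i j)))
    (≡.trans (cong₂ _*_ (^-+ α (tri i) (tri j)) (^-+ β (tri (ℤ.- i)) (tri (ℤ.- j))))
      (RS.solve 4 (λ a b c d → (a RS.:* b) RS.:* (c RS.:* d) RS.:= (a RS.:* c) RS.:* (b RS.:* d)) ≡.refl
        (α ^ tri i) (α ^ tri j) (β ^ tri (ℤ.- i)) (β ^ tri (ℤ.- j))))
    where open ℤS

  sign : ℤ → R
  sign = χ (- 1#) (- 1#)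

  sign² : ∀ i → sign i * sign i ≡ 1#
  sign² i = ≡.trans (RS.solve 2 (λ a b → (a :* b) :* (a :* b) := (a :* a) :* (b :* b)) ≡.refl ((- 1#) ^ tri i) ((- 1#) ^ tri (ℤ.- i)))
    (≡.trans (cong₂ _*_ (inverse-^ -1*-1 (tri i)) (inverse-^ -1*-1 (tri (ℤ.- i)))) (R.*-identityˡ 1#))
    where open RS

  sign-parity : ∀ i k c → sign i * sign (i ℤ.+ + 2 ℤ.* k ℤ.+ c) ≡ sign c
  sign-parity i k c = ≡.trans (≡.sym (χ-+ -1*-1 i (i ℤ.+ + 2 ℤ.* k ℤ.+ c))) (≡.trans
    (cong sign (solve 3 (λ i k c → i :+ (i :+ con (+ 2) :* k :+ c) := (i :+ k) :+ (i :+ k) :+ c) ≡.refl i k c))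
    (≡.trans (χ-+ -1*-1 (i ℤ.+ k ℤ.+ (i ℤ.+ k)) c) (≡.trans
      (cong (_* sign c) (≡.trans (χ-+ -1*-1 (i ℤ.+ k) (i ℤ.+ k)) (sign² (i ℤ.+ k)))) (R.*-identityˡ _))))
    where open ℤS

  F : ℕ → ℕ → PS
  F = Θ (- 1#) (- 1#)

  lattice : ℕ → ℕ → ℕ → ℕ → ℤ → ℤ × ℤ → ℕ
  lattice b b′ c c′ r (i , k) = θexp b b′ i ℕ.+ θexp c c′ (i ℤ.+ + 2 ℤ.* k ℤ.+ r)

  -- A product of two theta series is a sum over (i , j) ∈ ℤ²; it is split according to the parity of j - i.
  record Halves (b b′ c c′ : ℕ) : Set where
    field
      even odd : PS
      hasSum-even : HasSum (X ∘ lattice b b′ c c′ (+ 0)) even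
      hasSum-odd : HasSum (X ∘ lattice b b′ c c′ (+ 1)) odd
      product≈ : F b b′ ⊛ F c c′ ≈ even ⊖ odd

  halves : ∀ b b′ c c′ → 1 ≤ b ℕ.+ b′ → 1 ≤ c ℕ.+ c′ → Halves b b′ c c′
  halves b b′ c c′ 1≤ 1≤′ = record
    { even = total (row-summable classes Fin.zero)
    -- In the odd class all terms carry the sign -1. It is taken out here, so that both halves are
    -- sums of pure powers of `q` and can be matched by exponents alone.
    ; odd = ⊝ total (row-summable classes (Fin.suc Fin.zero))
    ; hasSum-even = hasSum-cong (λ (i , k) → S.trans (termwise i k (+ 0)) (mono-≡ {e = lattice b b′ c c′ (+ 0) (i , k)} (R.*-identityˡ 1#) ≡.refl)) S.refl
        (hasSum-total (row-summable classes Fin.zero))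
    ; hasSum-odd = hasSum-cong (λ (i , k) → S.trans (S.-‿cong (S.trans (termwise i k (+ 1)) (S.trans
          (mono-≡ {e = lattice b b′ c c′ (+ 1) (i , k)} (≡.trans (R.*-identityʳ _) (R.*-identityʳ _)) ≡.refl) (mono-neg (lattice b b′ c c′ (+ 1) (i , k)))))) (λ n → -‿involutive _)) S.refl
        (hasSum-⊝ (hasSum-total (row-summable classes (Fin.suc Fin.zero))))
    ; product≈ = S.trans (hasSum-unique (hasSum-fubini classes (λ r → hasSum-total (row-summable classes r))) (hasSum-Fin _))
        (SS.solve 2 (λ x y → x :+ (y :+ con (+ 0)) := x :- :- y) S.refl
          (total (row-summable classes Fin.zero)) (total (row-summable classes (Fin.suc Fin.zero)))) }
    where
    open SS
    open import Algebra.Properties.Ring R.ring using (-‿involutive)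
    open ResidueClasses 1
    term : ℤ × ℤ → PS
    term (i , j) = θterm (- 1#) (- 1#) b b′ i ⊛ θterm (- 1#) (- 1#) c c′ j
    spread : Fin 2 × (ℤ × ℤ) → ℤ × ℤ
    spread (r , (i , k)) = i , i ℤ.+ + 2 ℤ.* k ℤ.+ + toℕ r
    gather : ℤ × ℤ → Fin 2 × (ℤ × ℤ)
    gather (i , j) = proj₁ (split (j ℤ.- i)) , (i , proj₂ (split (j ℤ.- i)))
    spread-gather : ∀ ij → spread (gather ij) ≡ ij
    spread-gather (i , j) = cong (i ,_) (≡.trans (ℤP.+-assoc i _ _) (≡.trans (cong (λ x → i ℤ.+ x) (join-split (j ℤ.- i)))
      (ℤS.solve 2 (λ i j → i ℤS.:+ (j ℤS.:- i) ℤS.:= j) ≡.refl i j)))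
    gather-spread : ∀ rik → gather (spread rik) ≡ rik
    gather-spread (r , (i , k)) = cong (λ (r , k) → r , (i , k)) (≡.trans (cong split
      (ℤS.solve 3 (λ i k r → i ℤS.:+ k ℤS.:+ r ℤS.:- i ℤS.:= k ℤS.:+ r) ≡.refl i (+ 2 ℤ.* k) (+ toℕ r))) (split-join (r , k)))
    classes : HasSum (term ∘ spread) (F b b′ ⊛ F c c′)
    classes = hasSum-map spread gather spread-gather gather-spread
      (hasSum-⊛ (hasSum-Θ (- 1#) (- 1#) b b′ 1≤) (hasSum-Θ (- 1#) (- 1#) c c′ 1≤′))
    termwise : ∀ i k r → θterm (- 1#) (- 1#) b b′ i ⊛ θterm (- 1#) (- 1#) c c′ (i ℤ.+ + 2 ℤ.* k ℤ.+ r)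
      ≈ mono (sign r) (lattice b b′ c c′ r (i , k))
    termwise i k r = S.trans (mono-⊛ _ (θexp b b′ i) _ (θexp c c′ (i ℤ.+ + 2 ℤ.* k ℤ.+ r))) (mono-≡ {e = lattice b b′ c c′ r (i , k)} (sign-parity i k r) ≡.refl)

  -- Changes of variables are kept as integer coefficients, so that two of them are seen to be
  -- mutually inverse by evaluating six integers.
  record Affine : Set where
    constructor affine
    field a b c a′ b′ c′ : ℤ

  apply : Affine → ℤ × ℤ → ℤ × ℤ
  apply (affine a b c a′ b′ c′) (i , k) = a ℤ.* i ℤ.+ b ℤ.* k ℤ.+ c , a′ ℤ.* i ℤ.+ b′ ℤ.* k ℤ.+ c′

  _∙_ : Affine → Affine → Affine
  affine a b c a′ b′ c′ ∙ affine d e f d′ e′ f′ =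
    affine (a ℤ.* d ℤ.+ b ℤ.* d′) (a ℤ.* e ℤ.+ b ℤ.* e′) (a ℤ.* f ℤ.+ b ℤ.* f′ ℤ.+ c)
      (a′ ℤ.* d ℤ.+ b′ ℤ.* d′) (a′ ℤ.* e ℤ.+ b′ ℤ.* e′) (a′ ℤ.* f ℤ.+ b′ ℤ.* f′ ℤ.+ c′)

  identity : Affine
  identity = affine (+ 1) (+ 0) (+ 0) (+ 0) (+ 1) (+ 0)

  apply-∙ : ∀ A B x → apply A (apply B x) ≡ apply (A ∙ B) x
  apply-∙ (affine a b c a′ b′ c′) (affine d e f d′ e′ f′) (i , k) = cong₂ _,_ (row-∙ a b c) (row-∙ a′ b′ c′)
    where
    open ℤS
    row-∙ : ∀ a b c → a ℤ.* (d ℤ.* i ℤ.+ e ℤ.* k ℤ.+ f) ℤ.+ b ℤ.* (d′ ℤ.* i ℤ.+ e′ ℤ.* k ℤ.+ f′) ℤ.+ c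
      ≡ (a ℤ.* d ℤ.+ b ℤ.* d′) ℤ.* i ℤ.+ (a ℤ.* e ℤ.+ b ℤ.* e′) ℤ.* k ℤ.+ (a ℤ.* f ℤ.+ b ℤ.* f′ ℤ.+ c)
    row-∙ a b c = solve 11 (λ a b c d e f d′ e′ f′ i k → a :* (d :* i :+ e :* k :+ f) :+ b :* (d′ :* i :+ e′ :* k :+ f′) :+ c
      := (a :* d :+ b :* d′) :* i :+ (a :* e :+ b :* e′) :* k :+ (a :* f :+ b :* f′ :+ c)) ≡.refl a b c d e f d′ e′ f′ i k

  apply-inverse : ∀ {A B} → A ∙ B ≡ identity → ∀ x → apply A (apply B x) ≡ x
  apply-inverse {A} {B} AB (i , k) = ≡.trans (apply-∙ A B (i , k)) (≡.trans (cong (λ C → apply C (i , k)) AB)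
    (cong₂ _,_ (solve 2 (λ i k → con (+ 1) :* i :+ con (+ 0) :* k :+ con (+ 0) := i) ≡.refl i k)
      (solve 2 (λ i k → con (+ 0) :* i :+ con (+ 1) :* k :+ con (+ 0) := k) ≡.refl i k)))
    where open ℤS

  -- A lattice exponent with its parameters: b, b′, c, c′, r as in lattice, raised by s.
  record Form : Set where
    constructor form
    field s b b′ c c′ : ℕ
          r : ℤ

  evaluate : Form → ℤ × ℤ → ℕ
  evaluate (form s b b′ c c′ r) x = s ℕ.+ lattice b b′ c c′ r x

  :evaluate : Form → Exponents.Polynomial 2 → Exponents.Polynomial 2 → Exponents.Exponent 2
  :evaluate (form s b b′ c c′ r) i k = :num s :⊞ (:θexp b b′ i :⊞ :θexp c c′ (i :+ con (+ 2) :* k :+ con r))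
    where open Exponents

  :apply : (Exponents.Polynomial 2 → Exponents.Polynomial 2 → Exponents.Exponent 2) → Affine → Exponents.Exponent 2
  :apply f (affine a b c a′ b′ c′) = f (con a :* x :+ con b :* y :+ con c) (con a′ :* x :+ con b′ :* y :+ con c′)
    where
    open Exponents
    x y : Polynomial 2
    x = var Fin.zero
    y = var (Fin.suc Fin.zero)

  -- Two lattice sums agree when an affine automorphism of ℤ² carries one quadratic exponent to the
  -- other. The latter condition is a polynomial identity, checked on normal forms.
  reindexing : ∀ f g A B → A ∙ B ≡ identity → B ∙ A ≡ identity →
    (let open Exponents) →
    (∀ ρ → ⟦ twice-value (:evaluate f (var Fin.zero) (var (Fin.suc Fin.zero))) ⟧↓ ρ ≡ ⟦ twice-value (:apply (:evaluate g) A) ⟧↓ ρ) →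
    ∀ {S T} → HasSum (X ∘ evaluate f) S → HasSum (X ∘ evaluate g) T → S ≈ T
  reindexing f g A B AB BA eq h k = hasSum-unique h (hasSum-cong
    (λ (i , j) → X-≡ (≡.sym (exponents-equal (:evaluate f (var Fin.zero) (var (Fin.suc Fin.zero))) (:apply (:evaluate g) A) (i ∷ j ∷ []) (eq (i ∷ j ∷ [])))))
    S.refl (hasSum-map (apply A) (apply B) (apply-inverse {A} {B} AB) (apply-inverse {B} {A} BA) k))
    where open Exponents

  -- The quintuple product `f(-x²,-λx) f(-λx³,-λ²x⁶) = f(-x,-λx²) (f(-λ²x³,-λx⁶) + x
  -- f(-λ,-λ²x⁹))` at `x = q`, `λ = q²`. The even half on the left is that of the first product on
  -- the right and the odd half is that of the second; the two remaining halves on the right cancel.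
  quintuple₁ : F 2 3 ⊛ F 5 10 ≈ F 1 4 ⊛ (F 7 8 ⊕ X 1 ⊛ F 2 13)
  quintuple₁ = begin
    F 2 3 ⊛ F 5 10                                      ≈⟨ L.product≈ ⟩
    L.even ⊖ L.odd                                      ≈⟨ S.+-cong L0≈A0 (S.-‿cong L1≈B1) ⟩
    A.even ⊖ X 1 ⊛ B.odd                                ≈⟨ SS.solve 3 (λ a x y → a SS.:- y SS.:= a SS.:- x SS.:+ (x SS.:- y)) S.refl A.even (X 1 ⊛ B.even) (X 1 ⊛ B.odd) ⟩
    A.even ⊖ X 1 ⊛ B.even ⊕ (X 1 ⊛ B.even ⊖ X 1 ⊛ B.odd) ≈⟨ S.+-cong (S.+-congˡ {A.even} (S.-‿cong B0≈A1)) (SS.solve 3 (λ x b c → x SS.:* b SS.:- x SS.:* c SS.:= x SS.:* (b SS.:- c)) S.refl (X 1) B.even B.odd) ⟩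
    A.even ⊖ A.odd ⊕ X 1 ⊛ (B.even ⊖ B.odd)             ≈⟨ S.+-cong A.product≈ (S.*-congˡ {X 1} B.product≈) ⟨
    F 1 4 ⊛ F 7 8 ⊕ X 1 ⊛ (F 1 4 ⊛ F 2 13)              ≈⟨ SS.solve 4 (λ f a x b → f SS.:* a SS.:+ x SS.:* (f SS.:* b) SS.:= f SS.:* (a SS.:+ x SS.:* b)) S.refl (F 1 4) (F 7 8) (X 1) (F 2 13) ⟩
    F 1 4 ⊛ (F 7 8 ⊕ X 1 ⊛ F 2 13)                      ∎
    where
    open ℤS
    module L = Halves (halves 2 3 5 10 (s≤s z≤n) (s≤s z≤n))
    module A = Halves (halves 1 4 7 8 (s≤s z≤n) (s≤s z≤n))
    module B = Halves (halves 1 4 2 13 (s≤s z≤n) (s≤s z≤n))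
    shifted-even : HasSum (λ x → X (1 ℕ.+ lattice 1 4 2 13 (+ 0) x)) (X 1 ⊛ B.even)
    shifted-even = hasSum-cong (λ x → X-⊛ 1 _) S.refl (hasSum-⊛ˡ (X 1) B.hasSum-even)
    shifted-odd : HasSum (λ x → X (1 ℕ.+ lattice 1 4 2 13 (+ 1) x)) (X 1 ⊛ B.odd)
    shifted-odd = hasSum-cong (λ x → X-⊛ 1 _) S.refl (hasSum-⊛ˡ (X 1) B.hasSum-odd)
    L0≈A0 : L.even ≈ A.even
    L0≈A0 = reindexing (form 0 2 3 5 10 (+ 0)) (form 0 1 4 7 8 (+ 0))
      -- A unimodular substitution that carries the exponent of the left lattice sum to that of the
      -- right one, followed by its inverse; likewise in the other cases.
      (affine (+ 2) (+ 3) (+ 0) -[1+ 0 ] -[1+ 0 ] (+ 0))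
      (affine -[1+ 0 ] -[1+ 2 ] (+ 0) (+ 1) (+ 2) (+ 0))
      ≡.refl ≡.refl (λ { (_ ∷ _ ∷ []) → ≡.refl }) L.hasSum-even A.hasSum-even
    B0≈A1 : X 1 ⊛ B.even ≈ A.odd
    B0≈A1 = reindexing (form 1 1 4 2 13 (+ 0)) (form 0 1 4 7 8 (+ 1))
      (affine -[1+ 1 ] -[1+ 2 ] (+ 1) (+ 1) (+ 2) -[1+ 0 ])
      (affine -[1+ 1 ] -[1+ 2 ] -[1+ 0 ] (+ 1) (+ 2) (+ 1))
      ≡.refl ≡.refl (λ { (_ ∷ _ ∷ []) → ≡.refl }) shifted-even A.hasSum-odd
    L1≈B1 : L.odd ≈ X 1 ⊛ B.odd
    L1≈B1 = reindexing (form 0 2 3 5 10 (+ 1)) (form 1 1 4 2 13 (+ 1))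
      (affine -[1+ 0 ] -[1+ 2 ] -[1+ 0 ] (+ 0) (+ 1) (+ 0))
      (affine -[1+ 0 ] -[1+ 2 ] -[1+ 0 ] (+ 0) (+ 1) (+ 0))
      ≡.refl ≡.refl (λ { (_ ∷ _ ∷ []) → ≡.refl }) L.hasSum-odd shifted-odd

  -- The same identity at `x = q²`, `λ = q⁻¹`. The minus sign comes from
  -- `f(-q⁻¹,-q¹⁶) = -q⁻¹ f(-q,-q¹⁴)`. Now the odd half on the left is the even half of the second
  -- product.
  quintuple₂ : F 1 4 ⊛ F 5 10 ≈ F 2 3 ⊛ (F 4 11 ⊖ X 1 ⊛ F 1 14)
  quintuple₂ = begin
    F 1 4 ⊛ F 5 10                                      ≈⟨ L.product≈ ⟩
    L.even ⊖ L.odd                                      ≈⟨ S.+-cong L0≈A0 (S.-‿cong (S.sym B0≈L1)) ⟩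
    A.even ⊖ X 1 ⊛ B.even                               ≈⟨ SS.solve 3 (λ a x y → a SS.:- x SS.:= a SS.:- y SS.:- (x SS.:- y)) S.refl A.even (X 1 ⊛ B.even) (X 1 ⊛ B.odd) ⟩
    A.even ⊖ X 1 ⊛ B.odd ⊖ (X 1 ⊛ B.even ⊖ X 1 ⊛ B.odd) ≈⟨ S.+-cong (S.+-congˡ {A.even} (S.-‿cong (S.sym A1≈B1))) (S.-‿cong (SS.solve 3 (λ x b c → x SS.:* b SS.:- x SS.:* c SS.:= x SS.:* (b SS.:- c)) S.refl (X 1) B.even B.odd)) ⟩
    A.even ⊖ A.odd ⊖ X 1 ⊛ (B.even ⊖ B.odd)             ≈⟨ S.+-cong A.product≈ (S.-‿cong (S.*-congˡ {X 1} B.product≈)) ⟨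
    F 2 3 ⊛ F 4 11 ⊖ X 1 ⊛ (F 2 3 ⊛ F 1 14)             ≈⟨ SS.solve 4 (λ f a x b → f SS.:* a SS.:- x SS.:* (f SS.:* b) SS.:= f SS.:* (a SS.:- x SS.:* b)) S.refl (F 2 3) (F 4 11) (X 1) (F 1 14) ⟩
    F 2 3 ⊛ (F 4 11 ⊖ X 1 ⊛ F 1 14)                     ∎
    where
    open ℤS
    module L = Halves (halves 1 4 5 10 (s≤s z≤n) (s≤s z≤n))
    module A = Halves (halves 2 3 4 11 (s≤s z≤n) (s≤s z≤n))
    module B = Halves (halves 2 3 1 14 (s≤s z≤n) (s≤s z≤n))
    shifted-even : HasSum (λ x → X (1 ℕ.+ lattice 2 3 1 14 (+ 0) x)) (X 1 ⊛ B.even)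
    shifted-even = hasSum-cong (λ x → X-⊛ 1 _) S.refl (hasSum-⊛ˡ (X 1) B.hasSum-even)
    shifted-odd : HasSum (λ x → X (1 ℕ.+ lattice 2 3 1 14 (+ 1) x)) (X 1 ⊛ B.odd)
    shifted-odd = hasSum-cong (λ x → X-⊛ 1 _) S.refl (hasSum-⊛ˡ (X 1) B.hasSum-odd)
    L0≈A0 : L.even ≈ A.even
    L0≈A0 = reindexing (form 0 1 4 5 10 (+ 0)) (form 0 2 3 4 11 (+ 0))
      (affine (+ 1) (+ 3) (+ 0) (+ 0) -[1+ 0 ] (+ 0))
      (affine (+ 1) (+ 3) (+ 0) (+ 0) -[1+ 0 ] (+ 0))
      ≡.refl ≡.refl (λ { (_ ∷ _ ∷ []) → ≡.refl }) L.hasSum-even A.hasSum-even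
    B0≈L1 : X 1 ⊛ B.even ≈ L.odd
    B0≈L1 = reindexing (form 1 2 3 1 14 (+ 0)) (form 0 1 4 5 10 (+ 1))
      (affine -[1+ 1 ] -[1+ 2 ] (+ 1) (+ 1) (+ 2) -[1+ 0 ])
      (affine -[1+ 1 ] -[1+ 2 ] -[1+ 0 ] (+ 1) (+ 2) (+ 1))
      ≡.refl ≡.refl (λ { (_ ∷ _ ∷ []) → ≡.refl }) shifted-even L.hasSum-odd
    A1≈B1 : A.odd ≈ X 1 ⊛ B.odd
    A1≈B1 = reindexing (form 0 2 3 4 11 (+ 1)) (form 1 2 3 1 14 (+ 1))
      (affine -[1+ 1 ] -[1+ 2 ] -[1+ 0 ] (+ 1) (+ 1) (+ 0))
      (affine (+ 1) (+ 3) (+ 1) -[1+ 0 ] -[1+ 1 ] -[1+ 0 ])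
      ≡.refl ≡.refl (λ { (_ ∷ _ ∷ []) → ≡.refl }) A.hasSum-odd shifted-odd

-- Dissection of theta series modulo 5.

module Dissection (𝓡 : CoefficientRing) where
  open Quintuple 𝓡 public
  open import Relation.Binary.Reasoning.Setoid S.setoid

  -- The substitution of `q^5` for `q`, in steps of five coefficients so that its properties follow
  -- by structural recursion.
  D : PS → PS
  D f 0 = f 0
  D f 1 = 0#
  D f 2 = 0#
  D f 3 = 0#
  D f 4 = 0#
  D f (suc (suc (suc (suc (suc n))))) = D (tail f) n

  D-≤-cong : ∀ {f g} n → (∀ i → i ≤ n → f i ≡ g i) → D f n ≡ D g n
  D-≤-cong 0 p = p 0 z≤n
  D-≤-cong 1 p = ≡.refl
  D-≤-cong 2 p = ≡.refl
  D-≤-cong 3 p = ≡.refl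
  D-≤-cong 4 p = ≡.refl
  D-≤-cong (suc (suc (suc (suc (suc n))))) p =
    D-≤-cong n λ i i≤n → p (suc i) (s≤s (ℕP.≤-trans i≤n (ℕP.m≤n+m n 4)))

  D-cong : ∀ {f g} → f ≈ g → D f ≈ D g
  D-cong p n = D-≤-cong n (λ i _ → p i)

  D-[]cong : ∀ {f g M} → f ≈[ M ] g → D f ≈[ M ] D g
  D-[]cong p n n<M = D-≤-cong n (λ i i≤n → p i (ℕP.≤-<-trans i≤n n<M))

  D-⊕ : ∀ f g → D (f ⊕ g) ≈ D f ⊕ D g
  D-⊕ f g 0 = ≡.refl
  D-⊕ f g 1 = ≡.sym (R.+-identityʳ 0#)
  D-⊕ f g 2 = ≡.sym (R.+-identityʳ 0#)
  D-⊕ f g 3 = ≡.sym (R.+-identityʳ 0#)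
  D-⊕ f g 4 = ≡.sym (R.+-identityʳ 0#)
  D-⊕ f g (suc (suc (suc (suc (suc n))))) = D-⊕ (tail f) (tail g) n

  D-𝟘 : D 𝟘 ≈ 𝟘
  D-𝟘 0 = ≡.refl
  D-𝟘 1 = ≡.refl
  D-𝟘 2 = ≡.refl
  D-𝟘 3 = ≡.refl
  D-𝟘 4 = ≡.refl
  D-𝟘 (suc (suc (suc (suc (suc n))))) = D-𝟘 n

  D-scale : ∀ a f → D (scale a f) ≈ scale a (D f)
  D-scale a f 0 = ≡.refl
  D-scale a f 1 = ≡.sym (R.zeroʳ a)
  D-scale a f 2 = ≡.sym (R.zeroʳ a)
  D-scale a f 3 = ≡.sym (R.zeroʳ a)
  D-scale a f 4 = ≡.sym (R.zeroʳ a)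
  D-scale a f (suc (suc (suc (suc (suc n))))) = D-scale a (tail f) n

  D-⊛ : ∀ f g → D (f ⊛ g) ≈ D f ⊛ D g
  D-⊛ f g 0 = ≡.refl
  D-⊛ f g 1 = solve 2 (λ x y → con (+ 0) := x :* con (+ 0) :+ con (+ 0) :* y) ≡.refl (f 0) (g 0)
    where open RS
  D-⊛ f g 2 = solve 2 (λ x y → con (+ 0) := x :* con (+ 0) :+ (con (+ 0) :* con (+ 0) :+ con (+ 0) :* y)) ≡.refl (f 0) (g 0)
    where open RS
  D-⊛ f g 3 = solve 2 (λ x y → con (+ 0) := x :* con (+ 0) :+ (con (+ 0) :* con (+ 0) :+ (con (+ 0) :* con (+ 0) :+ con (+ 0) :* y))) ≡.refl (f 0) (g 0)
    where open RS
  D-⊛ f g 4 = solve 2 (λ x y → con (+ 0) := x :* con (+ 0) :+ (con (+ 0) :* con (+ 0) :+ (con (+ 0) :* con (+ 0) :+ (con (+ 0) :* con (+ 0) :+ con (+ 0) :* y)))) ≡.refl (f 0) (g 0)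
    where open RS
  D-⊛ f g (suc (suc (suc (suc (suc n))))) = ≡.trans (D-⊕ (scale (f 0) (tail g)) (tail f ⊛ g) n)
    (≡.trans (cong₂ _+_ (D-scale (f 0) (tail g) n) (D-⊛ (tail f) g n))
      (solve 6 (λ x a b c d y → x :+ y := x :+ (con (+ 0) :* a :+ (con (+ 0) :* b :+ (con (+ 0) :* c :+ (con (+ 0) :* d :+ y))))) ≡.refl
        (f 0 * D (tail g) n) (D g (4 ℕ.+ n)) (D g (3 ℕ.+ n)) (D g (2 ℕ.+ n)) (D g (1 ℕ.+ n)) _))
    where open RS

  D-const : ∀ a → D (const a) ≈ const a
  D-const a 0 = ≡.refl
  D-const a 1 = ≡.refl
  D-const a 2 = ≡.refl
  D-const a 3 = ≡.refl
  D-const a 4 = ≡.refl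
  D-const a (suc (suc (suc (suc (suc n))))) = D-𝟘 n

  D-mono : ∀ a e → D (mono a e) ≈ mono a (e ℕ.* 5)
  D-mono a zero = D-const a
  D-mono a (suc e) 0 = ≡.refl
  D-mono a (suc e) 1 = ≡.refl
  D-mono a (suc e) 2 = ≡.refl
  D-mono a (suc e) 3 = ≡.refl
  D-mono a (suc e) 4 = ≡.refl
  D-mono a (suc e) (suc (suc (suc (suc (suc n))))) = D-mono a e n

  D-sumL : ∀ {I : Set} {F : I → PS} (is : List I) → D (sumL is F) ≈ sumL is (D ∘ F)
  D-sumL [] = D-𝟘
  D-sumL {F = F} (i ∷ is) = S.trans (D-⊕ (F i) (sumL is F)) (S.+-congˡ (D-sumL is))

  hasSum-D : ∀ {I : Set} {F : I → PS} {S} → HasSum F S → HasSum (D ∘ F) (D S)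
  hasSum-D {F = F} h M = let is , u , p , e = h M in
    is , u , (λ i i∉ → []-trans (D-[]cong (p i i∉)) (≈⇒≈[] D-𝟘)) , []-trans (D-[]cong e) (≈⇒≈[] (D-sumL is))

  D-prodUpTo : ∀ F n → D (prodUpTo F n) ≈ prodUpTo (D ∘ F) n
  D-prodUpTo F zero = S.refl
  D-prodUpTo F (suc n) = S.trans (D-⊛ (prodUpTo F n) (F (suc n))) (S.*-congʳ (D-prodUpTo F n))

  D-Poch : ∀ α b a → D (Poch α b (suc a)) ≈ Poch α (b ℕ.* 5) (suc a ℕ.* 5)
  D-Poch α b a = S.sym (Π∞-unique {factor α (b ℕ.* 5) (suc a ℕ.* 5)} (factor-convergent α (b ℕ.* 5) (4 ℕ.+ a ℕ.* 5)) λ m →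
    m , ℕP.≤-refl , []-trans (≈⇒≈[] (S.trans (prodUpTo-cong (λ j → S.sym (dilated j)) m)
        (S.sym (D-prodUpTo (factor α b (suc a)) m))))
      (D-[]cong (Π∞-approx {factor α b (suc a)} (factor-convergent α b a) ℕP.≤-refl)))
    where
    dilated : ∀ j → D (factor α b (suc a) j) ≈ factor α (b ℕ.* 5) (suc a ℕ.* 5) j
    dilated j = S.trans (D-⊕ 𝟙 (mono α (b ℕ.+ j ℕ.* suc a))) (S.+-cong (D-const 1#) (S.trans (D-mono α (b ℕ.+ j ℕ.* suc a))
      (λ n → cong (λ e → mono α e n) (≡.trans (ℕP.*-distribʳ-+ 5 b (j ℕ.* suc a))
        (cong (b ℕ.* 5 ℕ.+_) (ℕP.*-assoc j (suc a) 5))))))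

  F-sym : ∀ b b′ → 1 ≤ b ℕ.+ b′ → 1 ≤ b′ ℕ.+ b → F b b′ ≈ F b′ b
  F-sym b b′ 1≤ 1≤′ = hasSum-unique (hasSum-Θ (- 1#) (- 1#) b b′ 1≤)
    (hasSum-cong (λ n → mono-≡ (≡.trans (R.*-comm _ _) (cong (λ m → (- 1#) ^ tri m * (- 1#) ^ tri (ℤ.- n)) (ℤP.neg-involutive n)))
        (θexp-neg b′ b n)) S.refl (hasSum-neg (hasSum-Θ (- 1#) (- 1#) b′ b 1≤′)))

  ^-^ : ∀ x m n → x ^ (m ℕ.* n) ≡ (x ^ n) ^ m
  ^-^ x zero n = ≡.refl
  ^-^ x (suc m) n = ≡.trans (^-+ x n (m ℕ.* n)) (cong (x ^ n *_) (^-^ x m n))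

  *-^ : ∀ x y n → (x * y) ^ n ≡ x ^ n * y ^ n
  *-^ x y zero = ≡.sym (R.*-identityˡ 1#)
  *-^ x y (suc n) = ≡.trans (cong (x * y *_) (*-^ x y n))
    (RS.solve 4 (λ a b c d → (a RS.:* b) RS.:* (c RS.:* d) RS.:= (a RS.:* c) RS.:* (b RS.:* d)) ≡.refl x y (x ^ n) (y ^ n))

  module FifthRoots (α β : R) (αβ≡1 : α * β ≡ 1#) (α⁵ : α ^ 5 ≡ - 1#) (β⁵ : β ^ 5 ≡ - 1#) where

    private
      five : ∀ {e p} → Twice e p → Twice (e ℕ.* 5) (+ 5 ℤ.* p)
      five {e} {p} t = ≡.subst (λ k → Twice k (+ 5 ℤ.* p)) (ℕP.*-comm 5 e) (5 *ᵉ t)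

    χ-5 : ∀ m → χ α β (+ 5 ℤ.* m) ≡ sign m
    χ-5 m = ≡.trans (inverse-^-≡ αβ≡1 {tri (+ 5 ℤ.* m)} {tri (ℤ.- (+ 5 ℤ.* m))} {tri m ℕ.* 5} {tri (ℤ.- m) ℕ.* 5}
        (equalᵉ (triᵉ (+ 5 ℤ.* m) +ᵉ five (triᵉ (ℤ.- m))) (five (triᵉ m) +ᵉ triᵉ (ℤ.- (+ 5 ℤ.* m)))
          (solve 1 (λ m → (con (+ 5) :* m) :* (con (+ 5) :* m :+ con (+ 1)) :+ con (+ 5) :* ((:- m) :* (:- m :+ con (+ 1)))
            := con (+ 5) :* (m :* (m :+ con (+ 1))) :+ (:- (con (+ 5) :* m)) :* (:- (con (+ 5) :* m) :+ con (+ 1))) ≡.refl m)))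
      (cong₂ _*_ (≡.trans (^-^ α (tri m) 5) (cong (_^ tri m) α⁵)) (≡.trans (^-^ β (tri (ℤ.- m)) 5) (cong (_^ tri (ℤ.- m)) β⁵)))
      where open ℤS

    -- The class of `r`: since the fifth power of `α` is -1, the coefficient at `5m + r` is
    -- `χ α β r` times `(-1)^m`. The exponent there is `s` plus five times a theta exponent, so a
    -- theta series in `q^5` with argument -1 remains.
    piece : ∀ b b′ c c′ s r → 1 ≤ c ℕ.+ c′ → (let open Exponents; m = var Fin.zero) →
      (∀ ρ → ⟦ twice-value (:θexp b b′ (con (+ 5) :* m :+ con r)) ⟧↓ ρ ≡ ⟦ twice-value (:num s :⊞ 5 :⊠ :θexp c c′ m) ⟧↓ ρ) →
      HasSum (λ m → θterm α β b b′ (+ 5 ℤ.* m ℤ.+ r)) (mono (χ α β r) s ⊛ D (F c c′))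
    piece b b′ c c′ s r 1≤ eq = hasSum-cong (λ m → S.trans (S.*-congˡ {mono (χ α β r) s} (D-mono (sign m) (θexp c c′ m)))
        (S.trans (mono-⊛ (χ α β r) s (sign m) (θexp c c′ m ℕ.* 5)) (mono-≡
          (≡.trans (R.*-comm _ _) (≡.trans (cong (_* χ α β r) (≡.sym (χ-5 m))) (≡.sym (χ-+ αβ≡1 (+ 5 ℤ.* m) r))))
          (≡.sym (exponent m))))) S.refl
      (hasSum-⊛ˡ (mono (χ α β r) s) (hasSum-D (hasSum-Θ (- 1#) (- 1#) c c′ 1≤)))
      where
      open Exponents
      exponent : ∀ m → θexp b b′ (+ 5 ℤ.* m ℤ.+ r) ≡ s ℕ.+ θexp c c′ m ℕ.* 5
      exponent m = ≡.trans
        (exponents-equal (:θexp b b′ (con (+ 5) :* var Fin.zero :+ con r)) (:num s :⊞ 5 :⊠ :θexp c c′ (var Fin.zero)) (m ∷ []) (eq (m ∷ [])))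
        (cong (s ℕ.+_) (ℕP.*-comm 5 (θexp c c′ m)))

    -- Lets the classes 3 and 4 be represented by -2 and -1. The positive representatives would in
    -- general lead to theta series with a negative parameter.
    shifted : ∀ {G : ℤ → PS} {S} r → HasSum (λ m → G (+ 5 ℤ.* m ℤ.+ (r ℤ.- + 5))) S → HasSum (λ m → G (+ 5 ℤ.* m ℤ.+ r)) S
    shifted {G} r h = hasSum-cong (λ m n → cong (λ i → G i n)
        (ℤS.solve 2 (λ m r → con (+ 5) :* (m :+ con (+ 1)) :+ (r :- con (+ 5)) := con (+ 5) :* m :+ r) ≡.refl m r)) S.refl (hasSum-shift h)
      where open ℤS

    dissect-1-2 : Θ α β 1 2 ≈ mono (χ α β (+ 0)) 0 ⊛ D (F 7 8) ⊕ (mono (χ α β (+ 1)) 1 ⊛ D (F 10 5) ⊕ (mono (χ α β (+ 2)) 5 ⊛ D (F 13 2) ⊕ (mono (χ α β (-[1+ 1 ])) 7 ⊛ D (F 1 14) ⊕ (mono (χ α β (-[1+ 0 ])) 2 ⊛ D (F 4 11)))))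
    dissect-1-2 = S.trans (hasSum-dissect 4 pieces (hasSum-Θ α β 1 2 (s≤s z≤n)) λ where
        Fin.zero → piece 1 2 7 8 0 (+ 0) (s≤s z≤n) λ { (_ ∷ []) → ≡.refl }
        (Fin.suc Fin.zero) → piece 1 2 10 5 1 (+ 1) (s≤s z≤n) λ { (_ ∷ []) → ≡.refl }
        (Fin.suc (Fin.suc Fin.zero)) → piece 1 2 13 2 5 (+ 2) (s≤s z≤n) λ { (_ ∷ []) → ≡.refl }
        (Fin.suc (Fin.suc (Fin.suc Fin.zero))) → shifted {θterm α β 1 2} (+ 3) (piece 1 2 1 14 7 (-[1+ 1 ]) (s≤s z≤n) λ { (_ ∷ []) → ≡.refl })
        (Fin.suc (Fin.suc (Fin.suc (Fin.suc Fin.zero)))) → shifted {θterm α β 1 2} (+ 4) (piece 1 2 4 11 2 (-[1+ 0 ]) (s≤s z≤n) λ { (_ ∷ []) → ≡.refl })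
      ) (S.+-congˡ (S.+-congˡ (S.+-congˡ (S.+-congˡ (S.+-identityʳ _)))))
      where
      open ℤS
      pieces : Fin 5 → PS
      pieces Fin.zero = mono (χ α β (+ 0)) 0 ⊛ D (F 7 8)
      pieces (Fin.suc Fin.zero) = mono (χ α β (+ 1)) 1 ⊛ D (F 10 5)
      pieces (Fin.suc (Fin.suc Fin.zero)) = mono (χ α β (+ 2)) 5 ⊛ D (F 13 2)
      pieces (Fin.suc (Fin.suc (Fin.suc Fin.zero))) = mono (χ α β (-[1+ 1 ])) 7 ⊛ D (F 1 14)
      pieces (Fin.suc (Fin.suc (Fin.suc (Fin.suc Fin.zero)))) = mono (χ α β (-[1+ 0 ])) 2 ⊛ D (F 4 11)

    dissect-0-1 : Θ α β 0 1 ≈ mono (χ α β (+ 0)) 0 ⊛ D (F 2 3) ⊕ (mono (χ α β (+ 1)) 0 ⊛ D (F 3 2) ⊕ (mono (χ α β (+ 2)) 1 ⊛ D (F 4 1) ⊕ (mono (χ α β (-[1+ 1 ])) 3 ⊛ D (F 0 5) ⊕ (mono (χ α β (-[1+ 0 ])) 1 ⊛ D (F 1 4)))))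
    dissect-0-1 = S.trans (hasSum-dissect 4 pieces (hasSum-Θ α β 0 1 (s≤s z≤n)) λ where
        Fin.zero → piece 0 1 2 3 0 (+ 0) (s≤s z≤n) λ { (_ ∷ []) → ≡.refl }
        (Fin.suc Fin.zero) → piece 0 1 3 2 0 (+ 1) (s≤s z≤n) λ { (_ ∷ []) → ≡.refl }
        (Fin.suc (Fin.suc Fin.zero)) → piece 0 1 4 1 1 (+ 2) (s≤s z≤n) λ { (_ ∷ []) → ≡.refl }
        (Fin.suc (Fin.suc (Fin.suc Fin.zero))) → shifted {θterm α β 0 1} (+ 3) (piece 0 1 0 5 3 (-[1+ 1 ]) (s≤s z≤n) λ { (_ ∷ []) → ≡.refl })
        (Fin.suc (Fin.suc (Fin.suc (Fin.suc Fin.zero)))) → shifted {θterm α β 0 1} (+ 4) (piece 0 1 1 4 1 (-[1+ 0 ]) (s≤s z≤n) λ { (_ ∷ []) → ≡.refl })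
      ) (S.+-congˡ (S.+-congˡ (S.+-congˡ (S.+-congˡ (S.+-identityʳ _)))))
      where
      open ℤS
      pieces : Fin 5 → PS
      pieces Fin.zero = mono (χ α β (+ 0)) 0 ⊛ D (F 2 3)
      pieces (Fin.suc Fin.zero) = mono (χ α β (+ 1)) 0 ⊛ D (F 3 2)
      pieces (Fin.suc (Fin.suc Fin.zero)) = mono (χ α β (+ 2)) 1 ⊛ D (F 4 1)
      pieces (Fin.suc (Fin.suc (Fin.suc Fin.zero))) = mono (χ α β (-[1+ 1 ])) 3 ⊛ D (F 0 5)
      pieces (Fin.suc (Fin.suc (Fin.suc (Fin.suc Fin.zero)))) = mono (χ α β (-[1+ 0 ])) 1 ⊛ D (F 1 4)

-- The summands on the right, cleared of denominators.

module ThetaQuotients (𝓡 : CoefficientRing) where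
  open Dissection 𝓡 public
  open import Relation.Binary.Reasoning.Setoid S.setoid

  -- [q^b; q^a]_∞
  [_⨾_] : ℕ → ℕ → PS
  [ b ⨾ a ] = Poch (- 1#) b a ⊛ Poch (- 1#) (a ∸ b) a

  ⟨_⟩ : ℕ → PS
  ⟨ a ⟩ = Poch (- 1#) a a

  F≈ : ∀ b b′ a₀ → b ℕ.+ b′ ≡ suc a₀ → F b b′ ≈ Poch (- 1#) b (suc a₀) ⊛ Poch (- 1#) b′ (suc a₀) ⊛ ⟨ suc a₀ ⟩
  F≈ b b′ a₀ eq = triple-product (- 1#) (- 1#) -1*-1 b b′ a₀ eq

  private
    split₃ : ∀ b → Poch (- 1#) b 5 ≈ Poch (- 1#) b 15 ⊛ Poch (- 1#) (b ℕ.+ 5) 15 ⊛ Poch (- 1#) (b ℕ.+ 10) 15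
    split₃ b = S.trans (Poch-split (- 1#) b 4 2) (S.*-congʳ {Poch (- 1#) (b ℕ.+ 10) 15} (S.*-congʳ {Poch (- 1#) (b ℕ.+ 5) 15} (S.trans (S.*-identityˡ _)
      (λ n → cong (λ e → Poch (- 1#) e 15 n) (ℕP.+-identityʳ b)))))

  ⟨1⟩≈ : ⟨ 1 ⟩ ≈ [ 1 ⨾ 5 ] ⊛ [ 2 ⨾ 5 ] ⊛ ⟨ 5 ⟩
  ⟨1⟩≈ = S.trans (Poch-split (- 1#) 1 0 4) (SS.solve 5 (λ a b c d e → con (+ 1) :* a :* b :* c :* d :* e := a :* d :* (b :* c) :* e) S.refl
      (Poch (- 1#) 1 5) (Poch (- 1#) 2 5) (Poch (- 1#) 3 5) (Poch (- 1#) 4 5) ⟨ 5 ⟩)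
    where open SS

  ⟨5⟩≈ : ⟨ 5 ⟩ ≈ [ 5 ⨾ 15 ] ⊛ ⟨ 15 ⟩
  ⟨5⟩≈ = split₃ 5

  [1⨾5]≈ : [ 1 ⨾ 5 ] ≈ [ 1 ⨾ 15 ] ⊛ [ 4 ⨾ 15 ] ⊛ [ 6 ⨾ 15 ]
  [1⨾5]≈ = S.trans (S.*-cong (split₃ 1) (split₃ 4)) (SS.solve 6 (λ a b c d e f → a :* b :* c :* (d :* e :* f) := a :* f :* (d :* c) :* (b :* e)) S.refl
      (Poch (- 1#) 1 15) (Poch (- 1#) 6 15) (Poch (- 1#) 11 15) (Poch (- 1#) 4 15) (Poch (- 1#) 9 15) (Poch (- 1#) 14 15))
    where open SS

  [2⨾5]≈ : [ 2 ⨾ 5 ] ≈ [ 2 ⨾ 15 ] ⊛ [ 3 ⨾ 15 ] ⊛ [ 7 ⨾ 15 ]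
  [2⨾5]≈ = S.trans (S.*-cong (split₃ 2) (split₃ 3)) (SS.solve 6 (λ a b c d e f → a :* b :* c :* (d :* e :* f) := a :* f :* (d :* c) :* (b :* e)) S.refl
      (Poch (- 1#) 2 15) (Poch (- 1#) 7 15) (Poch (- 1#) 12 15) (Poch (- 1#) 3 15) (Poch (- 1#) 8 15) (Poch (- 1#) 13 15))
    where open SS

  F5,10≈ : F 5 10 ≈ ⟨ 5 ⟩
  F5,10≈ = S.trans (F≈ 5 10 14 ≡.refl) (S.sym ⟨5⟩≈)

  -- In the applications z is a combination c ⊛ (l ⊖ r) ⊕ … over known identities l ≈ r.
  from-difference : ∀ {x y z} → x ⊖ y ≈ z → z ≈ 𝟘 → x ≈ y
  from-difference p q n = x∙y⁻¹≈ε⇒x≈y _ _ (≡.trans (p n) (q n))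
    where open import Algebra.Properties.Group R.+-group using (x∙y⁻¹≈ε⇒x≈y)

  vanish : ∀ {c l r} → l ≈ r → c ⊛ (l ⊖ r) ≈ 𝟘
  vanish {c} {l} {r} p = S.trans (S.*-congˡ {c} (S.trans (S.+-congʳ p) (S.-‿inverseʳ r))) (S.zeroʳ c)

  infixr 6 _and_
  _and_ : ∀ {x y} → x ≈ 𝟘 → y ≈ 𝟘 → x ⊕ y ≈ 𝟘
  p and q = S.trans (S.+-cong p q) (S.+-identityˡ 𝟘)

  -- Dilated by `D` it becomes `⟨ 5 ⟩ ⊛ ⟨ 25 ⟩`, the factor available in the final comparison. It
  -- clears every denominator: each summand becomes a product of two theta series, one of modulus 5
  -- and one of modulus 15, or a sum of two such products.
  U : PS
  U = ⟨ 1 ⟩ ⊛ ⟨ 5 ⟩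

  private
    U≈ : U ≈ [ 1 ⨾ 5 ] ⊛ [ 2 ⨾ 5 ] ⊛ ⟨ 5 ⟩ ⊛ ⟨ 5 ⟩
    U≈ = S.*-congʳ ⟨1⟩≈

    Q₁ : [ 2 ⨾ 5 ] ⊛ ⟨ 5 ⟩ ⊛ ⟨ 5 ⟩ ≈ [ 1 ⨾ 5 ] ⊛ ⟨ 5 ⟩ ⊛ (F 7 8 ⊕ X 1 ⊛ F 2 13)
    Q₁ = S.trans (S.*-cong (S.sym (F≈ 2 3 4 ≡.refl)) (S.sym F5,10≈)) (S.trans quintuple₁ (S.*-congʳ (F≈ 1 4 4 ≡.refl)))

    Q₂ : [ 1 ⨾ 5 ] ⊛ ⟨ 5 ⟩ ⊛ ⟨ 5 ⟩ ≈ [ 2 ⨾ 5 ] ⊛ ⟨ 5 ⟩ ⊛ (F 4 11 ⊖ X 1 ⊛ F 1 14)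
    Q₂ = S.trans (S.*-cong (S.sym (F≈ 1 4 4 ≡.refl)) (S.sym F5,10≈)) (S.trans quintuple₂ (S.*-congʳ (F≈ 2 3 4 ≡.refl)))

  -- Squares in the denominator are the only case beyond the triple product: cancelling the second
  -- copy of `[ 1 ⨾ 5 ]` is the quintuple product, and similarly in `U/t₂²`. Here `t` and `s` denote
  -- the symbols of modulus 5 and 15, and `I` is the given reciprocal.
  U/t₁² : ∀ I → [ 1 ⨾ 5 ] ⊛ [ 1 ⨾ 5 ] ⊛ I ≈ 𝟙 → U ⊛ ([ 2 ⨾ 5 ] ⊛ I) ≈ F 2 3 ⊛ (F 7 8 ⊕ X 1 ⊛ F 2 13)
  U/t₁² I inv = S.trans (S.*-congʳ U≈) (S.trans (from-difference
    (SS.solve 7 (λ t₁ t₂ p q c d i → ( t₁ :* t₂ :* p :* p ) :* (t₂ :* i) :- ( t₂ :* p ) :* ( c :+ q :* d ) := (t₁ :* t₂ :* i) :* (t₂ :* p :* p :- (t₁ :* p :* ( c :+ q :* d ))) :+ ((t₂ :* p :* ( c :+ q :* d )) :* (t₁ :* t₁ :* i :- (con (+ 1))))) S.refl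
      [ 1 ⨾ 5 ] [ 2 ⨾ 5 ] ⟨ 5 ⟩ (X 1) (F 7 8) (F 2 13) I)
    (vanish {[ 1 ⨾ 5 ] ⊛ [ 2 ⨾ 5 ] ⊛ I} Q₁ and vanish {[ 2 ⨾ 5 ] ⊛ ⟨ 5 ⟩ ⊛ ( (F 7 8) ⊕ (X 1) ⊛ (F 2 13) )} inv)) (S.*-congʳ (S.sym (F≈ 2 3 4 ≡.refl))))
    where open SS

  U/s₁s₄s₅s₆ : ∀ I → [ 1 ⨾ 15 ] ⊛ [ 4 ⨾ 15 ] ⊛ [ 5 ⨾ 15 ] ⊛ [ 6 ⨾ 15 ] ⊛ I ≈ 𝟙 → U ⊛ ([ 2 ⨾ 15 ] ⊛ I) ≈ F 2 3 ⊛ F 2 13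
  U/s₁s₄s₅s₆ I inv = S.trans (S.*-congʳ U≈) (S.trans (from-difference
    (SS.solve 10 (λ t₁ t₂ p r s₁ s₂ s₄ s₅ s₆ i → ( t₁ :* t₂ :* p :* p ) :* (s₂ :* i) :- ( t₂ :* p ) :* ( s₂ :* r ) := (t₂ :* p :* p :* s₂ :* i) :* (t₁ :- (s₁ :* s₄ :* s₆)) :+ ((s₁ :* s₄ :* s₆ :* t₂ :* p :* s₂ :* i) :* (p :- (s₅ :* r)) :+ ((t₂ :* p :* s₂ :* r) :* (s₁ :* s₄ :* s₅ :* s₆ :* i :- (con (+ 1)))))) S.refl
      [ 1 ⨾ 5 ] [ 2 ⨾ 5 ] ⟨ 5 ⟩ ⟨ 15 ⟩ [ 1 ⨾ 15 ] [ 2 ⨾ 15 ] [ 4 ⨾ 15 ] [ 5 ⨾ 15 ] [ 6 ⨾ 15 ] I)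
    (vanish {[ 2 ⨾ 5 ] ⊛ ⟨ 5 ⟩ ⊛ ⟨ 5 ⟩ ⊛ [ 2 ⨾ 15 ] ⊛ I} [1⨾5]≈ and vanish {[ 1 ⨾ 15 ] ⊛ [ 4 ⨾ 15 ] ⊛ [ 6 ⨾ 15 ] ⊛ [ 2 ⨾ 5 ] ⊛ ⟨ 5 ⟩ ⊛ [ 2 ⨾ 15 ] ⊛ I} ⟨5⟩≈ and vanish {[ 2 ⨾ 5 ] ⊛ ⟨ 5 ⟩ ⊛ [ 2 ⨾ 15 ] ⊛ ⟨ 15 ⟩} inv)) (S.sym (S.*-cong (F≈ 2 3 4 ≡.refl) (F≈ 2 13 14 ≡.refl))))
    where open SS

  U/t₁ : ∀ I → [ 1 ⨾ 5 ] ⊛ I ≈ 𝟙 → U ⊛ (I) ≈ F 2 3 ⊛ F 5 10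
  U/t₁ I inv = S.trans (S.*-congʳ U≈) (S.trans (from-difference
    (SS.solve 4 (λ t₁ t₂ p i → ( t₁ :* t₂ :* p :* p ) :* (i) :- ( t₂ :* p ) :* p := (t₂ :* p :* p) :* (t₁ :* i :- (con (+ 1)))) S.refl
      [ 1 ⨾ 5 ] [ 2 ⨾ 5 ] ⟨ 5 ⟩ I)
    (vanish {[ 2 ⨾ 5 ] ⊛ ⟨ 5 ⟩ ⊛ ⟨ 5 ⟩} inv)) (S.sym (S.*-cong (F≈ 2 3 4 ≡.refl) F5,10≈)))
    where open SS

  U/s₂s₃s₅ : ∀ I → [ 2 ⨾ 15 ] ⊛ [ 3 ⨾ 15 ] ⊛ [ 5 ⨾ 15 ] ⊛ I ≈ 𝟙 → U ⊛ (I) ≈ F 1 4 ⊛ F 7 8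
  U/s₂s₃s₅ I inv = S.trans (S.*-congʳ U≈) (S.trans (from-difference
    (SS.solve 9 (λ t₁ t₂ p r s₂ s₃ s₅ s₇ i → ( t₁ :* t₂ :* p :* p ) :* (i) :- ( t₁ :* p ) :* ( s₇ :* r ) := (t₁ :* p :* p :* i) :* (t₂ :- (s₂ :* s₃ :* s₇)) :+ ((t₁ :* p :* s₂ :* s₃ :* s₇ :* i) :* (p :- (s₅ :* r)) :+ ((t₁ :* p :* s₇ :* r) :* (s₂ :* s₃ :* s₅ :* i :- (con (+ 1)))))) S.refl
      [ 1 ⨾ 5 ] [ 2 ⨾ 5 ] ⟨ 5 ⟩ ⟨ 15 ⟩ [ 2 ⨾ 15 ] [ 3 ⨾ 15 ] [ 5 ⨾ 15 ] [ 7 ⨾ 15 ] I)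
    (vanish {[ 1 ⨾ 5 ] ⊛ ⟨ 5 ⟩ ⊛ ⟨ 5 ⟩ ⊛ I} [2⨾5]≈ and vanish {[ 1 ⨾ 5 ] ⊛ ⟨ 5 ⟩ ⊛ [ 2 ⨾ 15 ] ⊛ [ 3 ⨾ 15 ] ⊛ [ 7 ⨾ 15 ] ⊛ I} ⟨5⟩≈ and vanish {[ 1 ⨾ 5 ] ⊛ ⟨ 5 ⟩ ⊛ [ 7 ⨾ 15 ] ⊛ ⟨ 15 ⟩} inv)) (S.sym (S.*-cong (F≈ 1 4 4 ≡.refl) (F≈ 7 8 14 ≡.refl))))
    where open SS

  U/t₂ : ∀ I → [ 2 ⨾ 5 ] ⊛ I ≈ 𝟙 → U ⊛ (I) ≈ F 1 4 ⊛ F 5 10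
  U/t₂ I inv = S.trans (S.*-congʳ U≈) (S.trans (from-difference
    (SS.solve 4 (λ t₁ t₂ p i → ( t₁ :* t₂ :* p :* p ) :* (i) :- ( t₁ :* p ) :* p := (t₁ :* p :* p) :* (t₂ :* i :- (con (+ 1)))) S.refl
      [ 1 ⨾ 5 ] [ 2 ⨾ 5 ] ⟨ 5 ⟩ I)
    (vanish {[ 1 ⨾ 5 ] ⊛ ⟨ 5 ⟩ ⊛ ⟨ 5 ⟩} inv)) (S.sym (S.*-cong (F≈ 1 4 4 ≡.refl) F5,10≈)))
    where open SS

  U/s₁s₅s₆ : ∀ I → [ 1 ⨾ 15 ] ⊛ [ 5 ⨾ 15 ] ⊛ [ 6 ⨾ 15 ] ⊛ I ≈ 𝟙 → U ⊛ (I) ≈ F 2 3 ⊛ F 4 11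
  U/s₁s₅s₆ I inv = S.trans (S.*-congʳ U≈) (S.trans (from-difference
    (SS.solve 9 (λ t₁ t₂ p r s₁ s₄ s₅ s₆ i → ( t₁ :* t₂ :* p :* p ) :* (i) :- ( t₂ :* p ) :* ( s₄ :* r ) := (t₂ :* p :* p :* i) :* (t₁ :- (s₁ :* s₄ :* s₆)) :+ ((s₁ :* s₄ :* s₆ :* t₂ :* p :* i) :* (p :- (s₅ :* r)) :+ ((t₂ :* p :* s₄ :* r) :* (s₁ :* s₅ :* s₆ :* i :- (con (+ 1)))))) S.refl
      [ 1 ⨾ 5 ] [ 2 ⨾ 5 ] ⟨ 5 ⟩ ⟨ 15 ⟩ [ 1 ⨾ 15 ] [ 4 ⨾ 15 ] [ 5 ⨾ 15 ] [ 6 ⨾ 15 ] I)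
    (vanish {[ 2 ⨾ 5 ] ⊛ ⟨ 5 ⟩ ⊛ ⟨ 5 ⟩ ⊛ I} [1⨾5]≈ and vanish {[ 1 ⨾ 15 ] ⊛ [ 4 ⨾ 15 ] ⊛ [ 6 ⨾ 15 ] ⊛ [ 2 ⨾ 5 ] ⊛ ⟨ 5 ⟩ ⊛ I} ⟨5⟩≈ and vanish {[ 2 ⨾ 5 ] ⊛ ⟨ 5 ⟩ ⊛ [ 4 ⨾ 15 ] ⊛ ⟨ 15 ⟩} inv)) (S.sym (S.*-cong (F≈ 2 3 4 ≡.refl) (F≈ 4 11 14 ≡.refl))))
    where open SS

  U/t₂² : ∀ I → [ 2 ⨾ 5 ] ⊛ [ 2 ⨾ 5 ] ⊛ I ≈ 𝟙 → U ⊛ ([ 1 ⨾ 5 ] ⊛ I) ≈ F 1 4 ⊛ (F 4 11 ⊖ X 1 ⊛ F 1 14)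
  U/t₂² I inv = S.trans (S.*-congʳ U≈) (S.trans (from-difference
    (SS.solve 7 (λ t₁ t₂ p q e g i → ( t₁ :* t₂ :* p :* p ) :* (t₁ :* i) :- ( t₁ :* p ) :* ( e :- q :* g ) := (t₁ :* t₂ :* i) :* (t₁ :* p :* p :- (t₂ :* p :* ( e :- q :* g ))) :+ ((t₁ :* p :* ( e :- q :* g )) :* (t₂ :* t₂ :* i :- (con (+ 1))))) S.refl
      [ 1 ⨾ 5 ] [ 2 ⨾ 5 ] ⟨ 5 ⟩ (X 1) (F 4 11) (F 1 14) I)
    (vanish {[ 1 ⨾ 5 ] ⊛ [ 2 ⨾ 5 ] ⊛ I} Q₂ and vanish {[ 1 ⨾ 5 ] ⊛ ⟨ 5 ⟩ ⊛ ( (F 4 11) ⊖ (X 1) ⊛ (F 1 14) )} inv)) (S.*-congʳ (S.sym (F≈ 1 4 4 ≡.refl))))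
    where open SS

  U/s₂s₃s₅s₇ : ∀ I → [ 2 ⨾ 15 ] ⊛ [ 3 ⨾ 15 ] ⊛ [ 5 ⨾ 15 ] ⊛ [ 7 ⨾ 15 ] ⊛ I ≈ 𝟙 → U ⊛ ([ 1 ⨾ 15 ] ⊛ I) ≈ F 1 4 ⊛ F 1 14
  U/s₂s₃s₅s₇ I inv = S.trans (S.*-congʳ U≈) (S.trans (from-difference
    (SS.solve 10 (λ t₁ t₂ p r s₁ s₂ s₃ s₅ s₇ i → ( t₁ :* t₂ :* p :* p ) :* (s₁ :* i) :- ( t₁ :* p ) :* ( s₁ :* r ) := (t₁ :* p :* p :* s₁ :* i) :* (t₂ :- (s₂ :* s₃ :* s₇)) :+ ((t₁ :* p :* s₂ :* s₃ :* s₇ :* s₁ :* i) :* (p :- (s₅ :* r)) :+ ((t₁ :* p :* s₁ :* r) :* (s₂ :* s₃ :* s₅ :* s₇ :* i :- (con (+ 1)))))) S.refl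
      [ 1 ⨾ 5 ] [ 2 ⨾ 5 ] ⟨ 5 ⟩ ⟨ 15 ⟩ [ 1 ⨾ 15 ] [ 2 ⨾ 15 ] [ 3 ⨾ 15 ] [ 5 ⨾ 15 ] [ 7 ⨾ 15 ] I)
    (vanish {[ 1 ⨾ 5 ] ⊛ ⟨ 5 ⟩ ⊛ ⟨ 5 ⟩ ⊛ [ 1 ⨾ 15 ] ⊛ I} [2⨾5]≈ and vanish {[ 1 ⨾ 5 ] ⊛ ⟨ 5 ⟩ ⊛ [ 2 ⨾ 15 ] ⊛ [ 3 ⨾ 15 ] ⊛ [ 7 ⨾ 15 ] ⊛ [ 1 ⨾ 15 ] ⊛ I} ⟨5⟩≈ and vanish {[ 1 ⨾ 5 ] ⊛ ⟨ 5 ⟩ ⊛ [ 1 ⨾ 15 ] ⊛ ⟨ 15 ⟩} inv)) (S.sym (S.*-cong (F≈ 1 4 4 ≡.refl) (F≈ 1 14 14 ≡.refl))))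
    where open SS

-- Identities for a fifth root of unity.

private
  five-times : ∀ j → let n = 1 ℕ.+ j ℕ.* 1 in n ℕ.+ n ℕ.+ n ℕ.+ n ℕ.+ n ≡ 5 ℕ.+ j ℕ.* 5
  five-times = solve 1 (λ j → let n = con 1 :+ j :* con 1 in n :+ n :+ n :+ n :+ n := con 5 :+ j :* con 5) ≡.refl
    where
    open import Data.Nat.Solver
    open +-*-Solver

module Cyclotomic (𝓡 : CoefficientRing) where
  open ThetaQuotients 𝓡 public
  open import Relation.Binary.Reasoning.Setoid S.setoid

  module CyclotomicIdentities (ζ f : R) (Φ≡0 : 1# + ζ + ζ * ζ + ζ * ζ * ζ + ζ * ζ * ζ * ζ ≡ 0#) (5f≡1 : (1# + 1# + 1# + 1# + 1#) * f ≡ 1#) where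
    ζ² ζ³ ζ⁴ w : R
    ζ² = ζ * ζ
    ζ³ = ζ * ζ * ζ
    ζ⁴ = ζ * ζ * ζ * ζ
    w = (1# + - ζ) * (1# + - ζ²) * (ζ + - ζ⁴)

    c k₀ k₁ k₂ k₃ : R
    c = ζ + ζ⁴
    k₀ = ( 1# + 1# + 1# + c ) * f
    k₁ = ( - ( 1# + 1# ) + c ) * f
    k₂ = ( 1# + ( 1# + 1# ) * c ) * f
    k₃ = ( - 1# + - ( ( 1# + 1# ) * c ) ) * f

    -- Coefficients of the residue classes of N and T(ζ²) modulo 5.
    n₀ n₁ n₂ n₃ n₄ x₀ x₁ : R
    n₀ = 1# + ζ
    n₁ = - ( ζ² + ζ⁴ )
    n₂ = ζ³ + ζ³
    n₃ = ζ⁴ + ζ²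
    n₄ = - ( 1# + ζ )
    x₀ = 1# + - ζ²
    x₁ = ζ⁴ + - ζ³

    private
      open RS using (Polynomial; con; var; _:*_; _:+_; _:-_; :-_; _:^_; ⟦_⟧; ⟦_⟧↓; prove)

      0ᵖ 1ᵖ z z² z³ z⁴ φ wᵖ cᵖ k₀ᵖ k₁ᵖ k₂ᵖ k₃ᵖ n₀ᵖ n₁ᵖ n₂ᵖ n₃ᵖ n₄ᵖ x₀ᵖ x₁ᵖ : Polynomial 2
      0ᵖ = con (+ 0)
      1ᵖ = con (+ 1)
      z = var Fin.zero
      z² = z :* z
      z³ = z :* z :* z
      z⁴ = z :* z :* z :* z
      φ = var (Fin.suc Fin.zero)
      wᵖ = (1ᵖ :+ :- z) :* (1ᵖ :+ :- z²) :* (z :+ :- z⁴)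
      cᵖ = z :+ z⁴
      k₀ᵖ = (1ᵖ :+ 1ᵖ :+ 1ᵖ :+ cᵖ) :* φ
      k₁ᵖ = (:- (1ᵖ :+ 1ᵖ) :+ cᵖ) :* φ
      k₂ᵖ = (1ᵖ :+ (1ᵖ :+ 1ᵖ) :* cᵖ) :* φ
      k₃ᵖ = (:- 1ᵖ :+ :- ((1ᵖ :+ 1ᵖ) :* cᵖ)) :* φ
      n₀ᵖ = 1ᵖ :+ z
      n₁ᵖ = :- (z² :+ z⁴)
      n₂ᵖ = z³ :+ z³
      n₃ᵖ = z⁴ :+ z²
      n₄ᵖ = :- (1ᵖ :+ z)
      x₀ᵖ = 1ᵖ :+ :- z²
      x₁ᵖ = z⁴ :+ :- z³

      χᵖ : Polynomial 2 → Polynomial 2 → ℤ → Polynomial 2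
      χᵖ a b n = a :^ tri n :* b :^ tri (ℤ.- n)

      -- The cofactors u and v are found by polynomial division.
      modulo : ∀ x y u v →
        ⟦ x ⟧↓ (ζ ∷ f ∷ []) ≡ ⟦ y :+ ((1ᵖ :+ z :+ z² :+ z³ :+ z⁴) :* u :+ ((1ᵖ :+ 1ᵖ :+ 1ᵖ :+ 1ᵖ :+ 1ᵖ) :* φ :+ :- 1ᵖ) :* v) ⟧↓ (ζ ∷ f ∷ []) →
        ⟦ x ⟧ (ζ ∷ f ∷ []) ≡ ⟦ y ⟧ (ζ ∷ f ∷ [])
      modulo x y u v p = ≡.trans
        (prove ρ x (y :+ ((1ᵖ :+ z :+ z² :+ z³ :+ z⁴) :* u :+ ((1ᵖ :+ 1ᵖ :+ 1ᵖ :+ 1ᵖ :+ 1ᵖ) :* φ :+ :- 1ᵖ) :* v)) p)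
        (≡.trans (R.+-congˡ (cong₂ _+_ (cong (_* ⟦ u ⟧ ρ) Φ≡0) (cong (_* ⟦ v ⟧ ρ) (≡.trans (R.+-congʳ 5f≡1) (R.-‿inverseʳ 1#)))))
          (RS.solve 3 (λ y u v → y :+ (con (+ 0) :* u :+ con (+ 0) :* v) RS.:= y) ≡.refl (⟦ y ⟧ ρ) (⟦ u ⟧ ρ) (⟦ v ⟧ ρ)))
        where
        ρ = ζ ∷ f ∷ []

    ζ-ζ⁴ : ( - ζ ) * ( - ζ⁴ ) ≡ 1#
    ζ-ζ⁴ = modulo ((:- z) :* (:- z⁴)) 1ᵖ
      (:- 1ᵖ :+ z) 0ᵖ ≡.refl

    ζ²-ζ³ : ( - ζ² ) * ( - ζ³ ) ≡ 1#
    ζ²-ζ³ = modulo ((:- z²) :* (:- z³)) 1ᵖ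
      (:- 1ᵖ :+ z) 0ᵖ ≡.refl

    ζζ⁴≡1 : ζ * ζ⁴ ≡ 1#
    ζζ⁴≡1 = modulo (z :* z⁴) 1ᵖ
      (:- 1ᵖ :+ z) 0ᵖ ≡.refl

    fifth-power₁ : (- ζ) ^ 5 ≡ - 1#
    fifth-power₁ = modulo ((:- z) :^ 5) (:- 1ᵖ)
      (1ᵖ :- z) 0ᵖ ≡.refl

    fifth-power₂ : (- ζ²) ^ 5 ≡ - 1#
    fifth-power₂ = modulo ((:- z²) :^ 5) (:- 1ᵖ)
      (1ᵖ :- z :+ z :^ 5 :- z :^ 6) 0ᵖ ≡.refl

    fifth-power₃ : (- ζ³) ^ 5 ≡ - 1#
    fifth-power₃ = modulo ((:- z³) :^ 5) (:- 1ᵖ)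
      (1ᵖ :- z :+ z :^ 5 :- z :^ 6 :+ z :^ 10 :- z :^ 11) 0ᵖ ≡.refl

    fifth-power₄ : (- ζ⁴) ^ 5 ≡ - 1#
    fifth-power₄ = modulo ((:- z⁴) :^ 5) (:- 1ᵖ)
      (1ᵖ :- z :+ z :^ 5 :- z :^ 6 :+ z :^ 10 :- z :^ 11 :+ z :^ 15 :- z :^ 16) 0ᵖ ≡.refl

    -- As `ζ - ζ⁴ = ζ(1 - ζ³)`, the product `ζ⁴ (1 - ζ⁴) w` is that of all `1 - ζ^i` for `i` from 1
    -- to 4, which is the value 5 of the cyclotomic polynomial at 1. The two lemmas that follow
    -- arrange the same product differently.
    w-unit : ζ⁴ * (1# + - ζ⁴) * f * w ≡ 1#
    w-unit = modulo (z⁴ :* (1ᵖ :+ :- z⁴) :* φ :* wᵖ) 1ᵖ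
      (:- con (+ 5) :* φ :+ con (+ 5) :* z :* φ :- con (+ 4) :* z :^ 5 :* φ :+ con (+ 3) :* z :^ 6 :* φ :+ z :^ 8 :* φ :- con (+ 2) :* z :^ 10 :* φ :+ z :^ 11 :* φ) 1ᵖ ≡.refl

    1-ζ-unit : (1# + - ζ²) * (ζ + - ζ⁴) * (ζ⁴ * (1# + - ζ⁴) * f) * (1# + - ζ) ≡ 1#
    1-ζ-unit = modulo ((1ᵖ :+ :- z²) :* (z :+ :- z⁴) :* (z⁴ :* (1ᵖ :+ :- z⁴) :* φ) :* (1ᵖ :+ :- z)) 1ᵖ
      (:- con (+ 5) :* φ :+ con (+ 5) :* z :* φ :- con (+ 4) :* z :^ 5 :* φ :+ con (+ 3) :* z :^ 6 :* φ :+ z :^ 8 :* φ :- con (+ 2) :* z :^ 10 :* φ :+ z :^ 11 :* φ) 1ᵖ ≡.refl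

    1-ζ⁴-unit : ζ⁴ * w * f * (1# + - ζ⁴) ≡ 1#
    1-ζ⁴-unit = modulo (z⁴ :* wᵖ :* φ :* (1ᵖ :+ :- z⁴)) 1ᵖ
      (:- con (+ 5) :* φ :+ con (+ 5) :* z :* φ :- con (+ 4) :* z :^ 5 :* φ :+ con (+ 3) :* z :^ 6 :* φ :+ z :^ 8 :* φ :- con (+ 2) :* z :^ 10 :* φ :+ z :^ 11 :* φ) 1ᵖ ≡.refl

    -- From here to `c₃g`: the coefficient comparisons in `component₀` to `component₃`. The index is
    -- the component, the letter the theta series involved: c, d, e, g, h stand for `F 7 8`,
    -- `F 2 13`, `F 4 11`, `F 1 14`, `F 5 10`.
    c₀c : w * k₀ ≡ n₀ * x₀
    c₀c = modulo (wᵖ :* k₀ᵖ) (n₀ᵖ :* x₀ᵖ)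
      (:- con (+ 5) :* φ :+ con (+ 3) :* z :* φ :+ con (+ 5) :* z :^ 2 :* φ :- con (+ 2) :* z :^ 3 :* φ :- con (+ 2) :* z :^ 4 :* φ :+ con (+ 2) :* z :^ 6 :* φ :- z :^ 7 :* φ) (1ᵖ :+ z :- z :^ 2 :- z :^ 3) ≡.refl

    c₀d : w * ( k₀ + - ( 1# + c ) ) ≡ n₂ * x₀
    c₀d = modulo (wᵖ :* (k₀ᵖ :+ :- (1ᵖ :+ cᵖ))) (n₂ᵖ :* x₀ᵖ)
      (1ᵖ :- con (+ 5) :* φ :- z :+ con (+ 3) :* z :* φ :- z :^ 2 :+ con (+ 5) :* z :^ 2 :* φ :- con (+ 2) :* z :^ 3 :* φ :+ con (+ 2) :* z :^ 4 :- con (+ 2) :* z :^ 4 :* φ :- con (+ 2) :* z :^ 6 :+ con (+ 2) :* z :^ 6 :* φ :+ z :^ 7 :- z :^ 7 :* φ) (1ᵖ :+ z :- z :^ 2 :- z :^ 3) ≡.refl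

    c₁c : w * 1# ≡ n₀ * x₁ + - ( n₂ * x₁ )
    c₁c = modulo (wᵖ :* 1ᵖ) (n₀ᵖ :* x₁ᵖ :+ :- (n₂ᵖ :* x₁ᵖ))
      (z :- con (+ 2) :* z :^ 2 :+ z :^ 3) 0ᵖ ≡.refl

    c₁h : w * k₁ ≡ n₂ * x₁ + n₁ * x₀
    c₁h = modulo (wᵖ :* k₁ᵖ) (n₂ᵖ :* x₁ᵖ :+ n₁ᵖ :* x₀ᵖ)
      (:- z :+ con (+ 3) :* z :* φ :+ con (+ 3) :* z :^ 2 :- con (+ 5) :* z :^ 2 :* φ :- con (+ 2) :* z :^ 3 :+ con (+ 3) :* z :^ 3 :* φ :- con (+ 2) :* z :^ 4 :* φ :+ con (+ 2) :* z :^ 6 :* φ :- z :^ 7 :* φ) (:- z :+ z :^ 2) ≡.refl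

    c₂h : w * k₂ ≡ n₁ * x₁ + - ( n₃ * x₀ )
    c₂h = modulo (wᵖ :* k₂ᵖ) (n₁ᵖ :* x₁ᵖ :+ :- (n₃ᵖ :* x₀ᵖ))
      (1ᵖ :- con (+ 5) :* φ :- z :+ con (+ 6) :* z :* φ :+ z :^ 2 :- con (+ 2) :* z :^ 3 :+ z :^ 3 :* φ :+ z :^ 4 :- con (+ 4) :* z :^ 4 :* φ :+ con (+ 4) :* z :^ 6 :* φ :- con (+ 2) :* z :^ 7 :* φ) (1ᵖ :- z :^ 3) ≡.refl

    c₂e : - ( w * 1# ) ≡ n₃ * x₀ + n₄ * x₀
    c₂e = modulo (:- (wᵖ :* 1ᵖ)) (n₃ᵖ :* x₀ᵖ :+ n₄ᵖ :* x₀ᵖ)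
      (1ᵖ :- z :- z :^ 2 :+ z :^ 3) 0ᵖ ≡.refl

    c₃e : w * k₃ ≡ n₄ * x₁
    c₃e = modulo (wᵖ :* k₃ᵖ) (n₄ᵖ :* x₁ᵖ)
      (:- 1ᵖ :+ con (+ 5) :* φ :+ z :- con (+ 6) :* z :* φ :- z :^ 3 :* φ :+ con (+ 4) :* z :^ 4 :* φ :- con (+ 4) :* z :^ 6 :* φ :+ con (+ 2) :* z :^ 7 :* φ) (:- 1ᵖ :+ z :^ 3) ≡.refl

    c₃g : - ( w * ( k₃ + c ) ) ≡ n₃ * x₁
    c₃g = modulo (:- (wᵖ :* (k₃ᵖ :+ cᵖ))) (n₃ᵖ :* x₁ᵖ)
      (1ᵖ :- con (+ 5) :* φ :- z :+ con (+ 6) :* z :* φ :- z :^ 2 :+ z :^ 3 :+ z :^ 3 :* φ :+ z :^ 4 :- con (+ 4) :* z :^ 4 :* φ :- con (+ 2) :* z :^ 6 :+ con (+ 4) :* z :^ 6 :* φ :+ z :^ 7 :- con (+ 2) :* z :^ 7 :* φ) (1ᵖ :- z :^ 3) ≡.refl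

    χ-n₀ : ζ * χ (- ζ) (- ζ⁴) (+ 0) + χ (- ζ⁴) (- ζ) (+ 0) ≡ n₀
    χ-n₀ = modulo (z :* χᵖ (:- z) (:- z⁴) (+ 0) :+ χᵖ (:- z⁴) (:- z) (+ 0)) n₀ᵖ
      0ᵖ 0ᵖ ≡.refl

    χ-n₁ : ζ * χ (- ζ) (- ζ⁴) (+ 1) + χ (- ζ⁴) (- ζ) (+ 1) ≡ n₁
    χ-n₁ = modulo (z :* χᵖ (:- z) (:- z⁴) (+ 1) :+ χᵖ (:- z⁴) (:- z) (+ 1)) n₁ᵖ
      0ᵖ 0ᵖ ≡.refl

    χ-n₂ : ζ * χ (- ζ) (- ζ⁴) (+ 2) + χ (- ζ⁴) (- ζ) (+ 2) ≡ n₂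
    χ-n₂ = modulo (z :* χᵖ (:- z) (:- z⁴) (+ 2) :+ χᵖ (:- z⁴) (:- z) (+ 2)) n₂ᵖ
      (:- con (+ 2) :* z :^ 3 :+ con (+ 2) :* z :^ 4 :- z :^ 8 :+ z :^ 9) 0ᵖ ≡.refl

    χ-n₃ : ζ * χ (- ζ) (- ζ⁴) (-[1+ 1 ]) + χ (- ζ⁴) (- ζ) (-[1+ 1 ]) ≡ n₃
    χ-n₃ = modulo (z :* χᵖ (:- z) (:- z⁴) (-[1+ 1 ]) :+ χᵖ (:- z⁴) (:- z) (-[1+ 1 ])) n₃ᵖ
      (:- z :^ 2 :+ z :^ 3 :- z :^ 4 :+ z :^ 5 :- z :^ 9 :+ z :^ 10) 0ᵖ ≡.refl

    χ-n₄ : ζ * χ (- ζ) (- ζ⁴) (-[1+ 0 ]) + χ (- ζ⁴) (- ζ) (-[1+ 0 ]) ≡ n₄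
    χ-n₄ = modulo (z :* χᵖ (:- z) (:- z⁴) (-[1+ 0 ]) :+ χᵖ (:- z⁴) (:- z) (-[1+ 0 ])) n₄ᵖ
      (1ᵖ :- z) 0ᵖ ≡.refl

    χ-x₀ : χ (- ζ²) (- ζ³) (+ 0) + χ (- ζ²) (- ζ³) (+ 1) ≡ x₀
    χ-x₀ = modulo (χᵖ (:- z²) (:- z³) (+ 0) :+ χᵖ (:- z²) (:- z³) (+ 1)) x₀ᵖ
      0ᵖ 0ᵖ ≡.refl

    χ-x₁ : χ (- ζ²) (- ζ³) (+ 2) + χ (- ζ²) (- ζ³) (-[1+ 0 ]) ≡ x₁
    χ-x₁ = modulo (χᵖ (:- z²) (:- z³) (+ 2) :+ χᵖ (:- z²) (:- z³) (-[1+ 0 ])) x₁ᵖ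
      (:- z :^ 4 :+ z :^ 5) 0ᵖ ≡.refl

  module Root (ζ f : R) (Φ≡0 : 1# + ζ + ζ * ζ + ζ * ζ * ζ + ζ * ζ * ζ * ζ ≡ 0#) (5f≡1 : (1# + 1# + 1# + 1# + 1#) * f ≡ 1#) where
    open CyclotomicIdentities ζ f Φ≡0 5f≡1 public

    Z Z² Z³ Z⁴ : PS
    Z = const ζ
    Z² = const ζ²
    Z³ = const ζ³
    Z⁴ = const ζ⁴

    const-neg : ∀ a → const (- a) ≈ ⊝ const a
    const-neg a zero = ≡.refl
    const-neg a (suc n) = ≡.sym (-0#≈0#)
      where open import Algebra.Properties.Ring R.ring using (-0#≈0#)

    Z²≈ : Z² ≈ Z ⊛ Z
    Z²≈ = S.sym (const-* ζ ζ)

    Z³≈ : Z³ ≈ Z ⊛ Z ⊛ Z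
    Z³≈ = S.trans (S.sym (const-* ζ² ζ)) (S.*-congʳ Z²≈)

    Z⁴≈ : Z⁴ ≈ Z ⊛ Z ⊛ Z ⊛ Z
    Z⁴≈ = S.trans (S.sym (const-* ζ³ ζ)) (S.*-congʳ Z³≈)

    Φ≈𝟘 : 𝟙 ⊕ Z ⊕ Z ⊛ Z ⊕ Z ⊛ Z ⊛ Z ⊕ Z ⊛ Z ⊛ Z ⊛ Z ≈ 𝟘
    Φ≈𝟘 = S.trans (S.sym (S.trans (const-+ _ ζ⁴) (S.+-cong (S.trans (const-+ _ ζ³) (S.+-cong (S.trans (const-+ _ ζ²)
      (S.+-cong (const-+ 1# ζ) Z²≈)) Z³≈)) Z⁴≈))) (S.trans (const-cong Φ≡0) const-0)

    factor-const : ∀ a b j → factor (- a) b 1 j ≈ 𝟙 ⊖ const a ⊛ X (b ℕ.+ j ℕ.* 1)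
    factor-const a b j = S.+-congˡ {𝟙} (S.trans (mono≈ (- a) (b ℕ.+ j ℕ.* 1)) (S.trans (S.*-congʳ (const-neg a))
      (SS.solve 2 (λ a x → (:- a) :* x := :- (a :* x)) S.refl (const a) (X (b ℕ.+ j ℕ.* 1)))))
      where open SS

    -- (1 - x)(1 - ζx)(1 - ζ²x)(1 - ζ³x)(1 - ζ⁴x) = 1 - x⁵, factor by factor.
    cyclotomic-product : ⟨ 1 ⟩ ⊛ (Poch (- ζ) 1 1 ⊛ (Poch (- ζ⁴) 1 1 ⊛ (Poch (- ζ²) 1 1 ⊛ Poch (- ζ³) 1 1))) ≈ ⟨ 5 ⟩
    cyclotomic-product = S.sym (S.trans (Π∞-cong (λ j → S.sym (termwise j)))
      (S.trans (Π∞-⊛ {fac 1#} {λ j → fac ζ j ⊛ (fac ζ⁴ j ⊛ (fac ζ² j ⊛ fac ζ³ j))} (conv 1#)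
          (Convergent-⊛ {fac ζ} {λ j → fac ζ⁴ j ⊛ (fac ζ² j ⊛ fac ζ³ j)} (conv ζ)
            (Convergent-⊛ {fac ζ⁴} {λ j → fac ζ² j ⊛ fac ζ³ j} (conv ζ⁴) (Convergent-⊛ {fac ζ²} {fac ζ³} (conv ζ²) (conv ζ³)))))
      (S.*-congˡ {⟨ 1 ⟩} (S.trans (Π∞-⊛ {fac ζ} {λ j → fac ζ⁴ j ⊛ (fac ζ² j ⊛ fac ζ³ j)} (conv ζ)
            (Convergent-⊛ {fac ζ⁴} {λ j → fac ζ² j ⊛ fac ζ³ j} (conv ζ⁴) (Convergent-⊛ {fac ζ²} {fac ζ³} (conv ζ²) (conv ζ³))))
      (S.*-congˡ {Poch (- ζ) 1 1} (S.trans (Π∞-⊛ {fac ζ⁴} {λ j → fac ζ² j ⊛ fac ζ³ j} (conv ζ⁴) (Convergent-⊛ {fac ζ²} {fac ζ³} (conv ζ²) (conv ζ³)))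
      (S.*-congˡ {Poch (- ζ⁴) 1 1} (Π∞-⊛ {fac ζ²} {fac ζ³} (conv ζ²) (conv ζ³)))))))))
      where
      fac : R → ℕ → PS
      fac a = factor (- a) 1 1
      conv : ∀ a → Convergent (fac a)
      conv a = factor-convergent (- a) 1 0
      open SS
      termwise : ∀ j → fac 1# j ⊛ (fac ζ j ⊛ (fac ζ⁴ j ⊛ (fac ζ² j ⊛ fac ζ³ j))) ≈ factor (- 1#) 5 5 j
      termwise j = S.trans (S.*-cong (factor-const 1# 1 j) (S.*-cong (factor-const ζ 1 j) (S.*-cong
            (S.trans (factor-const ζ⁴ 1 j) (S.+-congˡ {𝟙} (S.-‿cong (S.*-congʳ Z⁴≈)))) (S.*-cong
            (S.trans (factor-const ζ² 1 j) (S.+-congˡ {𝟙} (S.-‿cong (S.*-congʳ Z²≈))))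
            (S.trans (factor-const ζ³ 1 j) (S.+-congˡ {𝟙} (S.-‿cong (S.*-congʳ Z³≈))))))))
        -- The second summand is a multiple of the cyclotomic polynomial at `z`, with the cofactor
        -- found by polynomial division; it vanishes in the next step.
        (S.trans (SS.solve 2 (λ z e → (con (+ 1) :- con (+ 1) :* e) :* ((con (+ 1) :- z :* e) :* ((con (+ 1) :- z :* z :* z :* z :* e) :* ((con (+ 1) :- z :* z :* e) :* (con (+ 1) :- z :* z :* z :* e))))
            := (con (+ 1) :- e :* e :* e :* e :* e) :+ (con (+ 1) :+ z :+ z :* z :+ z :* z :* z :+ z :* z :* z :* z) :* (con -[1+ 0 ] :* e :+ con (+ 1) :* e :* e :* e :* e :* e :+ con (+ 1) :* z :* e :* e :+ con -[1+ 0 ] :* z :* e :* e :* e :* e :* e :+ con (+ 1) :* z :* z :* z :* e :* e :+ con -[1+ 0 ] :* z :* z :* z :* e :* e :* e :+ con -[1+ 0 ] :* z :* z :* z :* z :* z :* e :* e :* e :+ con (+ 1) :* z :* z :* z :* z :* z :* e :* e :* e :* e :* e :+ con (+ 1) :* z :* z :* z :* z :* z :* z :* e :* e :* e :* e :+ con -[1+ 0 ] :* z :* z :* z :* z :* z :* z :* e :* e :* e :* e :* e)) S.refl Z x)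
        (S.trans (S.+-congˡ (S.trans (S.*-congʳ Φ≈𝟘) (S.zeroˡ _))) (S.trans (S.+-identityʳ _)
          (S.+-congˡ {𝟙} (S.trans (S.-‿cong x⁵) (S.sym (mono-neg (5 ℕ.+ j ℕ.* 5))))))))
        where
        x = X (1 ℕ.+ j ℕ.* 1)
        x⁵ : x ⊛ x ⊛ x ⊛ x ⊛ x ≈ X (5 ℕ.+ j ℕ.* 5)
        x⁵ = S.trans (S.*-congʳ (S.trans (S.*-congʳ (S.trans (S.*-congʳ (X-⊛ n n)) (X-⊛ (n ℕ.+ n) n))) (X-⊛ (n ℕ.+ n ℕ.+ n) n)))
          (S.trans (X-⊛ (n ℕ.+ n ℕ.+ n ℕ.+ n) n) (X-≡ (five-times j)))
          where
          n = 1 ℕ.+ j ℕ.* 1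

    -- T = T(ζ), T⁻ = T(ζ⁻¹), T² = T(ζ²)
    T T⁻ T² : PS
    T = Θ (- ζ) (- ζ⁴) 0 1
    T⁻ = Θ (- ζ⁴) (- ζ) 0 1
    T² = Θ (- ζ²) (- ζ³) 0 1

    private
      T-product : ∀ a b → (- a) * (- b) ≡ 1# → Θ (- a) (- b) 0 1 ≈ (𝟙 ⊖ const a) ⊛ Poch (- a) 1 1 ⊛ Poch (- b) 1 1 ⊛ ⟨ 1 ⟩
      T-product a b ab = S.trans (triple-product (- a) (- b) ab 0 1 0 ≡.refl) (S.*-congʳ (S.*-congʳ
        (S.trans (Poch-head (- a) 0 0) (S.*-congʳ (S.+-congˡ {𝟙} (const-neg a))))))

      -ζ⁴-ζ : (- ζ⁴) * (- ζ) ≡ 1#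
      -ζ⁴-ζ = ≡.trans (R.*-comm _ _) ζ-ζ⁴

      ZZ⁴≈𝟙 : Z ⊛ Z⁴ ≈ 𝟙
      ZZ⁴≈𝟙 = S.trans (const-* ζ ζ⁴) (const-cong ζζ⁴≡1)

    T-reflect : T ≈ ⊝ (Z ⊛ T⁻)
    T-reflect = S.trans (T-product ζ ζ⁴ ζ-ζ⁴) (S.trans (from-difference
        (solve 5 (λ z y p p′ q → (con (+ 1) :- z) :* p :* p′ :* q :- (:- (z :* ((con (+ 1) :- y) :* p′ :* p :* q))) := (:- (p :* p′ :* q)) :* (z :* y :- con (+ 1)))
          S.refl Z Z⁴ (Poch (- ζ) 1 1) (Poch (- ζ⁴) 1 1) ⟨ 1 ⟩) (vanish {⊝ (Poch (- ζ) 1 1 ⊛ Poch (- ζ⁴) 1 1 ⊛ ⟨ 1 ⟩)} ZZ⁴≈𝟙))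
      (S.-‿cong (S.*-congˡ {Z} (S.sym (T-product ζ⁴ ζ -ζ⁴-ζ)))))
      where open SS

    T⊛T² : T ⊛ T² ≈ (𝟙 ⊖ Z) ⊛ (𝟙 ⊖ Z²) ⊛ (⟨ 1 ⟩ ⊛ ⟨ 5 ⟩)
    T⊛T² = S.trans (S.*-cong (T-product ζ ζ⁴ ζ-ζ⁴) (T-product ζ² ζ³ ζ²-ζ³)) (S.trans
      (solve 7 (λ z z′ p₁ p₄ p₂ p₃ q → (z :* p₁ :* p₄ :* q) :* (z′ :* p₂ :* p₃ :* q) := z :* z′ :* (q :* (q :* (p₁ :* (p₄ :* (p₂ :* p₃)))))) S.refl
        (𝟙 ⊖ Z) (𝟙 ⊖ Z²) (Poch (- ζ) 1 1) (Poch (- ζ⁴) 1 1) (Poch (- ζ²) 1 1) (Poch (- ζ³) 1 1) ⟨ 1 ⟩)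
      (S.*-congˡ {(𝟙 ⊖ Z) ⊛ (𝟙 ⊖ Z²)} (S.*-congˡ {⟨ 1 ⟩} cyclotomic-product)))
      where open SS

    N : PS
    N = Z ⊛ Θ (- ζ) (- ζ⁴) 1 2 ⊕ Θ (- ζ⁴) (- ζ) 1 2

    dissect-N : N ≈ const n₀ ⊛ D (F 7 8) ⊕ const n₁ ⊛ (X 1 ⊛ D (F 5 10)) ⊕ const n₂ ⊛ (X 5 ⊛ D (F 2 13))
      ⊕ const n₃ ⊛ (X 7 ⊛ D (F 1 14)) ⊕ const n₄ ⊛ (X 2 ⊛ D (F 4 11))
    dissect-N = S.trans (S.+-cong (S.*-congˡ {Z} (P.dissect-1-2)) M.dissect-1-2)
      (S.trans (solve 11 (λ z a a′ b b′ c c′ d d′ e e′ → z :* (a :+ (b :+ (c :+ (d :+ e)))) :+ (a′ :+ (b′ :+ (c′ :+ (d′ :+ e′))))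
          := (z :* a :+ a′) :+ (z :* b :+ b′) :+ (z :* c :+ c′) :+ (z :* d :+ d′) :+ (z :* e :+ e′)) S.refl Z
          (mono (χ (- ζ) (- ζ⁴) (+ 0)) 0 ⊛ D (F 7 8)) (mono (χ (- ζ⁴) (- ζ) (+ 0)) 0 ⊛ D (F 7 8))
          (mono (χ (- ζ) (- ζ⁴) (+ 1)) 1 ⊛ D (F 10 5)) (mono (χ (- ζ⁴) (- ζ) (+ 1)) 1 ⊛ D (F 10 5))
          (mono (χ (- ζ) (- ζ⁴) (+ 2)) 5 ⊛ D (F 13 2)) (mono (χ (- ζ⁴) (- ζ) (+ 2)) 5 ⊛ D (F 13 2))
          (mono (χ (- ζ) (- ζ⁴) (-[1+ 1 ])) 7 ⊛ D (F 1 14)) (mono (χ (- ζ⁴) (- ζ) (-[1+ 1 ])) 7 ⊛ D (F 1 14))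
          (mono (χ (- ζ) (- ζ⁴) (-[1+ 0 ])) 2 ⊛ D (F 4 11)) (mono (χ (- ζ⁴) (- ζ) (-[1+ 0 ])) 2 ⊛ D (F 4 11)))
      (S.+-cong (S.+-cong (S.+-cong (S.+-cong
        (S.trans (class (+ 0) 0 (D (F 7 8)) χ-n₀) (S.*-congˡ {const n₀} (S.*-identityˡ (D (F 7 8)))))
        (S.trans (class (+ 1) 1 (D (F 10 5)) χ-n₁) (S.*-congˡ {const n₁} (S.*-congˡ {X 1} (D-cong (F-sym 10 5 (s≤s z≤n) (s≤s z≤n)))))))
        (S.trans (class (+ 2) 5 (D (F 13 2)) χ-n₂) (S.*-congˡ {const n₂} (S.*-congˡ {X 5} (D-cong (F-sym 13 2 (s≤s z≤n) (s≤s z≤n)))))))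
        (class -[1+ 1 ] 7 (D (F 1 14)) χ-n₃))
        (class -[1+ 0 ] 2 (D (F 4 11)) χ-n₄)))
      where
      open SS
      module P = FifthRoots (- ζ) (- ζ⁴) ζ-ζ⁴ fifth-power₁ fifth-power₄
      module M = FifthRoots (- ζ⁴) (- ζ) -ζ⁴-ζ fifth-power₄ fifth-power₁
      class : ∀ r s G {n} → ζ * χ (- ζ) (- ζ⁴) r + χ (- ζ⁴) (- ζ) r ≡ n →
        Z ⊛ (mono (χ (- ζ) (- ζ⁴) r) s ⊛ G) ⊕ mono (χ (- ζ⁴) (- ζ) r) s ⊛ G ≈ const n ⊛ (X s ⊛ G)
      class r s G {n} eq = S.trans (S.+-cong (S.*-congˡ {Z} (S.*-congʳ (mono≈ _ s))) (S.*-congʳ (mono≈ _ s)))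
        (S.trans (solve 5 (λ z a b x g → z :* (a :* x :* g) :+ b :* x :* g := (z :* a :+ b) :* (x :* g)) S.refl
            Z (const (χ (- ζ) (- ζ⁴) r)) (const (χ (- ζ⁴) (- ζ) r)) (X s) G)
          (S.*-congʳ (S.trans (S.+-congʳ (const-* ζ _)) (S.trans (S.sym (const-+ _ _)) (const-cong eq)))))

    -- The class -2 is a multiple of `F 0 5`, which contains the factor `1 - q^0`. By the symmetry
    -- of `F` the other four merge in pairs.
    dissect-T² : T² ≈ const x₀ ⊛ D (F 2 3) ⊕ const x₁ ⊛ (X 1 ⊛ D (F 1 4))
    dissect-T² = S.trans (FifthRoots.dissect-0-1 (- ζ²) (- ζ³) ζ²-ζ³ fifth-power₂ fifth-power₃)
      (S.trans (S.+-cong (term (+ 0) 0 S.refl) (S.+-cong (term (+ 1) 0 (F-sym 3 2 (s≤s z≤n) (s≤s z≤n)))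
          (S.+-cong (term (+ 2) 1 (F-sym 4 1 (s≤s z≤n) (s≤s z≤n))) (S.+-cong
            (S.trans (S.*-congˡ {mono (χ (- ζ²) (- ζ³) -[1+ 1 ]) 3} (S.trans (D-cong F05) D-𝟘)) (S.zeroʳ _)) (term -[1+ 0 ] 1 S.refl)))))
      (S.trans (solve 8 (λ a b c d u v x y → a :* (x :* u) :+ (b :* (x :* u) :+ (c :* (y :* v) :+ (con (+ 0) :+ d :* (y :* v)))) := (a :+ b) :* (x :* u) :+ (c :+ d) :* (y :* v)) S.refl
          (const (χ (- ζ²) (- ζ³) (+ 0))) (const (χ (- ζ²) (- ζ³) (+ 1))) (const (χ (- ζ²) (- ζ³) (+ 2))) (const (χ (- ζ²) (- ζ³) -[1+ 0 ]))
          (D (F 2 3)) (D (F 1 4)) 𝟙 (X 1))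
        (S.+-cong (S.*-cong (S.trans (S.sym (const-+ _ _)) (const-cong χ-x₀)) (S.*-identityˡ _))
          (S.*-congʳ (S.trans (S.sym (const-+ _ _)) (const-cong χ-x₁))))))
      where
      open SS
      term : ∀ r s {G G′} → G ≈ G′ → mono (χ (- ζ²) (- ζ³) r) s ⊛ D G ≈ const (χ (- ζ²) (- ζ³) r) ⊛ (X s ⊛ D G′)
      term r s p = S.trans (S.*-cong (mono≈ _ s) (D-cong p)) (S.*-assoc _ _ _)
      F05 : F 0 5 ≈ 𝟘
      F05 = S.trans (F≈ 0 5 4 ≡.refl) (S.trans (S.*-congʳ (S.trans (S.*-congʳ (S.trans (Poch-head (- 1#) 0 4)
        (S.trans (S.*-congʳ (S.trans (S.+-congˡ {𝟙} (mono-neg 0)) (S.-‿inverseʳ 𝟙))) (S.zeroˡ _)))) (S.zeroˡ _))) (S.zeroˡ _))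

-- The Lambert series and their partial fractions.

exactᵉ : ∀ {d p x} → Twice d p → p ≡ + 2 ℤ.* x → + d ≡ x
exactᵉ {d} {p} {x} (twice t) eq = ℤP.*-cancelˡ-≡ (+ 2) (+ d) x (≡.trans t eq)

exponent₁ exponent₂ : ℤ → ℤ
exponent₁ n = + 3 ℤ.* n ℤ.* n ℤ.+ n
exponent₂ n = + 3 ℤ.* n ℤ.* n ℤ.+ + 7 ℤ.* n ℤ.+ + 2

LambertExponent : ℕ → ℤ → Set
LambertExponent d k = + d ≡ + 3 ℤ.* k ℤ.* k ℤ.- + 2 ℤ.* k

module LambertExponents {d k} (d≡ : LambertExponent d k) where
  open import Data.Integer.Solver
  open +-*-Solver

  first-exponent : exponent₁ k ≡ + d ℤ.+ + 3 ℤ.* k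
  first-exponent = ≡.trans (solve 1 (λ k → con (+ 3) :* k :* k :+ k := (con (+ 3) :* k :* k :- con (+ 2) :* k) :+ con (+ 3) :* k) ≡.refl k)
    (cong (ℤ._+ + 3 ℤ.* k) (≡.sym d≡))

  -- Shifting the second sum by one gives both series the common prefactor `q^{k(3k-2)}`. The index
  -- becomes `3k - 2`, which `reflected-index` turns into `2 - 3k`.
  second-exponent : exponent₂ (k ℤ.- + 1) ≡ + d ℤ.+ (+ 3 ℤ.* (k ℤ.- + 1) ℤ.+ + 1)
  second-exponent = ≡.trans (solve 1 (λ k → con (+ 3) :* (k :- con (+ 1)) :* (k :- con (+ 1)) :+ con (+ 7) :* (k :- con (+ 1)) :+ con (+ 2)
      := (con (+ 3) :* k :* k :- con (+ 2) :* k) :+ (con (+ 3) :* (k :- con (+ 1)) :+ con (+ 1))) ≡.refl k)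
    (cong (ℤ._+ (+ 3 ℤ.* (k ℤ.- + 1) ℤ.+ + 1)) (≡.sym d≡))

  reflected-index : ℤ.- (+ 3 ℤ.* (k ℤ.- + 1) ℤ.+ + 1) ≡ + 2 ℤ.- + 3 ℤ.* k
  reflected-index = solve 1 (λ k → :- (con (+ 3) :* (k :- con (+ 1)) :+ con (+ 1)) := con (+ 2) :- con (+ 3) :* k) ≡.refl k

module LambertSeries (𝓡 : CoefficientRing) where
  open Cyclotomic 𝓡 public
  open import Relation.Binary.Reasoning.Setoid S.setoid

  -- G n = 1/(1 - ζ q^n), n ∈ ℤ, cleared of negative powers.
  Geometric : R → (ℤ → PS) → Set
  Geometric ζ G = ∀ a b n → + a ≡ + b ℤ.+ n → (X b ⊖ const ζ ⊛ X a) ⊛ G n ≈ X b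

  -- A cleared form of `1 - ζ q^n` that can be cancelled. Its constant term is `1 - ζ` at `n = 0`, 1
  -- for positive `n` and `-ζ` for negative `n`.
  record Denominator (ζ : R) (n : ℤ) : Set where
    constructor denominator
    field
      a b : ℕ
      a≡b+n : + a ≡ + b ℤ.+ n
      inverse : R
      unit : inverse * (X b ⊖ const ζ ⊛ X a) 0 ≡ 1#

  module _ (ζ ζ⁻ u u⁻ : R) (ζζ⁻≡1 : ζ * ζ⁻ ≡ 1#) (1-ζ : u * (1# + - ζ) ≡ 1#) (1-ζ⁻ : u⁻ * (1# + - ζ⁻) ≡ 1#) where

    denominators : ∀ n → Denominator ζ n
    denominators (+ zero) = denominator 0 0 ≡.refl u (≡.trans (cong (λ x → u * (1# + - x)) (R.*-identityʳ ζ)) 1-ζ)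
    denominators (+ suc n) = denominator (suc n) 0 ≡.refl 1#
      (solve 1 (λ z → con (+ 1) :* (con (+ 1) :+ :- (z :* con (+ 0))) := con (+ 1)) ≡.refl ζ)
      where open RS
    denominators -[1+ n ] = denominator 0 (suc n) (≡.sym (ℤP.+-inverseʳ (+ suc n))) (- ζ⁻)
      (≡.trans (solve 2 (λ z y → (:- y) :* (con (+ 0) :+ :- (z :* con (+ 1))) := z :* y) ≡.refl ζ ζ⁻) ζζ⁻≡1)
      where open RS

    module _ {G H : ℤ → PS} (G-spec : Geometric ζ G) (H-spec : Geometric ζ⁻ H) where
      open SS
      private
        Z Z⁻ : PS
        Z = const ζ
        Z⁻ = const ζ⁻

        ZZ⁻≈𝟙 : Z ⊛ Z⁻ ≈ 𝟙
        ZZ⁻≈𝟙 = S.trans (const-* ζ ζ⁻) (const-cong ζζ⁻≡1)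

      reflection : ∀ n → G (ℤ.- n) ⊕ H n ≈ 𝟙
      reflection n = let denominator a b eq v unit = denominators (ℤ.- n) in
        unit-cancel {X b ⊖ Z ⊛ X a} v unit (from-difference
          (solve 6 (λ x y z z′ g h → (y :- z :* x) :* (g :+ h) :- (y :- z :* x) :* con (+ 1)
              := con (+ 1) :* ((y :- z :* x) :* g :- y) :+ ((:- z) :* ((x :- z′ :* y) :* h :- x) :+ (:- (y :* h)) :* (z :* z′ :- con (+ 1))))
            S.refl (X a) (X b) Z Z⁻ (G (ℤ.- n)) (H n))
          (vanish {𝟙} (G-spec a b (ℤ.- n) eq) and vanish {⊝ Z} (H-spec b a n (flip a b eq)) and vanish {⊝ (X b ⊛ H n)} ZZ⁻≈𝟙))
        where
        flip : ∀ a b → + a ≡ + b ℤ.- n → + b ≡ + a ℤ.+ n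
        flip a b eq = ≡.trans (ℤS.solve 2 (λ b n → b ℤS.:= b ℤS.:- n ℤS.:+ n) ≡.refl (+ b) n) (cong (ℤ._+ n) (≡.sym eq))

      difference : ∀ a b n → + a ≡ + b ℤ.+ n → X b ⊛ (G n ⊖ H n) ≈ (Z ⊖ Z⁻) ⊛ X a ⊛ (G n ⊛ H n)
      difference a b n eq = from-difference
        (solve 6 (λ x y z z′ g h → y :* (g :- h) :- (z :- z′) :* x :* (g :* h)
            := (:- g) :* ((y :- z′ :* x) :* h :- y) :+ h :* ((y :- z :* x) :* g :- y)) S.refl (X a) (X b) Z Z⁻ (G n) (H n))
        (vanish {⊝ G n} (H-spec a b n eq) and vanish {H n} (G-spec a b n eq))

      -- Here `t` stands for `q^s G(n) H(n)`, given only through cleared equations because `s` may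
      -- be negative. As `G(n) - H(n) = (ζ - ζ⁻¹) q^n G(n) H(n)`, a factor `q^n` of `q^s` is used up
      -- and `q^d` remains.
      partial-fractions : ∀ n s d {t} → s ≡ + d ℤ.+ n → (∀ a b → + a ≡ + b ℤ.+ s → X a ⊛ (G n ⊛ H n) ≈ X b ⊛ t) →
        (Z ⊖ Z⁻) ⊛ t ≈ X d ⊛ (G n ⊖ H n)
      partial-fractions n s d {t} s≡ t-spec = let denominator a b eq _ _ = denominators n in X-cancel b (begin
        X b ⊛ ((Z ⊖ Z⁻) ⊛ t)                       ≈⟨ solve 3 (λ x w t → x :* (w :* t) := w :* (x :* t)) S.refl (X b) (Z ⊖ Z⁻) t ⟩
        (Z ⊖ Z⁻) ⊛ (X b ⊛ t)                       ≈⟨ S.*-congˡ {Z ⊖ Z⁻} (t-spec (a ℕ.+ d) b (exponents a b eq)) ⟨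
        (Z ⊖ Z⁻) ⊛ (X (a ℕ.+ d) ⊛ (G n ⊛ H n))     ≈⟨ S.*-congˡ {Z ⊖ Z⁻} (S.*-congʳ (X-⊛ a d)) ⟨
        (Z ⊖ Z⁻) ⊛ (X a ⊛ X d ⊛ (G n ⊛ H n))       ≈⟨ solve 4 (λ w a d g → w :* (a :* d :* g) := d :* (w :* a :* g)) S.refl (Z ⊖ Z⁻) (X a) (X d) (G n ⊛ H n) ⟩
        X d ⊛ ((Z ⊖ Z⁻) ⊛ X a ⊛ (G n ⊛ H n))       ≈⟨ S.*-congˡ {X d} (difference a b n eq) ⟨
        X d ⊛ (X b ⊛ (G n ⊖ H n))                  ≈⟨ solve 3 (λ d b g → d :* (b :* g) := b :* (d :* g)) S.refl (X d) (X b) (G n ⊖ H n) ⟩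
        X b ⊛ (X d ⊛ (G n ⊖ H n))                  ∎)
        where
        exponents : ∀ a b → + a ≡ + b ℤ.+ n → + (a ℕ.+ d) ≡ + b ℤ.+ s
        exponents a b eq = ≡.trans (cong (ℤ._+ + d) eq) (≡.trans
          (ℤS.solve 3 (λ b n d → b ℤS.:+ n ℤS.:+ d ℤS.:= b ℤS.:+ (d ℤS.:+ n)) ≡.refl (+ b) n (+ d)) (cong (λ x → + b ℤ.+ x) (≡.sym s≡)))

    quotient≈ : ∀ {G} (αβ≡1 : (- ζ) * (- ζ⁻) ≡ 1#) → Geometric ζ G → ∀ n →
      PolarSum.quotient (- ζ) (- ζ⁻) αβ≡1 n ≈ Θ (- ζ) (- ζ⁻) 0 1 ⊛ G n
    quotient≈ {G} αβ≡1 G-spec n = let denominator a b eq v unit = denominators n in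
      unit-cancel {X b ⊖ const ζ ⊛ X a} v unit (begin
        (X b ⊖ const ζ ⊛ X a) ⊛ quotient n
          ≈⟨ S.*-congʳ (S.+-congˡ {X b} (S.trans (S.*-congʳ (negate ζ)) (SS.solve 2 (λ z x → (:- z) :* x := :- (z :* x)) S.refl (const ζ) (X a)))) ⟨
        (X b ⊕ const (- ζ) ⊛ X a) ⊛ quotient n          ≈⟨ quotient-spec a b n eq ⟩
        X b ⊛ Θ (- ζ) (- ζ⁻) 0 1                        ≈⟨ S.*-congʳ (G-spec a b n eq) ⟨
        (X b ⊖ const ζ ⊛ X a) ⊛ G n ⊛ Θ (- ζ) (- ζ⁻) 0 1 ≈⟨ SS.solve 3 (λ x g t → x :* g :* t := x :* (t :* g)) S.refl (X b ⊖ const ζ ⊛ X a) (G n) (Θ (- ζ) (- ζ⁻) 0 1) ⟩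
        (X b ⊖ const ζ ⊛ X a) ⊛ (Θ (- ζ) (- ζ⁻) 0 1 ⊛ G n) ∎)
      where
      open SS
      open PolarSum (- ζ) (- ζ⁻) αβ≡1 using (quotient; quotient-spec)
      negate : ∀ a → const (- a) ≈ ⊝ const a
      negate a zero = ≡.refl
      negate a (suc n) = ≡.sym -0#≈0#
        where open import Algebra.Properties.Ring R.ring using (-0#≈0#)

  module Evaluation (ζ f : R) (Φ≡0 : 1# + ζ + ζ * ζ + ζ * ζ * ζ + ζ * ζ * ζ * ζ ≡ 0#) (5f≡1 : (1# + 1# + 1# + 1# + 1#) * f ≡ 1#) where
    open Root ζ f Φ≡0 5f≡1 public

    module _ (G H : ℤ → PS) (G-spec : Geometric ζ G) (H-spec : Geometric ζ⁴ H)
      (t₁ t₂ : ℤ → PS)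
      (t₁-spec : ∀ n a b → + a ≡ + b ℤ.+ exponent₁ n → X a ⊛ (G (+ 3 ℤ.* n) ⊛ H (+ 3 ℤ.* n)) ≈ X b ⊛ t₁ n)
      (t₂-spec : ∀ n a b → + a ≡ + b ℤ.+ exponent₂ n → X a ⊛ (G (+ 3 ℤ.* n ℤ.+ + 1) ⊛ H (+ 3 ℤ.* n ℤ.+ + 1)) ≈ X b ⊛ t₂ n)
      (S₁ S₂ : PS) (hasSum₁ : HasSum t₁ S₁) (hasSum₂ : HasSum t₂ S₂) where
      open SS
      private
        u u⁻ : R
        u = (1# + - ζ²) * (ζ + - ζ⁴) * (ζ⁴ * (1# + - ζ⁴) * f)
        u⁻ = ζ⁴ * w * f
        ζ⁴ζ≡1 : ζ⁴ * ζ ≡ 1#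
        ζ⁴ζ≡1 = ≡.trans (R.*-comm ζ⁴ ζ) ζζ⁴≡1
        -ζ⁴-ζ : (- ζ⁴) * (- ζ) ≡ 1#
        -ζ⁴-ζ = ≡.trans (R.*-comm _ _) ζ-ζ⁴

        module A = PolarSum (- ζ) (- ζ⁴) ζ-ζ⁴
        module A⁻ = PolarSum (- ζ⁴) (- ζ) -ζ⁴-ζ

        G-polar : ∀ n → A.quotient n ≈ T ⊛ G n
        G-polar = quotient≈ ζ ζ⁴ u u⁻ ζζ⁴≡1 1-ζ-unit 1-ζ⁴-unit ζ-ζ⁴ G-spec

        H-polar : ∀ n → A⁻.quotient n ≈ T⁻ ⊛ H n
        H-polar = quotient≈ ζ⁴ ζ u⁻ u ζ⁴ζ≡1 1-ζ⁴-unit 1-ζ-unit -ζ⁴-ζ H-spec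

        -- Both reflections together: `G(-n) = 1 - H(n)` and `H(-n) = 1 - G(n)`. It lets the second
        -- series be read at the index `2 - 3k` at which `polar` is built.
        odd-difference : ∀ n → G (ℤ.- n) ⊖ H (ℤ.- n) ≈ G n ⊖ H n
        odd-difference n = from-difference
          (solve 4 (λ g g′ h h′ → (g′ :- h′) :- (g :- h) := con (+ 1) :* ((g′ :+ h) :- con (+ 1)) :+ (:- con (+ 1)) :* ((h′ :+ g) :- con (+ 1)))
            S.refl (G n) (G (ℤ.- n)) (H n) (H (ℤ.- n)))
          (vanish {𝟙} (reflection ζ ζ⁴ u u⁻ ζζ⁴≡1 1-ζ-unit 1-ζ⁴-unit G-spec H-spec n)
            and vanish {⊝ 𝟙} (reflection ζ⁴ ζ u⁻ u ζ⁴ζ≡1 1-ζ⁴-unit 1-ζ-unit H-spec G-spec n))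

        fractions = partial-fractions ζ ζ⁴ u u⁻ ζζ⁴≡1 1-ζ-unit 1-ζ⁴-unit G-spec H-spec

        e≡ : ∀ k → LambertExponent (e k) k
        e≡ k = exactᵉ (θexpᵉ 1 5 k) (ℤS.solve 1 (λ k → ℤS.con (+ 1) ℤS.:* (k ℤS.:* (k ℤS.:+ ℤS.con (+ 1))) ℤS.:+ ℤS.con (+ 5) ℤS.:* ((ℤS.:- k) ℤS.:* (ℤS.:- k ℤS.:+ ℤS.con (+ 1)))
          ℤS.:= ℤS.con (+ 2) ℤS.:* (ℤS.con (+ 3) ℤS.:* k ℤS.:* k ℤS.:- ℤS.con (+ 2) ℤS.:* k)) ≡.refl k)

        first : ∀ k → (Z ⊖ Z⁴) ⊛ t₁ k ≈ X (e k) ⊛ (G (+ 3 ℤ.* k) ⊖ H (+ 3 ℤ.* k))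
        first k = fractions (+ 3 ℤ.* k) (exponent₁ k) (e k) (LambertExponents.first-exponent {e k} {k} (e≡ k)) (t₁-spec k)

        second : ∀ k → (Z ⊖ Z⁴) ⊛ t₂ (k ℤ.- + 1) ≈ X (e k) ⊛ (G (+ 2 ℤ.- + 3 ℤ.* k) ⊖ H (+ 2 ℤ.- + 3 ℤ.* k))
        second k = S.trans (fractions n (exponent₂ (k ℤ.- + 1)) (e k) (LambertExponents.second-exponent {e k} {k} (e≡ k)) (t₂-spec (k ℤ.- + 1)))
          (S.*-congˡ {X (e k)} (S.trans (S.sym (odd-difference n)) (λ m → cong (λ i → (G i ⊖ H i) m)
            (LambertExponents.reflected-index {e k} {k} (e≡ k)))))
          where
          n = + 3 ℤ.* (k ℤ.- + 1) ℤ.+ + 1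

        -- Multiplied by `T`, the fractions with `ζ` are quotients of `T`. Those with `ζ⁻¹` need
        -- `T⁻`, and `T-reflect` supplies it, which is the origin of the factor `Z` beside the
        -- second polar sum.
        polar-term : ∀ k → T ⊛ ((Z ⊖ Z⁴) ⊛ (t₁ k ⊖ t₂ (k ℤ.- + 1))) ≈ A.polar k ⊕ Z ⊛ A⁻.polar k
        polar-term k = begin
          T ⊛ ((Z ⊖ Z⁴) ⊛ (t₁ k ⊖ t₂ (k ℤ.- + 1)))
            ≈⟨ S.*-congˡ {T} (S.trans (solve 3 (λ w x y → w :* (x :- y) := w :* x :- w :* y) S.refl (Z ⊖ Z⁴) (t₁ k) (t₂ (k ℤ.- + 1)))
                 (S.+-cong (first k) (S.-‿cong (second k)))) ⟩
          T ⊛ (X (e k) ⊛ (G i ⊖ H i) ⊖ X (e k) ⊛ (G j ⊖ H j))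
            ≈⟨ solve 6 (λ t x g h g′ h′ → t :* (x :* (g :- h) :- x :* (g′ :- h′)) := x :* (t :* g :- t :* g′) :- x :* (t :* h :- t :* h′)) S.refl
                 T (X (e k)) (G i) (H i) (G j) (H j) ⟩
          X (e k) ⊛ (T ⊛ G i ⊖ T ⊛ G j) ⊖ X (e k) ⊛ (T ⊛ H i ⊖ T ⊛ H j)
            ≈⟨ S.+-cong (S.*-congˡ {X (e k)} (S.+-cong (S.sym (G-polar i)) (S.-‿cong (S.sym (G-polar j)))))
                 (S.-‿cong (S.*-congˡ {X (e k)} (S.+-cong (S.*-congʳ T-reflect) (S.-‿cong (S.*-congʳ T-reflect))))) ⟩
          A.polar k ⊖ X (e k) ⊛ (⊝ (Z ⊛ T⁻) ⊛ H i ⊖ ⊝ (Z ⊛ T⁻) ⊛ H j)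
            ≈⟨ S.+-congˡ {A.polar k} (solve 5 (λ x z t h h′ → :- (x :* ((:- (z :* t)) :* h :- (:- (z :* t)) :* h′)) := z :* (x :* (t :* h :- t :* h′))) S.refl
                 (X (e k)) Z T⁻ (H i) (H j)) ⟩
          A.polar k ⊕ Z ⊛ (X (e k) ⊛ (T⁻ ⊛ H i ⊖ T⁻ ⊛ H j))
            ≈⟨ S.+-congˡ {A.polar k} (S.*-congˡ {Z} (S.*-congˡ {X (e k)} (S.+-cong (H-polar i) (S.-‿cong (H-polar j))))) ⟨
          A.polar k ⊕ Z ⊛ A⁻.polar k ∎
          where
          i = + 3 ℤ.* k
          j = + 2 ℤ.- + 3 ℤ.* k

      numerator : T ⊛ ((Z ⊖ Z⁴) ⊛ (S₁ ⊖ S₂)) ≈ ⟨ 1 ⟩ ⊛ ⟨ 1 ⟩ ⊛ N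
      numerator = S.trans (hasSum-unique
          (hasSum-⊛ˡ T (hasSum-⊛ˡ (Z ⊖ Z⁴) (hasSum-⊖ hasSum₁ (hasSum-unshift hasSum₂))))
          (hasSum-cong (λ k → S.sym (polar-term k)) S.refl (hasSum-⊕ A.hasSum-polar (hasSum-⊛ˡ Z A⁻.hasSum-polar))))
        (S.trans (S.+-cong (S.*-cong (const-neg ζ) (S.*-congʳ E-1)) (S.*-congˡ {Z} (S.*-cong (const-neg ζ⁴) (S.*-congʳ E-1))))
        (from-difference
          (solve 5 (λ z z′ q p m → ((:- z) :* ((:- (q :* q)) :* p) :+ z :* ((:- z′) :* ((:- (q :* q)) :* m))) :- q :* q :* (z :* p :+ m)
            := (q :* q :* m) :* (z :* z′ :- con (+ 1))) S.refl Z Z⁴ ⟨ 1 ⟩ (Θ (- ζ) (- ζ⁴) 1 2) (Θ (- ζ⁴) (- ζ) 1 2))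
          (vanish {⟨ 1 ⟩ ⊛ ⟨ 1 ⟩ ⊛ Θ (- ζ⁴) (- ζ) 1 2} (S.trans (const-* ζ ζ⁴) (const-cong ζζ⁴≡1)))))

      W : PS
      W = (𝟙 ⊖ Z) ⊛ (𝟙 ⊖ Z²) ⊛ (Z ⊖ Z⁴)

      -- Multiplying by `T²` turns `T` into a constant times `⟨ 1 ⟩ ⊛ ⟨ 5 ⟩`. The powers of `⟨ 1 ⟩`
      -- then cancel against `I₀`, and only `⟨ 5 ⟩`, a series in `q^5`, stays beside the left-hand
      -- side.
      product-of-thetas : ∀ I₀ → ⟨ 1 ⟩ ⊛ I₀ ≈ 𝟙 → W ⊛ ⟨ 5 ⟩ ⊛ (I₀ ⊛ (S₁ ⊖ S₂)) ≈ N ⊛ T²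
      product-of-thetas I₀ inv = from-difference
        (solve 10 (λ z z² z⁴ q p i d n t t′ →
            (con (+ 1) :- z) :* (con (+ 1) :- z²) :* (z :- z⁴) :* p :* (i :* d) :- n :* t′
            := (:- ((con (+ 1) :- z) :* (con (+ 1) :- z²) :* (z :- z⁴) :* p :* (i :* d)) :+ n :* t′ :* (q :* i :+ con (+ 1))) :* (q :* i :- con (+ 1))
              :+ ((:- (i :* i :* ((z :- z⁴) :* d))) :* (t :* t′ :- (con (+ 1) :- z) :* (con (+ 1) :- z²) :* (q :* p))
              :+ (i :* i :* t′) :* (t :* ((z :- z⁴) :* d) :- q :* q :* n)))
          S.refl Z Z² Z⁴ ⟨ 1 ⟩ ⟨ 5 ⟩ I₀ (S₁ ⊖ S₂) N T T²)
        (vanish {⊝ (W ⊛ ⟨ 5 ⟩ ⊛ (I₀ ⊛ (S₁ ⊖ S₂))) ⊕ N ⊛ T² ⊛ (⟨ 1 ⟩ ⊛ I₀ ⊕ 𝟙)} inv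
          and vanish {⊝ (I₀ ⊛ I₀ ⊛ ((Z ⊖ Z⁴) ⊛ (S₁ ⊖ S₂)))} T⊛T²
          and vanish {I₀ ⊛ I₀ ⊛ T²} numerator)

-- Comparison of the residue classes modulo 5.

module Components (𝓡 : CoefficientRing) where
  open LambertSeries 𝓡 public
  open import Relation.Binary.Reasoning.Setoid S.setoid

  module Residues (ζ f : R) (Φ≡0 : 1# + ζ + ζ * ζ + ζ * ζ * ζ + ζ * ζ * ζ * ζ ≡ 0#) (5f≡1 : (1# + 1# + 1# + 1# + 1#) * f ≡ 1#)
    (I₁ I₂ I₃ I₄ I₅ I₆ I₇ I₈ : PS)
    (inv₁ : [ 1 ⨾ 5 ] ⊛ [ 1 ⨾ 5 ] ⊛ I₁ ≈ 𝟙)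
    (inv₂ : [ 1 ⨾ 15 ] ⊛ [ 4 ⨾ 15 ] ⊛ [ 5 ⨾ 15 ] ⊛ [ 6 ⨾ 15 ] ⊛ I₂ ≈ 𝟙)
    (inv₃ : [ 1 ⨾ 5 ] ⊛ I₃ ≈ 𝟙)
    (inv₄ : [ 2 ⨾ 15 ] ⊛ [ 3 ⨾ 15 ] ⊛ [ 5 ⨾ 15 ] ⊛ I₄ ≈ 𝟙)
    (inv₅ : [ 2 ⨾ 5 ] ⊛ I₅ ≈ 𝟙)
    (inv₆ : [ 1 ⨾ 15 ] ⊛ [ 5 ⨾ 15 ] ⊛ [ 6 ⨾ 15 ] ⊛ I₆ ≈ 𝟙)
    (inv₇ : [ 2 ⨾ 5 ] ⊛ [ 2 ⨾ 5 ] ⊛ I₇ ≈ 𝟙)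
    (inv₈ : [ 2 ⨾ 15 ] ⊛ [ 3 ⨾ 15 ] ⊛ [ 5 ⨾ 15 ] ⊛ [ 7 ⨾ 15 ] ⊛ I₈ ≈ 𝟙) where
    open Evaluation ζ f Φ≡0 5f≡1 public
    open SS

    A₀ A₁ A₂ A₃ : PS
    A₀ = const k₀ ⊛ ([ 2 ⨾ 5 ] ⊛ I₁) ⊖ X 1 ⊛ (const (1# + c) ⊛ ([ 2 ⨾ 15 ] ⊛ I₂))
    A₁ = const k₁ ⊛ I₃ ⊕ I₄
    A₂ = const k₂ ⊛ I₅ ⊖ I₆
    A₃ = const k₃ ⊛ ([ 1 ⨾ 5 ] ⊛ I₇) ⊖ X 1 ⊛ (const c ⊛ ([ 1 ⨾ 15 ] ⊛ I₈))

    private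
      const-⊖ : ∀ a b → const (a + - b) ≈ const a ⊖ const b
      const-⊖ a b = S.trans (const-+ a (- b)) (S.+-congˡ (const-neg b))

      coefficient : ∀ {a b n x} → a * b ≡ n * x → const a ⊛ const b ≈ const n ⊛ const x
      coefficient {a} {b} {n} {x} eq = S.trans (const-* a b) (S.trans (const-cong eq) (S.sym (const-* n x)))

    component₀ : const w ⊛ (U ⊛ A₀) ≈ const n₀ ⊛ const x₀ ⊛ (F 2 3 ⊛ F 7 8) ⊕ const n₂ ⊛ const x₀ ⊛ (X 1 ⊛ (F 2 3 ⊛ F 2 13))
    component₀ = from-difference
      (solve 12 (λ w u k l q κ l′ p r a c d →
          w :* (u :* (k :* l :- q :* (κ :* l′))) :- (p :* (a :* c) :+ r :* (q :* (a :* d)))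
        := (w :* k) :* (u :* l :- a :* (c :+ q :* d)) :+ ((:- (w :* q :* κ)) :* (u :* l′ :- a :* d) :+ (a :* c :* (w :* k :- p) :+ (q :* a :* d) :* (w :* (k :- κ) :- r))))
        S.refl (const w) U (const k₀) ([ 2 ⨾ 5 ] ⊛ I₁) (X 1) (const (1# + c)) ([ 2 ⨾ 15 ] ⊛ I₂) (const n₀ ⊛ const x₀) (const n₂ ⊛ const x₀) (F 2 3) (F 7 8) (F 2 13))
      (vanish {const w ⊛ const k₀} (U/t₁² I₁ inv₁) and vanish {⊝ (const w ⊛ X 1 ⊛ const (1# + c))} (U/s₁s₄s₅s₆ I₂ inv₂)
        and vanish {F 2 3 ⊛ F 7 8} (coefficient c₀c)
        and vanish {X 1 ⊛ F 2 3 ⊛ F 2 13} (S.trans (S.*-congˡ {const w} (S.sym (const-⊖ k₀ (1# + c)))) (coefficient c₀d)))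

    -- The class on the right contains `X 1 ⊛ (F 1 4 ⊛ F 2 13)`, which `A₁` does not produce. The
    -- quintuple product rewrites it as `F 2 3 ⊛ F 5 10 ⊖ F 1 4 ⊛ F 7 8`, which is why `n₂ * x₁`
    -- occurs in both `c₁c` and `c₁h`.
    component₁ : const w ⊛ (U ⊛ A₁) ≈ const n₀ ⊛ const x₁ ⊛ (F 1 4 ⊛ F 7 8) ⊕ const n₂ ⊛ const x₁ ⊛ (X 1 ⊛ (F 1 4 ⊛ F 2 13))
      ⊕ const n₁ ⊛ const x₀ ⊛ (F 2 3 ⊛ F 5 10)
    component₁ = from-difference
      (solve 14 (λ w u k l l′ p r s a b c d h q →
          w :* (u :* (k :* l :+ l′)) :- (p :* (b :* c) :+ r :* (q :* (b :* d)) :+ s :* (a :* h))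
        := (w :* k) :* (u :* l :- a :* h) :+ (w :* (u :* l′ :- b :* c) :+ (a :* h :* (w :* k :- (r :+ s)) :+ (b :* c :* (w :* con (+ 1) :- (p :- r))
          :+ r :* (a :* h :- b :* (c :+ q :* d))))))
        S.refl (const w) U (const k₁) I₃ I₄ (const n₀ ⊛ const x₁) (const n₂ ⊛ const x₁) (const n₁ ⊛ const x₀) (F 2 3) (F 1 4) (F 7 8) (F 2 13) (F 5 10) (X 1))
      (vanish {const w ⊛ const k₁} (U/t₁ I₃ inv₃) and vanish {const w} (U/s₂s₃s₅ I₄ inv₄)
        and vanish {F 2 3 ⊛ F 5 10} (S.trans (const-* w k₁) (S.trans (const-cong c₁h) (S.trans (const-+ _ _) (S.+-cong (S.sym (const-* n₂ x₁)) (S.sym (const-* n₁ x₀))))))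
        and vanish {F 1 4 ⊛ F 7 8} (S.trans (const-* w 1#) (S.trans (const-cong c₁c) (S.trans (const-⊖ _ _) (S.+-cong (S.sym (const-* n₀ x₁)) (S.-‿cong (S.sym (const-* n₂ x₁)))))))
        and vanish {const n₂ ⊛ const x₁} quintuple₁)

    -- As before, with `quintuple₂` rewriting `X 1 ⊛ (F 2 3 ⊛ F 1 14)` as
    -- `F 2 3 ⊛ F 4 11 ⊖ F 1 4 ⊛ F 5 10`.
    component₂ : const w ⊛ (U ⊛ A₂) ≈ const n₁ ⊛ const x₁ ⊛ (F 1 4 ⊛ F 5 10) ⊕ const n₃ ⊛ const x₀ ⊛ (X 1 ⊛ (F 2 3 ⊛ F 1 14))
      ⊕ const n₄ ⊛ const x₀ ⊛ (F 2 3 ⊛ F 4 11)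
    component₂ = from-difference
      (solve 14 (λ w u k l l′ p r s a b e g h q →
          w :* (u :* (k :* l :- l′)) :- (p :* (b :* h) :+ r :* (q :* (a :* g)) :+ s :* (a :* e))
        := (w :* k) :* (u :* l :- b :* h) :+ ((:- w) :* (u :* l′ :- a :* e) :+ (b :* h :* (w :* k :- (p :- r)) :+ (a :* e :* ((:- (w :* con (+ 1))) :- (r :+ s))
          :+ (:- r) :* (b :* h :- a :* (e :- q :* g))))))
        S.refl (const w) U (const k₂) I₅ I₆ (const n₁ ⊛ const x₁) (const n₃ ⊛ const x₀) (const n₄ ⊛ const x₀) (F 2 3) (F 1 4) (F 4 11) (F 1 14) (F 5 10) (X 1))
      (vanish {const w ⊛ const k₂} (U/t₂ I₅ inv₅) and vanish {⊝ const w} (U/s₁s₅s₆ I₆ inv₆)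
        and vanish {F 1 4 ⊛ F 5 10} (S.trans (const-* w k₂) (S.trans (const-cong c₂h) (S.trans (const-⊖ _ _) (S.+-cong (S.sym (const-* n₁ x₁)) (S.-‿cong (S.sym (const-* n₃ x₀)))))))
        and vanish {F 2 3 ⊛ F 4 11} (S.trans (S.-‿cong (const-* w 1#)) (S.trans (S.sym (const-neg _)) (S.trans (const-cong c₂e) (S.trans (const-+ _ _)
          (S.+-cong (S.sym (const-* n₃ x₀)) (S.sym (const-* n₄ x₀)))))))
        and vanish {⊝ (const n₃ ⊛ const x₀)} quintuple₂)

    component₃ : const w ⊛ (U ⊛ A₃) ≈ const n₃ ⊛ const x₁ ⊛ (X 1 ⊛ (F 1 4 ⊛ F 1 14)) ⊕ const n₄ ⊛ const x₁ ⊛ (F 1 4 ⊛ F 4 11)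
    component₃ = from-difference
      (solve 12 (λ w u k l q κ l′ r s b e g →
          w :* (u :* (k :* l :- q :* (κ :* l′))) :- (r :* (q :* (b :* g)) :+ s :* (b :* e))
        := (w :* k) :* (u :* l :- b :* (e :- q :* g)) :+ ((:- (w :* q :* κ)) :* (u :* l′ :- b :* g) :+ (b :* e :* (w :* k :- s) :+ (q :* b :* g) :* ((:- (w :* (k :+ κ))) :- r))))
        S.refl (const w) U (const k₃) ([ 1 ⨾ 5 ] ⊛ I₇) (X 1) (const c) ([ 1 ⨾ 15 ] ⊛ I₈) (const n₃ ⊛ const x₁) (const n₄ ⊛ const x₁) (F 1 4) (F 4 11) (F 1 14))
      (vanish {const w ⊛ const k₃} (U/t₂² I₇ inv₇) and vanish {⊝ (const w ⊛ X 1 ⊛ const c)} (U/s₂s₃s₅s₇ I₈ inv₈)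
        and vanish {F 1 4 ⊛ F 4 11} (coefficient c₃e)
        and vanish {X 1 ⊛ F 1 4 ⊛ F 1 14} (S.trans (S.-‿cong (S.trans (S.*-congˡ {const w} (S.sym (const-+ k₃ c))) (const-* w _)))
          (S.trans (S.sym (const-neg _)) (S.trans (const-cong c₃g) (S.sym (const-* n₃ x₁))))))

    private
      D-term : ∀ n x g h → D (const n ⊛ const x ⊛ (g ⊛ h)) ≈ const n ⊛ const x ⊛ (D g ⊛ D h)
      D-term n x g h = S.trans (D-⊛ (const n ⊛ const x) (g ⊛ h)) (S.*-cong
        (S.trans (D-⊛ (const n) (const x)) (S.*-cong (D-const n) (D-const x))) (D-⊛ g h))

      D-term′ : ∀ n x g h → D (const n ⊛ const x ⊛ (X 1 ⊛ (g ⊛ h))) ≈ const n ⊛ const x ⊛ (X 5 ⊛ (D g ⊛ D h))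
      D-term′ n x g h = S.trans (D-term n x (X 1) (g ⊛ h)) (S.*-congˡ {const n ⊛ const x} (S.*-cong (D-mono 1# 1) (D-⊛ g h)))

      D-component : ∀ A {B} → const w ⊛ (U ⊛ A) ≈ B → const w ⊛ ⟨ 5 ⟩ ⊛ (⟨ 25 ⟩ ⊛ D A) ≈ D B
      D-component A {B} p = S.trans (S.trans
          (solve 4 (λ w p r a → w :* p :* (r :* a) := w :* (p :* r :* a)) S.refl (const w) ⟨ 5 ⟩ ⟨ 25 ⟩ (D A))
          (S.sym (S.trans (D-⊛ (const w) (U ⊛ A)) (S.*-cong (D-const w) (S.trans (D-⊛ U A)
            (S.*-congʳ (S.trans (D-⊛ ⟨ 1 ⟩ ⟨ 5 ⟩) (S.*-cong (D-Poch (- 1#) 1 0) (D-Poch (- 1#) 5 4)))))))))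
        (D-cong p)

    w≈W : const w ≈ (𝟙 ⊖ Z) ⊛ (𝟙 ⊖ Z²) ⊛ (Z ⊖ Z⁴)
    w≈W = S.trans (S.sym (const-* _ _)) (S.*-cong (S.trans (S.sym (const-* _ _)) (S.*-cong (const-⊖ 1# ζ) (const-⊖ 1# ζ²))) (const-⊖ ζ ζ⁴))

    -- `N` lives in the classes 0, 1, 2 modulo 5 and `T²` in 0, 1. Their product therefore has no
    -- class 4, which is why four components suffice, and the four together factor as the product of
    -- the two dissections.
    right-hand-side : const w ⊛ ⟨ 5 ⟩ ⊛ (⟨ 25 ⟩ ⊛ (D A₀ ⊕ X 1 ⊛ D A₁ ⊕ X 2 ⊛ D A₂ ⊕ X 3 ⊛ D A₃)) ≈ N ⊛ T²
    right-hand-side = begin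
      const w ⊛ ⟨ 5 ⟩ ⊛ (⟨ 25 ⟩ ⊛ (D A₀ ⊕ X 1 ⊛ D A₁ ⊕ X 2 ⊛ D A₂ ⊕ X 3 ⊛ D A₃))
        ≈⟨ solve 9 (λ w r a b c d x y z → w :* (r :* (a :+ x :* b :+ y :* c :+ z :* d)) := w :* (r :* a) :+ x :* (w :* (r :* b)) :+ y :* (w :* (r :* c)) :+ z :* (w :* (r :* d))) S.refl
             (const w ⊛ ⟨ 5 ⟩) ⟨ 25 ⟩ (D A₀) (D A₁) (D A₂) (D A₃) (X 1) (X 2) (X 3) ⟩
      const w ⊛ ⟨ 5 ⟩ ⊛ (⟨ 25 ⟩ ⊛ D A₀) ⊕ X 1 ⊛ (const w ⊛ ⟨ 5 ⟩ ⊛ (⟨ 25 ⟩ ⊛ D A₁)) ⊕ X 2 ⊛ (const w ⊛ ⟨ 5 ⟩ ⊛ (⟨ 25 ⟩ ⊛ D A₂)) ⊕ X 3 ⊛ (const w ⊛ ⟨ 5 ⟩ ⊛ (⟨ 25 ⟩ ⊛ D A₃))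
        ≈⟨ S.+-cong (S.+-cong (S.+-cong
             (S.trans (D-component A₀ component₀) (S.trans (D-⊕ _ _) (S.+-cong (D-term n₀ x₀ (F 2 3) (F 7 8)) (D-term′ n₂ x₀ (F 2 3) (F 2 13)))))
             (S.*-congˡ {X 1} (S.trans (D-component A₁ component₁) (S.trans (D-⊕ _ _) (S.+-cong (S.trans (D-⊕ _ _)
               (S.+-cong (D-term n₀ x₁ (F 1 4) (F 7 8)) (D-term′ n₂ x₁ (F 1 4) (F 2 13)))) (D-term n₁ x₀ (F 2 3) (F 5 10)))))))
             (S.*-cong (S.sym (X-⊛ 1 1)) (S.trans (D-component A₂ component₂) (S.trans (D-⊕ _ _) (S.+-cong (S.trans (D-⊕ _ _)
               (S.+-cong (D-term n₁ x₁ (F 1 4) (F 5 10)) (D-term′ n₃ x₀ (F 2 3) (F 1 14)))) (D-term n₄ x₀ (F 2 3) (F 4 11)))))))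
             (S.*-cong (S.sym (S.trans (S.*-congʳ (X-⊛ 1 1)) (X-⊛ 2 1))) (S.trans (D-component A₃ component₃) (S.trans (D-⊕ _ _) (S.+-cong (D-term′ n₃ x₁ (F 1 4) (F 1 14)) (D-term n₄ x₁ (F 1 4) (F 4 11)))))) ⟩
      (C n₀ ⊛ C x₀ ⊛ (a ⊛ c′) ⊕ C n₂ ⊛ C x₀ ⊛ (X 5 ⊛ (a ⊛ d)))
        ⊕ X 1 ⊛ (C n₀ ⊛ C x₁ ⊛ (b ⊛ c′) ⊕ C n₂ ⊛ C x₁ ⊛ (X 5 ⊛ (b ⊛ d)) ⊕ C n₁ ⊛ C x₀ ⊛ (a ⊛ h))
        ⊕ X 1 ⊛ X 1 ⊛ (C n₁ ⊛ C x₁ ⊛ (b ⊛ h) ⊕ C n₃ ⊛ C x₀ ⊛ (X 5 ⊛ (a ⊛ g)) ⊕ C n₄ ⊛ C x₀ ⊛ (a ⊛ e′))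
        ⊕ X 1 ⊛ X 1 ⊛ X 1 ⊛ (C n₃ ⊛ C x₁ ⊛ (X 5 ⊛ (b ⊛ g)) ⊕ C n₄ ⊛ C x₁ ⊛ (b ⊛ e′))
        ≈⟨ solve 16 (λ n₀ n₁ n₂ n₃ n₄ x₀ x₁ q s a b c d e g h →
             (n₀ :* x₀ :* (a :* c) :+ n₂ :* x₀ :* (s :* (a :* d)))
             :+ q :* (n₀ :* x₁ :* (b :* c) :+ n₂ :* x₁ :* (s :* (b :* d)) :+ n₁ :* x₀ :* (a :* h))
             :+ q :* q :* (n₁ :* x₁ :* (b :* h) :+ n₃ :* x₀ :* (s :* (a :* g)) :+ n₄ :* x₀ :* (a :* e))
             :+ q :* q :* q :* (n₃ :* x₁ :* (s :* (b :* g)) :+ n₄ :* x₁ :* (b :* e))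
             := (n₀ :* c :+ n₁ :* (q :* h) :+ n₂ :* (s :* d) :+ n₃ :* (q :* q :* s :* g) :+ n₄ :* (q :* q :* e)) :* (x₀ :* a :+ x₁ :* (q :* b)))
             S.refl (C n₀) (C n₁) (C n₂) (C n₃) (C n₄) (C x₀) (C x₁) (X 1) (X 5) a b c′ d e′ g h ⟩
      (C n₀ ⊛ c′ ⊕ C n₁ ⊛ (X 1 ⊛ h) ⊕ C n₂ ⊛ (X 5 ⊛ d) ⊕ C n₃ ⊛ (X 1 ⊛ X 1 ⊛ X 5 ⊛ g) ⊕ C n₄ ⊛ (X 1 ⊛ X 1 ⊛ e′)) ⊛ (C x₀ ⊛ a ⊕ C x₁ ⊛ (X 1 ⊛ b))
        ≈⟨ S.*-congʳ (S.+-cong (S.+-congˡ (S.*-congˡ {C n₃} (S.*-congʳ (S.trans (S.*-congʳ (X-⊛ 1 1)) (X-⊛ 2 5))))) (S.*-congˡ {C n₄} (S.*-congʳ (X-⊛ 1 1)))) ⟩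
      (C n₀ ⊛ c′ ⊕ C n₁ ⊛ (X 1 ⊛ h) ⊕ C n₂ ⊛ (X 5 ⊛ d) ⊕ C n₃ ⊛ (X 7 ⊛ g) ⊕ C n₄ ⊛ (X 2 ⊛ e′)) ⊛ (C x₀ ⊛ a ⊕ C x₁ ⊛ (X 1 ⊛ b))
        ≈⟨ S.*-cong dissect-N dissect-T² ⟨
      N ⊛ T² ∎
      where
      C = const
      a = D (F 2 3)
      b = D (F 1 4)
      c′ = D (F 7 8)
      d = D (F 2 13)
      e′ = D (F 4 11)
      g = D (F 1 14)
      h = D (F 5 10)

    module _ (G H : ℤ → PS) (G-spec : Geometric ζ G) (H-spec : Geometric ζ⁴ H)
      (t₁ t₂ : ℤ → PS)
      (t₁-spec : ∀ n a b → + a ≡ + b ℤ.+ exponent₁ n → X a ⊛ (G (+ 3 ℤ.* n) ⊛ H (+ 3 ℤ.* n)) ≈ X b ⊛ t₁ n)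
      (t₂-spec : ∀ n a b → + a ≡ + b ℤ.+ exponent₂ n → X a ⊛ (G (+ 3 ℤ.* n ℤ.+ + 1) ⊛ H (+ 3 ℤ.* n ℤ.+ + 1)) ≈ X b ⊛ t₂ n)
      (S₁ S₂ : PS) (hasSum₁ : HasSum t₁ S₁) (hasSum₂ : HasSum t₂ S₂) (I₀ : PS) (inv₀ : ⟨ 1 ⟩ ⊛ I₀ ≈ 𝟙) where

      dissection : I₀ ⊛ (S₁ ⊖ S₂) ≈ ⟨ 25 ⟩ ⊛ (D A₀ ⊕ X 1 ⊛ D A₁ ⊕ X 2 ⊛ D A₂ ⊕ X 3 ⊛ D A₃)
      dissection = unit-cancel {const w ⊛ ⟨ 5 ⟩} (ζ⁴ * (1# + - ζ⁴) * f)
        (≡.trans (cong (λ x → ζ⁴ * (1# + - ζ⁴) * f * (w * x)) (Poch-0 (- 1#) 4 5)) (≡.trans (cong (ζ⁴ * (1# + - ζ⁴) * f *_) (R.*-identityʳ w)) w-unit))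
        (S.trans (S.*-congʳ (S.*-congʳ w≈W)) (S.trans
          (product-of-thetas G H G-spec H-spec t₁ t₂ t₁-spec t₂-spec S₁ S₂ hasSum₁ hasSum₂ I₀ inv₀) (S.sym right-hand-side)))

-- The coefficient ring of the statement is a field.

module CyclotomicField where
  open import Defs
  open import Data.Empty using (⊥; ⊥-elim)
  open import Data.Empty.Irrelevant using () renaming (⊥-elim to ⊥-elim-irr)
  open import Data.Nat.Coprimality using (Coprime)
  open import Data.Nat.Divisibility using (_∣_; divides)
  open import Data.Nat.Primality using (Prime; prime?; euclidsLemma)
  import Data.Rational.Unnormalised as ℚᵘ
  import Data.Rational.Unnormalised.Properties as ℚᵘP
  open import Data.Sum using (inj₁; inj₂)
  open import Relation.Nullary.Decidable using (from-yes)
  open ≡ using (refl; sym; trans)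

  open IntegerCoefficientSolver ℚP.+-*-commutativeRing

  mkK-cong : ∀ {a a′ b b′ c c′ d d′} → a ≡ a′ → b ≡ b′ → c ≡ c′ → d ≡ d′ → mkK a b c d ≡ mkK a′ b′ c′ d′
  mkK-cong refl refl refl refl = refl

  record KPolynomial (n : ℕ) : Set where
    constructor mkP
    field p0 p1 p2 p3 : Polynomial n

  open KPolynomial

  infixl 6 _:⊕_
  infixl 7 _:⊗_

  _:⊕_ _:⊗_ : ∀ {n} → KPolynomial n → KPolynomial n → KPolynomial n
  mkP a0 a1 a2 a3 :⊕ mkP b0 b1 b2 b3 = mkP (a0 :+ b0) (a1 :+ b1) (a2 :+ b2) (a3 :+ b3)
  mkP a0 a1 a2 a3 :⊗ mkP b0 b1 b2 b3 =
    let q0 = a0 :* b0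
        q1 = a0 :* b1 :+ a1 :* b0
        q2 = a0 :* b2 :+ a1 :* b1 :+ a2 :* b0
        q3 = a0 :* b3 :+ a1 :* b2 :+ a2 :* b1 :+ a3 :* b0
        q4 = a1 :* b3 :+ a2 :* b2 :+ a3 :* b1
        q5 = a2 :* b3 :+ a3 :* b2
        q6 = a3 :* b3
    in mkP (q0 :+ q5 :- q4) (q1 :+ q6 :- q4) (q2 :- q4) (q3 :- q4)

  K-assoc : ∀ a b c → (a *K b) *K c ≡ a *K (b *K c)
  K-assoc (mkK a0 a1 a2 a3) (mkK b0 b1 b2 b3) (mkK c0 c1 c2 c3) = mkK-cong
    (solve 12 (λ a0 a1 a2 a3 b0 b1 b2 b3 c0 c1 c2 c3 → p0 (mkP a0 a1 a2 a3 :⊗ mkP b0 b1 b2 b3 :⊗ mkP c0 c1 c2 c3) := p0 (mkP a0 a1 a2 a3 :⊗ (mkP b0 b1 b2 b3 :⊗ mkP c0 c1 c2 c3)))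
      refl a0 a1 a2 a3 b0 b1 b2 b3 c0 c1 c2 c3)
    (solve 12 (λ a0 a1 a2 a3 b0 b1 b2 b3 c0 c1 c2 c3 → p1 (mkP a0 a1 a2 a3 :⊗ mkP b0 b1 b2 b3 :⊗ mkP c0 c1 c2 c3) := p1 (mkP a0 a1 a2 a3 :⊗ (mkP b0 b1 b2 b3 :⊗ mkP c0 c1 c2 c3)))
      refl a0 a1 a2 a3 b0 b1 b2 b3 c0 c1 c2 c3)
    (solve 12 (λ a0 a1 a2 a3 b0 b1 b2 b3 c0 c1 c2 c3 → p2 (mkP a0 a1 a2 a3 :⊗ mkP b0 b1 b2 b3 :⊗ mkP c0 c1 c2 c3) := p2 (mkP a0 a1 a2 a3 :⊗ (mkP b0 b1 b2 b3 :⊗ mkP c0 c1 c2 c3)))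
      refl a0 a1 a2 a3 b0 b1 b2 b3 c0 c1 c2 c3)
    (solve 12 (λ a0 a1 a2 a3 b0 b1 b2 b3 c0 c1 c2 c3 → p3 (mkP a0 a1 a2 a3 :⊗ mkP b0 b1 b2 b3 :⊗ mkP c0 c1 c2 c3) := p3 (mkP a0 a1 a2 a3 :⊗ (mkP b0 b1 b2 b3 :⊗ mkP c0 c1 c2 c3)))
      refl a0 a1 a2 a3 b0 b1 b2 b3 c0 c1 c2 c3)

  K-comm : ∀ a b → a *K b ≡ b *K a
  K-comm (mkK a0 a1 a2 a3) (mkK b0 b1 b2 b3) = mkK-cong
    (solve 8 (λ a0 a1 a2 a3 b0 b1 b2 b3 → p0 (mkP a0 a1 a2 a3 :⊗ mkP b0 b1 b2 b3) := p0 (mkP b0 b1 b2 b3 :⊗ mkP a0 a1 a2 a3)) refl a0 a1 a2 a3 b0 b1 b2 b3)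
    (solve 8 (λ a0 a1 a2 a3 b0 b1 b2 b3 → p1 (mkP a0 a1 a2 a3 :⊗ mkP b0 b1 b2 b3) := p1 (mkP b0 b1 b2 b3 :⊗ mkP a0 a1 a2 a3)) refl a0 a1 a2 a3 b0 b1 b2 b3)
    (solve 8 (λ a0 a1 a2 a3 b0 b1 b2 b3 → p2 (mkP a0 a1 a2 a3 :⊗ mkP b0 b1 b2 b3) := p2 (mkP b0 b1 b2 b3 :⊗ mkP a0 a1 a2 a3)) refl a0 a1 a2 a3 b0 b1 b2 b3)
    (solve 8 (λ a0 a1 a2 a3 b0 b1 b2 b3 → p3 (mkP a0 a1 a2 a3 :⊗ mkP b0 b1 b2 b3) := p3 (mkP b0 b1 b2 b3 :⊗ mkP a0 a1 a2 a3)) refl a0 a1 a2 a3 b0 b1 b2 b3)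

  K-distribʳ : ∀ c a b → (a +K b) *K c ≡ a *K c +K b *K c
  K-distribʳ (mkK c0 c1 c2 c3) (mkK a0 a1 a2 a3) (mkK b0 b1 b2 b3) = mkK-cong
    (solve 12 (λ a0 a1 a2 a3 b0 b1 b2 b3 c0 c1 c2 c3 → let a = mkP a0 a1 a2 a3 ; b = mkP b0 b1 b2 b3 ; c = mkP c0 c1 c2 c3 in p0 ((a :⊕ b) :⊗ c) := p0 (a :⊗ c :⊕ b :⊗ c))
      refl a0 a1 a2 a3 b0 b1 b2 b3 c0 c1 c2 c3)
    (solve 12 (λ a0 a1 a2 a3 b0 b1 b2 b3 c0 c1 c2 c3 → let a = mkP a0 a1 a2 a3 ; b = mkP b0 b1 b2 b3 ; c = mkP c0 c1 c2 c3 in p1 ((a :⊕ b) :⊗ c) := p1 (a :⊗ c :⊕ b :⊗ c))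
      refl a0 a1 a2 a3 b0 b1 b2 b3 c0 c1 c2 c3)
    (solve 12 (λ a0 a1 a2 a3 b0 b1 b2 b3 c0 c1 c2 c3 → let a = mkP a0 a1 a2 a3 ; b = mkP b0 b1 b2 b3 ; c = mkP c0 c1 c2 c3 in p2 ((a :⊕ b) :⊗ c) := p2 (a :⊗ c :⊕ b :⊗ c))
      refl a0 a1 a2 a3 b0 b1 b2 b3 c0 c1 c2 c3)
    (solve 12 (λ a0 a1 a2 a3 b0 b1 b2 b3 c0 c1 c2 c3 → let a = mkP a0 a1 a2 a3 ; b = mkP b0 b1 b2 b3 ; c = mkP c0 c1 c2 c3 in p3 ((a :⊕ b) :⊗ c) := p3 (a :⊗ c :⊕ b :⊗ c))
      refl a0 a1 a2 a3 b0 b1 b2 b3 c0 c1 c2 c3)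

  1P : ∀ {n} → KPolynomial n
  1P = mkP (con (+ 1)) (con (+ 0)) (con (+ 0)) (con (+ 0))

  K-identityˡ : ∀ a → 1K *K a ≡ a
  K-identityˡ (mkK a0 a1 a2 a3) = mkK-cong
    (solve 4 (λ a0 a1 a2 a3 → p0 (1P :⊗ mkP a0 a1 a2 a3) := a0) refl a0 a1 a2 a3)
    (solve 4 (λ a0 a1 a2 a3 → p1 (1P :⊗ mkP a0 a1 a2 a3) := a1) refl a0 a1 a2 a3)
    (solve 4 (λ a0 a1 a2 a3 → p2 (1P :⊗ mkP a0 a1 a2 a3) := a2) refl a0 a1 a2 a3)
    (solve 4 (λ a0 a1 a2 a3 → p3 (1P :⊗ mkP a0 a1 a2 a3) := a3) refl a0 a1 a2 a3)

  abstract
    K-isCommutativeRing : IsCommutativeRing _≡_ _+K_ _*K_ -K_ 0K 1K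
    K-isCommutativeRing = record
      { isRing = record
        { +-isAbelianGroup = record
          { isGroup = record
            { isMonoid = record
              { isSemigroup = record
                { isMagma = record { isEquivalence = ≡.isEquivalence ; ∙-cong = cong₂ _+K_ }
                ; assoc = λ { (mkK a0 a1 a2 a3) (mkK b0 b1 b2 b3) (mkK c0 c1 c2 c3) →
                    mkK-cong (ℚP.+-assoc a0 b0 c0) (ℚP.+-assoc a1 b1 c1) (ℚP.+-assoc a2 b2 c2) (ℚP.+-assoc a3 b3 c3) } }
              ; identity = (λ { (mkK a0 a1 a2 a3) → mkK-cong (ℚP.+-identityˡ a0) (ℚP.+-identityˡ a1) (ℚP.+-identityˡ a2) (ℚP.+-identityˡ a3) })
                         , (λ { (mkK a0 a1 a2 a3) → mkK-cong (ℚP.+-identityʳ a0) (ℚP.+-identityʳ a1) (ℚP.+-identityʳ a2) (ℚP.+-identityʳ a3) }) }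
            ; inverse = (λ { (mkK a0 a1 a2 a3) → mkK-cong (ℚP.+-inverseˡ a0) (ℚP.+-inverseˡ a1) (ℚP.+-inverseˡ a2) (ℚP.+-inverseˡ a3) })
                      , (λ { (mkK a0 a1 a2 a3) → mkK-cong (ℚP.+-inverseʳ a0) (ℚP.+-inverseʳ a1) (ℚP.+-inverseʳ a2) (ℚP.+-inverseʳ a3) })
            ; ⁻¹-cong = cong (λ a → -K a) }
          ; comm = λ { (mkK a0 a1 a2 a3) (mkK b0 b1 b2 b3) → mkK-cong (ℚP.+-comm a0 b0) (ℚP.+-comm a1 b1) (ℚP.+-comm a2 b2) (ℚP.+-comm a3 b3) } }
        ; *-cong = cong₂ _*K_
        ; *-assoc = K-assoc
        ; *-identity = K-identityˡ , (λ a → trans (K-comm a 1K) (K-identityˡ a))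
        ; distrib = (λ c a b → trans (K-comm c (a +K b)) (trans (K-distribʳ c a b) (cong₂ _+K_ (K-comm a c) (K-comm b c)))) , K-distribʳ }
      ; *-comm = K-comm }

  private
    5-prime : Prime 5
    5-prime = from-yes (prime? 5)

    5∣square : ∀ n → 5 ∣ n ℕ.* n → 5 ∣ n
    5∣square n p with euclidsLemma n n 5-prime p
    ... | inj₁ q = q
    ... | inj₂ q = q

    no-√5 : ∀ m n → Coprime m n → m ℕ.* m ≡ 5 ℕ.* (n ℕ.* n) → ⊥
    no-√5 m n coprime eq = 5≢1 (coprime (5∣m , 5∣square n (5∣n² 5∣m)))
      where
      open import Data.Nat.Solver
      module N = +-*-Solver
      5≢1 : 5 ≢ 1
      5≢1 ()
      5∣m : 5 ∣ m
      5∣m = 5∣square m (divides (n ℕ.* n) (trans eq (ℕP.*-comm 5 (n ℕ.* n))))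
      5∣n² : 5 ∣ m → 5 ∣ n ℕ.* n
      5∣n² (divides k m≡k*5) = divides (k ℕ.* k) (ℕP.*-cancelˡ-≡ (n ℕ.* n) (k ℕ.* k ℕ.* 5) 5 (trans (sym eq) (trans (cong₂ ℕ._*_ m≡k*5 m≡k*5)
        (N.solve 1 (λ k → k N.:* N.con 5 N.:* (k N.:* N.con 5) N.:= N.con 5 N.:* (k N.:* k N.:* N.con 5)) refl k))))

  irrational-√5 : ∀ r → r ℚ.* r ≢ (+ 5) ℚ./ 1
  -- The coprimality stored in a rational number is irrelevant, so it may be used only inside an
  -- irrelevant contradiction.
  irrational-√5 r@(mkℚ n d coprime) eq = ⊥-elim-irr (no-√5 ∣ n ∣ (suc d) coprime (squares
      (ℚᵘP.≃-trans (ℚᵘP.≃-sym (ℚP.toℚᵘ-homo-* r r)) (ℚP.toℚᵘ-cong eq))))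
    where
    squares : ℚ.toℚᵘ r ℚᵘ.* ℚ.toℚᵘ r ℚᵘ.≃ ℚ.toℚᵘ ((+ 5) ℚ./ 1) → ∣ n ∣ ℕ.* ∣ n ∣ ≡ 5 ℕ.* (suc d ℕ.* suc d)
    squares (ℚᵘ.*≡* e) = trans (sym (ℤP.abs-* n n)) (trans (cong ∣_∣ (sym (ℤP.*-identityʳ (n ℤ.* n)))) (trans (cong ∣_∣ e)
      (ℤP.abs-* (+ 5) (+ (suc d ℕ.* suc d)))))

  1/-inverse : ∀ {p} (p≢0 : p ≢ 0ℚ) → (ℚ.1/_ p {{ℚ.≢-nonZero p≢0}}) ℚ.* p ≡ 1ℚ
  1/-inverse {p} p≢0 = ℚP.*-inverseˡ p {{ℚ.≢-nonZero p≢0}}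

  square-zero : ∀ p → p ℚ.* p ≡ 0ℚ → p ≡ 0ℚ
  square-zero p pp≡0 with p ℚ.≟ 0ℚ
  ... | yes p≡0 = p≡0
  ... | no p≢0 = let q = ℚ.1/_ p {{ℚ.≢-nonZero p≢0}} in trans
    (solve 3 (λ p q r → p := (q :* p) :* p :+ (con (+ 1) :- q :* p) :* p) refl p q p)
    (trans (cong₂ (λ x y → x ℚ.+ y ℚ.* p) (trans (ℚP.*-assoc q p p) (trans (cong (q ℚ.*_) pp≡0) (ℚP.*-zeroʳ q)))
        (trans (cong (λ x → 1ℚ ℚ.- x) (1/-inverse p≢0)) (ℚP.+-inverseʳ 1ℚ)))
      (trans (ℚP.+-identityˡ _) (ℚP.*-zeroˡ p)))

  square-nonNegative : ∀ p → NonNegative (p ℚ.* p)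
  square-nonNegative p@(mkℚ (+ n) d c) = ℚP.nonNeg*nonNeg⇒nonNeg p p
  square-nonNegative p@(mkℚ -[1+ n ] d c) = ℚP.nonPos*nonPos⇒nonPos p p

  sum-of-squares : ∀ p s → NonNegative s → p ℚ.* p ℚ.+ s ≡ 0ℚ → p ≡ 0ℚ
  sum-of-squares p s s≥0 eq with p ℚ.≟ 0ℚ
  ... | yes p≡0 = p≡0
  ... | no p≢0 = ⊥-elim (positive-zero (≡.subst Positive eq (ℚP.pos+nonNeg⇒pos (p ℚ.* p) {{pos}} s {{s≥0}})))
    where
    pos : Positive (p ℚ.* p)
    pos = ℚP.nonNeg∧nonZero⇒pos (p ℚ.* p) {{square-nonNegative p}} {{ℚ.≢-nonZero (λ pp≡0 → p≢0 (square-zero p pp≡0))}}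
    positive-zero : Positive 0ℚ → ⊥
    positive-zero ()

  -- The conjugates of a and the norm: with τ = x² + x³, a σ₄(a) = u + v τ and σ₂(a) σ₃(a) = (u - v) - v τ.
  module Norm (a0 a1 a2 a3 : ℚ) where
    u v : ℚ
    u = a0 ℚ.* a0 ℚ.+ a1 ℚ.* a1 ℚ.+ a2 ℚ.* a2 ℚ.+ a3 ℚ.* a3 ℚ.- (a0 ℚ.* a1 ℚ.+ a1 ℚ.* a2 ℚ.+ a2 ℚ.* a3)
    v = a0 ℚ.* a2 ℚ.+ a1 ℚ.* a3 ℚ.+ a0 ℚ.* a3 ℚ.- (a0 ℚ.* a1 ℚ.+ a1 ℚ.* a2 ℚ.+ a2 ℚ.* a3)

    norm : ℚ
    norm = u ℚ.* u ℚ.- u ℚ.* v ℚ.- v ℚ.* v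

    a : K
    a = mkK a0 a1 a2 a3

    open KPolynomial

    private
      uP vP : ∀ {n} → Polynomial n → Polynomial n → Polynomial n → Polynomial n → Polynomial n
      uP a0 a1 a2 a3 = a0 :* a0 :+ a1 :* a1 :+ a2 :* a2 :+ a3 :* a3 :- (a0 :* a1 :+ a1 :* a2 :+ a2 :* a3)
      vP a0 a1 a2 a3 = a0 :* a2 :+ a1 :* a3 :+ a0 :* a3 :- (a0 :* a1 :+ a1 :* a2 :+ a2 :* a3)
      s2 s3 s4 : ∀ {n} → Polynomial n → Polynomial n → Polynomial n → Polynomial n → KPolynomial n
      s2 a0 a1 a2 a3 = mkP (a0 :- a2) (a3 :- a2) (a1 :- a2) (:- a2)
      s3 a0 a1 a2 a3 = mkP (a0 :- a3) (a2 :- a3) (:- a3) (a1 :- a3)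
      s4 a0 a1 a2 a3 = mkP (a0 :- a1) (:- a1) (a3 :- a1) (a2 :- a1)

    c₂ c₃ c₄ cofactor : K
    c₂ = mkK (a0 ℚ.- a2) (a3 ℚ.- a2) (a1 ℚ.- a2) (ℚ.- a2)
    c₃ = mkK (a0 ℚ.- a3) (a2 ℚ.- a3) (ℚ.- a3) (a1 ℚ.- a3)
    c₄ = mkK (a0 ℚ.- a1) (ℚ.- a1) (a3 ℚ.- a1) (a2 ℚ.- a1)
    cofactor = c₄ *K (c₂ *K c₃)

    a*c₄ : a *K c₄ ≡ mkK u 0ℚ v v
    a*c₄ = mkK-cong
      (solve 4 (λ a0 a1 a2 a3 → p0 (mkP a0 a1 a2 a3 :⊗ s4 a0 a1 a2 a3) := uP a0 a1 a2 a3) refl a0 a1 a2 a3)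
      (solve 4 (λ a0 a1 a2 a3 → p1 (mkP a0 a1 a2 a3 :⊗ s4 a0 a1 a2 a3) := con (+ 0)) refl a0 a1 a2 a3)
      (solve 4 (λ a0 a1 a2 a3 → p2 (mkP a0 a1 a2 a3 :⊗ s4 a0 a1 a2 a3) := vP a0 a1 a2 a3) refl a0 a1 a2 a3)
      (solve 4 (λ a0 a1 a2 a3 → p3 (mkP a0 a1 a2 a3 :⊗ s4 a0 a1 a2 a3) := vP a0 a1 a2 a3) refl a0 a1 a2 a3)

    c₂*c₃ : c₂ *K c₃ ≡ mkK (u ℚ.- v) 0ℚ (ℚ.- v) (ℚ.- v)
    c₂*c₃ = mkK-cong
      (solve 4 (λ a0 a1 a2 a3 → p0 (s2 a0 a1 a2 a3 :⊗ s3 a0 a1 a2 a3) := uP a0 a1 a2 a3 :- vP a0 a1 a2 a3) refl a0 a1 a2 a3)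
      (solve 4 (λ a0 a1 a2 a3 → p1 (s2 a0 a1 a2 a3 :⊗ s3 a0 a1 a2 a3) := con (+ 0)) refl a0 a1 a2 a3)
      (solve 4 (λ a0 a1 a2 a3 → p2 (s2 a0 a1 a2 a3 :⊗ s3 a0 a1 a2 a3) := :- vP a0 a1 a2 a3) refl a0 a1 a2 a3)
      (solve 4 (λ a0 a1 a2 a3 → p3 (s2 a0 a1 a2 a3 :⊗ s3 a0 a1 a2 a3) := :- vP a0 a1 a2 a3) refl a0 a1 a2 a3)

    real-norm : ∀ u v → mkK u 0ℚ v v *K mkK (u ℚ.- v) 0ℚ (ℚ.- v) (ℚ.- v) ≡ ofℚ (u ℚ.* u ℚ.- u ℚ.* v ℚ.- v ℚ.* v)
    real-norm u v = mkK-cong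
      (solve 2 (λ u v → p0 (mkP u (con (+ 0)) v v :⊗ mkP (u :- v) (con (+ 0)) (:- v) (:- v)) := u :* u :- u :* v :- v :* v) refl u v)
      (solve 2 (λ u v → p1 (mkP u (con (+ 0)) v v :⊗ mkP (u :- v) (con (+ 0)) (:- v) (:- v)) := con (+ 0)) refl u v)
      (solve 2 (λ u v → p2 (mkP u (con (+ 0)) v v :⊗ mkP (u :- v) (con (+ 0)) (:- v) (:- v)) := con (+ 0)) refl u v)
      (solve 2 (λ u v → p3 (mkP u (con (+ 0)) v v :⊗ mkP (u :- v) (con (+ 0)) (:- v) (:- v)) := con (+ 0)) refl u v)

    a*cofactor : a *K cofactor ≡ ofℚ norm
    a*cofactor = regroup a c₄ (c₂ *K c₃) a*c₄ c₂*c₃ (real-norm u v)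
      where
      -- Stated for variables, so that the given equations are substituted without unfolding any
      -- product into rational coordinates.
      regroup : ∀ a b c {d e f} → a *K b ≡ d → c ≡ e → d *K e ≡ f → a *K (b *K c) ≡ f
      regroup a b c refl refl refl = sym (K-assoc a b c)

    -- 4 N(a) = (2u - v)² - 5v² and 2u = a₀² + (a₀ - a₁)² + (a₁ - a₂)² + (a₂ - a₃)² + a₃² when v = 0.
    norm-zero : norm ≡ 0ℚ → a ≡ 0K
    norm-zero norm≡0 = mkK-cong a0≡0 a1≡0 a2≡0 a3≡0
      where
      v≡0 : v ≡ 0ℚ
      v≡0 with v ℚ.≟ 0ℚ
      ... | yes v≡0 = v≡0
      ... | no v≢0 = let q = ℚ.1/_ v {{ℚ.≢-nonZero v≢0}} in
        -- If the norm vanishes and `v` does not, `(2u - v)/v` is a square root of 5.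
        ⊥-elim (irrational-√5 ((u ℚ.+ u ℚ.- v) ℚ.* q) (trans
          (solve 3 (λ u v q → (u :+ u :- v) :* q :* ((u :+ u :- v) :* q) :=
              con (+ 4) :* q :* q :* (u :* u :- u :* v :- v :* v) :+ con (+ 5) :+ con (+ 5) :* (q :* v :- con (+ 1)) :* (q :* v :+ con (+ 1))) refl u v q)
          (trans (cong₂ (λ x y → ((+ 4) ℚ./ 1) ℚ.* q ℚ.* q ℚ.* x ℚ.+ ((+ 5) ℚ./ 1) ℚ.+ ((+ 5) ℚ./ 1) ℚ.* (y ℚ.- 1ℚ) ℚ.* (q ℚ.* v ℚ.+ 1ℚ)) norm≡0 (1/-inverse v≢0))
            (solve 2 (λ q v → con (+ 4) :* q :* q :* con (+ 0) :+ con (+ 5) :+ con (+ 5) :* con (+ 0) :* (q :* v :+ con (+ 1)) := con (+ 5)) refl q v))))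
      u≡0 : u ≡ 0ℚ
      u≡0 = square-zero u (trans (solve 2 (λ u v → u :* u := (u :* u :- u :* v :- v :* v) :+ v :* (u :+ v)) refl u v)
        (trans (cong₂ (λ x y → x ℚ.+ y ℚ.* (u ℚ.+ v)) norm≡0 v≡0) (trans (ℚP.+-identityˡ _) (ℚP.*-zeroˡ (u ℚ.+ v)))))
      sq : ℚ → ℚ
      sq p = p ℚ.* p
      squares : sq a0 ℚ.+ (sq (a0 ℚ.- a1) ℚ.+ (sq (a1 ℚ.- a2) ℚ.+ (sq (a2 ℚ.- a3) ℚ.+ sq a3))) ≡ 0ℚ
      squares = trans (solve 4 (λ a0 a1 a2 a3 → a0 :* a0 :+ ((a0 :- a1) :* (a0 :- a1) :+ ((a1 :- a2) :* (a1 :- a2) :+ ((a2 :- a3) :* (a2 :- a3) :+ a3 :* a3)))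
          := uP a0 a1 a2 a3 :+ uP a0 a1 a2 a3) refl a0 a1 a2 a3)
        (cong₂ ℚ._+_ u≡0 u≡0)
      nn₀ : NonNegative (sq a3)
      nn₀ = square-nonNegative a3
      nn : ∀ p {s} → NonNegative s → NonNegative (sq p ℚ.+ s)
      nn p {s} s≥0 = ℚP.nonNeg+nonNeg⇒nonNeg (sq p) {{square-nonNegative p}} s {{s≥0}}
      drop : ∀ p s → NonNegative s → sq p ℚ.+ s ≡ 0ℚ → s ≡ 0ℚ
      drop p s s≥0 eq = trans (sym (ℚP.+-identityˡ s)) (trans (cong (ℚ._+ s) (sym (trans (cong₂ ℚ._*_ p≡0 p≡0) (ℚP.*-zeroˡ 0ℚ)))) eq)
        where p≡0 = sum-of-squares p s s≥0 eq
      e₁ = drop a0 _ (nn (a0 ℚ.- a1) (nn (a1 ℚ.- a2) (nn (a2 ℚ.- a3) nn₀))) squares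
      e₂ = drop (a0 ℚ.- a1) _ (nn (a1 ℚ.- a2) (nn (a2 ℚ.- a3) nn₀)) e₁
      e₃ = drop (a1 ℚ.- a2) _ (nn (a2 ℚ.- a3) nn₀) e₂
      a0≡0 = sum-of-squares a0 _ (nn (a0 ℚ.- a1) (nn (a1 ℚ.- a2) (nn (a2 ℚ.- a3) nn₀))) squares
      next : ∀ {p q} → p ≡ 0ℚ → p ℚ.- q ≡ 0ℚ → q ≡ 0ℚ
      next {p} {q} p≡0 p-q≡0 = trans (solve 2 (λ p q → q := p :- (p :- q)) refl p q) (trans (cong₂ ℚ._-_ p≡0 p-q≡0) (ℚP.+-inverseʳ 0ℚ))
      a1≡0 = next a0≡0 (sum-of-squares (a0 ℚ.- a1) _ (nn (a1 ℚ.- a2) (nn (a2 ℚ.- a3) nn₀)) e₁)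
      a2≡0 = next a1≡0 (sum-of-squares (a1 ℚ.- a2) _ (nn (a2 ℚ.- a3) nn₀) e₂)
      a3≡0 = next a2≡0 (sum-of-squares (a2 ℚ.- a3) _ nn₀ e₃)

  K-inverse : ∀ a → a ≢ 0K → Σ K λ b → b *K a ≡ 1K
  K-inverse a@(mkK a0 a1 a2 a3) a≢0 = ofℚ q *K c , go a c norm q (a*cofactor) (1/-inverse norm≢0)
    where
    open Norm a0 a1 a2 a3 using (norm; norm-zero; a*cofactor) renaming (cofactor to c)
    norm≢0 : norm ≢ 0ℚ
    norm≢0 eq = a≢0 (norm-zero eq)
    q = ℚ.1/_ norm {{ℚ.≢-nonZero norm≢0}}
    ofℚ-* : ∀ p q → ofℚ p *K ofℚ q ≡ ofℚ (p ℚ.* q)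
    ofℚ-* p q = mkK-cong
      (solve 2 (λ p q → p0 (oP p :⊗ oP q) := p :* q) refl p q) (solve 2 (λ p q → p1 (oP p :⊗ oP q) := con (+ 0)) refl p q)
      (solve 2 (λ p q → p2 (oP p :⊗ oP q) := con (+ 0)) refl p q) (solve 2 (λ p q → p3 (oP p :⊗ oP q) := con (+ 0)) refl p q)
      where
      open KPolynomial
      oP : ∀ {n} → Polynomial n → KPolynomial n
      oP p = mkP p (con (+ 0)) (con (+ 0)) (con (+ 0))
    go : ∀ a c n q → a *K c ≡ ofℚ n → q ℚ.* n ≡ 1ℚ → ofℚ q *K c *K a ≡ 1K
    go a c n q ac qn = trans (K-assoc (ofℚ q) c a) (trans (cong (λ z → ofℚ q *K z) (trans (K-comm c a) ac)) (trans (ofℚ-* q n) (cong ofℚ qn)))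

  -- Needed to read the fifth roots of unity off the factorisation of `z⁵ - 1`.
  no-zero-divisors : ∀ a b → a *K b ≡ 0K → a ≢ 0K → b ≡ 0K
  no-zero-divisors a b ab≡0 a≢0 = let c , ca≡1 = K-inverse a a≢0 in go a b c ab≡0 ca≡1
    where
    go : ∀ a b c → a *K b ≡ 0K → c *K a ≡ 1K → b ≡ 0K
    go a b c ab≡0 ca≡1 = trans (sym (K-identityˡ b)) (trans (cong (_*K b) (sym ca≡1)) (trans (K-assoc c a b) (trans (cong (λ z → c *K z) ab≡0)
      (zeroʳ c))))
      where open IsCommutativeRing K-isCommutativeRing using (zeroʳ)

  abstract
    _≟K_ : (a b : K) → Dec (a ≡ b)
    mkK a0 a1 a2 a3 ≟K mkK b0 b1 b2 b3 with a0 ℚ.≟ b0 | a1 ℚ.≟ b1 | a2 ℚ.≟ b2 | a3 ℚ.≟ b3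
    ... | yes refl | yes refl | yes refl | yes refl = yes refl
    ... | no n | _ | _ | _ = no λ e → n (cong k0 e)
    ... | yes _ | no n | _ | _ = no λ e → n (cong k1 e)
    ... | yes _ | yes _ | no n | _ = no λ e → n (cong k2 e)
    ... | yes _ | yes _ | yes _ | no n = no λ e → n (cong k3 e)

-- The primitive fifth roots of unity.

module FifthRootsOfUnity where
  open import Defs
  open CyclotomicField
  open ≡ using (refl; sym; trans)

  -- The operations of K are hidden: unfolding them to rational coordinates makes conversion checking explode.
  infixl 6 _+ₖ_
  infixl 7 _*ₖ_
  infix 8 -ₖ_

  abstract
    _+ₖ_ _*ₖ_ : K → K → K
    _+ₖ_ = _+K_
    _*ₖ_ = _*K_

    -ₖ_ : K → K
    -ₖ a = -K a

    invₖ : K → K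
    invₖ = invK

    invₖ≡ : ∀ a → invₖ a ≡ invK a
    invₖ≡ a = refl

    +ₖ≡ : ∀ a b → a +ₖ b ≡ a +K b
    +ₖ≡ a b = refl

    *ₖ≡ : ∀ a b → a *ₖ b ≡ a *K b
    *ₖ≡ a b = refl

    -ₖ≡ : ∀ a → -ₖ a ≡ -K a
    -ₖ≡ a = refl

    *ₖ-isCommutativeRing : IsCommutativeRing _≡_ _+ₖ_ _*ₖ_ -ₖ_ 0K 1K
    *ₖ-isCommutativeRing = K-isCommutativeRing

  𝓚 : CoefficientRing
  𝓚 = record { Carrier = K ; _+_ = _+ₖ_ ; _*_ = _*ₖ_ ; -_ = -ₖ_ ; 0# = 0K ; 1# = 1K ; isCommutativeRing = *ₖ-isCommutativeRing }

  pow : K → ℕ → K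
  pow a zero = 1K
  pow a (suc n) = a *ₖ pow a n

  pow≡ : ∀ a n → pow a n ≡ a ^K n
  pow≡ a zero = refl
  pow≡ a (suc n) = trans (*ₖ≡ a (pow a n)) (cong (λ b → a *K b) (pow≡ a n))

  module FifthPowers (𝓡 : CoefficientRing) where
    open CoefficientRing 𝓡
    open IntegerCoefficientSolver commutativeRing
    private module R = CommutativeRing commutativeRing

    factorisation : ∀ r z → 1# + r + r * r + r * r * r + r * r * r * r ≡ 0# →
      (z + - 1#) * ((z + - r) * ((z + - (r * r)) * ((z + - (r * r * r)) * (z + - (r * r * r * r))))) ≡ z * (z * (z * (z * (z * 1#)))) + - 1#
    factorisation r z Φ≡0 = trans
      (solve 2 (λ r z → (z :+ :- con (+ 1)) :* ((z :+ :- r) :* ((z :+ :- (r :* r)) :* ((z :+ :- (r :* r :* r)) :* (z :+ :- (r :* r :* r :* r)))))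
          := (z :* (z :* (z :* (z :* (z :* con (+ 1))))) :+ :- con (+ 1)) :+ (con (+ 1) :+ r :+ r :* r :+ r :* r :* r :+ r :* r :* r :* r) :* (con (+ 1) :+ con -[1+ 0 ] :* z :* z :* z :* z :+ con -[1+ 0 ] :* r :+ con (+ 1) :* r :* z :* z :* z :+ con -[1+ 0 ] :* r :* r :* r :* z :* z :+ con (+ 1) :* r :* r :* r :* z :* z :* z :+ con (+ 1) :* r :* r :* r :* r :* r :+ con -[1+ 0 ] :* r :* r :* r :* r :* r :* z :* z :+ con -[1+ 0 ] :* r :* r :* r :* r :* r :* r :+ con (+ 1) :* r :* r :* r :* r :* r :* r :* z)) refl r z)
      (trans (R.+-congˡ (trans (R.*-congʳ Φ≡0) (R.zeroˡ _))) (R.+-identityʳ _))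

    difference-zero : ∀ {x y} → x + - y ≡ 0# → x ≡ y
    difference-zero = x∙y⁻¹≈ε⇒x≈y _ _
      where open import Algebra.Properties.Group R.+-group using (x∙y⁻¹≈ε⇒x≈y)

  -- The few values of `invₖ` that occur. The inverse branches on a decision about rational numbers,
  -- so these facts are obtained by evaluation at each of the four concrete roots.
  record IsFifthRoot (ζ : K) : Set where
    field
      cyclotomic : 1K +ₖ ζ +ₖ ζ *ₖ ζ +ₖ ζ *ₖ ζ *ₖ ζ +ₖ ζ *ₖ ζ *ₖ ζ *ₖ ζ ≡ 0K
      inverse : invₖ ζ ≡ ζ *ₖ ζ *ₖ ζ *ₖ ζ
      ζ-inverse : ζ *ₖ invₖ ζ ≡ 1K
      double-inverse : invₖ (invₖ ζ) ≡ ζ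
      1-ζ-inverse : (1K +ₖ -ₖ ζ) *ₖ invₖ (1K +ₖ -ₖ ζ) ≡ 1K
      1-ζ⁻¹-inverse : (1K +ₖ -ₖ invₖ ζ) *ₖ invₖ (1K +ₖ -ₖ invₖ ζ) ≡ 1K

  private
    unit : ∀ {r u v} → 1K -K r ≡ u → invK u ≡ v → u *K v ≡ 1K → (1K +ₖ -ₖ r) *ₖ invₖ (1K +ₖ -ₖ r) ≡ 1K
    unit {r} {u} e i p = trans (cong (λ a → a *ₖ invₖ a) (trans (+ₖ≡ 1K (-ₖ r)) (trans (cong (λ a → 1K +K a) (-ₖ≡ r)) e)))
      (trans (*ₖ≡ u (invₖ u)) (trans (cong (λ a → u *K a) (trans (invₖ≡ u) i)) p))

    -- For a root `r` the inverse of `1 - r` is `(4 + 3r + 2r² + r³)/5`, because the product with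
    -- `1 - r` is `4 - r - r² - r³ - r⁴ = 5`. Each `v` is this element in the basis of `K`.
    r₁ u₁ v₁ : K
    r₁ = mkK 0ℚ 1ℚ 0ℚ 0ℚ
    u₁ = mkK 1ℚ (ℚ.- 1ℚ) 0ℚ 0ℚ
    v₁ = mkK ((+ 4) ℚ./ 5) ((+ 3) ℚ./ 5) ((+ 2) ℚ./ 5) ((+ 1) ℚ./ 5)

    r₂ u₂ v₂ : K
    r₂ = mkK 0ℚ 0ℚ 1ℚ 0ℚ
    u₂ = mkK 1ℚ 0ℚ (ℚ.- 1ℚ) 0ℚ
    v₂ = mkK ((+ 2) ℚ./ 5) (-[1+ 0 ] ℚ./ 5) ((+ 1) ℚ./ 5) (-[1+ 1 ] ℚ./ 5)

    r₃ u₃ v₃ : K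
    r₃ = mkK 0ℚ 0ℚ 0ℚ 1ℚ
    u₃ = mkK 1ℚ 0ℚ 0ℚ (ℚ.- 1ℚ)
    v₃ = mkK ((+ 3) ℚ./ 5) ((+ 1) ℚ./ 5) (-[1+ 0 ] ℚ./ 5) ((+ 2) ℚ./ 5)

    r₄ u₄ v₄ : K
    r₄ = mkK (ℚ.- 1ℚ) (ℚ.- 1ℚ) (ℚ.- 1ℚ) (ℚ.- 1ℚ)
    u₄ = mkK (1ℚ ℚ.+ 1ℚ) 1ℚ 1ℚ 1ℚ
    v₄ = mkK ((+ 1) ℚ./ 5) (-[1+ 2 ] ℚ./ 5) (-[1+ 1 ] ℚ./ 5) (-[1+ 0 ] ℚ./ 5)

    inverse₁ : invₖ r₁ ≡ r₄
    inverse₁ = trans (invₖ≡ r₁) refl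

    1-r₁ : 1K -K r₁ ≡ u₁
    1-r₁ = refl

    invK-u₁ : invK u₁ ≡ v₁
    invK-u₁ = refl

    u*v₁ : u₁ *K v₁ ≡ 1K
    u*v₁ = refl

    unit₁ : (1K +ₖ -ₖ r₁) *ₖ invₖ (1K +ₖ -ₖ r₁) ≡ 1K
    unit₁ = unit 1-r₁ invK-u₁ u*v₁

    inverse₂ : invₖ r₂ ≡ r₃
    inverse₂ = trans (invₖ≡ r₂) refl

    1-r₂ : 1K -K r₂ ≡ u₂
    1-r₂ = refl

    invK-u₂ : invK u₂ ≡ v₂
    invK-u₂ = refl

    u*v₂ : u₂ *K v₂ ≡ 1K
    u*v₂ = refl

    unit₂ : (1K +ₖ -ₖ r₂) *ₖ invₖ (1K +ₖ -ₖ r₂) ≡ 1K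
    unit₂ = unit 1-r₂ invK-u₂ u*v₂

    inverse₃ : invₖ r₃ ≡ r₂
    inverse₃ = trans (invₖ≡ r₃) refl

    1-r₃ : 1K -K r₃ ≡ u₃
    1-r₃ = refl

    invK-u₃ : invK u₃ ≡ v₃
    invK-u₃ = refl

    u*v₃ : u₃ *K v₃ ≡ 1K
    u*v₃ = refl

    unit₃ : (1K +ₖ -ₖ r₃) *ₖ invₖ (1K +ₖ -ₖ r₃) ≡ 1K
    unit₃ = unit 1-r₃ invK-u₃ u*v₃

    inverse₄ : invₖ r₄ ≡ r₁
    inverse₄ = trans (invₖ≡ r₄) refl

    1-r₄ : 1K -K r₄ ≡ u₄
    1-r₄ = refl

    invK-u₄ : invK u₄ ≡ v₄
    invK-u₄ = refl

    u*v₄ : u₄ *K v₄ ≡ 1K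
    u*v₄ = refl

    unit₄ : (1K +ₖ -ₖ r₄) *ₖ invₖ (1K +ₖ -ₖ r₄) ≡ 1K
    unit₄ = unit 1-r₄ invK-u₄ u*v₄

    p1₁ : r₁ *K r₁ ≡ r₂
    p1₁ = refl

    p2₁ : r₂ *K r₁ ≡ r₃
    p2₁ = refl

    p3₁ : r₃ *K r₁ ≡ r₄
    p3₁ = refl

    p4₁ : r₄ *K r₁ ≡ 1K
    p4₁ = refl

    p1₂ : r₂ *K r₂ ≡ r₄
    p1₂ = refl

    p2₂ : r₄ *K r₂ ≡ r₁
    p2₂ = refl

    p3₂ : r₁ *K r₂ ≡ r₃
    p3₂ = refl

    p4₂ : r₃ *K r₂ ≡ 1K
    p4₂ = refl

    p1₃ : r₃ *K r₃ ≡ r₁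
    p1₃ = refl

    p2₃ : r₁ *K r₃ ≡ r₄
    p2₃ = refl

    p3₃ : r₄ *K r₃ ≡ r₂
    p3₃ = refl

    p4₃ : r₂ *K r₃ ≡ 1K
    p4₃ = refl

    p1₄ : r₄ *K r₄ ≡ r₃
    p1₄ = refl

    p2₄ : r₃ *K r₄ ≡ r₂
    p2₄ = refl

    p3₄ : r₂ *K r₄ ≡ r₁
    p3₄ = refl

    p4₄ : r₁ *K r₄ ≡ 1K
    p4₄ = refl

    root : ∀ ζ ζ⁻ ζ² ζ³ ζ⁴ → ζ *K ζ ≡ ζ² → ζ² *K ζ ≡ ζ³ → ζ³ *K ζ ≡ ζ⁴ → ζ⁴ *K ζ ≡ 1K → 1K +K ζ +K ζ² +K ζ³ +K ζ⁴ ≡ 0K →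
      invₖ ζ ≡ ζ⁻ → invₖ ζ⁻ ≡ ζ → ζ⁻ ≡ ζ⁴ → (1K +ₖ -ₖ ζ) *ₖ invₖ (1K +ₖ -ₖ ζ) ≡ 1K → (1K +ₖ -ₖ ζ⁻) *ₖ invₖ (1K +ₖ -ₖ ζ⁻) ≡ 1K → IsFifthRoot ζ
    root ζ ζ⁻ ζ² ζ³ ζ⁴ e₂ e₃ e₄ e₅ sum i₁ i₂ refl w₁ w₂ = record
      { cyclotomic = trans (trans (+ₖ≡ _ _) (cong₂ _+K_ (trans (+ₖ≡ _ _) (cong₂ _+K_ (trans (+ₖ≡ _ _) (cong₂ _+K_ (+ₖ≡ 1K ζ) f₂)) f₃)) f₄)) sum
      ; inverse = trans i₁ (sym f₄)
      ; ζ-inverse = trans (*ₖ≡ ζ (invₖ ζ)) (trans (cong (λ a → ζ *K a) i₁) (trans (K-comm ζ ζ⁻) e₅))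
      ; double-inverse = trans (cong invₖ i₁) i₂
      ; 1-ζ-inverse = w₁
      ; 1-ζ⁻¹-inverse = trans (cong (λ a → (1K +ₖ -ₖ a) *ₖ invₖ (1K +ₖ -ₖ a)) i₁) w₂ }
      where
      f₂ : ζ *ₖ ζ ≡ ζ²
      f₂ = trans (*ₖ≡ ζ ζ) e₂
      f₃ : ζ *ₖ ζ *ₖ ζ ≡ ζ³
      f₃ = trans (*ₖ≡ _ ζ) (trans (cong (λ a → a *K ζ) f₂) e₃)
      f₄ : ζ *ₖ ζ *ₖ ζ *ₖ ζ ≡ ζ⁴
      f₄ = trans (*ₖ≡ _ ζ) (trans (cong (λ a → a *K ζ) f₃) e₄)

    sum₁ : 1K +K r₁ +K r₂ +K r₃ +K r₄ ≡ 0K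
    sum₁ = refl

    root₁ : IsFifthRoot r₁
    root₁ = root r₁ r₄ r₂ r₃ r₄ p1₁ p2₁ p3₁ p4₁ sum₁ inverse₁ inverse₄ refl unit₁ unit₄

    sum₂ : 1K +K r₂ +K r₄ +K r₁ +K r₃ ≡ 0K
    sum₂ = refl

    root₂ : IsFifthRoot r₂
    root₂ = root r₂ r₃ r₄ r₁ r₃ p1₂ p2₂ p3₂ p4₂ sum₂ inverse₂ inverse₃ refl unit₂ unit₃

    sum₃ : 1K +K r₃ +K r₁ +K r₄ +K r₂ ≡ 0K
    sum₃ = refl

    root₃ : IsFifthRoot r₃
    root₃ = root r₃ r₂ r₁ r₄ r₂ p1₃ p2₃ p3₃ p4₃ sum₃ inverse₃ inverse₂ refl unit₃ unit₂

    sum₄ : 1K +K r₄ +K r₃ +K r₂ +K r₁ ≡ 0K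
    sum₄ = refl

    root₄ : IsFifthRoot r₄
    root₄ = root r₄ r₁ r₃ r₂ r₁ p1₄ p2₄ p3₄ p4₄ sum₄ inverse₄ inverse₁ refl unit₄ unit₁

    open FifthPowers 𝓚

    zero-product : ∀ a b → a *ₖ b ≡ 0K → a ≢ 0K → b ≡ 0K
    zero-product a b ab≡0 = no-zero-divisors a b (trans (sym (*ₖ≡ a b)) ab≡0)

    search : ∀ (r : ℕ → K) ζ → pow ζ 5 ≡ 1K → ζ ≢ 1K →
      (ζ +ₖ -ₖ 1K) *ₖ ((ζ +ₖ -ₖ r 1) *ₖ ((ζ +ₖ -ₖ r 2) *ₖ ((ζ +ₖ -ₖ r 3) *ₖ (ζ +ₖ -ₖ r 4)))) ≡ pow ζ 5 +ₖ -ₖ 1K →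
      Σ ℕ λ i → (1 ℕ.≤ i × i ℕ.≤ 4) × ζ ≡ r i
    search r ζ ζ⁵≡1 ζ≢1 eq = go₁ ((ζ +ₖ -ₖ r 1) ≟K 0K)
      where
      module R = CommutativeRing (CoefficientRing.commutativeRing 𝓚)
      d : ℕ → K
      d i = ζ +ₖ -ₖ r i
      e₁ : d 1 *ₖ (d 2 *ₖ (d 3 *ₖ d 4)) ≡ 0K
      e₁ = zero-product (ζ +ₖ -ₖ 1K) (d 1 *ₖ (d 2 *ₖ (d 3 *ₖ d 4))) (trans eq (trans (cong (λ a → a +ₖ -ₖ 1K) ζ⁵≡1) (R.-‿inverseʳ 1K)))
        (λ e → ζ≢1 (difference-zero e))
      go₄ : d 4 ≡ 0K → Σ ℕ λ i → (1 ℕ.≤ i × i ℕ.≤ 4) × ζ ≡ r i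
      go₄ e = 4 , (s≤s z≤n , s≤s (s≤s (s≤s (s≤s z≤n)))) , difference-zero e
      go₃ : d 3 *ₖ d 4 ≡ 0K → Dec (d 3 ≡ 0K) → Σ ℕ λ i → (1 ℕ.≤ i × i ℕ.≤ 4) × ζ ≡ r i
      go₃ _ (yes e) = 3 , (s≤s z≤n , s≤s (s≤s (s≤s z≤n))) , difference-zero e
      go₃ p (no n) = go₄ (zero-product (d 3) (d 4) p n)
      go₂ : d 2 *ₖ (d 3 *ₖ d 4) ≡ 0K → Dec (d 2 ≡ 0K) → Σ ℕ λ i → (1 ℕ.≤ i × i ℕ.≤ 4) × ζ ≡ r i
      go₂ _ (yes e) = 2 , (s≤s z≤n , s≤s (s≤s z≤n)) , difference-zero e
      go₂ p (no n) = go₃ (zero-product (d 2) (d 3 *ₖ d 4) p n) (d 3 ≟K 0K)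
      go₁ : Dec (d 1 ≡ 0K) → Σ ℕ λ i → (1 ℕ.≤ i × i ℕ.≤ 4) × ζ ≡ r i
      go₁ (yes e) = 1 , (s≤s z≤n , s≤s z≤n) , difference-zero e
      go₁ (no n) = go₂ (zero-product (d 1) (d 2 *ₖ (d 3 *ₖ d 4)) e₁ n) (d 2 ≟K 0K)

    -- The powers are spelled with the opaque product, so that they are literally the factors in
    -- `factorisation`.
    rpow : ℕ → K
    rpow 1 = r₁
    rpow 2 = r₁ *ₖ r₁
    rpow 3 = r₁ *ₖ r₁ *ₖ r₁
    rpow _ = r₁ *ₖ r₁ *ₖ r₁ *ₖ r₁

    roots : ∀ i → 1 ℕ.≤ i → i ℕ.≤ 4 → IsFifthRoot (rpow i)
    roots 1 _ _ = root₁
    roots 2 _ _ = ≡.subst IsFifthRoot (sym r₂≡) root₂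
      where
      r₂≡ : r₁ *ₖ r₁ ≡ r₂
      r₂≡ = trans (*ₖ≡ r₁ r₁) p1₁
    roots 3 _ _ = ≡.subst IsFifthRoot (sym r₃≡) root₃
      where
      r₃≡ : r₁ *ₖ r₁ *ₖ r₁ ≡ r₃
      r₃≡ = trans (*ₖ≡ (r₁ *ₖ r₁) r₁) (trans (cong (λ a → a *K r₁) (trans (*ₖ≡ r₁ r₁) p1₁)) p2₁)
    roots 4 _ _ = ≡.subst IsFifthRoot (sym r₄≡) root₄
      where
      r₄≡ : r₁ *ₖ r₁ *ₖ r₁ *ₖ r₁ ≡ r₄
      r₄≡ = trans (*ₖ≡ (r₁ *ₖ r₁ *ₖ r₁) r₁) (trans (cong (λ a → a *K r₁)
        (trans (*ₖ≡ (r₁ *ₖ r₁) r₁) (trans (cong (λ a → a *K r₁) (trans (*ₖ≡ r₁ r₁) p1₁)) p2₁))) p3₁)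
    roots (suc (suc (suc (suc (suc _))))) _ (s≤s (s≤s (s≤s (s≤s ()))))

  -- K contains exactly the four primitive fifth roots of unity x, x², x³, x⁴.
  primitive⇒fifthRoot : ∀ ζ → PrimitiveRoot 5 ζ → IsFifthRoot ζ
  primitive⇒fifthRoot ζ (ζ⁵≡1 , ζʲ≢1) =
    let i , (1≤i , i≤4) , eq = search rpow ζ (trans (pow≡ ζ 5) ζ⁵≡1)
          (λ e → ζʲ≢1 1 (s≤s z≤n) (s≤s (s≤s z≤n)) (trans (sym (pow≡ ζ 1)) (trans (R.*-identityʳ ζ) e)))
          (factorisation r₁ ζ (IsFifthRoot.cyclotomic root₁))
    in ≡.subst IsFifthRoot (sym eq) (roots i 1≤i i≤4)
    where
    module R = CommutativeRing (CoefficientRing.commutativeRing 𝓚)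

-- Translation between the definitions of the statement and the abstract theory.

module Comparison where
  open import Defs
  open import Tactic.Cong using (cong!)
  open FifthRootsOfUnity
  open ≡ using (refl; sym; trans)

  module G = Components 𝓚
  open G using (_≈_)

  -- sumRange and convList are private to Defs.  Each of them is recovered as the solution of a metavariable:
  -- cong! finds a context in which two of their calls differ in one argument only.  The equation 0 ≡ 1 is never used.
  module PrivateSum where
    -- At 0 and 1 everything collapses to `0K`, so the context found by `cong!` is well typed
    -- although `p` does not relate the two calls. At a variable it is neutral and keeps the private
    -- call in view for unification.
    guard : ℕ → K → K
    guard 0 x = 0K
    guard 1 x = 0K
    guard (suc (suc _)) x = x

    upper upper′ lower′ : (ℤ → LS) → ℕ → K
    upper T N = coeffLS (T (+ suc N)) (+ N) +K coeffLS (T -[1+ N ]) (+ N)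
    upper′ T N = coeffLS (T (+ suc (suc N))) (+ suc N) +K coeffLS (T -[1+ suc N ]) (+ suc N)
    lower′ T N = coeffLS (T (+ suc N)) (+ suc N) +K coeffLS (T -[1+ N ]) (+ suc N)

    calls : ∀ {T N} {x y : K} → bilateralSum T N ≡ upper T N +K x → bilateralSum T (suc N) ≡ upper′ T N +K (lower′ T N +K y) →
      guard 0 x ≡ guard 1 y → guard 0 x ≡ guard 1 y
    calls _ _ p = p

    context : (T : ℤ → LS) (N : ℕ) → 0 ≡ 1 → 0K ≡ 0K
    context T N p = calls {T} {N} refl refl (cong! p)

    mutual
      range : (ℤ → LS) → ℕ → ℕ → K
      range = _

      range-solution : ∀ T N (p : 0 ≡ 1) → cong (λ φ → guard φ (range T φ N)) p ≡ context T N p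
      range-solution T N p = refl

    bilateralSum≡ : ∀ T N → bilateralSum T N ≡ range T N (suc N)
    bilateralSum≡ T N = refl

    range-suc : ∀ T N b → range T N (suc b) ≡ coeffLS (T (+ suc b)) (+ N) +K coeffLS (T -[1+ b ]) (+ N) +K range T N b
    range-suc T N b = refl

    range-zero : ∀ T N → range T N zero ≡ coeffLS (T (+ 0)) (+ N)
    range-zero T N = refl

  module PrivateConvolution where
    zeros ones : PS
    zeros _ = 0K
    ones _ = 1K

    guard : ℤ → K → K
    guard (+ 0) x = 0K
    guard (+ 1) x = 0K
    guard _ x = x

    guardPS : PS → K → K
    guardPS f x = guard (ℚ.ℚ.numerator (k0 (f 0))) x

    calls : ∀ {f n} {x y : K} → invPS f (suc n) ≡ -K (invK (f 0) *K x) →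
      invPS f (suc (suc n)) ≡ -K (invK (f 0) *K (f 1 *K invPS f (suc n) +K y)) → guardPS zeros x ≡ guardPS ones y → guardPS zeros x ≡ guardPS ones y
    calls _ _ p = p

    context : (f : PS) (n : ℕ) → zeros ≡ ones → 0K ≡ 0K
    context f n p = calls {f} {n} refl refl (cong! p)

    mutual
      conv : PS → PS → ℕ → K
      conv = _

      conv-solution : ∀ f n (p : zeros ≡ ones) → cong (λ φ → guardPS φ (conv φ f n)) p ≡ context f n p
      conv-solution f n p = refl

    invPS-suc : ∀ f n → invPS f (suc n) ≡ -K (invK (f 0) *K conv f f n)
    invPS-suc f n = refl

    conv-suc : ∀ g f n → conv g f (suc n) ≡ g 1 *K invPS f (suc n) +K conv (λ m → g (suc m)) f n
    conv-suc g f n = refl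

    conv-zero : ∀ g f → conv g f zero ≡ g 1 *K invPS f zero +K 0K
    conv-zero g f = refl

    invPS-zero : ∀ f → invPS f zero ≡ invK (f 0)
    invPS-zero f = refl

  private module R = CommutativeRing (CoefficientRing.commutativeRing 𝓚)

  +ₖ-≡ : ∀ {a a′ b b′} → a ≡ a′ → b ≡ b′ → a +K b ≡ a′ +ₖ b′
  +ₖ-≡ {a} {_} {b} refl refl = sym (+ₖ≡ a b)

  *ₖ-≡ : ∀ {a a′ b b′} → a ≡ a′ → b ≡ b′ → a *K b ≡ a′ *ₖ b′
  *ₖ-≡ {a} {_} {b} refl refl = sym (*ₖ≡ a b)

  -ₖ-≡ : ∀ {a a′} → a ≡ a′ → -K a ≡ -ₖ a′
  -ₖ-≡ {a} refl = sym (-ₖ≡ a)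

  ⊕≈ : ∀ {f f′ g g′} → f ≈ f′ → g ≈ g′ → f ⊕ g ≈ f′ G.⊕ g′
  ⊕≈ p q n = +ₖ-≡ (p n) (q n)

  ⊖≈ : ∀ {f f′ g g′} → f ≈ f′ → g ≈ g′ → f ⊖ g ≈ f′ G.⊖ g′
  ⊖≈ p q n = +ₖ-≡ (p n) (-ₖ-≡ (q n))

  ⊛≈ : ∀ {f f′ g g′} → f ≈ f′ → g ≈ g′ → f ⊛ g ≈ f′ G.⊛ g′
  ⊛≈ p q zero = *ₖ-≡ (p 0) (q 0)
  ⊛≈ p q (suc n) = +ₖ-≡ (*ₖ-≡ (p 0) (q (suc n))) (⊛≈ (λ m → p (suc m)) q n)

  constPS≈ : ∀ a → constPS a ≈ G.const a
  constPS≈ a zero = refl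
  constPS≈ a (suc n) = refl

  scalePS≈ : ∀ {a a′ f f′} → a ≡ a′ → f ≈ f′ → scalePS a f ≈ G.const a′ G.⊛ f′
  scalePS≈ {a′ = a′} {f′ = f′} p q n = trans (*ₖ-≡ p (q n)) (sym (G.const-⊛ a′ f′ n))

  shiftPS≈ : ∀ j {f f′} → f ≈ f′ → shiftPS j f ≈ G.X j G.⊛ f′
  shiftPS≈ j {f} {f′} p = G.S.trans (lemma j p) (G.shift≈X⊛ j f′)
    where
    lemma : ∀ j {f f′} → f ≈ f′ → shiftPS j f ≈ G.shift j f′
    lemma zero p n = p n
    lemma (suc j) p zero = refl
    lemma (suc j) p (suc n) = lemma j p n

  mono≈ : ∀ a j → mono a j ≈ G.const a G.⊛ G.X j
  mono≈ a j = G.S.trans (shiftPS≈ j (constPS≈ a)) (G.S.*-comm (G.X j) (G.const a))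

  prodUpTo≈ : ∀ {F F′ : ℕ → PS} → (∀ j → F j ≈ F′ j) → ∀ n → prodUpTo F n ≈ G.prodUpTo F′ n
  prodUpTo≈ p zero = p 0
  prodUpTo≈ p (suc n) = ⊛≈ (prodUpTo≈ p n) (p (suc n))

  poch≈ : ∀ a m → poch a m ≈ G.Poch (-ₖ 1K) a m
  poch≈ a m N = prodUpTo≈ {λ j → onePS ⊖ mono 1K (a ℕ.+ j ℕ.* m)} {G.factor (-ₖ 1K) a m}
    (λ j → G.S.trans (⊖≈ (constPS≈ 1K) (G.S.trans (mono≈ 1K (a ℕ.+ j ℕ.* m)) (G.S.*-identityˡ (G.X (a ℕ.+ j ℕ.* m)))))
      (G.S.+-congˡ {G.𝟙} (G.S.sym (G.mono-neg (a ℕ.+ j ℕ.* m))))) N N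

  theta≈ : ∀ a m → theta a m ≈ G.[ a ⨾ m ]
  theta≈ a m = ⊛≈ (poch≈ a m) (poch≈ (m ∸ a) m)

  dil-step : ∀ f n → dil 5 f (5 ℕ.+ n) ≡ dil 5 (λ m → f (suc m)) n
  dil-step f n with (5 ℕ.+ n) ℕ.% 5 ℕ.≟ 0 | n ℕ.% 5 ℕ.≟ 0
  ... | yes p | yes q = cong f (ℕDM.m/n≡1+[m∸n]/n {5 ℕ.+ n} {5} (ℕP.m≤m+n 5 n))
  ... | no p | no q = refl
  ... | yes p | no q = contradiction (trans (sym (ℕDM.[m+n]%n≡m%n n 5)) (trans (cong (ℕ._% 5) (ℕP.+-comm n 5)) p)) q
  ... | no p | yes q = contradiction (trans (cong (ℕ._% 5) (ℕP.+-comm 5 n)) (trans (ℕDM.[m+n]%n≡m%n n 5) q)) p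

  dil≈ : ∀ {f f′} → f ≈ f′ → dil 5 f ≈ G.D f′
  dil≈ p 0 = p 0
  dil≈ p 1 = refl
  dil≈ p 2 = refl
  dil≈ p 3 = refl
  dil≈ p 4 = refl
  dil≈ {f} p (suc (suc (suc (suc (suc n))))) = trans (dil-step f n) (dil≈ (λ m → p (suc m)) n)

  open PrivateConvolution using (conv; conv-suc; conv-zero; invPS-suc; invPS-zero)

  conv≡ : ∀ g f n → conv g f n ≡ (G.tail g G.⊛ invPS f) n
  conv≡ g f zero = trans (conv-zero g f) (trans (+ₖ-≡ (*ₖ-≡ refl refl) refl) (R.+-identityʳ _))
  conv≡ g f (suc n) = trans (conv-suc g f n) (+ₖ-≡ (*ₖ-≡ refl refl) (conv≡ (λ m → g (suc m)) f n))

  -- The recursion of `invPS` is the vanishing of the higher coefficients of the product. The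
  -- constant term is passed as a separate `a`, so that `invK` is not evaluated on a compound term.
  invPS-inverse : ∀ {f f′ a} → f ≈ f′ → f 0 ≡ a → a *ₖ invₖ a ≡ 1K → f′ G.⊛ invPS f ≈ G.𝟙
  invPS-inverse {f} {f′} {a} f≈ f0≡a unit = G.S.trans (G.S.*-congʳ {invPS f} {f′} {f} (λ n → sym (f≈ n))) inverse
    where
    head : f 0 *ₖ invₖ (f 0) ≡ 1K
    head = trans (cong (λ b → b *ₖ invₖ b) f0≡a) unit

    cancel : ∀ a i c → a *ₖ i ≡ 1K → a *ₖ (-ₖ (i *ₖ c)) +ₖ c ≡ 0K
    cancel a i c p = trans (solve 3 (λ a i c → a :* (:- (i :* c)) :+ c := (:- (a :* i :- con (+ 1))) :* c) refl a i c)
      (trans (cong (λ x → -ₖ (x +ₖ -ₖ 1K) *ₖ c) p) (solve 1 (λ c → (:- (con (+ 1) :- con (+ 1))) :* c := con (+ 0)) refl c))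
      where open IntegerCoefficientSolver (CoefficientRing.commutativeRing 𝓚)

    inverse : f G.⊛ invPS f ≈ G.𝟙
    inverse zero = trans (cong (λ b → f 0 *ₖ b) (trans (invPS-zero f) (sym (invₖ≡ (f 0))))) head
    inverse (suc n) = trans (cong₂ (λ b c → f 0 *ₖ b +ₖ c)
        (trans (invPS-suc f n) (-ₖ-≡ (*ₖ-≡ (sym (invₖ≡ (f 0))) refl))) (sym (conv≡ f f n)))
      (cancel (f 0) (invₖ (f 0)) (conv f f n) head)

  unit-1 : 1K *ₖ invₖ 1K ≡ 1K
  unit-1 = trans (cong (λ b → 1K *ₖ b) (trans (invₖ≡ 1K) refl)) (R.*-identityˡ 1K)

  inverse-of-product : ∀ {f f′} → f ≈ f′ → f′ 0 ≡ 1K → f′ G.⊛ invPS f ≈ G.𝟙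
  inverse-of-product p q = invPS-inverse p (trans (p 0) q) unit-1

  coefficients : ℤ → PS → PS
  coefficients s f N = coeffLS (mkLS s f) (+ N)

  coefficients-cong : ∀ s {f g} → f ≈ g → coefficients s f ≈ coefficients s g
  coefficients-cong s p N with + N ℤ.- s
  ... | + k = p k
  ... | -[1+ _ ] = refl

  -- `coeffLS` is read only at natural exponents and would drop a polar part. Here the factor `q^j`
  -- cancels the pole of `q^{d-j}`, so nothing is lost.
  coefficients-shift : ∀ d j {f} → coefficients (+ d ℤ.- + j) (G.shift j f) ≈ G.shift d f
  coefficients-shift d j {f} N with d ℕ.≤? N
  ... | yes d≤N = trans (cong (λ N → coefficients (+ d ℤ.- + j) (G.shift j f) N) (sym (ℕP.m+[n∸m]≡n d≤N)))
      (trans (lemma (N ∸ d)) (cong (G.shift d f) (ℕP.m+[n∸m]≡n d≤N)))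
    where
    lemma : ∀ i → coefficients (+ d ℤ.- + j) (G.shift j f) (d ℕ.+ i) ≡ G.shift d f (d ℕ.+ i)
    lemma i with + (d ℕ.+ i) ℤ.- (+ d ℤ.- + j) in eq
    ... | + k = trans (cong (G.shift j f) (sym (ℤP.+-injective (trans (sym (index d i j)) eq)))) (trans (G.shift-+ j f i) (sym (G.shift-+ d f i)))
      where
      index : ∀ d i j → + (d ℕ.+ i) ℤ.- (+ d ℤ.- + j) ≡ + (j ℕ.+ i)
      index d i j = solve 3 (λ d i j → d :+ i :- (d :- j) := j :+ i) refl (+ d) (+ i) (+ j)
        where open ℤSolver.+-*-Solver
    ... | -[1+ k ] with trans (sym eq) (index d i j)
      where
      index : ∀ d i j → + (d ℕ.+ i) ℤ.- (+ d ℤ.- + j) ≡ + (j ℕ.+ i)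
      index d i j = solve 3 (λ d i j → d :+ i :- (d :- j) := j :+ i) refl (+ d) (+ i) (+ j)
        where open ℤSolver.+-*-Solver
    ... | ()
  coefficients-shift d j {f} N | no d≰N with + N ℤ.- (+ d ℤ.- + j) in eq
  ... | -[1+ _ ] = sym (ord d f N (ℕP.≰⇒> d≰N))
    where
    ord : ∀ d f N → N < d → G.shift d f N ≡ 0K
    ord (suc d) f zero _ = refl
    ord (suc d) f (suc N) (s≤s p) = ord d f N p
  ... | + k = trans (ord j f k (ℕP.+-cancelʳ-< d k j (ℕP.<-≤-trans (ℕP.≤-reflexive (cong suc sum)) (small)))) (sym (ord d f N (ℕP.≰⇒> d≰N)))
    where
    ord : ∀ d f N → N < d → G.shift d f N ≡ 0K
    ord (suc d) f zero _ = refl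
    ord (suc d) f (suc N) (s≤s p) = ord d f N p
    sum : k ℕ.+ d ≡ N ℕ.+ j
    sum = ℤP.+-injective (trans (cong (ℤ._+ + d) (sym eq)) (solve 3 (λ N d j → N :- (d :- j) :+ d := N :+ j) refl (+ N) (+ d) (+ j)))
      where open ℤSolver.+-*-Solver
    small : suc (N ℕ.+ j) ≤ j ℕ.+ d
    small = ℕP.≤-trans (ℕP.+-monoˡ-≤ j (ℕP.≰⇒> d≰N)) (ℕP.≤-reflexive (ℕP.+-comm d j))

  -- 1/(1 - α q^n), as expanded in Defs
  geometric : K → ℤ → PS
  geometric α (+ n) = invPS (onePS ⊖ mono α n)
  geometric α -[1+ n ] = scalePS (-K (invK α)) (shiftPS (suc n) (invPS (onePS ⊖ mono (invK α) (suc n))))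

  geomInv≡ : ∀ α n → geomInv α n ≡ mkLS (+ 0) (geometric α n)
  geomInv≡ α (+ n) = refl
  geomInv≡ α -[1+ n ] = refl

  denominator≈ : ∀ α n → onePS ⊖ mono α n ≈ G.𝟙 G.⊖ G.const α G.⊛ G.X n
  denominator≈ α n = ⊖≈ (constPS≈ 1K) (mono≈ α n)

  denominator-inverse : ∀ α n → (1K +ₖ -ₖ α) *ₖ invₖ (1K +ₖ -ₖ α) ≡ 1K → (G.𝟙 G.⊖ G.const α G.⊛ G.X n) G.⊛ invPS (onePS ⊖ mono α n) ≈ G.𝟙
  denominator-inverse α zero unit = invPS-inverse (denominator≈ α zero)
    (trans (denominator≈ α zero 0) (cong (λ a → 1K +ₖ -ₖ a) (R.*-identityʳ α))) unit
  denominator-inverse α (suc n) _ = invPS-inverse (denominator≈ α (suc n))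
    (trans (denominator≈ α (suc n) 0) (trans (cong (λ a → 1K +ₖ -ₖ a) (R.zeroʳ α)) (trans (cong (λ a → 1K +ₖ a) -0#≈0#) (R.+-identityʳ 1K)))) unit-1
    where open import Algebra.Properties.Ring R.ring using (-0#≈0#)

  factored : ∀ α n → geometric α -[1+ n ] ≈ G.X (suc n) G.⊛ (G.const (-ₖ invₖ α) G.⊛ invPS (onePS ⊖ mono (invK α) (suc n)))
  factored α n = G.S.trans (scalePS≈ (-ₖ-≡ (sym (invₖ≡ α))) (shiftPS≈ (suc n) (λ _ → refl)))
    (solve 3 (λ a x j → a :* (x :* j) := x :* (a :* j)) G.S.refl (G.const (-ₖ invₖ α)) (G.X (suc n)) (invPS (onePS ⊖ mono (invK α) (suc n))))
    where open G.SS

  -- At a negative index the expansion is `-α⁻¹ q^m / (1 - α⁻¹ q^m)`. It meets the same cleared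
  -- equation as at natural indices, by `α α⁻¹ = 1` and the defining equation of the inner
  -- reciprocal.
  geometric-spec : ∀ α → α *ₖ invₖ α ≡ 1K → (1K +ₖ -ₖ α) *ₖ invₖ (1K +ₖ -ₖ α) ≡ 1K → G.Geometric α (geometric α)
  geometric-spec α _ unit a b (+ n) eq = G.from-difference
    (solve 5 (λ xa xb z x g → (xb :- z :* xa) :* g :- xb := xb :* ((con (+ 1) :- z :* x) :* g :- con (+ 1)) :+ (z :* g) :* (xb :* x :- xa))
      G.S.refl (G.X a) (G.X b) (G.const α) (G.X n) (geometric α (+ n)))
    (G.vanish {G.X b} (denominator-inverse α n unit) G.and G.vanish {G.const α G.⊛ geometric α (+ n)}
      (G.S.trans (G.X-⊛ b n) (G.X-≡ (sym (ℤP.+-injective eq)))))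
    where open G.SS
  geometric-spec α αα⁻≡1 _ a b -[1+ n ] eq = G.S.trans (G.S.*-congˡ {G.X b G.⊖ G.const α G.⊛ G.X a} (factored α n)) (G.from-difference
    (solve 7 (λ xa xb z z′ nz x j → (xb :- z :* xa) :* (x :* (nz :* j)) :- xb
        := (x :* nz :* j) :* (xb :- xa :* x) :+ ((xa :* x :* (x :- z) :* j) :* (nz :- (:- z′))
          :+ ((xa :* x :* j) :* (z :* z′ :- con (+ 1)) :+ ((xa :* x) :* ((con (+ 1) :- z′ :* x) :* j :- con (+ 1)) :+ (:- con (+ 1)) :* (xb :- xa :* x)))))
      G.S.refl (G.X a) (G.X b) (G.const α) (G.const (invₖ α)) (G.const (-ₖ invₖ α)) (G.X (suc n)) J)
    (G.vanish {G.X (suc n) G.⊛ G.const (-ₖ invₖ α) G.⊛ J} b≈ G.and G.vanish {G.X a G.⊛ G.X (suc n) G.⊛ (G.X (suc n) G.⊖ G.const α) G.⊛ J} negated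
      G.and G.vanish {G.X a G.⊛ G.X (suc n) G.⊛ J} (G.S.trans (G.const-* α (invₖ α)) (G.const-cong αα⁻≡1))
      G.and G.vanish {G.X a G.⊛ G.X (suc n)} J-inverse G.and G.vanish {G.⊝ G.𝟙} b≈))
    where
    open G.SS
    J = invPS (onePS ⊖ mono (invK α) (suc n))
    b≈ : G.X b ≈ G.X a G.⊛ G.X (suc n)
    b≈ = G.S.trans (G.X-≡ (ℤP.+-injective (trans (ℤsolve (+ b) (+ suc n)) (cong (ℤ._+ + suc n) (sym eq))))) (G.S.sym (G.X-⊛ a (suc n)))
      where
      ℤsolve : ∀ b n → b ≡ b ℤ.- n ℤ.+ n
      ℤsolve = Z.solve 2 (λ b n → b Z.:= b Z.:- n Z.:+ n) refl
        where module Z = ℤSolver.+-*-Solver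
    negated : G.const (-ₖ invₖ α) ≈ G.⊝ G.const (invₖ α)
    negated zero = refl
    negated (suc n) = sym -0#≈0#
      where open import Algebra.Properties.Ring R.ring using (-0#≈0#)
    J-inverse : (G.𝟙 G.⊖ G.const (invₖ α) G.⊛ G.X (suc n)) G.⊛ J ≈ G.𝟙
    J-inverse = G.S.trans (G.S.*-congʳ (G.S.+-congˡ {G.𝟙} (G.S.-‿cong (G.S.*-congʳ (G.const-cong (invₖ≡ α))))))
      (invPS-inverse (denominator≈ (invK α) (suc n)) (trans (denominator≈ (invK α) (suc n) 0) (trans (cong (λ a → 1K +ₖ -ₖ a) (R.zeroʳ (invK α)))
        (trans (cong (λ a → 1K +ₖ a) -0#≈0#) (R.+-identityʳ 1K)))) unit-1)
      where open import Algebra.Properties.Ring R.ring using (-0#≈0#)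

  -- The terms of both Lambert series are power series: with s = d + n, the poles of q^s G H cancel.
  record Regular (f : PS) (s : ℤ) (d : ℕ) : Set where
    constructor regular
    field
      d′ j : ℕ
      g : PS
      f≈ : f ≈ G.X j G.⊛ g
      s≡ : s ≡ + d′ ℤ.- + j
      d≤d′ : d ≤ d′

    coefficients≈ : coefficients s f ≈ G.X d′ G.⊛ g
    coefficients≈ = G.S.trans (coefficients-cong s (G.S.trans f≈ (G.S.sym (G.shift≈X⊛ j g))))
      (G.S.trans (λ N → cong (λ s → coefficients s (G.shift j g) N) s≡) (G.S.trans (coefficients-shift d′ j) (G.shift≈X⊛ d′ g)))

    coefficients-spec : ∀ a b → + a ≡ + b ℤ.+ s → G.X a G.⊛ f ≈ G.X b G.⊛ coefficients s f
    coefficients-spec a b eq = G.S.trans (G.S.*-congˡ {G.X a} f≈) (G.S.trans (G.S.sym (G.S.*-assoc (G.X a) (G.X j) g))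
      (G.S.trans (G.S.*-congʳ (G.S.trans (G.X-⊛ a j) (G.S.trans (G.X-≡ exponents) (G.S.sym (G.X-⊛ b d′)))))
      (G.S.trans (G.S.*-assoc (G.X b) (G.X d′) g) (G.S.*-congˡ {G.X b} (G.S.sym coefficients≈)))))
      where
      exponents : a ℕ.+ j ≡ b ℕ.+ d′
      exponents = ℤP.+-injective (trans (cong (ℤ._+ + j) (trans eq (cong (λ s → + b ℤ.+ s) s≡)))
        (solve 3 (λ b d j → b :+ (d :- j) :+ j := b :+ d) refl (+ b) (+ d′) (+ j)))
        where open ℤSolver.+-*-Solver

    coefficients-Ord : G.Ord d (coefficients s f)
    coefficients-Ord = G.Ord-≈ (G.S.sym coefficients≈) (G.Ord-⊛ˡ {G.X d′} (G.[]-mono d≤d′ (G.Ord-mono 1K d′)))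

  product-regular : ∀ ζ ξ n s d → s ≡ + d ℤ.+ n → Regular (geometric ζ n G.⊛ geometric ξ n) s d
  product-regular ζ ξ (+ n) s d eq = regular (d ℕ.+ n) 0 (geometric ζ (+ n) G.⊛ geometric ξ (+ n)) (G.S.sym (G.S.*-identityˡ (geometric ζ (+ n) G.⊛ geometric ξ (+ n))))
    (trans eq (sym (ℤP.+-identityʳ (+ (d ℕ.+ n))))) (ℕP.m≤m+n d n)
  product-regular ζ ξ -[1+ n ] s d eq = regular d (suc n) (g G.⊛ geometric ξ -[1+ n ])
    (G.S.trans (G.S.*-congʳ (factored ζ n)) (G.S.*-assoc (G.X (suc n)) g (geometric ξ -[1+ n ]))) eq ℕP.≤-refl
    where g = G.const (-ₖ invₖ ζ) G.⊛ invPS (onePS ⊖ mono (invK ζ) (suc n))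

  bilateral-hasSum : ∀ T → (∀ n → G.Ord (∣ n ∣ ∸ 1) (λ N → coeffLS (T n) (+ N))) → G.HasSum (λ n N → coeffLS (T n) (+ N)) (bilateralSum T)
  bilateral-hasSum T ord = G.hasSum-window (bilateralSum T) ord λ N → trans (bilateralSum≡ T N) (windowed N (suc N))
    where
    open PrivateSum
    windowed : ∀ N b → range T N b ≡ G.sumL (window b) (λ n N → coeffLS (T n) (+ N)) N
    windowed N zero = trans (range-zero T N) (sym (R.+-identityʳ _))
    windowed N (suc b) = trans (range-suc T N b) (trans (+ₖ-≡ (+ₖ-≡ refl refl) (windowed N b)) (R.+-assoc _ _ _))

  module Terms (ζ : K) where
    H : ℤ → PS
    H = geometric (invK ζ)

    G₀ : ℤ → PS
    G₀ = geometric ζ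

    product : ℤ → PS
    product n = G₀ n G.⊛ H n

    lambert≡ : ∀ s n → (λ N → coeffLS (qpow s ⊛L geomInv ζ n ⊛L geomInv (invK ζ) n) (+ N)) ≈ coefficients s (product n)
    lambert≡ s n N = trans (cong₂ (λ a b → coeffLS (qpow s ⊛L a ⊛L b) (+ N)) (geomInv≡ ζ n) (geomInv≡ (invK ζ) n))
      (trans (cong (λ s → coefficients s (onePS ⊛ G₀ n ⊛ H n) N) (trans (ℤP.+-identityʳ (s ℤ.+ + 0)) (ℤP.+-identityʳ s)))
        (coefficients-cong s {onePS ⊛ G₀ n ⊛ H n} (⊛≈ (G.S.trans (⊛≈ (constPS≈ 1K) (λ _ → refl)) (G.S.*-identityˡ (G₀ n))) (λ _ → refl)) N))

    t₁ t₂ : ℤ → PS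
    t₁ n N = coeffLS (term1 ζ n) (+ N)
    t₂ n N = coeffLS (term2 ζ n) (+ N)

    private
      exponent : ∀ k → LambertExponent (G.θexp 1 5 k) k
      exponent k = exactᵉ (G.θexpᵉ 1 5 k) (solve 1 (λ k → con (+ 1) :* (k :* (k :+ con (+ 1))) :+ con (+ 5) :* ((:- k) :* (:- k :+ con (+ 1)))
            := con (+ 2) :* (con (+ 3) :* k :* k :- con (+ 2) :* k)) refl k)
        where open ℤSolver.+-*-Solver

      regular₁ : ∀ n → Regular (product (+ 3 ℤ.* n)) (exponent₁ n) (G.θexp 1 5 n)
      regular₁ n = product-regular ζ (invK ζ) (+ 3 ℤ.* n) (exponent₁ n) (G.θexp 1 5 n) (LambertExponents.first-exponent {G.θexp 1 5 n} {n} (exponent n))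

      n+1-1 : ∀ n → n ℤ.+ + 1 ℤ.- + 1 ≡ n
      n+1-1 = solve 1 (λ n → n :+ con (+ 1) :- con (+ 1) := n) refl
        where open ℤSolver.+-*-Solver

      regular₂ : ∀ n → Regular (product (+ 3 ℤ.* n ℤ.+ + 1)) (exponent₂ n) (G.θexp 1 5 (n ℤ.+ + 1))
      regular₂ n = product-regular ζ (invK ζ) (+ 3 ℤ.* n ℤ.+ + 1) (exponent₂ n) (G.θexp 1 5 (n ℤ.+ + 1))
        (trans (cong exponent₂ (sym (n+1-1 n))) (trans (LambertExponents.second-exponent {G.θexp 1 5 (n ℤ.+ + 1)} {n ℤ.+ + 1} (exponent (n ℤ.+ + 1)))
          (cong (λ m → + G.θexp 1 5 (n ℤ.+ + 1) ℤ.+ (+ 3 ℤ.* m ℤ.+ + 1)) (n+1-1 n))))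

      ∣n∣∸1≤θexp : ∀ n → ∣ n ∣ ∸ 1 ≤ G.θexp 1 5 (n ℤ.+ + 1)
      ∣n∣∸1≤θexp (+ n) = ℕP.≤-trans (ℕP.m∸n≤m n 1) (ℕP.≤-trans (ℕP.m≤m+n n 1) (ℕP.≤-trans (n≤triangle (n ℕ.+ 1))
        (ℕP.≤-trans (ℕP.≤-reflexive (sym (ℕP.*-identityˡ (triangle (n ℕ.+ 1))))) (ℕP.m≤m+n _ _))))
      ∣n∣∸1≤θexp -[1+ zero ] = z≤n
      ∣n∣∸1≤θexp -[1+ suc n ] = ℕP.≤-trans (n≤triangle (suc n)) (ℕP.≤-trans (ℕP.m≤m+n (triangle (suc n)) _) (ℕP.m≤n+m _ (1 ℕ.* tri -[1+ n ])))

    t₁-spec : ∀ n a b → + a ≡ + b ℤ.+ exponent₁ n → G.X a G.⊛ product (+ 3 ℤ.* n) ≈ G.X b G.⊛ t₁ n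
    t₁-spec n a b eq = G.S.trans (Regular.coefficients-spec (regular₁ n) a b eq) (G.S.*-congˡ {G.X b} (G.S.sym (lambert≡ (exponent₁ n) (+ 3 ℤ.* n))))

    t₂-spec : ∀ n a b → + a ≡ + b ℤ.+ exponent₂ n → G.X a G.⊛ product (+ 3 ℤ.* n ℤ.+ + 1) ≈ G.X b G.⊛ t₂ n
    t₂-spec n a b eq = G.S.trans (Regular.coefficients-spec (regular₂ n) a b eq) (G.S.*-congˡ {G.X b} (G.S.sym (lambert≡ (exponent₂ n) (+ 3 ℤ.* n ℤ.+ + 1))))

    hasSum₁ : G.HasSum t₁ (bilateralSum (term1 ζ))
    hasSum₁ = bilateral-hasSum (term1 ζ) λ n → G.Ord-≈ (G.S.sym (lambert≡ (exponent₁ n) (+ 3 ℤ.* n)))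
      (G.[]-mono (G.∣i∣∸1≤θexp 1 5 n (s≤s z≤n)) (Regular.coefficients-Ord (regular₁ n)))

    hasSum₂ : G.HasSum t₂ (bilateralSum (term2 ζ))
    hasSum₂ = bilateral-hasSum (term2 ζ) λ n → G.Ord-≈ (G.S.sym (lambert≡ (exponent₂ n) (+ 3 ℤ.* n ℤ.+ + 1)))
      (G.[]-mono (∣n∣∸1≤θexp n) (Regular.coefficients-Ord (regular₂ n)))

  private
    2K 3K 5K : K
    2K = κ (+ 2)
    3K = κ (+ 3)
    5K = κ (+ 5)

    2≡ : 2K ≡ 1K +ₖ 1K
    2≡ = +ₖ-≡ {1K} {1K} {1K} {1K} refl refl

    3≡ : 3K ≡ 1K +ₖ 1K +ₖ 1K
    3≡ = +ₖ-≡ {2K} {1K +ₖ 1K} {1K} {1K} 2≡ refl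

    5≡ : 5K ≡ 1K +ₖ 1K +ₖ 1K +ₖ 1K +ₖ 1K
    5≡ = +ₖ-≡ {κ (+ 4)} {1K +ₖ 1K +ₖ 1K +ₖ 1K} {1K} {1K} (+ₖ-≡ {3K} {1K +ₖ 1K +ₖ 1K} {1K} {1K} 3≡ refl) refl

    -2≡ : κ (ℤ.- + 2) ≡ -ₖ (1K +ₖ 1K)
    -2≡ = -ₖ-≡ {2K} 2≡

    -1≡ : κ (ℤ.- + 1) ≡ -ₖ 1K
    -1≡ = -ₖ-≡ {1K} refl

    5*fifth : 5K *K fifth ≡ 1K
    5*fifth = refl

    5f≡1 : (1K +ₖ 1K +ₖ 1K +ₖ 1K +ₖ 1K) *ₖ fifth ≡ 1K
    5f≡1 = trans (sym (*ₖ-≡ {5K} {1K +ₖ 1K +ₖ 1K +ₖ 1K +ₖ 1K} {fifth} {fifth} 5≡ refl)) 5*fifth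

  module Final (ζ : K) (root : IsFifthRoot ζ) where
    open IsFifthRoot root
    open Terms ζ

    private
      θ : ∀ a m → theta a m ≈ G.[ a ⨾ m ]
      θ = theta≈

      _·_ : ∀ {f g : PS} → f 0 ≡ 1K → g 0 ≡ 1K → (f G.⊛ g) 0 ≡ 1K
      p · q = trans (cong₂ _*ₖ_ p q) (R.*-identityˡ 1K)

      P0 : ∀ b a → G.Poch (-ₖ 1K) (suc b) a 0 ≡ 1K
      P0 b a = G.Poch-0 (-ₖ 1K) b a

      θ0 : ∀ b b′ a → a ℕ.∸ suc b ≡ suc b′ → G.[ suc b ⨾ a ] 0 ≡ 1K
      θ0 b b′ a eq = _·_ {G.Poch (-ₖ 1K) (suc b) a} {G.Poch (-ₖ 1K) (a ℕ.∸ suc b) a} (P0 b a)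
        (trans (cong (λ e → G.Poch (-ₖ 1K) e a 0) eq) (P0 b′ a))

      1-5 : G.[ 1 ⨾ 5 ] 0 ≡ 1K
      1-5 = θ0 0 3 5 refl
      2-5 : G.[ 2 ⨾ 5 ] 0 ≡ 1K
      2-5 = θ0 1 2 5 refl
      1-15 : G.[ 1 ⨾ 15 ] 0 ≡ 1K
      1-15 = θ0 0 13 15 refl
      2-15 : G.[ 2 ⨾ 15 ] 0 ≡ 1K
      2-15 = θ0 1 12 15 refl
      3-15 : G.[ 3 ⨾ 15 ] 0 ≡ 1K
      3-15 = θ0 2 11 15 refl
      4-15 : G.[ 4 ⨾ 15 ] 0 ≡ 1K
      4-15 = θ0 3 10 15 refl
      5-15 : G.[ 5 ⨾ 15 ] 0 ≡ 1K
      5-15 = θ0 4 9 15 refl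
      6-15 : G.[ 6 ⨾ 15 ] 0 ≡ 1K
      6-15 = θ0 5 8 15 refl
      7-15 : G.[ 7 ⨾ 15 ] 0 ≡ 1K
      7-15 = θ0 6 7 15 refl

      I₁ I₂ I₃ I₄ I₅ I₆ I₇ I₈ : PS
      I₁ = invPS (theta 1 5 ⊛ theta 1 5)
      I₂ = invPS (theta 1 15 ⊛ theta 4 15 ⊛ theta 5 15 ⊛ theta 6 15)
      I₃ = invPS (theta 1 5)
      I₄ = invPS (theta 2 15 ⊛ theta 3 15 ⊛ theta 5 15)
      I₅ = invPS (theta 2 5)
      I₆ = invPS (theta 1 15 ⊛ theta 5 15 ⊛ theta 6 15)
      I₇ = invPS (theta 2 5 ⊛ theta 2 5)
      I₈ = invPS (theta 2 15 ⊛ theta 3 15 ⊛ theta 5 15 ⊛ theta 7 15)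

      inverse₁ : G.[ 1 ⨾ 5 ] G.⊛ G.[ 1 ⨾ 5 ] G.⊛ I₁ ≈ G.𝟙
      inverse₁ = inverse-of-product (⊛≈ (θ 1 5) (θ 1 5)) (_·_ {G.[ 1 ⨾ 5 ]} {G.[ 1 ⨾ 5 ]} 1-5 1-5)
      inverse₂ : G.[ 1 ⨾ 15 ] G.⊛ G.[ 4 ⨾ 15 ] G.⊛ G.[ 5 ⨾ 15 ] G.⊛ G.[ 6 ⨾ 15 ] G.⊛ I₂ ≈ G.𝟙
      inverse₂ = inverse-of-product (⊛≈ (⊛≈ (⊛≈ (θ 1 15) (θ 4 15)) (θ 5 15)) (θ 6 15))
        (_·_ {G.[ 1 ⨾ 15 ] G.⊛ G.[ 4 ⨾ 15 ] G.⊛ G.[ 5 ⨾ 15 ]} {G.[ 6 ⨾ 15 ]} (_·_ {G.[ 1 ⨾ 15 ] G.⊛ G.[ 4 ⨾ 15 ]} {G.[ 5 ⨾ 15 ]} (_·_ {G.[ 1 ⨾ 15 ]} {G.[ 4 ⨾ 15 ]} 1-15 4-15) 5-15) 6-15)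
      inverse₃ : G.[ 1 ⨾ 5 ] G.⊛ I₃ ≈ G.𝟙
      inverse₃ = inverse-of-product (θ 1 5) 1-5
      inverse₄ : G.[ 2 ⨾ 15 ] G.⊛ G.[ 3 ⨾ 15 ] G.⊛ G.[ 5 ⨾ 15 ] G.⊛ I₄ ≈ G.𝟙
      inverse₄ = inverse-of-product (⊛≈ (⊛≈ (θ 2 15) (θ 3 15)) (θ 5 15))
        (_·_ {G.[ 2 ⨾ 15 ] G.⊛ G.[ 3 ⨾ 15 ]} {G.[ 5 ⨾ 15 ]} (_·_ {G.[ 2 ⨾ 15 ]} {G.[ 3 ⨾ 15 ]} 2-15 3-15) 5-15)
      inverse₅ : G.[ 2 ⨾ 5 ] G.⊛ I₅ ≈ G.𝟙
      inverse₅ = inverse-of-product (θ 2 5) 2-5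
      inverse₆ : G.[ 1 ⨾ 15 ] G.⊛ G.[ 5 ⨾ 15 ] G.⊛ G.[ 6 ⨾ 15 ] G.⊛ I₆ ≈ G.𝟙
      inverse₆ = inverse-of-product (⊛≈ (⊛≈ (θ 1 15) (θ 5 15)) (θ 6 15))
        (_·_ {G.[ 1 ⨾ 15 ] G.⊛ G.[ 5 ⨾ 15 ]} {G.[ 6 ⨾ 15 ]} (_·_ {G.[ 1 ⨾ 15 ]} {G.[ 5 ⨾ 15 ]} 1-15 5-15) 6-15)
      inverse₇ : G.[ 2 ⨾ 5 ] G.⊛ G.[ 2 ⨾ 5 ] G.⊛ I₇ ≈ G.𝟙
      inverse₇ = inverse-of-product (⊛≈ (θ 2 5) (θ 2 5)) (_·_ {G.[ 2 ⨾ 5 ]} {G.[ 2 ⨾ 5 ]} 2-5 2-5)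
      inverse₈ : G.[ 2 ⨾ 15 ] G.⊛ G.[ 3 ⨾ 15 ] G.⊛ G.[ 5 ⨾ 15 ] G.⊛ G.[ 7 ⨾ 15 ] G.⊛ I₈ ≈ G.𝟙
      inverse₈ = inverse-of-product (⊛≈ (⊛≈ (⊛≈ (θ 2 15) (θ 3 15)) (θ 5 15)) (θ 7 15))
        (_·_ {G.[ 2 ⨾ 15 ] G.⊛ G.[ 3 ⨾ 15 ] G.⊛ G.[ 5 ⨾ 15 ]} {G.[ 7 ⨾ 15 ]} (_·_ {G.[ 2 ⨾ 15 ] G.⊛ G.[ 3 ⨾ 15 ]} {G.[ 5 ⨾ 15 ]} (_·_ {G.[ 2 ⨾ 15 ]} {G.[ 3 ⨾ 15 ]} 2-15 3-15) 5-15) 7-15)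

      inverse₀ : G.⟨ 1 ⟩ G.⊛ invPS (poch 1 1) ≈ G.𝟙
      inverse₀ = inverse-of-product (poch≈ 1 1) (P0 0 1)

      module Res = G.Residues ζ fifth cyclotomic 5f≡1 I₁ I₂ I₃ I₄ I₅ I₆ I₇ I₈ inverse₁ inverse₂ inverse₃ inverse₄ inverse₅ inverse₆ inverse₇ inverse₈

      ⁻¹≡ζ⁴ : invK ζ ≡ Res.ζ⁴
      ⁻¹≡ζ⁴ = trans (sym (invₖ≡ ζ)) inverse

      c≡ : ζ +K ζ ^K 4 ≡ Res.c
      c≡ = +ₖ-≡ refl (trans (sym (pow≡ ζ 4)) (solve 1 (λ z → z :* (z :* (z :* (z :* con (+ 1)))) := z :* z :* z :* z) refl ζ))
        where open IntegerCoefficientSolver (CoefficientRing.commutativeRing 𝓚)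

      A₀≈ : A450 Res.c ≈ Res.A₀
      A₀≈ = ⊖≈ (scalePS≈ (*ₖ-≡ (+ₖ-≡ 3≡ refl) refl) (⊛≈ (θ 2 5) (λ _ → refl)))
        (shiftPS≈ 1 (scalePS≈ (+ₖ-≡ refl refl) (⊛≈ (θ 2 15) (λ _ → refl))))

      A₁≈ : A451 Res.c ≈ Res.A₁
      A₁≈ = ⊕≈ (scalePS≈ (*ₖ-≡ (+ₖ-≡ -2≡ refl) refl) (λ _ → refl)) (λ _ → refl)

      A₂≈ : A452 Res.c ≈ Res.A₂
      A₂≈ = ⊖≈ (scalePS≈ (*ₖ-≡ (+ₖ-≡ refl (*ₖ-≡ 2≡ refl)) refl) (λ _ → refl)) (λ _ → refl)

      A₃≈ : A453 Res.c ≈ Res.A₃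
      A₃≈ = ⊖≈ (scalePS≈ (*ₖ-≡ (+ₖ-≡ -1≡ (-ₖ-≡ (*ₖ-≡ 2≡ refl))) refl) (⊛≈ (θ 1 5) (λ _ → refl)))
        (shiftPS≈ 1 (scalePS≈ refl (⊛≈ (θ 1 15) (λ _ → refl))))

      right : RHS Res.c ≈ G.⟨ 25 ⟩ G.⊛ (G.D Res.A₀ G.⊕ G.X 1 G.⊛ G.D Res.A₁ G.⊕ G.X 2 G.⊛ G.D Res.A₂ G.⊕ G.X 3 G.⊛ G.D Res.A₃)
      right = ⊛≈ (poch≈ 25 25) (⊕≈ (⊕≈ (⊕≈ (dil≈ A₀≈) (shiftPS≈ 1 (dil≈ A₁≈))) (shiftPS≈ 2 (dil≈ A₂≈))) (shiftPS≈ 3 (dil≈ A₃≈)))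

      left : LHS ζ ≈ invPS (poch 1 1) G.⊛ (bilateralSum (term1 ζ) G.⊖ bilateralSum (term2 ζ))
      left = ⊛≈ (λ _ → refl) (⊖≈ (λ _ → refl) (λ _ → refl))

      G-spec : G.Geometric ζ G₀
      G-spec = geometric-spec ζ ζ-inverse 1-ζ-inverse

      H-spec : G.Geometric Res.ζ⁴ H
      H-spec = ≡.subst (λ ξ → G.Geometric ξ H) ⁻¹≡ζ⁴ (≡.subst (λ ξ → G.Geometric ξ (geometric ξ)) (invₖ≡ ζ)
        (geometric-spec (invₖ ζ) (trans (cong (λ a → invₖ ζ *ₖ a) double-inverse) (trans (R.*-comm (invₖ ζ) ζ) ζ-inverse)) 1-ζ⁻¹-inverse))

    dissection : LHS ζ ≈ RHS (ζ +K ζ ^K 4)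
    dissection = G.S.trans left (G.S.trans
      (Res.dissection G₀ H G-spec H-spec t₁ t₂ t₁-spec t₂-spec (bilateralSum (term1 ζ)) (bilateralSum (term2 ζ)) hasSum₁ hasSum₂ (invPS (poch 1 1)) inverse₀)
      (G.S.trans (G.S.sym right) (λ N → cong (λ c → RHS c N) (sym c≡))))

open import Defs

theorem6 : (ζ : K) → PrimitiveRoot 5 ζ →
    ∀ (N : ℕ) → LHS ζ N ≡ RHS (ζ +K ζ ^K 4) N
theorem6 ζ primitive-root = Comparison.Final.dissection ζ (FifthRootsOfUnity.primitive⇒fifthRoot ζ primitive-root)
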